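{- Let $s\geq 4$ and $t\geq 3$ be integers. Then, as $n\to\infty$, \[ \mathrm{ex}(n,C_s,\textnormal{rainbow- }C_t)= \begin{cases} \Theta(n^{s/2}) & \text{if } t=4,\\ \Theta(n^{s/2}) & \text{if } s,t \text{ are even with } s\neq t,\\ \Theta(n^{s/2-1}) & \text{if } s=t\geq 6 \text{ and } t \text{ is even},\\ \Theta(n^{(s-1)/2}) & \text{if } t\geq 6 \text{ is even and } s \text{ is odd},\\ \Theta(n^{s-2}) & \text{if } s,t \text{ are odd with } s\leq t,\\ \Theta(n^{s}) & \text{if } t \text{ is odd, and } s>t \text{ or } s \text{ is even}. \end{cases} \]
   Context: A proper edge-colouring of a graph assigns colours to edges so that any two edges sharing a vertex receive different colours. A subgraph of an edge-coloured graph is rainbow if all its edges have distinct colours. For graphs $H,F$, $\mathrm{ex}(n,H,\textnormal{rainbow- }F)$ denotes the maximum number of subgraphs isomorphic to $H$ (copies of $H$) in a properly edge-coloured graph on $n$ vertices that contains no rainbow subgraph isomorphic to $F$. $C_m$ denotes the cycle of length $m$. The constants implied by $\Theta$ may depend on $s$ and $t$. -}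

module Defs where

open import Data.Nat using (ℕ; zero; suc; _*_; _^_; _≤_; _≥_)
open import Data.Nat.DivMod using (_mod_)
open import Data.Fin using (Fin; toℕ)
open import Data.Product using (Σ; ∃; ∃-syntax; _×_; _,_)
open import Data.Sum using (_⊎_)
open import Function.Definitions using (Injective)
open import Relation.Binary.PropositionalEquality using (_≡_; _≢_)
open import Relation.Nullary using (¬_)
open import Function.Bundles using (_⇔_)

record Graph (n : ℕ) : Set₁ where
  field
    Adj   : Fin n → Fin n → Set
    sym   : ∀ {u v} → Adj u v → Adj v u
    irref : ∀ {u} → ¬ Adj u u
open Graph public

record ProperColouring {n : ℕ} (G : Graph n) : Set where
  field
    col    : Fin n → Fin n → ℕ
    colSym : ∀ {u v} → Adj G u v → col u v ≡ col v u
    proper : ∀ {u v w} → Adj G u v → Adj G u w → v ≢ w → col u v ≢ col u w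
open ProperColouring public

next : ∀ {m} → Fin m → Fin m
next {suc k} i = suc (toℕ i) mod suc k

-- An injective map f : Fin m → Fin n sending consecutive (cyclically) indices to
-- adjacent vertices; its image is a subgraph of G isomorphic to C_m (m ≥ 3).
record CycleIn {n : ℕ} (G : Graph n) (m : ℕ) : Set where
  field
    vtx  : Fin m → Fin n
    inj  : Injective _≡_ _≡_ vtx
    adj  : ∀ i → Adj G (vtx i) (vtx (next i))
open CycleIn public

EdgeOf : ∀ {n m} {G : Graph n} → CycleIn G m → Fin n → Fin n → Set
EdgeOf C u v = ∃[ i ] ((vtx C i ≡ u × vtx C (next i) ≡ v) ⊎ (vtx C i ≡ v × vtx C (next i) ≡ u))

SameCopy : ∀ {n m} {G : Graph n} → CycleIn G m → CycleIn G m → Set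
SameCopy C D = ∀ u v → EdgeOf C u v ⇔ EdgeOf D u v

DistinctCopies : ∀ {n} (G : Graph n) (m k : ℕ) → Set
DistinctCopies G m k =
  Σ (Fin k → CycleIn G m) λ F → ∀ i j → i ≢ j → ¬ SameCopy (F i) (F j)

RainbowCycle : ∀ {n} (G : Graph n) → ProperColouring G → ℕ → Set
RainbowCycle G c t =
  Σ (CycleIn G t) λ C → ∀ i j → i ≢ j →
    col c (vtx C i) (vtx C (next i)) ≢ col c (vtx C j) (vtx C (next j))

-- Θ(n^(d/2)) for ex(n, C_s, rainbow-C_t), with the exponent given doubled (d = 2·exponent)
-- so that half-integer exponents are expressible; bounds are on the square of the count.
-- Upper: every properly edge-coloured n-vertex graph without rainbow C_t has at most X
--   copies of C_s, where X² ≤ K·n^d.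
-- Lower: some such graph has at least Y copies of C_s, where n^d ≤ k·Y².
ExTheta : (s t d : ℕ) → Set₁
ExTheta s t d =
  (∃[ K ] ∃[ N ] ∀ n → n ≥ N → (G : Graph n) (c : ProperColouring G) →
      ¬ RainbowCycle G c t → ∀ m → DistinctCopies G s m → m * m ≤ K * n ^ d)
  × (∃[ k ] ∃[ N ] ∀ n → n ≥ N → Σ (Graph n) λ G → Σ (ProperColouring G) λ c →
      ¬ RainbowCycle G c t × (∃[ m ] (DistinctCopies G s m × n ^ d ≤ k * (m * m))))

open import Data.Nat.Divisibility using (_∣_)

Even Odd : ℕ → Set
Even n = 2 ∣ n
Odd n = ¬ (2 ∣ n)

{-# OPTIONS --safe #-}
module Submission where

-- Upper bounds. Cycles are counted by coding: if all of them occur in a list of K n^j tuples,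
-- there are O(n^j). For t even, peeling vertices of small degree from the graph between N(v) and
-- V ∖ {v} (a dense remainder would contain a rainbow C_t through v) shows that for every path
-- u, m, w either m is one of boundedly many vertices given u and w, or w and u are so given m and
-- one another. Hence there are O(n^2) paths of length 2 and, for t ≥ 6, also of length 3: a
-- path of length 3 that is not determined by two of its vertices lies in a dense graph whose
-- vertices are all reached from v through the same colour, and can be replaced by another one
-- that is determined. Longer paths are covered by steps of length 2, and the remaining one or two
-- vertices of a cycle by the alternative above, together with a colour coincidence if s = t. For
-- s ≤ t odd the same peeling between two neighbourhoods determines one vertex out of any two
-- adjacent ones, and two of them are used.
--
-- Lower bounds. All graphs are blow-ups of C_s: with every second part a single vertex for t even;
-- with two perfect matchings of one colour for s ≤ t odd, because an odd cycle uses both. For t = 4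
-- the parts are copies of (ℤ/p)^2 and consecutive parts are joined by translations from disjoint
-- subsets of the Sidon set {(u, u^2)}; Chebyshev's argument provides primes of all magnitudes.

open import Defs renaming (sym to adjSym; irref to adjIrref)
open import Data.Bool using (Bool; true; false; not; _xor_)
open import Data.Bool.Properties using (not-involutive)
open import Data.Empty using (⊥; ⊥-elim)
open import Data.Fin using (Fin; zero; suc; toℕ; fromℕ; fromℕ<; inject₁; combine; remQuot; finToFun; funToFin)
import Data.Fin.Properties as Fₚ
open import Data.Fin.Relation.Unary.Top using (view; ‵fromℕ; ‵inject₁)
open import Data.Integer using (ℤ) renaming (_+_ to infixl 6 _⊕_; _-_ to infixl 6 _⊝_; _*_ to infixl 7 _⊛_)
import Data.Integer as ℤ
import Data.Integer.Properties as ℤₚ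
open import Data.Integer.Divisibility.Signed using () renaming (_∣_ to infix 4 _∣ℤ_)
import Data.Integer.Divisibility.Signed as ℤDv
import Data.Integer.Tactic.RingSolver as ℤSolver
open import Data.List using (List; []; _∷_; _++_; length; map; concatMap; filter; allFin; upTo; lookup)
import Data.List.Properties as Lₚ
open import Data.List.Membership.Propositional using (_∈_; _∉_; find; lose)
import Data.List.Membership.Propositional.Properties as Mₚ
open import Data.List.Relation.Unary.All as All using (All; []; _∷_)
import Data.List.Relation.Unary.All.Properties as Allₚ
open import Data.List.Relation.Unary.AllPairs using ([]; _∷_)
open import Data.List.Relation.Unary.Any as Any using (Any; here; there)
import Data.List.Relation.Unary.Any.Properties as Anyₚ
open import Data.List.Relation.Unary.Unique.Propositional using (Unique)
import Data.List.Relation.Unary.Unique.Propositional.Properties as Uₚ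
open import Data.Nat using (ℕ; zero; suc; _+_; _*_; _∸_; _^_; _!; _≤_; _<_; _≥_; _>_; z≤n; s≤s; NonZero; _/_; _%_)
import Data.Nat
import Data.Nat.DivMod as DM
open import Data.Nat.Divisibility using (_∣_; divides)
import Data.Nat.Divisibility as Dv
import Data.Nat.Properties as ℕₚ
open import Data.Nat.Primality using (Prime; prime?; euclidsLemma; ¬prime[1]; prime⇒nonTrivial; prime⇒nonZero)
open import Data.Nat.Primality.Factorisation using (PrimeFactorisation; factorise)
open import Data.Nat.ListAction using (product)
open import Data.Nat.Tactic.RingSolver using (solve-∀)
open import Data.Product using (Σ; ∃; ∃-syntax; _×_; _,_; proj₁; proj₂)
open import Data.Sum using (_⊎_; inj₁; inj₂)
open import Data.Unit using (⊤; tt)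
open import Function using (_∘_; id)
open import Function.Bundles using (mk⇔; Equivalence)
open import Relation.Binary.Definitions using (tri<; tri≈; tri>)
open import Relation.Binary.PropositionalEquality using (_≡_; _≢_; refl; sym; trans; cong; cong₂; subst; subst₂)
open import Relation.Nullary using (¬_; Dec; yes; no; contradiction)
open import Relation.Nullary.Decidable using (_×-dec_; _⊎-dec_; ¬?; map′)

-- Greedy choices and peeling

-- Greedy extension rests on properness: among the neighbours of a vertex a forbidden colour, like a
-- forbidden vertex, excludes at most one, so bounded minimum degree suffices. Peeling is used
-- instead of an edge count because the coding needs pointwise information: every edge outside the
-- dense core lies in a bounded list attached to one of its ends. For length 3 the obstacle is
-- circularity: x may be determined by v and y while y is determined by x and a, and then no two
-- vertices fix the path. Choosing x as a function of y leaves a bipartite graph of pairs (y, a). It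
-- can still be dense if all its edges x y have one colour r: a path that enters through some x has
-- used r and cannot close through another x. The blow-ups with single vertices contain cycles of
-- length 4, so t = 4 needs a construction of its own. There the exponent for odd s is larger by a
-- half, because a graph without rainbow C_4 may have about n^(3/2) edges.

∈-concatMap : {A B : Set} {f : A → List B} {xs : List A} {x : A} {y : B} →
  x ∈ xs → y ∈ f x → y ∈ concatMap f xs
∈-concatMap {f = f} {x ∷ xs} (here refl) y∈ = Mₚ.∈-++⁺ˡ y∈
∈-concatMap {f = f} {x ∷ xs} (there p) y∈ = Mₚ.∈-++⁺ʳ (f x) (∈-concatMap p y∈)

length-concatMap : {A B : Set} (f : A → List B) (xs : List A) {K : ℕ} →
  (∀ x → length (f x) ≤ K) → length (concatMap f xs) ≤ length xs * K
length-concatMap f [] h = z≤n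
length-concatMap f (x ∷ xs) h = subst (_≤ _) (sym (Lₚ.length-++ (f x)))
  (ℕₚ.+-mono-≤ (h x) (length-concatMap f xs h))

length-concatMap-≤ : {A B : Set} (f : A → List B) (xs : List A) {J K : ℕ} →
  length xs ≤ J → (∀ x → length (f x) ≤ K) → length (concatMap f xs) ≤ J * K
length-concatMap-≤ f xs {J} {K} h g = ℕₚ.≤-trans (length-concatMap f xs g) (ℕₚ.*-monoˡ-≤ K h)

length-map-≤ : ∀ {α β} {A : Set α} {B : Set β} (f : A → B) {xs : List A} {K : ℕ} → length xs ≤ K → length (map f xs) ≤ K
length-map-≤ f {xs} h = subst (_≤ _) (sym (Lₚ.length-map f xs)) h

length-++-≤ : ∀ {α} {A : Set α} (xs {ys} : List A) {J K : ℕ} → length xs ≤ J → length ys ≤ K → length (xs ++ ys) ≤ J + K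
length-++-≤ xs h g = subst (_≤ _) (sym (Lₚ.length-++ xs)) (ℕₚ.+-mono-≤ h g)

-- A constraint on the elements of L that excludes at most one of them.
record Constraint {A : Set} (L : List A) : Set₁ where
  field
    Bad  : A → Set
    bad? : ∀ a → Dec (Bad a)
    amo  : ∀ {x y} → x ∈ L → y ∈ L → Bad x → Bad y → x ≡ y
open Constraint public

length≤1+filter : {A : Set} {P : A → Set} (P? : ∀ a → Dec (P a)) (M : List A) → Unique M →
  (∀ {x y} → x ∈ M → y ∈ M → P x → P y → x ≡ y) → length M ≤ suc (length (filter (¬? ∘ P?) M))
length≤1+filter P? [] u h = z≤n
length≤1+filter {P = P} P? (x ∷ M) (x∉ ∷ u) h with P? x
... | yes px = s≤s (ℕₚ.≤-reflexive (cong length (sym (Lₚ.filter-all (¬? ∘ P?)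
        (All.tabulate λ {y} y∈ py → All.lookup x∉ y∈ (h (here refl) (there y∈) px py))))))
... | no ¬px = s≤s (length≤1+filter P? M u λ p q → h (there p) (there q))

pick′ : {A : Set} {L : List A} (cs : List (Constraint L)) (M : List A) → Unique M → (∀ {x} → x ∈ M → x ∈ L) →
  length cs < length M → ∃ λ a → a ∈ M × All (λ c → ¬ Bad c a) cs
pick′ [] (x ∷ M) u s l = x , here refl , []
pick′ (c ∷ cs) M u s l
  with pick′ cs (filter (¬? ∘ bad? c) M) (Uₚ.filter⁺ (¬? ∘ bad? c) u) (s ∘ proj₁ ∘ Mₚ.∈-filter⁻ (¬? ∘ bad? c))
         (ℕₚ.≤-pred (ℕₚ.≤-trans l (length≤1+filter (bad? c) M u λ p q → amo c (s p) (s q))))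
... | a , a∈ , h = a , proj₁ (Mₚ.∈-filter⁻ (¬? ∘ bad? c) a∈) , proj₂ (Mₚ.∈-filter⁻ (¬? ∘ bad? c) {xs = M} a∈) ∷ h

pick : {A : Set} (L : List A) (cs : List (Constraint L)) → Unique L →
  length cs < length L → ∃ λ a → a ∈ L × All (λ c → ¬ Bad c a) cs
pick L cs u l = pick′ cs L u id l

-- E is read as a bipartite graph on two copies of the vertex set. Weakness is a parameter because
-- one application measures it by a maximal matching instead of the degree. An edge is recorded at
-- the end that is removed first, together with the neighbourhood of that end at that time; this
-- gives `covers`. Vertices never removed have the record [], hence [] must be weak.
module Peeling {n : ℕ}
  (E : Fin n → Fin n → Set) (E? : ∀ x y → Dec (E x y))
  (WeakL : Fin n → List (Fin n) → Set) (weakL? : ∀ x l → Dec (WeakL x l)) (weakL[] : ∀ x → WeakL x [])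
  (WeakR : Fin n → List (Fin n) → Set) (weakR? : ∀ y l → Dec (WeakR y l)) (weakR[] : ∀ y → WeakR y [])
  where

  nbrsR : Fin n → List (Fin n) → List (Fin n)
  nbrsR x Y = filter (E? x) Y

  nbrsL : Fin n → List (Fin n) → List (Fin n)
  nbrsL y X = filter (λ x → E? x y) X

  record Peeled (X Y : List (Fin n)) : Set where
    field
      coreL coreR : List (Fin n)
      uniqueL : Unique coreL
      uniqueR : Unique coreR
      strongL : ∀ {x} → x ∈ coreL → ¬ WeakL x (nbrsR x coreR)
      strongR : ∀ {y} → y ∈ coreR → ¬ WeakR y (nbrsL y coreL)
      recL recR : Fin n → List (Fin n)
      weakL : ∀ x → WeakL x (recL x)
      weakR : ∀ y → WeakR y (recR y)
      covers : ∀ {x y} → x ∈ X → y ∈ Y → E x y → (x ∈ coreL × y ∈ coreR) ⊎ (y ∈ recL x ⊎ x ∈ recR y)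

  remove : Fin n → List (Fin n) → List (Fin n)
  remove x = filter (λ z → ¬? (z Fₚ.≟ x))

  length-remove : ∀ {x X} → x ∈ X → length (remove x X) < length X
  length-remove {x} {X} x∈ = Lₚ.filter-notAll (λ z → ¬? (z Fₚ.≟ x)) X (Any.map (λ { refl h → h refl }) x∈)

  override : Fin n → List (Fin n) → (Fin n → List (Fin n)) → Fin n → List (Fin n)
  override x l f z with z Fₚ.≟ x
  ... | yes _ = l
  ... | no _ = f z

  override-all : ∀ {x l f} (P : Fin n → List (Fin n) → Set) → P x l → (∀ z → P z (f z)) → ∀ z → P z (override x l f z)
  override-all {x} P p h z with z Fₚ.≟ x
  ... | yes refl = p
  ... | no _ = h z

  peel′ : (k : ℕ) (X Y : List (Fin n)) → Unique X → Unique Y → length X + length Y ≤ k → Peeled X Y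
  peel′ k X Y uX uY h with Any.any? (λ x → weakL? x (nbrsR x Y)) X | Any.any? (λ y → weakR? y (nbrsL y X)) Y
  ... | no ¬wX | no ¬wY = record
    { coreL = X ; coreR = Y ; uniqueL = uX ; uniqueR = uY
    ; strongL = λ x∈ w → ¬wX (lose x∈ w) ; strongR = λ y∈ w → ¬wY (lose y∈ w)
    ; recL = λ _ → [] ; recR = λ _ → [] ; weakL = weakL[] ; weakR = weakR[]
    ; covers = λ p q _ → inj₁ (p , q) }
  peel′ zero [] Y uX uY h | yes () | _
  peel′ zero [] [] uX uY h | no _ | yes ()
  peel′ (suc k) X Y uX uY h | yes wX | _ with find wX
  ... | x₀ , x₀∈ , w = record
    { coreL = coreL ; coreR = coreR ; uniqueL = uniqueL ; uniqueR = uniqueR ; strongL = strongL ; strongR = strongR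
    ; recL = override x₀ (nbrsR x₀ Y) recL ; recR = recR
    ; weakL = override-all WeakL w weakL ; weakR = weakR
    ; covers = cov }
    where
    open Peeled (peel′ k (remove x₀ X) Y (Uₚ.filter⁺ _ uX) uY
      (ℕₚ.≤-pred (ℕₚ.≤-trans (ℕₚ.+-monoˡ-< (length Y) (length-remove x₀∈)) h)))
    cov : ∀ {x y} → x ∈ X → y ∈ Y → E x y → (x ∈ coreL × y ∈ coreR) ⊎ (y ∈ override x₀ (nbrsR x₀ Y) recL x ⊎ x ∈ recR y)
    cov {x} {y} x∈ y∈ e with x Fₚ.≟ x₀
    ... | yes refl = inj₂ (inj₁ (Mₚ.∈-filter⁺ (E? x) y∈ e))
    ... | no ne = covers (Mₚ.∈-filter⁺ _ x∈ ne) y∈ e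
  peel′ (suc k) X Y uX uY h | no _ | yes wY with find wY
  ... | y₀ , y₀∈ , w = record
    { coreL = coreL ; coreR = coreR ; uniqueL = uniqueL ; uniqueR = uniqueR ; strongL = strongL ; strongR = strongR
    ; recL = recL ; recR = override y₀ (nbrsL y₀ X) recR
    ; weakL = weakL ; weakR = override-all WeakR w weakR
    ; covers = cov }
    where
    open Peeled (peel′ k X (remove y₀ Y) uX (Uₚ.filter⁺ _ uY)
      (ℕₚ.≤-pred (ℕₚ.≤-trans (ℕₚ.+-monoʳ-< (length X) (length-remove y₀∈)) h)))
    cov : ∀ {x y} → x ∈ X → y ∈ Y → E x y → (x ∈ coreL × y ∈ coreR) ⊎ (y ∈ recL x ⊎ x ∈ override y₀ (nbrsL y₀ X) recR y)
    cov {x} {y} x∈ y∈ e with y Fₚ.≟ y₀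
    ... | yes refl = inj₂ (inj₂ (Mₚ.∈-filter⁺ (λ z → E? z y) x∈ e))
    ... | no ne = covers x∈ (Mₚ.∈-filter⁺ _ y∈ ne) e

  abstract
    peel : Peeled (allFin n) (allFin n)
    peel = peel′ _ _ _ (Uₚ.allFin⁺ n) (Uₚ.allFin⁺ n) ℕₚ.≤-refl

-- Rainbow paths

toℕ-next : ∀ {m} (i : Fin (suc m)) → toℕ (next i) ≡ suc (toℕ i) % suc m
toℕ-next {m} i = Fₚ.toℕ-fromℕ< (DM.m%n<n (suc (toℕ i)) (suc m))

next-inject₁ : ∀ {m} (i : Fin m) → next (inject₁ i) ≡ suc i
next-inject₁ {m} i = Fₚ.toℕ-injective (trans (toℕ-next (inject₁ i))
  (trans (cong (λ k → suc k % suc m) (Fₚ.toℕ-inject₁ i)) (DM.m<n⇒m%n≡m (s≤s (Fₚ.toℕ<n i)))))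

next-fromℕ : ∀ m → next (fromℕ m) ≡ zero
next-fromℕ m = Fₚ.toℕ-injective (trans (toℕ-next (fromℕ m))
  (trans (cong (λ k → suc k % suc m) (Fₚ.toℕ-fromℕ m)) (DM.n%n≡0 (suc m))))

-- room T exceeds the number of constraints met when a path with at most T edges is extended.
abstract
  room : ℕ → ℕ
  room T = 8 * T + 8

  8≤room : ∀ T → 8 ≤ room T
  8≤room T = ℕₚ.m≤n+m 8 (8 * T)

  room-< : ∀ {T e ℓ a} → e ≤ 5 * T + 5 → ℓ ≤ T → a ≤ 1 → e + (suc ℓ + (ℓ + a)) < room T
  room-< {T} {e} {ℓ} {a} he hℓ ha = ℕₚ.≤-trans
    (s≤s (ℕₚ.+-mono-≤ he (ℕₚ.+-mono-≤ (s≤s hℓ) (ℕₚ.+-mono-≤ hℓ ha)))) (subst₂ _≤_ (lhs T) (rhs T) (ℕₚ.m≤m+n _ T))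
    where
    lhs : ∀ T → 8 + 7 * T ≡ suc ((5 * T + 5) + (suc T + (T + 1)))
    lhs = solve-∀
    rhs : ∀ T → 8 + 7 * T + T ≡ 8 * T + 8
    rhs = solve-∀

module Rainbow {n : ℕ} (G : Graph n) (c : ProperColouring G) where

  infix 4 _~_
  _~_ : Fin n → Fin n → Set
  _~_ = Adj G

  κ : Fin n → Fin n → ℕ
  κ = col c

  ~⇒≢ : ∀ {u v} → u ~ v → u ≢ v
  ~⇒≢ e refl = adjIrref G e

  properAt : ∀ {u v w} → u ~ v → u ~ w → κ u v ≡ κ u w → v ≡ w
  properAt {u} {v} {w} e f h with v Fₚ.≟ w
  ... | yes p = p
  ... | no ne = contradiction h (proper c e f ne)

  properAt′ : ∀ {u v w} → u ~ v → u ~ w → κ v u ≡ κ w u → v ≡ w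
  properAt′ e f h = properAt e f (trans (colSym c e) (trans h (sym (colSym c f))))

  -- Rainbow paths from a to u; the vertex and colour lists have the newest entry first.
  -- The colours in Ac are not used.
  data RPath (Ac : List ℕ) (a : Fin n) : Fin n → ℕ → List (Fin n) → List ℕ → Set where
    start : RPath Ac a a 0 (a ∷ []) []
    step  : ∀ {u ℓ vs cs w} → RPath Ac a u ℓ vs cs → u ~ w → w ∉ vs → κ u w ∉ cs → κ u w ∉ Ac →
            RPath Ac a w (suc ℓ) (w ∷ vs) (κ u w ∷ cs)

  module _ {a : Fin n} where

    forget : ∀ {Ac u ℓ vs cs} → RPath Ac a u ℓ vs cs → RPath [] a u ℓ vs cs
    forget start = start
    forget (step p e v k _) = step (forget p) e v k λ ()

    length-vs : ∀ {Ac u ℓ vs cs} → RPath Ac a u ℓ vs cs → length vs ≡ suc ℓ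
    length-vs start = refl
    length-vs (step p _ _ _ _) = cong suc (length-vs p)

    length-cs : ∀ {Ac u ℓ vs cs} → RPath Ac a u ℓ vs cs → length cs ≡ ℓ
    length-cs start = refl
    length-cs (step p _ _ _ _) = cong suc (length-cs p)

    avoids : ∀ {Ac u ℓ vs cs q} → RPath Ac a u ℓ vs cs → q ∈ Ac → q ∉ cs
    avoids (step p e _ _ k) q∈ (here refl) = k q∈
    avoids (step p e _ _ k) q∈ (there h) = avoids p q∈ h

    start∈ : ∀ {Ac u ℓ vs cs} → RPath Ac a u ℓ vs cs → a ∈ vs
    start∈ start = here refl
    start∈ (step p _ _ _ _) = there (start∈ p)

    end∈ : ∀ {Ac u ℓ vs cs} → RPath Ac a u ℓ vs cs → u ∈ vs
    end∈ start = here refl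
    end∈ (step p _ _ _ _) = here refl

    at : ∀ {Ac u ℓ vs cs} → RPath Ac a u ℓ vs cs → Fin (suc ℓ) → Fin n
    at {u = u} p zero = u
    at (step p _ _ _ _) (suc i) = at p i

    at∈ : ∀ {Ac u ℓ vs cs} (p : RPath Ac a u ℓ vs cs) i → at p i ∈ vs
    at∈ p zero = end∈ p
    at∈ (step p _ _ _ _) (suc i) = there (at∈ p i)

    at-injective : ∀ {Ac u ℓ vs cs} (p : RPath Ac a u ℓ vs cs) {i j} → at p i ≡ at p j → i ≡ j
    at-injective p {zero} {zero} h = refl
    at-injective (step p e v _ _) {zero} {suc j} refl = contradiction (at∈ p j) v
    at-injective (step p e v _ _) {suc i} {zero} refl = contradiction (at∈ p i) v
    at-injective (step p e v _ _) {suc i} {suc j} h = cong suc (at-injective p h)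

    at-last : ∀ {Ac u ℓ vs cs} (p : RPath Ac a u ℓ vs cs) → at p (fromℕ ℓ) ≡ a
    at-last start = refl
    at-last (step p _ _ _ _) = at-last p

    at-~ : ∀ {Ac u ℓ vs cs} (p : RPath Ac a u ℓ vs cs) i → at p (inject₁ i) ~ at p (suc i)
    at-~ (step p e v _ _) zero = adjSym G e
    at-~ (step p e v _ _) (suc i) = at-~ p i

    at-col∈ : ∀ {Ac u ℓ vs cs} (p : RPath Ac a u ℓ vs cs) i → κ (at p (inject₁ i)) (at p (suc i)) ∈ cs
    at-col∈ (step p e v _ _) zero = here (colSym c (adjSym G e))
    at-col∈ (step p e v _ _) (suc i) = there (at-col∈ p i)

    at-col-injective : ∀ {Ac u ℓ vs cs} (p : RPath Ac a u ℓ vs cs) {i j} →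
      κ (at p (inject₁ i)) (at p (suc i)) ≡ κ (at p (inject₁ j)) (at p (suc j)) → i ≡ j
    at-col-injective (step p e v _ _) {zero} {zero} h = refl
    at-col-injective (step p e v k _) {zero} {suc j} h =
      contradiction (subst (_∈ _) (sym (trans (colSym c e) h)) (at-col∈ p j)) k
    at-col-injective (step p e v k _) {suc i} {zero} h =
      contradiction (subst (_∈ _) (sym (trans (colSym c e) (sym h))) (at-col∈ p i)) k
    at-col-injective (step p e v k _) {suc i} {suc j} h = cong suc (at-col-injective p h)

    close : ∀ {Ac u ℓ vs cs} → RPath Ac a u ℓ vs cs → u ~ a → κ u a ∉ cs → RainbowCycle G c (suc ℓ)
    close {u = u} {ℓ} {vs} {cs} p e k = C , rainbow
      where
      edgeCol : Fin (suc ℓ) → ℕ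
      edgeCol i = κ (at p i) (at p (next i))
      adj′ : ∀ i → at p i ~ at p (next i)
      adj′ i with view i
      -- Indices run from the newest vertex back to the start, so the wrap-around edge of the cycle
      -- is the closing edge.
      ... | ‵fromℕ rewrite next-fromℕ ℓ | at-last p = adjSym G e
      ... | ‵inject₁ j rewrite next-inject₁ j = at-~ p j
      C : CycleIn G (suc ℓ)
      C = record { vtx = at p ; inj = at-injective p ; adj = adj′ }
      top-col : edgeCol (fromℕ ℓ) ≡ κ u a
      top-col rewrite next-fromℕ ℓ | at-last p = sym (colSym c e)
      inner-col : ∀ j → edgeCol (inject₁ j) ≡ κ (at p (inject₁ j)) (at p (suc j))
      inner-col j rewrite next-inject₁ j = refl
      clash : ∀ j → edgeCol (inject₁ j) ≡ edgeCol (fromℕ ℓ) → ⊥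
      clash j h = k (subst (_∈ cs) (trans (sym (inner-col j)) (trans h top-col)) (at-col∈ p j))
      rainbow : ∀ i j → i ≢ j → edgeCol i ≢ edgeCol j
      rainbow i j ne h with view i | view j
      ... | ‵fromℕ | ‵fromℕ = ne refl
      ... | ‵fromℕ | ‵inject₁ j′ = clash j′ (sym h)
      ... | ‵inject₁ i′ | ‵fromℕ = clash i′ h
      ... | ‵inject₁ i′ | ‵inject₁ j′ = ne (cong inject₁ (at-col-injective p
              (trans (sym (inner-col i′)) (trans h (inner-col j′)))))

  keyConstraints : {K : Set} (_≟K_ : (a b : K) → Dec (a ≡ b)) {L : List (Fin n)} (key : Fin n → K) →
    (∀ {x y} → x ∈ L → y ∈ L → key x ≡ key y → x ≡ y) → List K → List (Constraint L)
  keyConstraints _≟K_ key inj = map λ k → record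
    { Bad = λ x → key x ≡ k ; bad? = λ x → key x ≟K k ; amo = λ x∈ y∈ p q → inj x∈ y∈ (trans p (sym q)) }

  keyConstraints-∉ : {K : Set} (_≟K_ : (a b : K) → Dec (a ≡ b)) {L : List (Fin n)} (key : Fin n → K)
    (inj : ∀ {x y} → x ∈ L → y ∈ L → key x ≡ key y → x ≡ y) (ks : List K) {x : Fin n} →
    All (λ c → ¬ Bad c x) (keyConstraints _≟K_ {L} key inj ks) → key x ∉ ks
  keyConstraints-∉ _≟K_ key inj ks h k∈ = All.lookup (Allₚ.map⁻ h) k∈ refl

  avoidV : {L : List (Fin n)} → List (Fin n) → List (Constraint L)
  avoidV = keyConstraints Fₚ._≟_ id (λ _ _ h → h)

  avoidV-∉ : {L : List (Fin n)} (ks : List (Fin n)) {x : Fin n} → All (λ c → ¬ Bad c x) (avoidV {L} ks) → x ∉ ks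
  avoidV-∉ = keyConstraints-∉ Fₚ._≟_ id (λ _ _ h → h)

  -- The used vertices, the used colours and the colours in `Ac` become constraints with one
  -- exclusion each, the colours because κ u is injective on the neighbours of u. Together with `es`
  -- they number exactly the left side of the hypothesis.
  extend : ∀ {Ac a u ℓ vs cs} → RPath Ac a u ℓ vs cs → (L : List (Fin n)) → Unique L → (∀ {y} → y ∈ L → u ~ y) →
    (es : List (Constraint L)) → length es + (suc ℓ + (ℓ + length Ac)) < length L →
    ∃ λ y → y ∈ L × RPath Ac a y (suc ℓ) (y ∷ vs) (κ u y ∷ cs) × All (λ c → ¬ Bad c y) es
  extend {Ac} {a} {u} {ℓ} {vs} {cs} p L uL adjL es len =
    let y , y∈ , h = pick L (es ++ (V ++ (K₁ ++ K₂))) uL (subst (_< length L) (sym lenEq) len)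
        hes , h′ = Allₚ.++⁻ es h
        hV , h″ = Allₚ.++⁻ V h′
        hK₁ , hK₂ = Allₚ.++⁻ K₁ h″
    in y , y∈ , step p (adjL y∈) (avoidV-∉ vs hV) (keyConstraints-∉ ℕₚ._≟_ (κ u) injκ cs hK₁)
                  (keyConstraints-∉ ℕₚ._≟_ (κ u) injκ Ac hK₂) , hes
    where
    injκ : ∀ {x y} → x ∈ L → y ∈ L → κ u x ≡ κ u y → x ≡ y
    injκ x∈ y∈ = properAt (adjL x∈) (adjL y∈)
    V K₁ K₂ : List (Constraint L)
    V = avoidV vs
    K₁ = keyConstraints ℕₚ._≟_ (κ u) injκ cs
    K₂ = keyConstraints ℕₚ._≟_ (κ u) injκ Ac
    lenEq : length (es ++ (V ++ (K₁ ++ K₂))) ≡ length es + (suc ℓ + (ℓ + length Ac))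
    lenEq = trans (Lₚ.length-++ es) (cong (length es +_) (trans (Lₚ.length-++ V) (cong₂ _+_
      (trans (Lₚ.length-map _ vs) (length-vs p)) (trans (Lₚ.length-++ K₁) (cong₂ _+_
      (trans (Lₚ.length-map _ cs) (length-cs p)) (Lₚ.length-map _ Ac))))))

  -- A bipartite graph of minimum degree D. L and R may share vertices: paths in it are kept simple
  -- by their own vertex lists.
  record DenseCore (D : ℕ) : Set₁ where
    field
      L R : List (Fin n)
      H : Fin n → Fin n → Set
      H⇒~ : ∀ {x y} → H x y → x ~ y
      right : Fin n → List (Fin n)
      left : Fin n → List (Fin n)
      right-unique : ∀ {x} → x ∈ L → Unique (right x)
      left-unique : ∀ {y} → y ∈ R → Unique (left y)
      right-long : ∀ {x} → x ∈ L → D ≤ length (right x)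
      left-long : ∀ {y} → y ∈ R → D ≤ length (left y)
      right⊆ : ∀ {x y} → x ∈ L → y ∈ right x → H x y × y ∈ R
      left⊆ : ∀ {x y} → y ∈ R → x ∈ left y → H x y × x ∈ L

  flip-core : ∀ {D} → DenseCore D → DenseCore D
  flip-core K = record
    { L = R ; R = L ; H = λ y x → H x y ; H⇒~ = adjSym G ∘ H⇒~ ; right = left ; left = right
    ; right-unique = left-unique ; left-unique = right-unique ; right-long = left-long ; left-long = right-long
    ; right⊆ = left⊆ ; left⊆ = right⊆ }
    where open DenseCore K

  record RPathInto (Ac : List ℕ) (a : Fin n) (ℓ : ℕ) (S : List (Fin n)) : Set where
    constructor into
    field
      {end} : Fin n
      {vs} : List (Fin n)
      {cs} : List ℕ
      end∈S : end ∈ S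
      path : RPath Ac a end ℓ vs cs

  half-step : ∀ {T} (K : DenseCore (room T)) → let open DenseCore K in
    ∀ {Ac a ℓ} → RPathInto Ac a ℓ L → ℓ ≤ T → length Ac ≤ 1 → RPathInto Ac a (suc ℓ) R
  half-step K (into {x} x∈ p) len lenA =
    let y , y∈ , p₁ , _ = extend p (right x) (right-unique x∈) (λ h → H⇒~ (proj₁ (right⊆ x∈ h))) []
                            (ℕₚ.<-≤-trans (room-< z≤n len lenA) (right-long x∈))
    in into (proj₂ (right⊆ x∈ y∈)) p₁
    where open DenseCore K

  -- Round trips through R supply an arbitrary even number of edges, so only the entry into the core
  -- and the closing have to be designed for each application.
  double-steps : ∀ {T} (K : DenseCore (room T)) → let open DenseCore K in
    ∀ {Ac a ℓ} (j : ℕ) → RPathInto Ac a ℓ L → j + j + ℓ ≤ T → length Ac ≤ 1 → RPathInto Ac a (j + j + ℓ) L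
  double-steps K zero p len lenA = p
  double-steps {T} K {Ac} {a} {ℓ} (suc j) p len lenA = subst (λ m → RPathInto Ac a m (DenseCore.L K)) (sym eq)
    (half-step (flip-core K) (half-step K (double-steps K j p (ℕₚ.≤-trans (ℕₚ.m≤n+m _ 2) len′) lenA)
      (ℕₚ.≤-trans (ℕₚ.m≤n+m _ 2) len′) lenA) (ℕₚ.≤-trans (ℕₚ.n≤1+n _) len′) lenA)
    where
    eq : suc j + suc j + ℓ ≡ suc (suc (j + j + ℓ))
    eq = cong (λ k → suc (k + ℓ)) (ℕₚ.+-suc j j)
    len′ : suc (suc (j + j + ℓ)) ≤ T
    len′ = subst (_≤ T) eq len

-- Cores from degree peeling, and paths of length 2 for even t

module Cores {n : ℕ} (G : Graph n) (c : ProperColouring G) (adj? : ∀ u v → Dec (Adj G u v)) where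
  open Rainbow G c

  module DegreePeeling (D : ℕ) (E : Fin n → Fin n → Set) (E? : ∀ x y → Dec (E x y)) (E⇒~ : ∀ {x y} → E x y → x ~ y) where

    -- With `suc D` the empty list is weak even for D = 0, and every vertex of the core has a
    -- neighbour in it.
    open Peeling E E? (λ _ l → length l < suc D) (λ _ l → length l ℕₚ.<? suc D) (λ _ → s≤s z≤n)
                      (λ _ l → length l < suc D) (λ _ l → length l ℕₚ.<? suc D) (λ _ → s≤s z≤n) public
    open Peeled peel public

    E?′ : ∀ x y → Dec (E x y)
    E?′ = E?

    core : DenseCore D
    core = record
      { L = coreL ; R = coreR ; H = E ; H⇒~ = E⇒~
      ; right = λ x → nbrsR x coreR ; left = λ y → nbrsL y coreL
      ; right-unique = λ _ → Uₚ.filter⁺ _ uniqueR ; left-unique = λ _ → Uₚ.filter⁺ _ uniqueL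
      ; right-long = λ x∈ → ℕₚ.≤-trans (ℕₚ.n≤1+n D) (ℕₚ.≮⇒≥ (strongL x∈))
      ; left-long = λ y∈ → ℕₚ.≤-trans (ℕₚ.n≤1+n D) (ℕₚ.≮⇒≥ (strongR y∈))
      ; right⊆ = λ {x} _ h → proj₂ (Mₚ.∈-filter⁻ (E? x) {xs = coreR} h) , proj₁ (Mₚ.∈-filter⁻ (E? x) h)
      ; left⊆ = λ {_} {y} _ h → proj₂ (Mₚ.∈-filter⁻ (λ x → E? x y) {xs = coreL} h) , proj₁ (Mₚ.∈-filter⁻ (λ x → E? x y) h) }

    right-nonempty : ∀ {x} → x ∈ coreL → ∃ λ y → y ∈ nbrsR x coreR
    right-nonempty {x} x∈ with nbrsR x coreR | ℕₚ.≮⇒≥ (strongL x∈)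
    ... | y ∷ _ | _ = y , here refl

    E-right : ∀ {x} → x ∈ coreL → ∃ λ y → E x y
    E-right {x} x∈ = go (right-nonempty x∈)
      where
      go : (∃ λ y → y ∈ nbrsR x coreR) → ∃ λ y → E x y
      go (y , y∈) = y , proj₂ (Mₚ.∈-filter⁻ (E? x) {xs = coreR} y∈)

  colourNbrs : Fin n → ℕ → List (Fin n)
  colourNbrs u q = filter (λ w → adj? u w ×-dec (κ u w ℕₚ.≟ q)) (allFin n)

  length-colourNbrs : ∀ u q → length (colourNbrs u q) ≤ 1
  length-colourNbrs u q with colourNbrs u q in eq | Uₚ.filter⁺ (λ w → adj? u w ×-dec (κ u w ℕₚ.≟ q)) (Uₚ.allFin⁺ n)
  ... | [] | _ = z≤n
  ... | w ∷ [] | _ = s≤s z≤n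
  ... | w₁ ∷ w₂ ∷ _ | (w≢ ∷ _) ∷ _ = contradiction
          (properAt (proj₁ (mem (here refl))) (proj₁ (mem (there (here refl))))
            (trans (proj₂ (mem (here refl))) (sym (proj₂ (mem (there (here refl))))))) w≢
    where
    mem : ∀ {w} → w ∈ w₁ ∷ w₂ ∷ _ → u ~ w × κ u w ≡ q
    mem w∈ = proj₂ (Mₚ.∈-filter⁻ (λ w → adj? u w ×-dec (κ u w ℕₚ.≟ q)) {xs = allFin n} (subst (_ ∈_) (sym eq) w∈))

  ∈-colourNbrs : ∀ {u w q} → u ~ w → κ u w ≡ q → w ∈ colourNbrs u q
  ∈-colourNbrs e h = Mₚ.∈-filter⁺ _ (Mₚ.∈-allFin _) (e , h)

  -- Faudree–Simonovits: a dense bipartite graph between N(v) and V ∖ {v} would close up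
  -- through v to a rainbow cycle of length j + j + 4.
  module TwoPaths (j : ℕ) (no-rainbow : ¬ RainbowCycle G c (j + j + 4)) where

    T : ℕ
    T = j + j + 4

    module _ (v : Fin n) where
      E : Fin n → Fin n → Set
      E x y = v ~ x × x ~ y × y ≢ v

      module P = DegreePeeling (room T) E (λ x y → adj? v x ×-dec (adj? x y ×-dec ¬? (y Fₚ.≟ v))) (proj₁ ∘ proj₂)

      open DenseCore P.core

      left-inj : ∀ {y x x′} → x ∈ left y → x′ ∈ left y → κ x v ≡ κ x′ v → x ≡ x′
      left-inj {y} h h′ = properAt′ (v~ h) (v~ h′)
        where
        v~ : ∀ {x} → x ∈ left y → v ~ x
        v~ {x} h = proj₁ (proj₂ (Mₚ.∈-filter⁻ (λ x → P.E?′ x y) {xs = L} h))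

      closing : ∀ {y} → List ℕ → List (Constraint (left y))
      closing = keyConstraints ℕₚ._≟_ (λ x → κ x v) left-inj

      finish : ∀ {y x ℓ vs cs} → suc ℓ ≡ T → E x y → RPath [] v x ℓ (x ∷ vs) (κ y x ∷ cs) → κ x v ∉ cs → ⊥
      finish eq (v~x , x~y , y≢v) p k = no-rainbow (subst (RainbowCycle G c) eq (close p (adjSym G v~x) λ where
        (here h) → y≢v (sym (properAt (adjSym G v~x) x~y (trans h (colSym c (adjSym G x~y)))))
        (there h) → k h))

      close-up : ∀ {ℓ} → suc (suc ℓ) ≡ T → RPathInto [] v ℓ R → ⊥
      close-up {ℓ} eq (into {y} {vs} {cs} y∈ p) = go (extend p (left y) (left-unique y∈) (λ h → adjSym G (H⇒~ (proj₁ (left⊆ y∈ h))))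
          (closing cs) (ℕₚ.<-≤-trans (room-< bound ℓ≤T z≤n) (left-long y∈)))
        where
        ℓ≤T : ℓ ≤ T
        ℓ≤T = subst (ℓ ≤_) eq (ℕₚ.m≤n+m ℓ 2)
        bound : length (closing {y} cs) ≤ 5 * T + 5
        bound = subst (_≤ 5 * T + 5) (sym (trans (Lₚ.length-map _ cs) (length-cs p)))
                  (ℕₚ.≤-trans ℓ≤T (ℕₚ.≤-trans (ℕₚ.m≤m+n T _) (ℕₚ.m≤m+n (5 * T) 5)))
        go : (∃ λ x → x ∈ left y × RPath [] v x (suc ℓ) (x ∷ vs) (κ y x ∷ cs) × All (λ c → ¬ Bad c x) (closing {y} cs)) → ⊥
        go (x , x∈ , p′ , h) = finish eq (proj₁ (left⊆ y∈ x∈)) p′ (keyConstraints-∉ ℕₚ._≟_ (λ x → κ x v) left-inj cs h)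

      -- One edge from v to x, j round trips, a step to R, a step back to L and the closing edge to
      -- v make 1 + 2j + 1 + 1 + 1 = T edges. The last two colours differ because y ≠ v.
      core-empty : ∀ {x} → x ∉ L
      core-empty {x} x∈ = close-up eq (half-step P.core (double-steps P.core j (into x∈
          (step start v~x (λ { (here h) → ~⇒≢ v~x (sym h) }) (λ ()) (λ ()))) bound z≤n) bound z≤n)
        where
        v~x : v ~ x
        v~x = proj₁ (proj₂ (P.E-right x∈))
        bound : j + j + 1 ≤ T
        bound = ℕₚ.+-monoʳ-≤ (j + j) (s≤s z≤n)
        arith : ∀ j → suc (suc (suc (j + j + 1))) ≡ j + j + 4
        arith = solve-∀
        eq : suc (suc (suc (j + j + 1))) ≡ T
        eq = arith j

    -- The records of the peeling rooted at v: F v x contains candidates for the vertex after v, x,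
    -- and G₀ v y candidates for the vertex between v and y.
    F G₀ : Fin n → Fin n → List (Fin n)
    F v x = P.recL v x
    G₀ v y = P.recR v y

    length-F : ∀ v x → length (F v x) ≤ room T
    length-F v x = ℕₚ.≤-pred (P.weakL v x)

    length-G₀ : ∀ v x → length (G₀ v x) ≤ room T
    length-G₀ v x = ℕₚ.≤-pred (P.weakR v x)

    two-path : ∀ {v x y} → v ~ x → x ~ y → y ≢ v → y ∈ F v x ⊎ x ∈ G₀ v y
    two-path {v} e f ne with P.covers v (Mₚ.∈-allFin _) (Mₚ.∈-allFin _) (e , f , ne)
    ... | inj₁ (x∈ , _) = contradiction x∈ (core-empty v)
    ... | inj₂ h = h

    B : ℕ
    B = room T + room T

    Gs : Fin n → Fin n → List (Fin n)
    Gs u w = G₀ u w ++ G₀ w u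

    length-Gs : ∀ u w → length (Gs u w) ≤ B
    length-Gs u w = length-++-≤ (G₀ u w) (length-G₀ u w) (length-G₀ w u)

    length-F≤B : ∀ u w → length (F u w) ≤ B
    length-F≤B u w = ℕₚ.≤-trans (length-F u w) (ℕₚ.m≤m+n _ _)

    -- If m is in the list of the two ends for neither orientation, then for both orientations the
    -- far end is in the list of the near end and m. Keeping both memberships allows a path to be
    -- continued from either side.
    middle : ∀ {u m w} → u ~ m → m ~ w → w ≢ u → m ∈ Gs u w ⊎ (w ∈ F u m × u ∈ F w m)
    middle {u} {m} {w} e f ne with two-path e f ne | two-path (adjSym G f) (adjSym G e) (ne ∘ sym)
    ... | inj₂ h | _ = inj₁ (Mₚ.∈-++⁺ˡ h)
    ... | inj₁ _ | inj₂ h = inj₁ (Mₚ.∈-++⁺ʳ (G₀ u w) h)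
    ... | inj₁ h | inj₁ h′ = inj₂ (h , h′)

-- Three-paths when t ≥ 6 is even

-- Each y is viewed as an edge joining the value `key₁ y` to the value `key₂ y`, and `match` is a
-- greedy maximal matching. If it is large, it is a large set on which both keys are injective; if
-- it is small, its few values of the keys meet every y by maximality.
module Matching {n : ℕ} (key₁ : Fin n → Fin n) (key₂ : Fin n → ℕ) where

  fresh? : (y : Fin n) (m : List (Fin n)) → Dec (key₁ y ∈ map key₁ m ⊎ key₂ y ∈ map key₂ m)
  fresh? y m = Any.any? (key₁ y Fₚ.≟_) (map key₁ m) ⊎-dec Any.any? (key₂ y ℕₚ.≟_) (map key₂ m)

  match : List (Fin n) → List (Fin n)
  match [] = []
  match (y ∷ ys) with fresh? y (match ys)
  ... | yes _ = match ys
  ... | no _ = y ∷ match ys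

  match⊆ : ∀ {y} l → y ∈ match l → y ∈ l
  match⊆ (x ∷ l) h with fresh? x (match l)
  ... | yes _ = there (match⊆ l h)
  match⊆ (x ∷ l) (here refl) | no _ = here refl
  match⊆ (x ∷ l) (there h) | no _ = there (match⊆ l h)

  match-maximal : ∀ {y} l → y ∈ l → key₁ y ∈ map key₁ (match l) ⊎ key₂ y ∈ map key₂ (match l)
  match-maximal (x ∷ l) h with fresh? x (match l)
  match-maximal (x ∷ l) (here refl) | yes p = p
  match-maximal (x ∷ l) (there h) | yes _ = match-maximal l h
  match-maximal (x ∷ l) (here refl) | no _ = inj₁ (here refl)
  match-maximal (x ∷ l) (there h) | no _ with match-maximal l h
  ... | inj₁ p = inj₁ (there p)
  ... | inj₂ p = inj₂ (there p)

  key₁-injective : ∀ l {x y} → x ∈ match l → y ∈ match l → key₁ x ≡ key₁ y → x ≡ y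
  key₁-injective (z ∷ l) h g e with fresh? z (match l)
  ... | yes _ = key₁-injective l h g e
  key₁-injective (z ∷ l) (here refl) (here refl) e | no _ = refl
  key₁-injective (z ∷ l) (here refl) (there g) e | no ¬p =
    contradiction (inj₁ (subst (_∈ map key₁ (match l)) (sym e) (Mₚ.∈-map⁺ key₁ g))) ¬p
  key₁-injective (z ∷ l) (there h) (here refl) e | no ¬p =
    contradiction (inj₁ (subst (_∈ map key₁ (match l)) e (Mₚ.∈-map⁺ key₁ h))) ¬p
  key₁-injective (z ∷ l) (there h) (there g) e | no _ = key₁-injective l h g e

  key₂-injective : ∀ l {x y} → x ∈ match l → y ∈ match l → key₂ x ≡ key₂ y → x ≡ y
  key₂-injective (z ∷ l) h g e with fresh? z (match l)
  ... | yes _ = key₂-injective l h g e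
  key₂-injective (z ∷ l) (here refl) (here refl) e | no _ = refl
  key₂-injective (z ∷ l) (here refl) (there g) e | no ¬p =
    contradiction (inj₂ (subst (_∈ map key₂ (match l)) (sym e) (Mₚ.∈-map⁺ key₂ g))) ¬p
  key₂-injective (z ∷ l) (there h) (here refl) e | no ¬p =
    contradiction (inj₂ (subst (_∈ map key₂ (match l)) e (Mₚ.∈-map⁺ key₂ h))) ¬p
  key₂-injective (z ∷ l) (there h) (there g) e | no _ = key₂-injective l h g e

  match-unique : ∀ l → Unique (match l)
  match-unique [] = []
  match-unique (x ∷ l) with fresh? x (match l)
  ... | yes _ = match-unique l
  ... | no ¬p = All.tabulate (λ { h refl → ¬p (inj₁ (Mₚ.∈-map⁺ key₁ h)) }) ∷ match-unique l

  length-match : ∀ l → length (match l) ≤ length l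
  length-match [] = z≤n
  length-match (x ∷ l) with fresh? x (match l)
  ... | yes _ = ℕₚ.m≤n⇒m≤1+n (length-match l)
  ... | no _ = s≤s (length-match l)

module ThreePathCores {n : ℕ} (G : Graph n) (c : ProperColouring G) (adj? : ∀ u v → Dec (Adj G u v))
  (j : ℕ) (no-rainbow : ¬ RainbowCycle G c (suc j + suc j + 4)) where

  open Rainbow G c
  open Cores G c adj?

  T : ℕ
  T = suc j + suc j + 4

  bound : ∀ {e} → e ≤ 6 → j + j + e ≤ T
  bound {e} h = subst (j + j + e ≤_) (arith j) (ℕₚ.+-monoʳ-≤ (j + j) h)
    where
    arith : ∀ j → j + j + 6 ≡ suc j + suc j + 4
    arith = solve-∀

  cycle-length : suc (suc (suc (j + j + 3))) ≡ T
  cycle-length = arith j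
    where
    arith : ∀ j → suc (suc (suc (j + j + 3))) ≡ suc j + suc j + 4
    arith = solve-∀

  weaken-core : ∀ {D D′} → D ≤ D′ → DenseCore D′ → DenseCore D
  weaken-core h K = record
    { L = L ; R = R ; H = H ; H⇒~ = H⇒~ ; right = right ; left = left
    ; right-unique = right-unique ; left-unique = left-unique
    ; right-long = λ x∈ → ℕₚ.≤-trans h (right-long x∈) ; left-long = λ x∈ → ℕₚ.≤-trans h (left-long x∈)
    ; right⊆ = right⊆ ; left⊆ = left⊆ }
    where open DenseCore K

  -- The paths v ~ p y ~ y ~ a whose end edges have different colours.
  module Parents (v : Fin n) (p : Fin n → Fin n) where

    record E (y a : Fin n) : Set where
      constructor mkE
      field
        v~p : v ~ p y
        p~y : p y ~ y
        y~a : y ~ a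
        p≢a : p y ≢ a
        v≢y : v ≢ y
        v≢a : v ≢ a
        col≢ : κ v (p y) ≢ κ y a
    open E public

    E? : ∀ y a → Dec (E y a)
    E? y a = map′ (λ (h₁ , h₂ , h₃ , h₄ , h₅ , h₆ , h₇) → mkE h₁ h₂ h₃ h₄ h₅ h₆ h₇)
                  (λ (mkE h₁ h₂ h₃ h₄ h₅ h₆ h₇) → h₁ , h₂ , h₃ , h₄ , h₅ , h₆ , h₇)
                  (adj? v (p y) ×-dec (adj? (p y) y ×-dec (adj? y a ×-dec (¬? (p y Fₚ.≟ a) ×-dec
                    (¬? (v Fₚ.≟ y) ×-dec (¬? (v Fₚ.≟ a) ×-dec ¬? (κ v (p y) ℕₚ.≟ κ y a)))))))

    q : Fin n → ℕ
    q y = κ (p y) y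

    -- The edges a y, y p(y) and p(y) v have different colours by p(y) ≠ a, by v ≠ y and by `col≢`;
    -- the last condition concerns disjoint edges, does not follow from properness and is therefore
    -- part of `E`.
    finish : ∀ {y a ℓ vs cs} → suc (suc ℓ) ≡ T → E y a → RPath [] v y ℓ (y ∷ vs) (κ a y ∷ cs) →
      p y ∉ vs → q y ∉ cs → κ (p y) v ∉ cs → ⊥
    finish {y} {a} {cs = cs} eq (mkE v~x x~y y~a x≢a v≢y _ col≢) π x∉ q∉ k∉ =
      no-rainbow (subst (RainbowCycle G c) eq (close
        (step π (adjSym G x~y) (λ { (here h) → ~⇒≢ x~y h ; (there h) → x∉ h }) last∉ (λ ()))
        (adjSym G v~x) closing∉))
      where
      last∉ : κ y (p y) ∉ κ a y ∷ cs
      last∉ (here h) = x≢a (properAt (adjSym G x~y) y~a (trans h (colSym c (adjSym G y~a))))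
      last∉ (there h) = q∉ (subst (_∈ cs) (colSym c (adjSym G x~y)) h)
      closing∉ : κ (p y) v ∉ κ y (p y) ∷ κ a y ∷ cs
      closing∉ (here h) = v≢y (properAt (adjSym G v~x) x~y (trans h (colSym c (adjSym G x~y))))
      closing∉ (there (here h)) = col≢ (trans (colSym c v~x) (trans h (colSym c (adjSym G y~a))))
      closing∉ (there (there h)) = k∉ h

    -- Injectivity of p on M turns the conditions on the vertex p(y) and on the colour of p(y) v
    -- into constraints with one exclusion each. The colour `q y` is left to `es₃` and the last
    -- hypothesis, because it is injective on M in one application and constant in the other.
    close-up : ∀ {Ac a ℓ vs cs} → suc (suc (suc ℓ)) ≡ T → RPath Ac v a ℓ vs cs → length Ac ≤ 1 →
      (M : List (Fin n)) → Unique M → room T ≤ length M → (∀ {y} → y ∈ M → E y a) →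
      (∀ {y y′} → y ∈ M → y′ ∈ M → p y ≡ p y′ → y ≡ y′) →
      (es : List (Constraint M)) → length es ≤ T → (∀ {y} → y ∈ M → All (λ c → ¬ Bad c y) es → q y ∉ cs) → ⊥
    close-up {Ac} {a} {ℓ} {vs} {cs} eq π lenA M uM len M⊆ pinj es₃ len-es₃ q∉ =
      go (extend π M uM (λ h → adjSym G (y~a (M⊆ h))) es (ℕₚ.<-≤-trans (room-< len-es ℓ≤T lenA) len))
      where
      ℓ≤T : ℓ ≤ T
      ℓ≤T = subst (ℓ ≤_) eq (ℕₚ.m≤n+m ℓ 3)
      kinj : ∀ {y y′} → y ∈ M → y′ ∈ M → κ (p y) v ≡ κ (p y′) v → y ≡ y′
      kinj h h′ e = pinj h h′ (properAt′ (v~p (M⊆ h)) (v~p (M⊆ h′)) e)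
      es₁ es₂ es : List (Constraint M)
      es₁ = keyConstraints Fₚ._≟_ p pinj vs
      es₂ = keyConstraints ℕₚ._≟_ (λ y → κ (p y) v) kinj cs
      es = es₁ ++ (es₂ ++ es₃)
      len-es : length es ≤ 5 * T + 5
      len-es = ℕₚ.≤-trans (length-++-≤ es₁ (length-map-≤ _ {vs} (ℕₚ.≤-trans (ℕₚ.≤-reflexive (length-vs π)) (s≤s ℓ≤T)))
                 (length-++-≤ es₂ (length-map-≤ _ {cs} (ℕₚ.≤-trans (ℕₚ.≤-reflexive (length-cs π)) ℓ≤T)) len-es₃))
                 (subst₂ _≤_ refl (arith T) (ℕₚ.m≤m+n (suc T + (T + T)) (2 * T + 4)))
        where
        arith : ∀ T → suc T + (T + T) + (2 * T + 4) ≡ 5 * T + 5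
        arith = solve-∀
      go : (∃ λ y → y ∈ M × RPath Ac v y (suc ℓ) (y ∷ vs) (κ a y ∷ cs) × All (λ c → ¬ Bad c y) es) → ⊥
      go (y , y∈ , π′ , h) = finish eq (M⊆ y∈) (forget π′)
        (keyConstraints-∉ Fₚ._≟_ p pinj vs (Allₚ.++⁻ˡ es₁ h))
        (q∉ y∈ (Allₚ.++⁻ʳ es₂ (Allₚ.++⁻ʳ es₁ h)))
        (keyConstraints-∉ ℕₚ._≟_ (λ y → κ (p y) v) kinj cs (Allₚ.++⁻ˡ es₂ (Allₚ.++⁻ʳ es₁ h)))

    open Matching p q

    -- Peeling of E in which a right vertex is weak when few parents and few parent colours
    -- cover its neighbours.
    module P₁ where
      open Peeling E E? (λ _ l → length l < suc (room T)) (λ _ l → length l ℕₚ.<? suc (room T)) (λ _ → s≤s z≤n)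
                   (λ _ l → length (match l) < suc (room T)) (λ _ l → length (match l) ℕₚ.<? suc (room T)) (λ _ → s≤s z≤n) public
      open Peeled peel public

      core : DenseCore (room T)
      core = record
        { L = coreL ; R = coreR ; H = E ; H⇒~ = y~a
        ; right = λ x → nbrsR x coreR ; left = λ y → nbrsL y coreL
        ; right-unique = λ _ → Uₚ.filter⁺ _ uniqueR ; left-unique = λ _ → Uₚ.filter⁺ _ uniqueL
        ; right-long = λ x∈ → ℕₚ.≤-trans (ℕₚ.n≤1+n _) (ℕₚ.≮⇒≥ (strongL x∈))
        ; left-long = λ {y} y∈ → ℕₚ.≤-trans (ℕₚ.n≤1+n _) (ℕₚ.≤-trans (ℕₚ.≮⇒≥ (strongR y∈)) (length-match (nbrsL y coreL)))
        ; right⊆ = λ {x} _ h → proj₂ (Mₚ.∈-filter⁻ (E? x) {xs = coreR} h) , proj₁ (Mₚ.∈-filter⁻ (E? x) h)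
        ; left⊆ = λ {_} {y} _ h → proj₂ (Mₚ.∈-filter⁻ (λ x → E? x y) {xs = coreL} h) , proj₁ (Mₚ.∈-filter⁻ (λ x → E? x y) h) }

      conclude : RPathInto [] v (j + j + 3) coreR → ⊥
      conclude (into {a} {vs} {cs} a∈ π) = close-up cycle-length π z≤n (match l) (match-unique l)
          (ℕₚ.≤-trans (ℕₚ.n≤1+n _) (ℕₚ.≮⇒≥ (strongR a∈))) M⊆ (key₁-injective l)
          (keyConstraints ℕₚ._≟_ q (key₂-injective l) cs)
          (length-map-≤ _ {cs} (ℕₚ.≤-trans (ℕₚ.≤-reflexive (length-cs π)) (bound (s≤s (s≤s (s≤s z≤n))))))
          (λ _ h → keyConstraints-∉ ℕₚ._≟_ q (key₂-injective l) cs h)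
        where
        l : List (Fin n)
        l = nbrsL a coreL
        M⊆ : ∀ {y} → y ∈ match l → E y a
        M⊆ h = proj₂ (Mₚ.∈-filter⁻ (λ y → E? y a) {xs = coreL} (match⊆ l h))

      -- The path v, p(y), y enters L with two edges, 2j + 1 further edges lead to R, and three
      -- edges close: 2j + 6 = T.
      core-empty : ∀ {y a} → y ∈ coreL → E y a → ⊥
      core-empty {y} y∈ (mkE v~x x~y y~a x≢a v≢y _ _) = conclude (subst (λ m → RPathInto [] v m coreR) (sym (ℕₚ.+-suc (j + j) 2))
        (half-step core (double-steps core j (into y∈ π) (bound (s≤s (s≤s z≤n))) z≤n) (bound (s≤s (s≤s z≤n))) z≤n))
        where
        π : RPath [] v y 2 (y ∷ p y ∷ v ∷ []) (κ (p y) y ∷ κ v (p y) ∷ [])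
        π = step (step start v~x (λ { (here h) → ~⇒≢ v~x (sym h) }) (λ ()) (λ ())) x~y
              (λ { (here h) → ~⇒≢ x~y (sym h) ; (there (here h)) → v≢y (sym h) })
              (λ { (here h) → v≢y (properAt (adjSym G v~x) x~y (sym (trans h (colSym c v~x)))) }) (λ ())

    -- With the colour r of the parent edges fixed, parents are injective. The last edge but one of
    -- the cycle always has colour r, so the path must avoid r from its start; this is the purpose
    -- of the list `Ac`. Entering through a parent uses r, which is why this core may be non-empty.
    module P₂ (r : ℕ) where
      E₂ : Fin n → Fin n → Set
      E₂ y a = E y a × q y ≡ r

      -- Twice `room T`: the later choice of y₁ must also avoid a list `F x₀ v` of up to `room T`
      -- parents.
      open DegreePeeling (room T + room T) E₂ (λ y a → E? y a ×-dec (q y ℕₚ.≟ r)) (y~a ∘ proj₁) public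

      q-injective : ∀ {y a y′ a′} → E₂ y a → E₂ y′ a′ → p y ≡ p y′ → y ≡ y′
      q-injective {y} {_} {y′} (e , h) (e′ , h′) eq = properAt (p~y e) (subst (_~ y′) (sym eq) (p~y e′))
        (trans h (trans (sym h′) (cong (λ x → κ x y′) (sym eq))))

      conclude : RPathInto (r ∷ []) v (j + j + 3) coreR → ⊥
      conclude (into {a} {vs} {cs} a∈ π) = close-up cycle-length π (s≤s z≤n) (left a) (left-unique a∈)
          (ℕₚ.≤-trans (ℕₚ.m≤m+n _ _) (left-long a∈)) (proj₁ ∘ E∈)
          (λ h h′ → q-injective (E∈ h) (E∈ h′)) [] z≤n
          (λ h _ → subst (_∉ cs) (sym (proj₂ (E∈ h))) (avoids π (here refl)))
        where
        open DenseCore core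
        E∈ : ∀ {y} → y ∈ left a → E₂ y a
        E∈ h = proj₁ (left⊆ a∈ h)

      -- Three edges into the right part have the parity of two edges into the left part, so j round
      -- trips from the right reach the length that `conclude` closes.
      no-connection : ∀ {y₁ vs cs} → y₁ ∈ coreR → RPath (r ∷ []) v y₁ 3 vs cs → ⊥
      no-connection y₁∈ π = conclude (double-steps (weaken-core (ℕₚ.m≤m+n _ _) (flip-core core)) j (into y₁∈ π)
        (bound (s≤s (s≤s (s≤s z≤n)))) (s≤s z≤n))

nth : {A : Set} → A → List A → ℕ → A
nth d [] _ = d
nth d (x ∷ l) zero = x
nth d (x ∷ l) (suc i) = nth d l i

∈⇒nth : {A : Set} {d x : A} {l : List A} → x ∈ l → ∃ λ i → i < length l × nth d l i ≡ x
∈⇒nth (here refl) = 0 , s≤s z≤n , refl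
∈⇒nth (there h) = let i , i< , eq = ∈⇒nth h in suc i , s≤s i< , eq

length-allFin : ∀ n → length (allFin n) ≡ n
length-allFin n = Lₚ.length-tabulate {n = n} id

allPairs : (n : ℕ) → List (Fin n × Fin n)
allPairs n = concatMap (λ u → map (u ,_) (allFin n)) (allFin n)

length-allPairs : ∀ n → length (allPairs n) ≤ n * n
length-allPairs n = length-concatMap-≤ _ (allFin n) (ℕₚ.≤-reflexive (length-allFin n))
  (λ u → length-map-≤ _ {allFin n} (ℕₚ.≤-reflexive (length-allFin n)))

∈-allPairs : ∀ {n} (u w : Fin n) → (u , w) ∈ allPairs n
∈-allPairs u w = ∈-concatMap (Mₚ.∈-allFin u) (Mₚ.∈-map⁺ _ (Mₚ.∈-allFin w))

module ThreePaths {n : ℕ} (G : Graph n) (c : ProperColouring G) (adj? : ∀ u v → Dec (Adj G u v))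
  (j : ℕ) (no-rainbow : ¬ RainbowCycle G c (suc j + suc j + 4)) where

  open Rainbow G c
  open Cores G c adj?
  open ThreePathCores G c adj? j no-rainbow
  open TwoPaths (suc j) no-rainbow using (F; G₀; Gs; B; length-F; length-F≤B; length-Gs; length-G₀; two-path; middle)

  record Path₃ (v x y a : Fin n) : Set where
    constructor path₃
    field
      v~x : v ~ x
      x~y : x ~ y
      y~a : y ~ a
      v≢y : v ≢ y
      x≢a : x ≢ a
      v≢a : v ≢ a

  Quad : Set
  Quad = Fin n × Fin n × Fin n × Fin n

  -- An index ι makes the vertex between v and y a function of y, as the peeling of pairs (y, a)
  -- requires. Past the end of the list the value is v, which is not adjacent to itself and so
  -- yields no path.
  parent : ℕ → Fin n → Fin n → Fin n
  parent ι v y = nth v (Gs v y) ι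

  module PP (ι : ℕ) (v : Fin n) = Parents v (parent ι v)

  coverParents coverColours : (ι : ℕ) (v a : Fin n) → List (Fin n)
  coverParents ι v a = map (parent ι v) (Matching.match (parent ι v) (PP.q ι v) (PP.P₁.recR ι v a))
  coverColours ι v a = Matching.match (parent ι v) (PP.q ι v) (PP.P₁.recR ι v a)

  -- Each list holds paths (v, x, y, a) recovered from the two vertices that are its arguments, by a
  -- bounded number of choices.
  bySS byS byS′ byColour : Fin n → Fin n → List Quad
  bySS x y = concatMap (λ v → map (λ a → v , x , y , a) (F x y)) (F y x)
  byS x a = concatMap (λ y → map (λ v → v , x , y , a) (F y x)) (Gs x a)
  byS′ v y = concatMap (λ x → map (λ a → v , x , y , a) (F x y)) (Gs v y)
  byColour v y = concatMap (λ x → map (λ a → v , x , y , a) (colourNbrs y (κ v x))) (Gs v y)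

  -- A record at a leaves few parents or few colours. A parent x gives y through `Gs x a`; a colour
  -- r makes the second peeling, with its own records, available at v and a.
  byRecL byParent byRecL₂ byRecR₂ : ℕ → Fin n → Fin n → List Quad
  byRecL ι v y = map (λ a → v , parent ι v y , y , a) (PP.P₁.recL ι v y)
  byParent ι v a = concatMap (λ x → map (λ y → v , x , y , a) (Gs x a)) (coverParents ι v a)
  byRecL₂ ι v y = map (λ a → v , parent ι v y , y , a) (PP.P₂.recL ι v (PP.q ι v y) y)
  byRecR₂ ι v a = concatMap (λ y′ → map (λ y → v , parent ι v y , y , a) (PP.P₂.recR ι v (PP.q ι v y′) a)) (coverColours ι v a)

  indexed : (ℕ → Fin n → Fin n → List Quad) → Fin n → Fin n → List Quad
  indexed f u w = concatMap (λ ι → f ι u w) (upTo B)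

  determined : Fin n → Fin n → List Quad
  determined u w = bySS u w ++ byS u w ++ byS′ u w ++ byColour u w ++
    indexed byRecL u w ++ indexed byParent u w ++ indexed byRecL₂ u w ++ indexed byRecR₂ u w

  K₀ : ℕ
  K₀ = B * B + (B * B + (B * B + (B * 1 + (B * B + (B * (B * B) + (B * B + B * (B * B)))))))

  roomT≤B : room T ≤ B
  roomT≤B = ℕₚ.m≤m+n _ _

  length-indexed : ∀ f {K} → (∀ ι u w → length (f ι u w) ≤ K) → ∀ u w → length (indexed f u w) ≤ B * K
  length-indexed f h u w = length-concatMap-≤ (λ ι → f ι u w) (upTo B) (ℕₚ.≤-reflexive (Lₚ.length-upTo B)) (λ ι → h ι u w)

  length-coverColours : ∀ ι v a → length (coverColours ι v a) ≤ B
  length-coverColours ι v a = ℕₚ.≤-trans (ℕₚ.≤-pred (PP.P₁.weakR ι v a)) roomT≤B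

  module _ (u w : Fin n) where
    length-bySS : length (bySS u w) ≤ B * B
    length-bySS = length-concatMap-≤ (λ v → map (λ a → v , u , w , a) (F u w)) (F w u) (length-F≤B w u)
      (λ v → length-map-≤ (λ a → v , u , w , a) {F u w} (length-F≤B u w))

    length-byS : length (byS u w) ≤ B * B
    length-byS = length-concatMap-≤ (λ y → map (λ v → v , u , y , w) (F y u)) (Gs u w) (length-Gs u w)
      (λ y → length-map-≤ (λ v → v , u , y , w) {F y u} (length-F≤B y u))

    length-byS′ : length (byS′ u w) ≤ B * B
    length-byS′ = length-concatMap-≤ (λ x → map (λ a → u , x , w , a) (F x w)) (Gs u w) (length-Gs u w)
      (λ x → length-map-≤ (λ a → u , x , w , a) {F x w} (length-F≤B x w))

    length-byColour : length (byColour u w) ≤ B * 1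
    length-byColour = length-concatMap-≤ (λ x → map (λ a → u , x , w , a) (colourNbrs w (κ u x))) (Gs u w) (length-Gs u w)
      (λ x → length-map-≤ (λ a → u , x , w , a) {colourNbrs w (κ u x)} (length-colourNbrs w (κ u x)))

  module _ (ι : ℕ) (u w : Fin n) where
    length-byRecL : length (byRecL ι u w) ≤ B
    length-byRecL = length-map-≤ (λ a → u , parent ι u w , w , a) {PP.P₁.recL ι u w} (ℕₚ.≤-trans (ℕₚ.≤-pred (PP.P₁.weakL ι u w)) roomT≤B)

    length-byParent : length (byParent ι u w) ≤ B * B
    length-byParent = length-concatMap-≤ (λ x → map (λ y → u , x , y , w) (Gs x w)) (coverParents ι u w)
      (length-map-≤ (parent ι u) {coverColours ι u w} (length-coverColours ι u w))
      (λ x → length-map-≤ (λ y → u , x , y , w) {Gs x w} (length-Gs x w))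

    length-byRecL₂ : length (byRecL₂ ι u w) ≤ B
    length-byRecL₂ = length-map-≤ (λ a → u , parent ι u w , w , a) {PP.P₂.recL ι u (PP.q ι u w) w} (ℕₚ.≤-pred (PP.P₂.weakL ι u (PP.q ι u w) w))

    length-byRecR₂ : length (byRecR₂ ι u w) ≤ B * B
    length-byRecR₂ = length-concatMap-≤ (λ y′ → map (λ y → u , parent ι u y , y , w) (PP.P₂.recR ι u (PP.q ι u y′) w))
      (coverColours ι u w) (length-coverColours ι u w)
      (λ y′ → length-map-≤ (λ y → u , parent ι u y , y , w) {PP.P₂.recR ι u (PP.q ι u y′) w} (ℕₚ.≤-pred (PP.P₂.weakR ι u (PP.q ι u y′) w)))

  length-determined : ∀ u w → length (determined u w) ≤ K₀
  length-determined u w =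
    length-++-≤ (bySS u w) (length-bySS u w) (length-++-≤ (byS u w) (length-byS u w)
    (length-++-≤ (byS′ u w) (length-byS′ u w) (length-++-≤ (byColour u w) (length-byColour u w)
    (length-++-≤ (indexed byRecL u w) (length-indexed byRecL length-byRecL u w)
    (length-++-≤ (indexed byParent u w) (length-indexed byParent length-byParent u w)
    (length-++-≤ (indexed byRecL₂ u w) (length-indexed byRecL₂ length-byRecL₂ u w)
      (length-indexed byRecR₂ length-byRecR₂ u w)))))))

  baseList : List Quad
  baseList = concatMap (λ uw → determined (proj₁ uw) (proj₂ uw)) (allPairs n)

  base : ∀ {Q} u w → Q ∈ determined u w → Q ∈ baseList
  base u w h = ∈-concatMap (∈-allPairs u w) h

  -- The only case in which no two vertices determine the path directly: (y, a) survives the peeling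
  -- rooted at v for the colour of x y.
  record InCore (v x y a : Fin n) : Set where
    field
      ι : ℕ
      parent≡ : parent ι v y ≡ x
      edge : PP.E ι v y a
      y∈ : y ∈ PP.P₂.coreL ι v (κ x y)
      a∈ : a ∈ PP.P₂.coreR ι v (κ x y)

  ∈-indexed : ∀ {Q} f ι u w → ι < B → Q ∈ f ι u w → Q ∈ indexed f u w
  ∈-indexed f ι u w h Q∈ = ∈-concatMap (Mₚ.∈-upTo⁺ h) Q∈

  module _ {v x y a : Fin n} where

    inl₁ : (v , x , y , a) ∈ bySS x y → (v , x , y , a) ∈ baseList
    inl₁ h = base x y (Mₚ.∈-++⁺ˡ h)
    inl₂ : (v , x , y , a) ∈ byS x a → (v , x , y , a) ∈ baseList
    inl₂ h = base x a (Mₚ.∈-++⁺ʳ (bySS x a) (Mₚ.∈-++⁺ˡ h))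
    inl₃ : (v , x , y , a) ∈ byS′ v y → (v , x , y , a) ∈ baseList
    inl₃ h = base v y (Mₚ.∈-++⁺ʳ (bySS v y) (Mₚ.∈-++⁺ʳ (byS v y) (Mₚ.∈-++⁺ˡ h)))
    tail₄ : ∀ u w → (v , x , y , a) ∈ byColour u w ++ indexed byRecL u w ++ indexed byParent u w ++ indexed byRecL₂ u w ++ indexed byRecR₂ u w →
      (v , x , y , a) ∈ baseList
    tail₄ u w h = base u w (Mₚ.∈-++⁺ʳ (bySS u w) (Mₚ.∈-++⁺ʳ (byS u w) (Mₚ.∈-++⁺ʳ (byS′ u w) h)))
    inl₄ : (v , x , y , a) ∈ byColour v y → (v , x , y , a) ∈ baseList
    inl₄ h = tail₄ v y (Mₚ.∈-++⁺ˡ h)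
    inl₅ : (v , x , y , a) ∈ indexed byRecL v y → (v , x , y , a) ∈ baseList
    inl₅ h = tail₄ v y (Mₚ.∈-++⁺ʳ (byColour v y) (Mₚ.∈-++⁺ˡ h))
    inl₆ : (v , x , y , a) ∈ indexed byParent v a → (v , x , y , a) ∈ baseList
    inl₆ h = tail₄ v a (Mₚ.∈-++⁺ʳ (byColour v a) (Mₚ.∈-++⁺ʳ (indexed byRecL v a) (Mₚ.∈-++⁺ˡ h)))
    inl₇ : (v , x , y , a) ∈ indexed byRecL₂ v y → (v , x , y , a) ∈ baseList
    inl₇ h = tail₄ v y (Mₚ.∈-++⁺ʳ (byColour v y) (Mₚ.∈-++⁺ʳ (indexed byRecL v y) (Mₚ.∈-++⁺ʳ (indexed byParent v y) (Mₚ.∈-++⁺ˡ h))))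
    inl₈ : (v , x , y , a) ∈ indexed byRecR₂ v a → (v , x , y , a) ∈ baseList
    inl₈ h = tail₄ v a (Mₚ.∈-++⁺ʳ (byColour v a) (Mₚ.∈-++⁺ʳ (indexed byRecL v a) (Mₚ.∈-++⁺ʳ (indexed byParent v a) (Mₚ.∈-++⁺ʳ (indexed byRecL₂ v a) h))))

  module ByIndex (ι : ℕ) (ι< : ι < B) (v y a : Fin n) (e : PP.E ι v y a) (y∈Gs : y ∈ Gs (parent ι v y) a) where

    Goal : Set
    Goal = (v , parent ι v y , y , a) ∈ baseList ⊎ InCore v (parent ι v y) y a

    by-peel₂ : ∀ {y′} → y′ ∈ coverColours ι v a → PP.q ι v y ≡ PP.q ι v y′ →
      (y ∈ PP.P₂.coreL ι v (PP.q ι v y) × a ∈ PP.P₂.coreR ι v (PP.q ι v y)) ⊎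
      (a ∈ PP.P₂.recL ι v (PP.q ι v y) y ⊎ y ∈ PP.P₂.recR ι v (PP.q ι v y) a) → Goal
    by-peel₂ y′∈ q≡ (inj₁ (y∈ , a∈)) = inj₂ (record { ι = ι ; parent≡ = refl ; edge = e ; y∈ = y∈ ; a∈ = a∈ })
    by-peel₂ y′∈ q≡ (inj₂ (inj₁ a∈)) =
      inj₁ (inl₇ (∈-indexed byRecL₂ ι v y ι< (Mₚ.∈-map⁺ (λ a → v , parent ι v y , y , a) a∈)))
    by-peel₂ {y′} y′∈ q≡ (inj₂ (inj₂ y∈)) =
      inj₁ (inl₈ (∈-indexed byRecR₂ ι v a ι< (∈-concatMap {f = λ y′ → map (λ y → v , parent ι v y , y , a) (PP.P₂.recR ι v (PP.q ι v y′) a)} y′∈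
        (Mₚ.∈-map⁺ (λ y → v , parent ι v y , y , a) (subst (λ r → y ∈ PP.P₂.recR ι v r a) q≡ y∈)))))

    by-cover : parent ι v y ∈ map (parent ι v) (coverColours ι v a) ⊎ PP.q ι v y ∈ map (PP.q ι v) (coverColours ι v a) → Goal
    by-cover (inj₁ x∈) = inj₁ (inl₆ (∈-indexed byParent ι v a ι< (∈-concatMap {f = λ x → map (λ y → v , x , y , a) (Gs x a)} x∈
      (Mₚ.∈-map⁺ (λ z → v , parent ι v y , z , a) y∈Gs))))
    by-cover (inj₂ q∈) = go (Mₚ.∈-map⁻ (PP.q ι v) q∈)
      where
      go : (∃ λ y′ → y′ ∈ coverColours ι v a × PP.q ι v y ≡ PP.q ι v y′) → Goal
      go (y′ , y′∈ , q≡) = by-peel₂ y′∈ q≡ (PP.P₂.covers ι v (PP.q ι v y) (Mₚ.∈-allFin y) (Mₚ.∈-allFin a) (e , refl))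

    by-peel₁ : (y ∈ PP.P₁.coreL ι v × a ∈ PP.P₁.coreR ι v) ⊎ (a ∈ PP.P₁.recL ι v y ⊎ y ∈ PP.P₁.recR ι v a) → Goal
    by-peel₁ (inj₁ (y∈ , _)) = ⊥-elim (PP.P₁.core-empty ι v y∈ e)
    by-peel₁ (inj₂ (inj₁ a∈)) = inj₁ (inl₅ (∈-indexed byRecL ι v y ι< (Mₚ.∈-map⁺ (λ a → v , parent ι v y , y , a) a∈)))
    by-peel₁ (inj₂ (inj₂ y∈)) = by-cover (Matching.match-maximal (parent ι v) (PP.q ι v) (PP.P₁.recR ι v a) y∈)

    by-index′ : Goal
    by-index′ = by-peel₁ (PP.P₁.covers ι v (Mₚ.∈-allFin y) (Mₚ.∈-allFin a) e)

  module _ {v x y a : Fin n} (π : Path₃ v x y a) where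
      open Path₃ π

      by-index : (ι : ℕ) → ι < B → parent ι v y ≡ x → y ∈ Gs x a → κ v x ≢ κ y a → (v , x , y , a) ∈ baseList ⊎ InCore v x y a
      by-index ι ι< refl y∈Gs ne = ByIndex.by-index′ ι ι< v y a (PP.mkE v~x x~y y~a x≢a v≢y v≢a ne) y∈Gs

      Goal₀ : Set
      Goal₀ = (v , x , y , a) ∈ baseList ⊎ InCore v x y a

      classifyBB : x ∈ Gs v y → y ∈ Gs x a → Dec (κ v x ≡ κ y a) → Goal₀
      classifyBB x∈ y∈ (yes h) = inj₁ (inl₄ (∈-concatMap {f = λ x → map (λ a → v , x , y , a) (colourNbrs y (κ v x))} x∈
        (Mₚ.∈-map⁺ (λ a → v , x , y , a) (∈-colourNbrs y~a (sym h)))))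
      classifyBB x∈ y∈ (no ne) = go (∈⇒nth {d = v} x∈)
        where
        go : (∃ λ ι → ι < length (Gs v y) × nth v (Gs v y) ι ≡ x) → Goal₀
        go (ι , ι< , eq) = by-index ι (ℕₚ.<-≤-trans ι< (length-Gs v y)) eq y∈ ne

      classify′ : x ∈ Gs v y ⊎ (y ∈ F v x × v ∈ F y x) → y ∈ Gs x a ⊎ (a ∈ F x y × x ∈ F a y) → Goal₀
      classify′ (inj₂ (_ , v∈)) (inj₂ (a∈ , _)) = inj₁ (inl₁ (∈-concatMap {f = λ v → map (λ a → v , x , y , a) (F x y)} v∈
        (Mₚ.∈-map⁺ (λ a → v , x , y , a) a∈)))
      classify′ (inj₂ (_ , v∈)) (inj₁ y∈) = inj₁ (inl₂ (∈-concatMap {f = λ y → map (λ v → v , x , y , a) (F y x)} y∈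
        (Mₚ.∈-map⁺ (λ v → v , x , y , a) v∈)))
      classify′ (inj₁ x∈) (inj₂ (a∈ , _)) = inj₁ (inl₃ (∈-concatMap {f = λ x → map (λ a → v , x , y , a) (F x y)} x∈
        (Mₚ.∈-map⁺ (λ a → v , x , y , a) a∈)))
      classify′ (inj₁ x∈) (inj₁ y∈) = classifyBB x∈ y∈ (κ v x ℕₚ.≟ κ y a)

      classify : (v , x , y , a) ∈ baseList ⊎ InCore v x y a
      classify = classify′ (middle v~x x~y (v≢y ∘ sym)) (middle x~y y~a (x≢a ∘ sym))

  -- Recovers v from the continued path: x₁ is the neighbour of y₁ along the colour of x₀ y₀, and v
  -- is a vertex between x₀ and x₁.
  extended : Quad → List Quad
  extended (x₀ , y₀ , a₁ , y₁) = concatMap (λ x₁ → map (λ v → v , x₀ , y₀ , a₁) (G₀ x₀ x₁)) (colourNbrs y₁ (κ x₀ y₀))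

  threePaths : List Quad
  threePaths = baseList ++ concatMap extended baseList

  -- In a core, (v,x₀,y₀,a₁) continues to some y₁ such that v is determined by x₀, y₀, y₁, and
  -- (x₀,y₀,a₁,y₁) is not itself in a core: otherwise the path x₀ v x₁ y₁, with x₁ the parent
  -- of y₁, would close up to a rainbow cycle.
  module _ {v x₀ y₀ a₁ : Fin n} (π : Path₃ v x₀ y₀ a₁) (ic : InCore v x₀ y₀ a₁) where
    open Path₃ π
    open InCore ic

    p : Fin n → Fin n
    p = parent ι v

    module Core₂ = PP.P₂ ι v (κ x₀ y₀)
    open DenseCore Core₂.core

    E∈ : ∀ {y} → y ∈ left a₁ → PP.E ι v y a₁ × PP.q ι v y ≡ κ x₀ y₀
    E∈ h = proj₁ (left⊆ a∈ h)

    pinj : ∀ {y y′} → y ∈ left a₁ → y′ ∈ left a₁ → p y ≡ p y′ → y ≡ y′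
    pinj h h′ = Core₂.q-injective (E∈ h) (E∈ h′)

    kinj : ∀ {y y′} → y ∈ left a₁ → y′ ∈ left a₁ → κ v (p y) ≡ κ v (p y′) → y ≡ y′
    kinj h h′ e = pinj h h′ (properAt (PP.v~p (proj₁ (E∈ h))) (PP.v~p (proj₁ (E∈ h′))) e)

    es₁ es₂ es₃ : List (Constraint (left a₁))
    es₁ = avoidV (y₀ ∷ x₀ ∷ [])
    -- With x₁ outside `F x₀ v`, the path x₀, v, x₁ must put v into `G₀ x₀ x₁`. The next list keeps
    -- ρ away from the colour of y₀ a₁.
    es₂ = keyConstraints Fₚ._≟_ p pinj (F x₀ v)
    es₃ = keyConstraints ℕₚ._≟_ (λ y → κ v (p y)) kinj (κ y₀ a₁ ∷ [])

    enough : length (es₁ ++ es₂ ++ es₃) < length (left a₁)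
    enough = ℕₚ.<-≤-trans (s≤s (length-++-≤ es₁ {es₂ ++ es₃} ℕₚ.≤-refl (length-++-≤ es₂ {es₃} (length-map-≤ _ {F x₀ v} (length-F x₀ v)) ℕₚ.≤-refl)))
      (ℕₚ.≤-trans (ℕₚ.≤-trans (ℕₚ.≤-reflexive (cong (3 +_) (ℕₚ.+-comm (room T) 1)))
        (ℕₚ.+-monoˡ-≤ (room T) {4} (ℕₚ.≤-trans (s≤s (s≤s (s≤s (s≤s z≤n)))) (8≤room T)))) (left-long a∈))

    module Continue (y₁ : Fin n) (y₁∈ : y₁ ∈ left a₁) (y₁∉ : y₁ ∉ y₀ ∷ x₀ ∷ []) (x₁∉F : p y₁ ∉ F x₀ v)
      (k∉ : κ v (p y₁) ∉ κ y₀ a₁ ∷ []) where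
      e₁ : PP.E ι v y₁ a₁
      e₁ = proj₁ (E∈ y₁∈)
      q≡ : κ (p y₁) y₁ ≡ κ x₀ y₀
      q≡ = proj₂ (E∈ y₁∈)
      x₁ : Fin n
      x₁ = p y₁
      x₁≢x₀ : x₁ ≢ x₀
      x₁≢x₀ eq = y₁∉ (here (Core₂.q-injective (e₁ , q≡) (edge , cong (λ x → κ x y₀) parent≡) (trans eq (sym parent≡))))
      v∈ : v ∈ G₀ x₀ x₁
      v∈ = go (two-path (adjSym G v~x) (PP.v~p e₁) x₁≢x₀)
        where
        go : x₁ ∈ F x₀ v ⊎ v ∈ G₀ x₀ x₁ → v ∈ G₀ x₀ x₁
        go (inj₁ h) = ⊥-elim (x₁∉F h)
        go (inj₂ h) = h
      x₁∈ : x₁ ∈ colourNbrs y₁ (κ x₀ y₀)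
      x₁∈ = ∈-colourNbrs (adjSym G (PP.p~y e₁)) (trans (sym (colSym c (PP.p~y e₁))) q≡)
      π′ : Path₃ x₀ y₀ a₁ y₁
      π′ = path₃ x~y y~a (adjSym G (PP.y~a e₁)) x≢a (λ eq → y₁∉ (here (sym eq))) (λ eq → y₁∉ (there (here (sym eq))))
      r : ℕ
      r = κ y₀ a₁
      -- The edges x₁ y₁ and x₀ y₀ share the colour of the core. Hence properness at x₀ separates
      -- the last edge of ρ from the first, and properness at y₀ separates it from the forbidden
      -- colour.
      ρ : RPath (r ∷ []) x₀ y₁ 3 (y₁ ∷ x₁ ∷ v ∷ x₀ ∷ []) (κ x₁ y₁ ∷ κ v x₁ ∷ κ x₀ v ∷ [])
      ρ = step (step (step start (adjSym G v~x) (λ { (here h) → ~⇒≢ v~x h }) (λ ())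
              (λ { (here h) → PP.col≢ edge (trans (cong (κ v) parent≡) (trans (colSym c v~x) h)) }))
            (PP.v~p e₁) (λ { (here h) → ~⇒≢ (PP.v~p e₁) (sym h) ; (there (here h)) → x₁≢x₀ h })
            (λ { (here h) → x₁≢x₀ (properAt (PP.v~p e₁) v~x (trans h (sym (colSym c v~x)))) }) k∉)
          (PP.p~y e₁) (λ { (here h) → ~⇒≢ (PP.p~y e₁) (sym h) ; (there (here h)) → PP.v≢y e₁ (sym h)
                         ; (there (there (here h))) → y₁∉ (there (here h)) })
          (λ { (here h) → PP.v≢y e₁ (sym (properAt (PP.p~y e₁) (adjSym G (PP.v~p e₁)) (trans h (colSym c (PP.v~p e₁)))))
             ; (there (here h)) → v≢y (sym (properAt x~y (adjSym G v~x) (trans (sym q≡) h))) })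
          (λ { (here h) → x≢a (properAt (adjSym G x~y) y~a (trans (sym (colSym c x~y)) (trans (sym q≡) h))) })
      next-in-base : (x₀ , y₀ , a₁ , y₁) ∈ baseList ⊎ InCore x₀ y₀ a₁ y₁ → (x₀ , y₀ , a₁ , y₁) ∈ baseList
      next-in-base (inj₁ h) = h
      next-in-base (inj₂ ic′) = ⊥-elim (PP.P₂.no-connection (InCore.ι ic′) x₀ r (InCore.a∈ ic′) ρ)
      conclusion : (v , x₀ , y₀ , a₁) ∈ threePaths
      conclusion = Mₚ.∈-++⁺ʳ baseList (∈-concatMap {f = extended} (next-in-base (classify π′))
        (∈-concatMap {f = λ x₁ → map (λ v → v , x₀ , y₀ , a₁) (G₀ x₀ x₁)} x₁∈ (Mₚ.∈-map⁺ (λ v → v , x₀ , y₀ , a₁) v∈)))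

    continue : (∃ λ y₁ → y₁ ∈ left a₁ × All (λ c → ¬ Bad c y₁) (es₁ ++ es₂ ++ es₃)) → (v , x₀ , y₀ , a₁) ∈ threePaths
    continue (y₁ , y₁∈ , h) = Continue.conclusion y₁ y₁∈ (avoidV-∉ (y₀ ∷ x₀ ∷ []) (Allₚ.++⁻ˡ es₁ h))
      (keyConstraints-∉ Fₚ._≟_ p pinj (F x₀ v) (Allₚ.++⁻ˡ es₂ (Allₚ.++⁻ʳ es₁ h)))
      (keyConstraints-∉ ℕₚ._≟_ (λ y → κ v (p y)) kinj (κ y₀ a₁ ∷ []) (Allₚ.++⁻ʳ es₂ (Allₚ.++⁻ʳ es₁ h)))

    core-determined : (v , x₀ , y₀ , a₁) ∈ threePaths
    core-determined = continue (pick (left a₁) (es₁ ++ es₂ ++ es₃) uL enough)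
      where
      uL : Unique (left a₁)
      uL = left-unique {a₁} a∈

  ∈-threePaths : ∀ {v x y a} → Path₃ v x y a → (v , x , y , a) ∈ threePaths
  ∈-threePaths {v} {x} {y} {a} π = go (classify π)
    where
    go : (v , x , y , a) ∈ baseList ⊎ InCore v x y a → (v , x , y , a) ∈ threePaths
    go (inj₁ h) = Mₚ.∈-++⁺ˡ h
    go (inj₂ ic) = core-determined π ic

  K₃ : ℕ
  K₃ = K₀ + K₀ * (1 * B)

  length-threePaths : length threePaths ≤ n * n * K₃
  length-threePaths = ℕₚ.≤-trans (length-++-≤ baseList {concatMap extended baseList} length-base
      (length-concatMap-≤ extended baseList length-base length-extended))
    (ℕₚ.≤-reflexive (arith (n * n) K₀ (1 * B)))
    where
    length-extended : ∀ Q → length (extended Q) ≤ 1 * B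
    length-extended (x₀ , y₀ , a₁ , y₁) = length-concatMap-≤ (λ x₁ → map (λ v → v , x₀ , y₀ , a₁) (G₀ x₀ x₁))
      (colourNbrs y₁ (κ x₀ y₀)) (length-colourNbrs y₁ (κ x₀ y₀))
      (λ x₁ → length-map-≤ (λ v → v , x₀ , y₀ , a₁) {G₀ x₀ x₁} (ℕₚ.≤-trans (length-G₀ x₀ x₁) roomT≤B))
    length-base : length baseList ≤ n * n * K₀
    length-base = length-concatMap-≤ (λ uw → determined (proj₁ uw) (proj₂ uw)) (allPairs n) (length-allPairs n) (λ uw → length-determined (proj₁ uw) (proj₂ uw))
    arith : ∀ N K L → N * K + N * K * L ≡ N * (K + K * L)
    arith = solve-∀

-- Cycles as periodic sequences, and lists of their windows

+-%-cong : ∀ {s} .{{_ : NonZero s}} x y z → x % s ≡ y % s → (x + z) % s ≡ (y + z) % s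
+-%-cong {s} x y z h = trans (DM.%-distribˡ-+ x z s) (trans (cong (λ a → (a + z % s) % s) h) (sym (DM.%-distribˡ-+ y z s)))

%-+-injective : ∀ {s} .{{_ : NonZero s}} d i → d < s → (d + i) % s ≡ i % s → d ≡ 0
%-+-injective {s} d i d< h = trans (sym (DM.m<n⇒m%n≡m d<)) (trans (sym shift) (trans (+-%-cong (d + i) i e h) back))
  where
  -- Adding e completes i to a multiple of s, which cancels i modulo s.
  e : ℕ
  e = s * i ∸ i
  i+e : i + e ≡ i * s
  i+e = trans (ℕₚ.m+[n∸m]≡n (ℕₚ.m≤n*m i s)) (ℕₚ.*-comm s i)
  shift : (d + i + e) % s ≡ d % s
  shift = trans (cong (_% s) (trans (ℕₚ.+-assoc d i e) (cong (d +_) i+e))) (DM.[m+kn]%n≡m%n d i s)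
  back : (i + e) % s ≡ 0
  back = trans (cong (_% s) i+e) (DM.m*n%n≡0 i s)

-- The vertices v i, …, v (i + ℓ − 1), with the last one first.
window : {V : Set} → (ℕ → V) → ℕ → ℕ → List V
window v i zero = []
window v i (suc ℓ) = v (ℓ + i) ∷ window v i ℓ

window-≡ : {V : Set} {v w : ℕ → V} (i : ℕ) {s j : ℕ} → window v i s ≡ window w i s → j < s → v (j + i) ≡ w (j + i)
window-≡ i {suc s} {j} h j< with j ℕₚ.≟ s
... | yes refl = Lₚ.∷-injectiveˡ h
... | no ne = window-≡ i (Lₚ.∷-injectiveʳ h) (ℕₚ.≤∧≢⇒< (ℕₚ.≤-pred j<) ne)

window-cong : {V : Set} {v : ℕ → V} (i i′ ℓ : ℕ) → (∀ j → v (j + i) ≡ v (j + i′)) → window v i ℓ ≡ window v i′ ℓ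
window-cong i i′ zero h = refl
window-cong i i′ (suc ℓ) h = cong₂ _∷_ (h ℓ) (window-cong i i′ ℓ h)

toℕ-mod : ∀ i s → toℕ (i DM.mod suc s) ≡ i % suc s
toℕ-mod i s = Fₚ.toℕ-fromℕ< (DM.m%n<n i (suc s))

-- Positions are natural numbers read modulo the length, so windows can wrap around and shifts are
-- ordinary additions.
module Sequence {n s : ℕ} {G : Graph n} (C : CycleIn G (suc s)) where

  seq : ℕ → Fin n
  seq i = vtx C (i DM.mod suc s)

  seq-toℕ : ∀ k → seq (toℕ k) ≡ vtx C k
  seq-toℕ k = cong (vtx C) (Fₚ.toℕ-injective (trans (toℕ-mod (toℕ k) s) (DM.m<n⇒m%n≡m (Fₚ.toℕ<n k))))

  seq-cong : ∀ i j → i % suc s ≡ j % suc s → seq i ≡ seq j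
  seq-cong i j h = cong (vtx C) (Fₚ.toℕ-injective (trans (toℕ-mod i s) (trans h (sym (toℕ-mod j s)))))

  seq-injective : ∀ i j → seq i ≡ seq j → i % suc s ≡ j % suc s
  seq-injective i j h = trans (sym (toℕ-mod i s)) (trans (cong toℕ (inj C h)) (toℕ-mod j s))

  seq-next : ∀ i → vtx C (next (i DM.mod suc s)) ≡ seq (suc i)
  seq-next i = cong (vtx C) (Fₚ.toℕ-injective (trans (toℕ-next _) (trans (cong (λ k → suc k % suc s) (toℕ-mod i s))
    (trans (suc-% i) (sym (toℕ-mod (suc i) s))))))
    where
    suc-% : ∀ i → suc (i % suc s) % suc s ≡ suc i % suc s
    suc-% i = trans (cong (_% suc s) (ℕₚ.+-comm 1 (i % suc s))) (trans (+-%-cong (i % suc s) i 1 (DM.m%n%n≡m%n i (suc s)))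
      (cong (_% suc s) (ℕₚ.+-comm i 1)))

  seq-adj : ∀ i → Adj G (seq i) (seq (suc i))
  seq-adj i = subst (Adj G (seq i)) (seq-next i) (adj C (i DM.mod suc s))

  seq-period : ∀ i → seq (suc s + i) ≡ seq i
  seq-period i = seq-cong (suc s + i) i (trans (cong (_% suc s) (ℕₚ.+-comm (suc s) i)) (DM.[m+n]%n≡m%n i (suc s)))

  seq-≢ : ∀ d {i} → 0 < d → d < suc s → seq (d + i) ≢ seq i
  seq-≢ d {i} 0<d d< h = ℕₚ.<⇒≢ 0<d (sym (%-+-injective d i d< (seq-injective (d + i) i h)))

open Sequence public

sameCopy : ∀ {n s} {G : Graph n} (C D : CycleIn G s) → (∀ k → vtx C k ≡ vtx D k) → SameCopy C D
sameCopy C D h u w = mk⇔ (to C D h) (to D C (sym ∘ h))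
  where
  to : ∀ C D → (∀ k → vtx C k ≡ vtx D k) → EdgeOf C u w → EdgeOf D u w
  to C D h (i , inj₁ (p , q)) = i , inj₁ (trans (sym (h i)) p , trans (sym (h (next i))) q)
  to C D h (i , inj₂ (p , q)) = i , inj₂ (trans (sym (h i)) p , trans (sym (h (next i))) q)

window-determines : ∀ {n s} {G : Graph n} (C D : CycleIn G (suc s)) (i : ℕ) → i < suc s →
  window (seq C) i (suc s) ≡ window (seq D) i (suc s) → ∀ k → vtx C k ≡ vtx D k
window-determines {s = s} C D i i< h k =
  trans (sym (back C)) (trans (window-≡ i h (DM.m%n<n e (suc s))) (back D))
  where
  e : ℕ
  e = toℕ k + (suc s ∸ i)
  index : (e % suc s + i) % suc s ≡ toℕ k % suc s
  index = trans (+-%-cong (e % suc s) e i (DM.m%n%n≡m%n e (suc s)))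
    (trans (cong (_% suc s) (trans (ℕₚ.+-assoc (toℕ k) (suc s ∸ i) i) (cong (toℕ k +_) (ℕₚ.m∸n+n≡m (ℕₚ.<⇒≤ i<)))))
      (DM.[m+n]%n≡m%n (toℕ k) (suc s)))
  back : ∀ C → seq C (e % suc s + i) ≡ vtx C k
  back C = trans (seq-cong C (e % suc s + i) (toℕ k) index) (seq-toℕ C k)

-- A copy is coded by the starting position of its listed window modulo s and by the index of the
-- window in L. Equal codes force pointwise equal cycles, hence the same copy.
count-copies : ∀ {n s m} {G : Graph n} (L : List (List (Fin n))) →
  (∀ (C : CycleIn G (suc s)) → ∃ λ i → window (seq C) i (suc s) ∈ L) →
  DistinctCopies G (suc s) m → m ≤ suc s * length L
count-copies {n} {s} {m} {G} L h (copies , distinct) = Fₚ.injective⇒≤ code-injective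
  where
  start : ∀ C → ∃ λ i → i < suc s × window (seq C) i (suc s) ∈ L
  start C = let i , w∈ = h C in i % suc s , DM.m%n<n i (suc s) ,
    subst (_∈ L) (window-cong i (i % suc s) (suc s) (λ j → seq-cong C (j + i) (j + i % suc s) (trans (cong (_% suc s) (ℕₚ.+-comm j i))
      (trans (sym (+-%-cong (i % suc s) i j (DM.m%n%n≡m%n i (suc s)))) (cong (_% suc s) (ℕₚ.+-comm (i % suc s) j)))))) w∈
  codeOf : ∀ {C} → (∃ λ i → i < suc s × window (seq C) i (suc s) ∈ L) → Fin (suc s) × Fin (length L)
  codeOf (i , i< , w∈) = fromℕ< i< , Any.index w∈
  code : Fin m → Fin (suc s * length L)
  code k = combine (proj₁ (codeOf {copies k} (start (copies k)))) (proj₂ (codeOf {copies k} (start (copies k))))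
  same : ∀ {C D} (p : ∃ λ i → i < suc s × window (seq C) i (suc s) ∈ L) (q : ∃ λ i → i < suc s × window (seq D) i (suc s) ∈ L) →
    proj₁ (codeOf {C} p) ≡ proj₁ (codeOf {D} q) → proj₂ (codeOf {C} p) ≡ proj₂ (codeOf {D} q) → SameCopy C D
  same {C} {D} (i , i< , w∈) (i′ , i′< , w∈′) e₁ e₂ =
    sameCopy C D (window-determines C D i i< (trans (Anyₚ.lookup-index w∈) (trans (cong (lookup L) e₂)
      (trans (sym (Anyₚ.lookup-index w∈′)) (cong (λ i → window (seq D) i (suc s)) (sym i≡))))))
    where
    i≡ : i ≡ i′
    i≡ = trans (sym (Fₚ.toℕ-fromℕ< i<)) (trans (cong toℕ e₁) (Fₚ.toℕ-fromℕ< i′<))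
  code-injective : ∀ {k l} → code k ≡ code l → k ≡ l
  code-injective {k} {l} e with k Fₚ.≟ l
  ... | yes p = p
  ... | no ne = contradiction (same {copies k} {copies l} (start (copies k)) (start (copies l)) (proj₁ e₁₂) (proj₂ e₁₂)) (distinct k l ne)
    where
    a : ∀ k → Fin (suc s)
    a k = proj₁ (codeOf {copies k} (start (copies k)))
    b : ∀ k → Fin (length L)
    b k = proj₂ (codeOf {copies k} (start (copies k)))
    e₁₂ : a k ≡ a l × b k ≡ b l
    e₁₂ = Fₚ.combine-injective (a k) (b k) (a l) (b l) e

module WindowLists (n : ℕ) where

  -- The exponent j is the price of the coding: an arbitrary new vertex costs a factor n, a
  -- determined one a constant, and a pair covered by two-path steps a single factor n.
  record WList (K j : ℕ) : Set where
    constructor wlist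
    field
      list : List (List (Fin n))
      bound : length list ≤ K * n ^ j
  open WList public

  emptyW : WList 1 0
  emptyW = wlist ([] ∷ []) (s≤s z≤n)

  unionW : ∀ {K K′ j} → WList K j → WList K′ j → WList (K + K′) j
  unionW {K} {K′} {j} (wlist L h) (wlist L′ h′) =
    wlist (L ++ L′) (subst (length (L ++ L′) ≤_) (sym (ℕₚ.*-distribʳ-+ (n ^ j) K K′)) (length-++-≤ L h h′))

  freeW : ∀ {K j} → WList K j → WList K (suc j)
  freeW {K} {j} (wlist L h) = wlist (concatMap (λ w → map (_∷ w) (allFin n)) L)
    (ℕₚ.≤-trans (length-concatMap-≤ (λ w → map (_∷ w) (allFin n)) L h
      (λ w → length-map-≤ (_∷ w) {allFin n} (ℕₚ.≤-reflexive (Lₚ.length-tabulate {n = n} id)))) (ℕₚ.≤-reflexive (arith K (n ^ j) n)))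
    where
    arith : ∀ K N n → K * N * n ≡ K * (n * N)
    arith = solve-∀

  ∈-freeW : ∀ {K j w} {W : WList K j} (u : Fin n) → w ∈ list W → u ∷ w ∈ list (freeW W)
  ∈-freeW {w = w} u h = ∈-concatMap {f = λ w → map (_∷ w) (allFin n)} h (Mₚ.∈-map⁺ (_∷ w) (Mₚ.∈-allFin u))

  detW : ∀ {K j} (det : List (Fin n) → List (Fin n)) (b : ℕ) → (∀ w → length (det w) ≤ b) → WList K j → WList (K * b) j
  detW {K} {j} det b hb (wlist L h) = wlist (concatMap (λ w → map (_∷ w) (det w)) L)
    (ℕₚ.≤-trans (length-concatMap-≤ (λ w → map (_∷ w) (det w)) L h
      (λ w → length-map-≤ (_∷ w) {det w} (hb w))) (ℕₚ.≤-reflexive (arith K (n ^ j) b)))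
    where
    arith : ∀ K N b → K * N * b ≡ K * b * N
    arith = solve-∀

  ∈-detW : ∀ {K j w u} {W : WList K j} {det b hb} → w ∈ list W → u ∈ det w → u ∷ w ∈ list (detW det b hb W)
  ∈-detW {w = w} {det = det} h u∈ = ∈-concatMap {f = λ w → map (_∷ w) (det w)} h (Mₚ.∈-map⁺ (_∷ w) u∈)

  allW : ∀ ℓ → WList 1 ℓ
  allW zero = emptyW
  allW (suc ℓ) = freeW (allW ℓ)

  ∈-allW : ∀ (v : ℕ → Fin n) i ℓ → window v i ℓ ∈ list (allW ℓ)
  ∈-allW v i zero = here refl
  ∈-allW v i (suc ℓ) = ∈-freeW {W = allW ℓ} (v (ℓ + i)) (∈-allW v i ℓ)

  pairW : ∀ {K j} (steps : Fin n → List (Fin n × Fin n)) (b : ℕ) → (∀ u → length (steps u) ≤ b * n) → WList K j → WList (K * b) (suc j)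
  pairW {K} {j} steps b hb (wlist L h) = wlist (concatMap f L)
    (ℕₚ.≤-trans (length-concatMap-≤ f L h f-bound) (ℕₚ.≤-reflexive (arith K (n ^ j) b n)))
    where
    f : List (Fin n) → List (List (Fin n))
    f [] = []
    f (u ∷ w) = map (λ (x , y) → y ∷ x ∷ u ∷ w) (steps u)
    f-bound : ∀ w → length (f w) ≤ b * n
    f-bound [] = z≤n
    f-bound (u ∷ w) = length-map-≤ _ {steps u} (hb u)
    arith : ∀ K N b n → K * N * (b * n) ≡ K * b * (n * N)
    arith = solve-∀

  ∈-pairW : ∀ {K j w u x y} {W : WList K j} {steps b hb} → u ∷ w ∈ list W → (x , y) ∈ steps u → y ∷ x ∷ u ∷ w ∈ list (pairW steps b hb W)
  ∈-pairW {w = w} {u} {W = W} h xy∈ = ∈-concatMap h (Mₚ.∈-map⁺ (λ (x , y) → y ∷ x ∷ u ∷ w) xy∈)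

lastOf : {V : Set} → V → List V → V
lastOf u [] = u
lastOf u (x ∷ w) = lastOf x w

lastOf-window : {V : Set} (v : ℕ → V) (i ℓ : ℕ) → lastOf (v (ℓ + i)) (window v i ℓ) ≡ v i
lastOf-window v i zero = refl
lastOf-window v i (suc ℓ) = lastOf-window v i ℓ

-- The two newest vertices, or the newest and the oldest vertex, determine the candidates.
viaNewest viaEnds : {V : Set} → (V → V → List V) → List V → List V
viaNewest f [] = []
viaNewest f (_ ∷ []) = []
viaNewest f (u ∷ x ∷ _) = f x u
viaEnds f [] = []
viaEnds f (u ∷ w) = f u (lastOf u w)

module _ {V : Set} {f : V → V → List V} {b : ℕ} (hb : ∀ u w → length (f u w) ≤ b) where

  length-viaNewest : ∀ w → length (viaNewest f w) ≤ b
  length-viaNewest [] = z≤n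
  length-viaNewest (_ ∷ []) = z≤n
  length-viaNewest (u ∷ x ∷ _) = hb x u

  length-viaEnds : ∀ w → length (viaEnds f w) ≤ b
  length-viaEnds [] = z≤n
  length-viaEnds (u ∷ w) = hb u (lastOf u w)

∈-viaEnds : {V : Set} {f : V → V → List V} (v : ℕ → V) (i ℓ : ℕ) {x : V} → x ∈ f (v (ℓ + i)) (v i) → x ∈ viaEnds f (window v i (suc ℓ))
∈-viaEnds {f = f} v i ℓ {x} = subst (λ z → x ∈ f (v (ℓ + i)) z) (sym (lastOf-window v i ℓ))

any-or-all : {P Q : ℕ → Set} → (∀ j → P j ⊎ Q j) → ∀ ℓ → (∃ λ j → P j) ⊎ (∀ j → j < ℓ → Q j)
any-or-all h zero = inj₂ λ _ ()
any-or-all h (suc ℓ) with any-or-all h ℓ | h ℓ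
... | inj₁ p | _ = inj₁ p
... | inj₂ _ | inj₁ p = inj₁ (ℓ , p)
... | inj₂ qs | inj₂ q = inj₂ λ j j< → go j (j ℕₚ.≟ ℓ) j<
  where
  go : ∀ j → Dec (j ≡ ℓ) → j < suc ℓ → _
  go j (yes refl) _ = q
  go j (no ne) j< = qs j (ℕₚ.≤∧≢⇒< (ℕₚ.≤-pred j<) ne)

infixl 8 _↑_·_
-- This is K b^r, bracketed as the iterated constructions multiply, so that their types agree by
-- computation.
_↑_·_ : ℕ → ℕ → ℕ → ℕ
K ↑ zero · b = K
K ↑ suc r · b = (K ↑ r · b) * b

module Determined {n : ℕ} (G : Graph n) (B : ℕ) (F Gs : Fin n → Fin n → List (Fin n))
  (length-F : ∀ u w → length (F u w) ≤ B) (length-Gs : ∀ u w → length (Gs u w) ≤ B)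
  (middle : ∀ {u m w} → Adj G u m → Adj G m w → w ≢ u → m ∈ Gs u w ⊎ (w ∈ F u m × u ∈ F w m)) where

  open WindowLists n

  -- A continuation by two vertices has one free vertex: the nearer one if F gives the farther, the
  -- farther one if Gs gives the nearer.
  steps : Fin n → List (Fin n × Fin n)
  steps u = concatMap (λ x → map (x ,_) (F u x)) (allFin n) ++ concatMap (λ y → map (_, y) (Gs u y)) (allFin n)

  length-steps : ∀ u → length (steps u) ≤ (B + B) * n
  length-steps u = subst (length (steps u) ≤_) (arith n B)
    (length-++-≤ (concatMap (λ x → map (x ,_) (F u x)) (allFin n))
      (length-concatMap-≤ (λ x → map (x ,_) (F u x)) (allFin n) lenV (λ x → length-map-≤ (x ,_) {F u x} (length-F u x)))
      (length-concatMap-≤ (λ y → map (_, y) (Gs u y)) (allFin n) lenV (λ y → length-map-≤ (_, y) {Gs u y} (length-Gs u y))))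
    where
    lenV : length (allFin n) ≤ n
    lenV = ℕₚ.≤-reflexive (Lₚ.length-tabulate {n = n} id)
    arith : ∀ n B → n * B + n * B ≡ (B + B) * n
    arith = solve-∀

  ∈-steps : ∀ {u x y} → Adj G u x → Adj G x y → y ≢ u → (x , y) ∈ steps u
  ∈-steps {u} {x} {y} e f ne = go (middle e f ne)
    where
    go : x ∈ Gs u y ⊎ (y ∈ F u x × u ∈ F y x) → (x , y) ∈ steps u
    go (inj₁ x∈) = Mₚ.∈-++⁺ʳ (concatMap (λ x → map (x ,_) (F u x)) (allFin n))
      (∈-concatMap {f = λ y → map (_, y) (Gs u y)} (Mₚ.∈-allFin y) (Mₚ.∈-map⁺ (_, y) x∈))
    go (inj₂ (y∈ , _)) = Mₚ.∈-++⁺ˡ (∈-concatMap {f = λ x → map (x ,_) (F u x)} (Mₚ.∈-allFin x) (Mₚ.∈-map⁺ (x ,_) y∈))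

  pairsW : ∀ {K e} (r : ℕ) → WList K e → WList (K ↑ r · (B + B)) (r + e)
  pairsW zero W = W
  pairsW (suc r) W = pairW steps (B + B) length-steps (pairsW r W)

  forwardW : ∀ {K e} (r : ℕ) → WList K e → WList (K ↑ r · B) e
  forwardW zero W = W
  forwardW (suc r) W = detW (viaNewest F) B (length-viaNewest length-F) (forwardW r W)

  closeW : ∀ {K e} → WList K e → WList (K * B) e
  closeW W = detW (viaEnds Gs) B (length-viaEnds length-Gs) W

  raiseW : ∀ {K e e′} → 1 ≤ n → e ≤ e′ → WList K e → WList K e′
  raiseW {K} 1≤n h (wlist L b) = wlist L (ℕₚ.≤-trans b (ℕₚ.*-monoʳ-≤ K (ℕₚ.^-monoʳ-≤ n {{Data.Nat.>-nonZero 1≤n}} h)))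

  module _ {s : ℕ} (4≤s : 4 ≤ suc s) (C : CycleIn G (suc s)) where

    v : ℕ → Fin n
    v = seq C

    v-≢ : ∀ d {i} → 0 < d → d < 4 → v (d + i) ≢ v i
    v-≢ d 0<d d<4 = seq-≢ C d 0<d (ℕₚ.<-≤-trans d<4 4≤s)

    v-≢₂ : ∀ j → v (2 + j) ≢ v j
    v-≢₂ j = v-≢ 2 (s≤s z≤n) (s≤s (s≤s (s≤s z≤n)))

    Between Strong : ℕ → Set
    Between j = v (1 + j) ∈ Gs (v j) (v (2 + j))
    Strong j = v (2 + j) ∈ F (v j) (v (1 + j)) × v j ∈ F (v (2 + j)) (v (1 + j))

    middle-at : ∀ j → Between j ⊎ Strong j
    middle-at j = middle (seq-adj C j) (seq-adj C (1 + j)) (v-≢₂ j)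

    ∈-pairsW : ∀ {K e} {W : WList K e} r i ℓ → window v i (suc ℓ) ∈ list W → window v i (r + r + suc ℓ) ∈ list (pairsW r W)
    ∈-pairsW zero i ℓ h = h
    ∈-pairsW {W = W} (suc r) i ℓ h = subst (λ m → window v i m ∈ list (pairsW (suc r) W)) (cong suc (sym shift))
      (∈-pairW {W = pairsW r W} {steps} {B + B} {length-steps} prev (∈-steps (seq-adj C p) (seq-adj C (1 + p)) (v-≢₂ p)))
      where
      q p : ℕ
      q = r + r + ℓ
      p = q + i
      shift : r + suc r + suc ℓ ≡ suc (suc q)
      shift = arith r ℓ
        where
        arith : ∀ r ℓ → r + suc r + suc ℓ ≡ suc (suc (r + r + ℓ))
        arith = solve-∀
      prev : window v i (suc q) ∈ list (pairsW r W)
      prev = subst (λ m → window v i m ∈ list (pairsW r W)) (ℕₚ.+-suc (r + r) ℓ) (∈-pairsW {W = W} r i ℓ h)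

    ∈-forwardW : ∀ {K e} {W : WList K e} r i → (∀ j → j < r → Strong (j + i)) → window v i 2 ∈ list W → window v i (r + 2) ∈ list (forwardW r W)
    ∈-forwardW zero i hs h = h
    ∈-forwardW {W = W} (suc r) i hs h = subst (λ m → window v i (suc m) ∈ list (forwardW (suc r) W)) (ℕₚ.+-comm 2 r)
      (∈-detW {W = forwardW r W} {viaNewest F} {B} {length-viaNewest length-F}
        (subst (λ m → window v i m ∈ list (forwardW r W)) (ℕₚ.+-comm r 2) (∈-forwardW {W = W} r i (λ j j< → hs j (ℕₚ.m≤n⇒m≤1+n j<)) h))
        (proj₁ (hs r ℕₚ.≤-refl)))

    -- s − 1 consecutive vertices determine the remaining one if it lies between its neighbours.
    ∈-closeW : ∀ {K e} {W : WList K e} j → Between j → window v (2 + j) s ∈ list W → window v (2 + j) (suc s) ∈ list (closeW W)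
    ∈-closeW {K} {e} {W} j b h = go s refl (ℕₚ.≤-trans (s≤s z≤n) (ℕₚ.≤-pred 4≤s)) h
      where
      go : ∀ s₀ → s ≡ s₀ → 1 ≤ s₀ → window v (2 + j) s₀ ∈ list W → v (s₀ + (2 + j)) ∷ window v (2 + j) s₀ ∈ list (closeW W)
      go (suc ℓ) refl _ h = ∈-detW {W = W} {viaEnds Gs} {B} {length-viaEnds length-Gs} h (∈-viaEnds {f = Gs} v (2 + j) ℓ
        (subst₂ (λ a b → a ∈ Gs b (v (2 + j))) (sym (trans (cong (v ∘ suc) (arith₁ ℓ j)) (seq-period C (1 + j))))
          (sym (trans (cong v (arith₂ ℓ j)) (seq-period C j))) b))
        where
        arith₁ : ∀ ℓ j → ℓ + suc (suc j) ≡ suc (ℓ + suc j)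
        arith₁ = solve-∀
        arith₂ : ∀ ℓ j → ℓ + suc (suc j) ≡ suc (suc (ℓ + j))
        arith₂ = solve-∀

  -- If windows of s − 1 vertices are covered by W and windows of two vertices by W₂, then all
  -- cycles of length s are: either a vertex lies between its neighbours or two adjacent
  -- vertices determine everything.
  cycleW : ∀ {K K₂ e} (s : ℕ) → WList K e → WList K₂ e → WList (K * B + K₂ ↑ s · B) e
  cycleW s W W₂ = unionW (closeW W) (forwardW s W₂)

  ∈-cycleW : ∀ {K K₂ e s} (W : WList K e) (W₂ : WList K₂ e) → 4 ≤ suc (suc s) → (C : CycleIn G (suc (suc s))) →
    (∀ i → window (seq C) i (suc s) ∈ list W) → (∀ i → window (seq C) i 2 ∈ list W₂) →
    ∃ λ i → window (seq C) i (suc (suc s)) ∈ list (cycleW s W W₂)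
  ∈-cycleW {s = s} W W₂ 4≤s C h h₂ = go (any-or-all (middle-at 4≤s C) s)
    where
    go : (∃ λ j → Between 4≤s C j) ⊎ (∀ j → j < s → Strong 4≤s C j) → _
    go (inj₁ (j , b)) = 2 + j , Mₚ.∈-++⁺ˡ (∈-closeW 4≤s C {W = W} j b (h (2 + j)))
    go (inj₂ hs) = 0 , Mₚ.∈-++⁺ʳ (list (closeW W)) (subst (λ m → window (seq C) 0 m ∈ list (forwardW s W₂)) (ℕₚ.+-comm s 2)
      (∈-forwardW 4≤s C {W = W₂} s 0 (λ j j< → subst (Strong 4≤s C) (sym (ℕₚ.+-identityʳ j)) (hs j j<)) (h₂ 0)))


-- From covers by windows to upper bounds, with s ≠ t in mind

¬¬-Fin : ∀ {n} {P : Fin n → Set} → (∀ i → ¬ ¬ P i) → ¬ ¬ (∀ i → P i)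
¬¬-Fin {zero} h k = k λ ()
¬¬-Fin {suc n} h k = h zero λ p₀ → ¬¬-Fin (h ∘ suc) λ ps → k λ { zero → p₀ ; (suc i) → ps i }

¬¬-dec : ∀ {P : Set} → ¬ ¬ (Dec P)
¬¬-dec k = k (no (k ∘ yes))

-- Adjacency is an arbitrary family of types, but only finitely many instances of excluded middle
-- are involved and the bounds to be proved are decidable inequalities. Decidable adjacency may
-- therefore be assumed under a double negation.
¬¬-adj? : ∀ {n} (G : Graph n) → ¬ ¬ (∀ u v → Dec (Adj G u v))
¬¬-adj? G = ¬¬-Fin λ u → ¬¬-Fin λ v → ¬¬-dec

Upper : (s t d : ℕ) → Set₁
Upper s t d = ∃[ K ] ∃[ N ] ∀ n → n ≥ N → (G : Graph n) (c : ProperColouring G) →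
  ¬ RainbowCycle G c t → ∀ m → DistinctCopies G s m → m * m ≤ K * n ^ d

square-bound : ∀ {m a K N} → m ≤ a * (K * N) → m * m ≤ (a * K) * (a * K) * (N * N)
square-bound {m} {a} {K} {N} h = ℕₚ.≤-trans (ℕₚ.*-mono-≤ h h) (ℕₚ.≤-reflexive (arith a K N))
  where
  arith : ∀ a K N → a * (K * N) * (a * (K * N)) ≡ (a * K) * (a * K) * (N * N)
  arith = solve-∀

stable-≤ : ∀ {a b} → ¬ ¬ (a ≤ b) → a ≤ b
stable-≤ {a} {b} h with a ℕₚ.≤? b
... | yes p = p
... | no ¬p = contradiction ¬p h

CycleCover : ∀ {n} → Graph n → (s K e : ℕ) → Set
CycleCover {n} G s K e = Σ (WindowLists.WList n K e) λ W →
  ∀ (C : CycleIn G (suc s)) → ∃ λ i → window (seq C) i (suc s) ∈ WindowLists.list W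

cover⇒upper : ∀ s t K e → (∀ {n} → 1 ≤ n → (G : Graph n) (c : ProperColouring G) → (∀ u v → Dec (Adj G u v)) →
  ¬ RainbowCycle G c t → CycleCover G s K e) → Upper (suc s) t (e + e)
cover⇒upper s t K e h = suc s * K * (suc s * K) , 1 , λ n n≥1 G c nr m D →
  stable-≤ λ k → ¬¬-adj? G λ adj? → k (bound n n≥1 G c nr m D adj?)
  where
  bound : ∀ n → n ≥ 1 → (G : Graph n) (c : ProperColouring G) → ¬ RainbowCycle G c t → ∀ m → DistinctCopies G (suc s) m →
    (∀ u v → Dec (Adj G u v)) → m * m ≤ suc s * K * (suc s * K) * n ^ (e + e)
  bound n n≥1 G c nr m D adj? = go (h n≥1 G c adj? nr)
    where
    go : CycleCover G s K e → m * m ≤ suc s * K * (suc s * K) * n ^ (e + e)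
    go (W , mem) = subst (λ N → m * m ≤ suc s * K * (suc s * K) * N) (sym (ℕₚ.^-distribˡ-+-* n e e))
      (square-bound {a = suc s} {K} {n ^ e} (ℕₚ.≤-trans (count-copies (WindowLists.list W) mem D) (ℕₚ.*-monoʳ-≤ (suc s) (WindowLists.bound W))))

module _ (j : ℕ) where
  twoPathBound : ℕ
  twoPathBound = room (j + j + 4) + room (j + j + 4)

  private B = twoPathBound

  evenK : ℕ → ℕ
  evenK r = (1 ↑ r · (B + B)) * B + 1 ↑ (r + r) · B

  -- One free vertex and r steps give 2r + 1 = s - 1 vertices at cost n^(r+1) = n^(s/2). The two
  -- free vertices of the other alternative fit because r ≥ 1.
  even-cover : ∀ r {n} → 1 ≤ r → 1 ≤ n → (G : Graph n) (c : ProperColouring G) → (∀ u v → Dec (Adj G u v)) →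
    ¬ RainbowCycle G c (j + j + 4) → CycleCover G (suc (r + r)) (evenK r) (r + 1)
  even-cover r {n} 1≤r 1≤n G c adj? nr = cycleW (r + r) W W₂ , λ C → ∈-cycleW W W₂ (4≤s r 1≤r) C
      (λ i → subst (λ m → window (seq C) i m ∈ list W) (ℕₚ.+-comm (r + r) 1)
        (∈-pairsW (4≤s r 1≤r) C {W = freeW emptyW} r i 0 (∈-allW (seq C) i 1)))
      (λ i → ∈-allW (seq C) i 2)
    where
    open Cores G c adj?
    open TwoPaths j nr using (F; Gs; length-F≤B; length-Gs; middle)
    open Determined G B F Gs length-F≤B length-Gs middle
    open WindowLists n
    4≤s : ∀ r → 1 ≤ r → 4 ≤ suc (suc (r + r))
    4≤s (suc r) _ = s≤s (s≤s (s≤s (subst (1 ≤_) (sym (ℕₚ.+-suc r r)) (s≤s z≤n))))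
    W : WList (1 ↑ r · (B + B)) (r + 1)
    W = pairsW r (freeW emptyW)
    W₂ : WList 1 (r + 1)
    W₂ = raiseW 1≤n (ℕₚ.+-monoˡ-≤ 1 1≤r) (freeW (freeW emptyW))

  even-upper : ∀ r → 1 ≤ r → Upper (suc (suc (r + r))) (j + j + 4) (r + 1 + (r + 1))
  even-upper r 1≤r = cover⇒upper (suc (r + r)) (j + j + 4) (evenK r) (r + 1) (even-cover r 1≤r)

module _ (j : ℕ) where
  private
    B = twoPathBound (suc j)
    t = suc j + suc j + 4

  -- The constant of `threePaths` written without a graph, since the constant of the upper bound is
  -- chosen before the graph.
  threeK : ℕ
  threeK = K₀ + K₀ * (1 * B)
    where
    K₀ : ℕ
    K₀ = B * B + (B * B + (B * B + (B * 1 + (B * B + (B * (B * B) + (B * B + B * (B * B)))))))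

  oddK : ℕ → ℕ
  oddK r = (threeK ↑ r · (B + B)) * B + 1 ↑ suc (suc (suc (r + r))) · B

  module ThreePathWindows {n : ℕ} (G : Graph n) (c : ProperColouring G) (adj? : ∀ u v → Dec (Adj G u v))
    (nr : ¬ RainbowCycle G c t) where
    open Cores G c adj?
    open TwoPaths (suc j) nr using (F; Gs; length-F≤B; length-Gs; middle) public
    open Determined G B F Gs length-F≤B length-Gs middle public
    open ThreePaths G c adj? j nr using (threePaths; path₃; ∈-threePaths; length-threePaths)
    open WindowLists n

    toWindow : Fin n × Fin n × Fin n × Fin n → List (Fin n)
    toWindow (v , x , y , a) = a ∷ y ∷ x ∷ v ∷ []

    fourW : WList threeK 2
    fourW = wlist (map toWindow threePaths) (length-map-≤ toWindow {threePaths}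
      (ℕₚ.≤-trans length-threePaths (ℕₚ.≤-reflexive (trans (ℕₚ.*-comm (n * n) threeK) (cong (λ k → threeK * (n * k)) (sym (ℕₚ.*-identityʳ n)))))))

    module _ {s : ℕ} (4≤s : 4 ≤ suc s) (C : CycleIn G (suc s)) where

      ∈-fourW : ∀ i → window (seq C) i 4 ∈ list fourW
      ∈-fourW i = Mₚ.∈-map⁺ toWindow (∈-threePaths (path₃ (seq-adj C i) (seq-adj C (1 + i)) (seq-adj C (2 + i))
        (v-≢₂ 4≤s C i ∘ sym) (v-≢₂ 4≤s C (1 + i) ∘ sym) (v-≢ 4≤s C 3 (s≤s z≤n) ℕₚ.≤-refl ∘ sym)))

      ∈-evenW : ∀ r i → window (seq C) i (r + r + 4) ∈ list (pairsW r fourW)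
      ∈-evenW r i = ∈-pairsW 4≤s C {W = fourW} r i 3 (∈-fourW i)

  -- A path of length 3 supplies four vertices at cost n^2 and r steps supply 2r more: s - 1 = 2r +
  -- 4 vertices at cost n^((s-1)/2).
  odd-cover : ∀ r {n} → 1 ≤ n → (G : Graph n) (c : ProperColouring G) → (∀ u v → Dec (Adj G u v)) →
    ¬ RainbowCycle G c t → CycleCover G (suc (suc (suc (suc (r + r))))) (oddK r) (r + 2)
  odd-cover r {n} 1≤n G c adj? nr = cycleW (suc (suc (suc (r + r)))) W W₂ , λ C → ∈-cycleW W W₂ (s≤s (s≤s (s≤s (s≤s z≤n)))) C
      (λ i → subst (λ m → window (seq C) i m ∈ list W) (ℕₚ.+-comm (r + r) 4) (∈-evenW (s≤s (s≤s (s≤s (s≤s z≤n)))) C r i))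
      (λ i → ∈-allW (seq C) i 2)
    where
    open ThreePathWindows G c adj? nr
    open WindowLists n
    W : WList (threeK ↑ r · (B + B)) (r + 2)
    W = pairsW r fourW
    W₂ : WList 1 (r + 2)
    W₂ = raiseW 1≤n (ℕₚ.m≤n+m 2 r) (freeW (freeW emptyW))

  odd-upper : ∀ r → Upper (suc (suc (suc (suc (suc (r + r)))))) t (r + 2 + (r + 2))
  odd-upper r = cover⇒upper (suc (suc (suc (suc (r + r))))) t (oddK r) (r + 2) (odd-cover r)

-- The upper bound for t = 4 and s odd

Σ[_] : {A : Set} → List A → (A → ℕ) → ℕ
Σ[ [] ] f = 0
Σ[ x ∷ l ] f = f x + Σ[ l ] f

module _ {A : Set} where

  Σ-mono : ∀ (l : List A) {f g : A → ℕ} → (∀ x → x ∈ l → f x ≤ g x) → Σ[ l ] f ≤ Σ[ l ] g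
  Σ-mono [] h = z≤n
  Σ-mono (x ∷ l) h = ℕₚ.+-mono-≤ (h x (here refl)) (Σ-mono l λ y y∈ → h y (there y∈))

  Σ-≡ : ∀ (l : List A) {f g : A → ℕ} → (∀ x → f x ≡ g x) → Σ[ l ] f ≡ Σ[ l ] g
  Σ-≡ [] h = refl
  Σ-≡ (x ∷ l) h = cong₂ _+_ (h x) (Σ-≡ l h)

  Σ-+ : ∀ (l : List A) (f g : A → ℕ) → Σ[ l ] (λ x → f x + g x) ≡ Σ[ l ] f + Σ[ l ] g
  Σ-+ [] f g = refl
  Σ-+ (x ∷ l) f g = trans (cong (f x + g x +_) (Σ-+ l f g)) (arith (f x) (g x) (Σ[ l ] f) (Σ[ l ] g))
    where
    arith : ∀ a b c d → a + b + (c + d) ≡ a + c + (b + d)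
    arith = solve-∀

  Σ-const : ∀ (l : List A) K → Σ[ l ] (λ _ → K) ≡ length l * K
  Σ-const [] K = refl
  Σ-const (x ∷ l) K = cong (K +_) (Σ-const l K)

  Σ-filter : ∀ {P : A → Set} (P? : ∀ x → Dec (P x)) (l : List A) (f : A → ℕ) → Σ[ filter P? l ] f ≤ Σ[ l ] f
  Σ-filter P? [] f = z≤n
  Σ-filter P? (x ∷ l) f with P? x
  ... | yes _ = ℕₚ.+-monoʳ-≤ (f x) (Σ-filter P? l f)
  ... | no _ = ℕₚ.≤-trans (Σ-filter P? l f) (ℕₚ.m≤n+m _ (f x))

  Σ-scale : ∀ k (l : List A) (f : A → ℕ) → Σ[ l ] (λ x → k * f x) ≡ k * Σ[ l ] f
  Σ-scale k [] f = sym (ℕₚ.*-zeroʳ k)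
  Σ-scale k (x ∷ l) f = trans (cong (k * f x +_) (Σ-scale k l f)) (sym (ℕₚ.*-distribˡ-+ k (f x) (Σ[ l ] f)))

  2ab≤a²+b² : ∀ a b → 2 * (a * b) ≤ a * a + b * b
  2ab≤a²+b² a b with ℕₚ.≤-total a b
  ... | inj₁ a≤b with ℕₚ.m≤n⇒∃[o]m+o≡n a≤b
  ... | e , refl = subst (2 * (a * (a + e)) ≤_) (arith a e) (ℕₚ.m≤m+n (2 * (a * (a + e))) (e * e))
    where
    arith : ∀ a e → 2 * (a * (a + e)) + e * e ≡ a * a + (a + e) * (a + e)
    arith = solve-∀
  2ab≤a²+b² a b | inj₂ b≤a with ℕₚ.m≤n⇒∃[o]m+o≡n b≤a
  ... | e , refl = subst (2 * ((b + e) * b) ≤_) (arith b e) (ℕₚ.m≤m+n (2 * ((b + e) * b)) (e * e))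
    where
    arith : ∀ b e → 2 * ((b + e) * b) + e * e ≡ (b + e) * (b + e) + b * b
    arith = solve-∀

  cauchy-schwarz : ∀ (l : List A) (f : A → ℕ) → Σ[ l ] f * Σ[ l ] f ≤ length l * Σ[ l ] (λ x → f x * f x)
  cauchy-schwarz [] f = z≤n
  cauchy-schwarz (x ∷ l) f = begin
    (a + S) * (a + S)                                   ≡⟨ expand a S ⟩
    a * a + 2 * (a * S) + S * S                         ≤⟨ ℕₚ.+-mono-≤ (ℕₚ.+-monoʳ-≤ (a * a) cross) (cauchy-schwarz l f) ⟩
    a * a + (length l * (a * a) + Q) + length l * Q     ≡⟨ collect a (length l) Q ⟩
    suc (length l) * (a * a + Q)                        ∎
    where
    open ℕₚ.≤-Reasoning
    a S Q : ℕ
    a = f x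
    S = Σ[ l ] f
    Q = Σ[ l ] (λ x → f x * f x)
    expand : ∀ a S → (a + S) * (a + S) ≡ a * a + 2 * (a * S) + S * S
    expand = solve-∀
    collect : ∀ a n Q → a * a + (n * (a * a) + Q) + n * Q ≡ suc n * (a * a + Q)
    collect = solve-∀
    cross : 2 * (a * S) ≤ length l * (a * a) + Q
    cross = begin
      2 * (a * S)                           ≡⟨ sym (ℕₚ.*-assoc 2 a S) ⟩
      2 * a * S                             ≡⟨ sym (Σ-scale (2 * a) l f) ⟩
      Σ[ l ] (λ y → 2 * a * f y)            ≤⟨ Σ-mono l (λ y _ → subst (_≤ a * a + f y * f y) (sym (ℕₚ.*-assoc 2 a (f y))) (2ab≤a²+b² a (f y))) ⟩
      Σ[ l ] (λ y → a * a + f y * f y)      ≡⟨ Σ-+ l (λ _ → a * a) (λ y → f y * f y) ⟩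
      Σ[ l ] (λ _ → a * a) + Q              ≡⟨ cong (_+ Q) (Σ-const l (a * a)) ⟩
      length l * (a * a) + Q                ∎

Σ-swap : {A B : Set} (k : List A) (l : List B) (f : A → B → ℕ) → Σ[ k ] (λ x → Σ[ l ] (f x)) ≡ Σ[ l ] (λ y → Σ[ k ] (λ x → f x y))
Σ-swap [] l f = sym (trans (Σ-const l 0) (ℕₚ.*-zeroʳ (length l)))
Σ-swap (x ∷ k) l f = trans (cong (Σ[ l ] (f x) +_) (Σ-swap k l f)) (sym (Σ-+ l (f x) (λ y → Σ[ k ] (λ x → f x y))))

indicator : {P : Set} → Dec P → ℕ
indicator (yes _) = 1
indicator (no _) = 0

length-filter≡Σ : {A : Set} {P : A → Set} (P? : ∀ x → Dec (P x)) (l : List A) → length (filter P? l) ≡ Σ[ l ] (indicator ∘ P?)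
length-filter≡Σ P? [] = refl
length-filter≡Σ P? (x ∷ l) with P? x
... | yes _ = cong suc (length-filter≡Σ P? l)
... | no _ = length-filter≡Σ P? l

length-concatMap≡Σ : {A B : Set} (f : A → List B) (l : List A) → length (concatMap f l) ≡ Σ[ l ] (length ∘ f)
length-concatMap≡Σ f [] = refl
length-concatMap≡Σ f (x ∷ l) = trans (Lₚ.length-++ (f x)) (cong (length (f x) +_) (length-concatMap≡Σ f l))

unique-⊆⇒length≤ : {A : Set} (xs {ys} : List A) → Unique xs → (∀ {x} → x ∈ xs → x ∈ ys) → length xs ≤ length ys
unique-⊆⇒length≤ [] u h = z≤n
unique-⊆⇒length≤ {A} (x ∷ xs) {ys} (x∉ ∷ u) h with Mₚ.∈-∃++ (h (here refl))
... | as , bs , refl = subst (suc (length xs) ≤_) (sym (trans (Lₚ.length-++ as) (ℕₚ.+-suc (length as) (length bs))))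
    (s≤s (subst (length xs ≤_) (Lₚ.length-++ as) (unique-⊆⇒length≤ xs u λ {y} y∈ → move y∈ (Mₚ.∈-++⁻ as (h (there y∈))))))
  where
  move : ∀ {y} → y ∈ xs → y ∈ as ⊎ y ∈ x ∷ bs → y ∈ as ++ bs
  move y∈ (inj₁ p) = Mₚ.∈-++⁺ˡ p
  move y∈ (inj₂ (here refl)) = contradiction refl (All.lookup x∉ y∈)
  move y∈ (inj₂ (there p)) = Mₚ.∈-++⁺ʳ as p

module EdgeBound {n : ℕ} (G : Graph n) (adj? : ∀ u v → Dec (Adj G u v)) (B : ℕ) (F Gs : Fin n → Fin n → List (Fin n))
  (length-F : ∀ u w → length (F u w) ≤ B) (length-Gs : ∀ u w → length (Gs u w) ≤ B)
  (middle : ∀ {u m w} → Adj G u m → Adj G m w → w ≢ u → m ∈ Gs u w ⊎ (w ∈ F u m × u ∈ F w m)) where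

  V : List (Fin n)
  V = allFin n

  length-V : length V ≡ n
  length-V = Lₚ.length-tabulate {n = n} id

  nbrs : Fin n → List (Fin n)
  nbrs x = filter (adj? x) V

  d : Fin n → ℕ
  d x = length (nbrs x)

  between? : ∀ x v y → Dec (x ∈ Gs v y)
  between? x v y = Any.any? (x Fₚ.≟_) (Gs v y)

  ends : Fin n → Fin n → List (Fin n)
  ends v x = filter (between? x v) V

  -- Seen from a fixed neighbour v of x, every other neighbour y of x is one of B candidates given v
  -- and x, or x lies between v and y.
  degree-bound : ∀ {x v} → v ∈ nbrs x → d x ≤ suc B + length (ends v x)
  degree-bound {x} {v} v∈ = ℕₚ.≤-trans
    (unique-⊆⇒length≤ (nbrs x) {(v ∷ F v x) ++ ends v x} (Uₚ.filter⁺ (adj? x) (Uₚ.allFin⁺ n)) (λ {y} y∈ → go (y Fₚ.≟ v) y∈))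
    (length-++-≤ (v ∷ F v x) {ends v x} (s≤s (length-F v x)) ℕₚ.≤-refl)
    where
    x~ : ∀ {y} → y ∈ nbrs x → Adj G x y
    x~ y∈ = proj₂ (Mₚ.∈-filter⁻ (adj? x) {xs = V} y∈)
    go : ∀ {y} → Dec (y ≡ v) → y ∈ nbrs x → y ∈ (v ∷ F v x) ++ ends v x
    go (yes refl) y∈ = here refl
    go {y} (no ne) y∈ = go′ (middle (adjSym G (x~ v∈)) (x~ y∈) ne)
      where
      go′ : x ∈ Gs v y ⊎ (y ∈ F v x × v ∈ F y x) → y ∈ (v ∷ F v x) ++ ends v x
      go′ (inj₁ h) = Mₚ.∈-++⁺ʳ (v ∷ F v x) (Mₚ.∈-filter⁺ (between? x v) (Mₚ.∈-allFin y) h)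
      go′ (inj₂ (h , _)) = there (Mₚ.∈-++⁺ˡ h)

  -- The square d(x)^2 is a sum of d(x) over the neighbours v of x, each term bounded relative to
  -- its v. The sizes of `ends v x` then sum to the number of triples with x ∈ `Gs v y`, at most B
  -- for each pair v, y.
  Σd²≤ : Σ[ V ] (λ x → d x * d x) ≤ n * n * (suc B + B)
  Σd²≤ = begin
    Σ[ V ] (λ x → d x * d x)                                        ≡⟨ sym (Σ-≡ V λ x → Σ-const (nbrs x) (d x)) ⟩
    Σ[ V ] (λ x → Σ[ nbrs x ] (λ _ → d x))                          ≤⟨ Σ-mono V (λ x _ → ℕₚ.≤-trans (Σ-mono (nbrs x) (λ v → degree-bound))
                                                                          (Σ-filter (adj? x) V _)) ⟩
    Σ[ V ] (λ x → Σ[ V ] (λ v → suc B + length (ends v x)))         ≡⟨ Σ-swap V V _ ⟩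
    Σ[ V ] (λ v → Σ[ V ] (λ x → suc B + length (ends v x)))         ≤⟨ Σ-mono V (λ v _ → inner v) ⟩
    Σ[ V ] (λ v → n * (suc B + B))                                  ≡⟨ trans (Σ-const V _) (cong (_* (n * (suc B + B))) length-V) ⟩
    n * (n * (suc B + B))                                           ≡⟨ sym (ℕₚ.*-assoc n n (suc B + B)) ⟩
    n * n * (suc B + B)                                             ∎
    where
    open ℕₚ.≤-Reasoning
    inner : ∀ v → Σ[ V ] (λ x → suc B + length (ends v x)) ≤ n * (suc B + B)
    inner v = begin
      Σ[ V ] (λ x → suc B + length (ends v x))                              ≡⟨ Σ-+ V (λ _ → suc B) (λ x → length (ends v x)) ⟩
      Σ[ V ] (λ _ → suc B) + Σ[ V ] (λ x → length (ends v x))               ≡⟨ cong₂ _+_ (trans (Σ-const V (suc B)) (cong (_* suc B) length-V))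
                                                                                (Σ-≡ V λ x → length-filter≡Σ (between? x v) V) ⟩
      n * suc B + Σ[ V ] (λ x → Σ[ V ] (λ y → indicator (between? x v y)))  ≡⟨ cong (n * suc B +_) (Σ-swap V V _) ⟩
      n * suc B + Σ[ V ] (λ y → Σ[ V ] (λ x → indicator (between? x v y)))  ≤⟨ ℕₚ.+-monoʳ-≤ (n * suc B) (Σ-mono V (λ y _ → few v y)) ⟩
      n * suc B + Σ[ V ] (λ y → B)                                          ≡⟨ cong (n * suc B +_) (trans (Σ-const V B) (cong (_* B) length-V)) ⟩
      n * suc B + n * B                                                     ≡⟨ sym (ℕₚ.*-distribˡ-+ n (suc B) B) ⟩
      n * (suc B + B)                                                       ∎
      where
      few : ∀ v y → Σ[ V ] (λ x → indicator (between? x v y)) ≤ B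
      few v y = ℕₚ.≤-trans (ℕₚ.≤-reflexive (sym (length-filter≡Σ (λ x → between? x v y) V)))
        (ℕₚ.≤-trans (unique-⊆⇒length≤ (filter (λ x → between? x v y) V) (Uₚ.filter⁺ (λ x → between? x v y) (Uₚ.allFin⁺ n))
          (λ h → proj₂ (Mₚ.∈-filter⁻ (λ x → between? x v y) {xs = V} h))) (length-Gs v y))

  edges : List (List (Fin n))
  edges = concatMap (λ x → map (λ y → y ∷ x ∷ []) (nbrs x)) V

  ∈-edges : ∀ {x y} → Adj G x y → y ∷ x ∷ [] ∈ edges
  ∈-edges {x} {y} e = ∈-concatMap {f = λ x → map (λ y → y ∷ x ∷ []) (nbrs x)} (Mₚ.∈-allFin x)
    (Mₚ.∈-map⁺ (λ y → y ∷ x ∷ []) (Mₚ.∈-filter⁺ (adj? x) (Mₚ.∈-allFin y) e))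

  edges²≤ : length edges * length edges ≤ (suc B + B) * n ^ 3
  edges²≤ = begin
    length edges * length edges              ≡⟨ cong (λ k → k * k) (trans (length-concatMap≡Σ _ V) (Σ-≡ V λ x → Lₚ.length-map _ (nbrs x))) ⟩
    Σ[ V ] d * Σ[ V ] d                      ≤⟨ cauchy-schwarz V d ⟩
    length V * Σ[ V ] (λ x → d x * d x)      ≤⟨ ℕₚ.*-mono-≤ (ℕₚ.≤-reflexive length-V) Σd²≤ ⟩
    n * (n * n * (suc B + B))                ≡⟨ arith n (suc B + B) ⟩
    (suc B + B) * n ^ 3                      ∎
    where
    open ℕₚ.≤-Reasoning
    arith : ∀ n K → n * (n * n * K) ≡ K * (n * (n * (n * 1)))
    arith = solve-∀

↑-* : ∀ K r b → K ↑ r · b ≡ K * (1 ↑ r · b)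
↑-* K zero b = sym (ℕₚ.*-identityʳ K)
↑-* K (suc r) b = trans (cong (_* b) (↑-* K r b)) (ℕₚ.*-assoc K (1 ↑ r · b) b)

-- For t = 4 and s odd the windows grow from an edge, and there are O(n^(3/2)) edges.
odd-upper₄ : ∀ r → 1 ≤ r → Upper (suc (suc (suc (r + r)))) 4 (r + r + 3)
odd-upper₄ r 1≤r = (s * K′) * (s * K′) * (suc B + B) , 1 , λ n n≥1 G c nr m D →
  stable-≤ λ k → ¬¬-adj? G λ adj? → k (bound n n≥1 G c nr m D adj?)
  where
  B s K′ : ℕ
  B = twoPathBound 0
  s = suc (suc (suc (r + r)))
  K′ = (1 ↑ r · (B + B)) * B + 1 ↑ suc (r + r) · B
  4≤s : 4 ≤ s
  4≤s = s≤s (s≤s (s≤s (ℕₚ.≤-trans 1≤r (ℕₚ.m≤m+n r r))))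
  bound : ∀ n → n ≥ 1 → (G : Graph n) (c : ProperColouring G) → ¬ RainbowCycle G c 4 → ∀ m → DistinctCopies G s m →
    (∀ u v → Dec (Adj G u v)) → m * m ≤ (s * K′) * (s * K′) * (suc B + B) * n ^ (r + r + 3)
  bound n n≥1 G c nr m D adj? = begin
    m * m                                                     ≤⟨ square-bound {a = s} {E * K′} {n ^ r} (ℕₚ.≤-trans count bounded) ⟩
    (s * (E * K′)) * (s * (E * K′)) * (n ^ r * n ^ r)         ≡⟨ arith₁ s E K′ (n ^ r) ⟩
    (s * K′) * (s * K′) * (E * E) * (n ^ r * n ^ r)           ≤⟨ ℕₚ.*-monoˡ-≤ (n ^ r * n ^ r) (ℕₚ.*-monoʳ-≤ ((s * K′) * (s * K′)) edges²≤) ⟩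
    (s * K′) * (s * K′) * ((suc B + B) * n ^ 3) * (n ^ r * n ^ r)  ≡⟨ arith₂ ((s * K′) * (s * K′)) (suc B + B) (n ^ 3) (n ^ r) ⟩
    (s * K′) * (s * K′) * (suc B + B) * (n ^ r * n ^ r * n ^ 3)    ≡⟨ cong ((s * K′) * (s * K′) * (suc B + B) *_)
        (trans (cong (_* n ^ 3) (sym (ℕₚ.^-distribˡ-+-* n r r))) (sym (ℕₚ.^-distribˡ-+-* n (r + r) 3))) ⟩
    (s * K′) * (s * K′) * (suc B + B) * n ^ (r + r + 3)       ∎
    where
    open ℕₚ.≤-Reasoning
    open Cores G c adj?
    open TwoPaths 0 nr using (F; Gs; length-F≤B; length-Gs; middle)
    open Determined G B F Gs length-F≤B length-Gs middle
    open EdgeBound G adj? B F Gs length-F≤B length-Gs middle using (edges; ∈-edges; edges²≤)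
    open WindowLists n
    E : ℕ
    E = length edges
    -- The number of edges is carried as a constant with exponent 0, because its bound n^(3/2) has a
    -- half-integer exponent; it enters only after squaring.
    W₀ : WList E 0
    W₀ = wlist edges (ℕₚ.≤-reflexive (sym (ℕₚ.*-identityʳ E)))
    W : WList (E ↑ r · (B + B)) (r + 0)
    W = pairsW r W₀
    W₂ : WList E (r + 0)
    W₂ = raiseW n≥1 z≤n W₀
    ∈W₀ : ∀ (C : CycleIn G s) i → window (seq C) i 2 ∈ edges
    ∈W₀ C i = ∈-edges (seq-adj C i)
    count : m ≤ s * length (list (cycleW (suc (r + r)) W W₂))
    count = count-copies (list (cycleW (suc (r + r)) W W₂)) (λ C → ∈-cycleW W W₂ 4≤s C
      (λ i → subst (λ m → window (seq C) i m ∈ list W) (ℕₚ.+-comm (r + r) 2) (∈-pairsW 4≤s C {W = W₀} r i 1 (∈W₀ C i)))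
      (λ i → ∈W₀ C i)) D
    bounded : s * length (list (cycleW (suc (r + r)) W W₂)) ≤ s * (E * K′ * n ^ r)
    bounded = ℕₚ.*-monoʳ-≤ s (ℕₚ.≤-trans (WList.bound (cycleW (suc (r + r)) W W₂)) (ℕₚ.≤-reflexive (cong₂ _*_
      (trans (cong₂ (λ a b → a * B + b) (↑-* E r (B + B)) (↑-* E (suc (r + r)) B)) (arith E (1 ↑ r · (B + B)) B (1 ↑ suc (r + r) · B)))
      (cong (n ^_) (ℕₚ.+-identityʳ r)))))
      where
      arith : ∀ E x B y → E * x * B + E * y ≡ E * (x * B + y)
      arith = solve-∀
    arith₁ : ∀ s E K N → (s * (E * K)) * (s * (E * K)) * (N * N) ≡ (s * K) * (s * K) * (E * E) * (N * N)
    arith₁ = solve-∀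
    arith₂ : ∀ a b c N → a * (b * c) * (N * N) ≡ a * b * (N * N * c)
    arith₂ = solve-∀

-- The upper bound for s = t even

module Rerouting {n : ℕ} (G : Graph n) (c : ProperColouring G) (adj? : ∀ u v → Dec (Adj G u v)) where
  open Rainbow G c

  common : Fin n → Fin n → List (Fin n)
  common u w = filter (λ x → adj? u x ×-dec adj? x w) (allFin n)

  common-~ : ∀ {u w x} → x ∈ common u w → u ~ x × x ~ w
  common-~ {u} {w} h = proj₂ (Mₚ.∈-filter⁻ (λ x → adj? u x ×-dec adj? x w) {xs = allFin n} h)

  ∈-common : ∀ {u w x} → u ~ x → x ~ w → x ∈ common u w
  ∈-common {u} {w} {x} e f = Mₚ.∈-filter⁺ (λ x → adj? u x ×-dec adj? x w) (Mₚ.∈-allFin x) (e , f)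

  common-unique : ∀ u w → Unique (common u w)
  common-unique u w = Uₚ.filter⁺ (λ x → adj? u x ×-dec adj? x w) (Uₚ.allFin⁺ n)

  common-inj : ∀ {u w x y} → x ∈ common u w → y ∈ common u w → κ x w ≡ κ y w → x ≡ y
  common-inj h h′ = properAt′ (adjSym G (proj₂ (common-~ h))) (adjSym G (proj₂ (common-~ h′)))

  half-reroute : ∀ {T a u ℓ vs cs} w → u ≢ w → RPath [] a u ℓ vs cs → (zs : List (Fin n)) → length zs ≤ T → ℓ ≤ T →
    room T ≤ length (common u w) →
    ∃ λ x → RPath [] a x (suc ℓ) (x ∷ vs) (κ u x ∷ cs) × x ~ w × x ∉ zs × κ x w ∉ κ u x ∷ cs
  half-reroute {T} {a} {u} {ℓ} {vs} {cs} w u≢w p zs len-zs ℓ≤T h =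
    go (extend p (common u w) (common-unique u w) (λ h → proj₁ (common-~ h)) (es₁ ++ es₂) (ℕₚ.<-≤-trans (room-< len-es ℓ≤T z≤n) h))
    where
    es₁ es₂ : List (Constraint (common u w))
    es₁ = avoidV zs
    es₂ = keyConstraints ℕₚ._≟_ (λ x → κ x w) common-inj cs
    len-es : length (es₁ ++ es₂) ≤ 5 * T + 5
    len-es = ℕₚ.≤-trans (length-++-≤ es₁ (length-map-≤ _ {zs} len-zs) (length-map-≤ _ {cs} (ℕₚ.≤-trans (ℕₚ.≤-reflexive (length-cs p)) ℓ≤T)))
      (subst (T + T ≤_) (arith T) (ℕₚ.m≤m+n (T + T) (3 * T + 5)))
      where
      arith : ∀ T → T + T + (3 * T + 5) ≡ 5 * T + 5
      arith = solve-∀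
    go : (∃ λ x → x ∈ common u w × RPath [] a x (suc ℓ) (x ∷ vs) (κ u x ∷ cs) × All (λ c → ¬ Bad c x) (es₁ ++ es₂)) →
      ∃ λ x → RPath [] a x (suc ℓ) (x ∷ vs) (κ u x ∷ cs) × x ~ w × x ∉ zs × κ x w ∉ κ u x ∷ cs
    go (x , x∈ , p′ , hs) = x , p′ , proj₂ (common-~ x∈) , avoidV-∉ zs (Allₚ.++⁻ˡ es₁ hs) , λ where
      (here e) → u≢w (properAt (adjSym G (proj₁ (common-~ x∈))) (proj₂ (common-~ x∈))
                   (trans (sym (colSym c (proj₁ (common-~ x∈)))) (sym e)))
      (there e) → keyConstraints-∉ ℕₚ._≟_ (λ x → κ x w) common-inj cs (Allₚ.++⁻ʳ es₁ hs) e

  module _ (T r : ℕ) (z : ℕ → Fin n) (z-inj : ∀ i i′ → i ≤ r → i′ ≤ r → z i ≡ z i′ → i ≡ i′)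
    (rich : ∀ i → i < r → room T ≤ length (common (z i) (z (suc i)))) (r≤T : suc r ≤ T) (2r≤T : r + r ≤ T) where

    zs : List (Fin n)
    zs = map z (upTo (suc r))

    length-zs : length zs ≤ T
    length-zs = length-map-≤ z {upTo (suc r)} (ℕₚ.≤-trans (ℕₚ.≤-reflexive (Lₚ.length-upTo (suc r))) r≤T)

    ∈-zs : ∀ {i} → i ≤ r → z i ∈ zs
    ∈-zs h = Mₚ.∈-map⁺ z (Mₚ.∈-upTo⁺ (s≤s h))

    -- Every z i is kept and the vertices between them are fresh common neighbours, chosen to make
    -- all colours different. They avoid all of `zs`, so the later z i can still be visited.
    reroute : ∀ m → m ≤ r → ∃ λ vs → ∃ λ cs → RPath [] (z 0) (z m) (m + m) vs cs × (∀ i → m < i → i ≤ r → z i ∉ vs)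
    reroute zero _ = _ , _ , start , λ { (suc i) _ i≤ (here h) → contradiction (z-inj (suc i) 0 i≤ z≤n h) λ () }
    reroute (suc m) m< = go (reroute m (ℕₚ.<⇒≤ m<))
      where
      2m≤T : m + m ≤ T
      2m≤T = ℕₚ.≤-trans (ℕₚ.+-mono-≤ (ℕₚ.<⇒≤ m<) (ℕₚ.<⇒≤ m<)) 2r≤T
      ne : z m ≢ z (suc m)
      ne h = contradiction (z-inj m (suc m) (ℕₚ.<⇒≤ m<) m< h) (ℕₚ.<⇒≢ (ℕₚ.n<1+n m))
      go : (∃ λ vs → ∃ λ cs → RPath [] (z 0) (z m) (m + m) vs cs × (∀ i → m < i → i ≤ r → z i ∉ vs)) →
        ∃ λ vs → ∃ λ cs → RPath [] (z 0) (z (suc m)) (suc m + suc m) vs cs × (∀ i → suc m < i → i ≤ r → z i ∉ vs)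
      go (vs , cs , p , future) = go′ (half-reroute (z (suc m)) ne p zs length-zs 2m≤T (rich m m<))
        where
        go′ : (∃ λ x → RPath [] (z 0) x (suc (m + m)) (x ∷ vs) (κ (z m) x ∷ cs) × x ~ z (suc m) × x ∉ zs × κ x (z (suc m)) ∉ κ (z m) x ∷ cs) →
          ∃ λ vs → ∃ λ cs → RPath [] (z 0) (z (suc m)) (suc m + suc m) vs cs × (∀ i → suc m < i → i ≤ r → z i ∉ vs)
        go′ (x , p′ , e , x∉ , k∉) = z (suc m) ∷ x ∷ vs , κ x (z (suc m)) ∷ κ (z m) x ∷ cs
          , subst (λ ℓ → RPath [] (z 0) (z (suc m)) ℓ (z (suc m) ∷ x ∷ vs) (κ x (z (suc m)) ∷ κ (z m) x ∷ cs)) (cong suc (sym (ℕₚ.+-suc m m)))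
            (step p′ e (λ { (here h) → x∉ (subst (_∈ zs) h (∈-zs m<)) ; (there h) → future (suc m) ℕₚ.≤-refl m< h }) k∉ λ ())
          , λ { i m<i i≤ (here h) → contradiction (z-inj i (suc m) i≤ m< h) (ℕₚ.>⇒≢ m<i)
              ; i m<i i≤ (there (here h)) → x∉ (subst (_∈ zs) h (∈-zs i≤))
              ; i m<i i≤ (there (there h)) → future i (ℕₚ.<⇒≤ m<i) i≤ h }

    reroute-cycle : 1 ≤ r → room T ≤ length (common (z r) (z 0)) → RainbowCycle G c (suc (suc (r + r)))
    reroute-cycle 1≤r rich₀ = go (reroute r ℕₚ.≤-refl)
      where
      ne : z r ≢ z 0
      ne h = contradiction (z-inj r 0 ℕₚ.≤-refl z≤n h) (ℕₚ.>⇒≢ 1≤r)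
      go : (∃ λ vs → ∃ λ cs → RPath [] (z 0) (z r) (r + r) vs cs × (∀ i → r < i → i ≤ r → z i ∉ vs)) → RainbowCycle G c (suc (suc (r + r)))
      go (vs , cs , p , _) = go′ (half-reroute (z 0) ne p [] z≤n 2r≤T rich₀)
        where
        go′ : _ → RainbowCycle G c (suc (suc (r + r)))
        go′ (x , p′ , e , _ , k∉) = close p′ e k∉

module WindowColours {n : ℕ} (G : Graph n) (c : ProperColouring G) (adj? : ∀ u v → Dec (Adj G u v)) where
  open Rainbow G c
  open Cores G c adj? using (colourNbrs; length-colourNbrs; ∈-colourNbrs)

  -- The first argument bounds the number of colours independently of the window, as the constant of
  -- `detW` requires.
  coloursOf : ℕ → List (Fin n) → List ℕ
  coloursOf zero w = []
  coloursOf (suc f) [] = []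
  coloursOf (suc f) (_ ∷ []) = []
  coloursOf (suc f) (u ∷ x ∷ w) = κ x u ∷ coloursOf f (x ∷ w)

  length-coloursOf : ∀ f w → length (coloursOf f w) ≤ f
  length-coloursOf zero w = z≤n
  length-coloursOf (suc f) [] = z≤n
  length-coloursOf (suc f) (_ ∷ []) = z≤n
  length-coloursOf (suc f) (u ∷ x ∷ w) = s≤s (length-coloursOf f (x ∷ w))

  ∈-coloursOf : ∀ (v : ℕ → Fin n) i ℓ f d → suc d < ℓ → ℓ ≤ f → κ (v (d + i)) (v (suc d + i)) ∈ coloursOf f (window v i ℓ)
  ∈-coloursOf v i (suc (suc ℓ)) (suc f) d d< ℓ≤f with d ℕₚ.≟ ℓ
  ... | yes refl = here refl
  ... | no ne = there (∈-coloursOf v i (suc ℓ) f d (s≤s (ℕₚ.≤∧≢⇒< (ℕₚ.≤-pred (ℕₚ.≤-pred d<)) ne)) (ℕₚ.≤-pred ℓ≤f))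
  ∈-coloursOf v i (suc zero) f d (s≤s ()) ℓ≤f

  colourDet : ℕ → List (Fin n) → List (Fin n)
  colourDet f [] = []
  colourDet f (u ∷ w) = concatMap (colourNbrs u) (coloursOf f (u ∷ w))

  length-colourDet : ∀ f w → length (colourDet f w) ≤ f * 1
  length-colourDet f [] = z≤n
  length-colourDet f (u ∷ w) = length-concatMap-≤ (colourNbrs u) (coloursOf f (u ∷ w)) (length-coloursOf f (u ∷ w)) (length-colourNbrs u)

  ∈-colourDet : ∀ {f u w q x} → u ~ x → q ∈ coloursOf f (u ∷ w) → κ u x ≡ q → x ∈ colourDet f (u ∷ w)
  ∈-colourDet {u = u} e q∈ h = ∈-concatMap {f = colourNbrs u} q∈ (∈-colourNbrs e h)

module CycleColours {n s : ℕ} {G : Graph n} (c : ProperColouring G) (3≤s : 3 ≤ suc s) (C : CycleIn G (suc s)) where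
  open Rainbow G c

  v : ℕ → Fin n
  v = seq C

  e : ℕ → ℕ
  e i = κ (v i) (v (suc i))

  e-toℕ : ∀ k → e (toℕ k) ≡ κ (vtx C k) (vtx C (next k))
  e-toℕ k = cong₂ κ (seq-toℕ C k) (trans (sym (seq-next C (toℕ k))) (cong (vtx C ∘ next)
    (Fₚ.toℕ-injective (trans (toℕ-mod (toℕ k) s) (DM.m<n⇒m%n≡m (Fₚ.toℕ<n k))))))

  e-period : ∀ i → e (suc s + i) ≡ e i
  e-period i = cong₂ κ (seq-period C i) (trans (cong v (sym (ℕₚ.+-suc (suc s) i))) (seq-period C (suc i)))

  e-cong : ∀ i j → i % suc s ≡ j % suc s → e i ≡ e j
  e-cong i j h = cong₂ κ (seq-cong C i j h) (seq-cong C (suc i) (suc j)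
    (trans (cong (_% suc s) (ℕₚ.+-comm 1 i)) (trans (+-%-cong i j 1 h) (cong (_% suc s) (ℕₚ.+-comm j 1)))))

  adjacent-≢ : ∀ i → e i ≢ e (suc i)
  adjacent-≢ i h = seq-≢ C 2 (s≤s z≤n) 3≤s (properAt (seq-adj C (suc i)) (adjSym G (seq-adj C i))
    (trans (sym h) (colSym c (seq-adj C i))))

  Coincidence : ℕ → Set
  Coincidence i = ∃ λ α → ∃ λ β → α < β × β < suc s × e (α + i) ≡ e (β + i)

  AllDistinct : ℕ → Set
  AllDistinct i = ∀ α β → α < suc s → β < suc s → e (α + i) ≡ e (β + i) → α ≡ β

  coincidence? : ∀ i → Coincidence i ⊎ AllDistinct i
  coincidence? i with Fₚ.any? {n = suc s} (λ α → Fₚ.any? {n = suc s} (λ β → (toℕ α ℕₚ.<? toℕ β) ×-dec (e (toℕ α + i) ℕₚ.≟ e (toℕ β + i))))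
  ... | yes (α , β , α<β , h) = inj₁ (toℕ α , toℕ β , α<β , Fₚ.toℕ<n β , h)
  ... | no ¬h = inj₂ λ α β α< β< h → go α β α< β< h
    where
    none : ∀ α β → α < suc s → β < suc s → α < β → e (α + i) ≢ e (β + i)
    none α β α< β< lt h = ¬h (fromℕ< α< , fromℕ< β< , subst₂ _<_ (sym (Fₚ.toℕ-fromℕ< α<)) (sym (Fₚ.toℕ-fromℕ< β<)) lt ,
      subst₂ (λ a b → e (a + i) ≡ e (b + i)) (sym (Fₚ.toℕ-fromℕ< α<)) (sym (Fₚ.toℕ-fromℕ< β<)) h)
    go : ∀ α β → α < suc s → β < suc s → e (α + i) ≡ e (β + i) → α ≡ β
    go α β α< β< h with ℕₚ.<-cmp α β
    ... | tri< lt _ _ = contradiction h (none α β α< β< lt)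
    ... | tri≈ _ eq _ = eq
    ... | tri> _ _ gt = contradiction (sym h) (none β α β< α< gt)

  rainbow : AllDistinct 0 → RainbowCycle G c (suc s)
  rainbow h = C , λ i j ne eq → ne (Fₚ.toℕ-injective (h (toℕ i) (toℕ j) (Fₚ.toℕ<n i) (Fₚ.toℕ<n j)
    (trans (cong e (ℕₚ.+-identityʳ (toℕ i))) (trans (e-toℕ i) (trans eq (sym (trans (cong e (ℕₚ.+-identityʳ (toℕ j))) (e-toℕ j))))))))

  -- Two equally coloured edges are not adjacent: there are vertices on both sides.
  gaps : ∀ {i} → Coincidence i → ∃ λ α → ∃ λ g → ∃ λ h → suc s ≡ 4 + (g + h) × e (α + i) ≡ e (2 + g + α + i)
  gaps {i} (α , β , α<β , β<s , eq) = go (ℕₚ.m≤n⇒∃[o]m+o≡n α<β) (ℕₚ.m≤n⇒∃[o]m+o≡n β<s)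
    where
    go : (∃ λ a → suc α + a ≡ β) → (∃ λ b → suc β + b ≡ suc s) → _
    go (zero , refl) _ = contradiction (trans eq (cong (λ k → e (suc k + i)) (ℕₚ.+-identityʳ α))) (adjacent-≢ (α + i))
    go (suc g , refl) (b , eq₂) = go′ α b eq₂ eq
      where
      go′ : ∀ α b → suc (suc α + suc g) + b ≡ suc s → e (α + i) ≡ e (suc α + suc g + i) → _
      go′ zero zero eq₂ eq = contradiction (trans (sym eq) (trans (sym (e-period i)) (cong (λ k → e (k + i)) (trans (sym eq₂) (ℕₚ.+-identityʳ _)))))
        (adjacent-≢ (suc (suc g) + i))
      go′ α (suc h) eq₂ eq = α , g , α + h , trans (sym eq₂) (arith α g h) , trans eq (cong (λ k → e (k + i)) (arith₂ α g))
        where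
        arith : ∀ α g h → suc (suc α + suc g) + suc h ≡ 4 + (g + (α + h))
        arith = solve-∀
        arith₂ : ∀ α g → suc α + suc g ≡ 2 + g + α
        arith₂ = solve-∀
      go′ (suc α) zero eq₂ eq = suc α , g , α , trans (sym eq₂) (arith α g) , trans eq (cong (λ k → e (k + i)) (arith₂ α g))
        where
        arith : ∀ α g → suc (suc (suc α) + suc g) + 0 ≡ 4 + (g + α)
        arith = solve-∀
        arith₂ : ∀ α g → suc (suc α) + suc g ≡ 2 + g + suc α
        arith₂ = solve-∀

module _ (j : ℕ) where
  private
    B = twoPathBound (suc j)
    t = suc j + suc j + 4

  betweenBound selfK : ℕ
  betweenBound = B + room t
  selfK = (base * B) * B + (base * B) * betweenBound + (base * (t * 1)) * betweenBound
    where
    base : ℕ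
    base = threeK j ↑ j · (B + B)

  private
    t≡ : t ≡ suc (suc (j + j + 4))
    t≡ = arith j
      where
      arith : ∀ j → suc j + suc j + 4 ≡ suc (suc (j + j + 4))
      arith = solve-∀

  module SelfCover {n : ℕ} (G : Graph n) (c : ProperColouring G) (adj? : ∀ u v → Dec (Adj G u v))
    (nr : ¬ RainbowCycle G c t) where
    open Rainbow G c
    open Rerouting G c adj?
    open WindowColours G c adj?
    open ThreePathWindows j G c adj? nr hiding (v)
    open WindowLists n

    short : ∀ {u w} → Dec (length (common u w) < room t) → List (Fin n)
    short {u} {w} (yes _) = common u w
    short (no _) = []

    length-short : ∀ {u w} (d : Dec (length (common u w) < room t)) → length (short d) ≤ room t
    length-short (yes h) = ℕₚ.<⇒≤ h
    length-short (no _) = z≤n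

    -- Common neighbours are included when there are few of them. A vertex that is not in this list
    -- thus has ends with at least `room t` common neighbours, enough for rerouting.
    Bs : Fin n → Fin n → List (Fin n)
    Bs u w = Gs u w ++ short {u} {w} (length (common u w) ℕₚ.<? room t)

    length-Bs : ∀ u w → length (Bs u w) ≤ betweenBound
    length-Bs u w = length-++-≤ (Gs u w) (length-Gs u w) (length-short {u} {w} (length (common u w) ℕₚ.<? room t))

    -- These windows have s - 2 = 2j + 4 vertices and already cost n^(j+2) = n^(s/2-1), so both
    -- remaining vertices must be determined. The lists below do so in three ways: twice forward,
    -- forward then between, and by a colour then between.
    base : WList (threeK j ↑ j · (B + B)) (j + 2)
    base = pairsW j fourW

    forward₁ : WList ((threeK j ↑ j · (B + B)) * B) (j + 2)
    forward₁ = detW (viaNewest F) B (length-viaNewest length-F≤B) base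

    forward₂ : WList ((threeK j ↑ j · (B + B)) * B * B) (j + 2)
    forward₂ = detW (viaNewest F) B (length-viaNewest length-F≤B) forward₁

    forwardBetween : WList ((threeK j ↑ j · (B + B)) * B * betweenBound) (j + 2)
    forwardBetween = detW (viaEnds Bs) betweenBound (length-viaEnds length-Bs) forward₁

    colour₁ : WList ((threeK j ↑ j · (B + B)) * (t * 1)) (j + 2)
    colour₁ = detW (colourDet t) (t * 1) (length-colourDet t) base

    colourBetween : WList ((threeK j ↑ j · (B + B)) * (t * 1) * betweenBound) (j + 2)
    colourBetween = detW (viaEnds Bs) betweenBound (length-viaEnds length-Bs) colour₁

    selfW : WList selfK (j + 2)
    selfW = unionW (unionW forward₂ forwardBetween) colourBetween

    module _ (C : CycleIn G (suc (suc (j + j + 4)))) where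

      m : ℕ
      m = j + j + 4

      4≤ : 4 ≤ suc (suc m)
      4≤ = ℕₚ.≤-trans (ℕₚ.m≤n+m 4 (j + j)) (ℕₚ.m≤n+m m 2)

      3≤ : 3 ≤ suc (suc m)
      3≤ = ℕₚ.≤-trans (ℕₚ.n≤1+n 3) 4≤

      open CycleColours c 3≤ C

      InW : Set
      InW = ∃ λ i → window v i (suc (suc m)) ∈ list selfW

      back : ∀ x y → x ≡ suc (suc m) + y → v x ≡ v y
      back x y h = trans (cong v h) (seq-period C y)

      record Strong′ (p : ℕ) : Set where
        constructor strong
        field
          next∈ : v (2 + p) ∈ F (v p) (v (1 + p))
          rich : room t ≤ length (common (v p) (v (2 + p)))

      Between′ : ℕ → Set
      Between′ p = v (1 + p) ∈ Bs (v p) (v (2 + p))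

      middle′ : ∀ p → Between′ p ⊎ Strong′ p
      middle′ p = go (middle (seq-adj C p) (seq-adj C (1 + p)) (v-≢₂ 4≤ C p)) (length (common (v p) (v (2 + p))) ℕₚ.<? room t) refl
        where
        go : v (1 + p) ∈ Gs (v p) (v (2 + p)) ⊎ (v (2 + p) ∈ F (v p) (v (1 + p)) × v p ∈ F (v (2 + p)) (v (1 + p))) →
          (d : Dec (length (common (v p) (v (2 + p))) < room t)) → (length (common (v p) (v (2 + p))) ℕₚ.<? room t) ≡ d →
          Between′ p ⊎ Strong′ p
        go (inj₁ h) _ _ = inj₁ (Mₚ.∈-++⁺ˡ h)
        go (inj₂ _) (yes lt) eq = inj₁ (Mₚ.∈-++⁺ʳ (Gs (v p) (v (2 + p)))
          (subst (λ d → v (1 + p) ∈ short d) (sym eq) (∈-common (seq-adj C p) (seq-adj C (1 + p)))))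
        go (inj₂ (h , _)) (no ge) _ = inj₂ (strong h (ℕₚ.≮⇒≥ ge))

      window-tail : ∀ i {x y} → v (j + j + 3 + i) ≡ x → v (j + j + 2 + i) ≡ y → window v i m ≡ x ∷ y ∷ window v i (j + j + 2)
      window-tail i hx hy = trans (cong (window v i) (ℕₚ.+-suc (j + j) 3))
        (cong₂ _∷_ hx (trans (cong (window v i) (ℕₚ.+-suc (j + j) 2)) (cong (_∷ window v i (j + j + 2)) hy)))

      shift₀ : ∀ j p → j + j + 3 + (4 + p) ≡ suc (suc (j + j + 4)) + (1 + p)
      shift₀ = solve-∀
      shift₁ : ∀ j p → j + j + 2 + (4 + p) ≡ suc (suc (j + j + 4)) + p
      shift₁ = solve-∀
      shift₂ : ∀ j p → j + j + 4 + (4 + p) ≡ suc (suc (j + j + 4)) + (2 + p)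
      shift₂ = solve-∀
      shift₃ : ∀ j p → suc (j + j + 4) + (4 + p) ≡ suc (suc (j + j + 4)) + (3 + p)
      shift₃ = solve-∀

      module _ (p : ℕ) (st : Strong′ p) where
        -- The window of s - 2 vertices that starts here ends with v p, v (1 + p), and omits v (2 +
        -- p), v (3 + p).
        origin : ℕ
        origin = 4 + p

        unfolded : window v origin m ≡ v (1 + p) ∷ v p ∷ window v origin (j + j + 2)
        unfolded = window-tail origin (back _ (1 + p) (shift₀ j p)) (back _ p (shift₁ j p))

        fresh₁ : v (m + origin) ≡ v (2 + p)
        fresh₁ = back _ (2 + p) (shift₂ j p)

        fresh₂ : v (suc m + origin) ≡ v (3 + p)
        fresh₂ = back _ (3 + p) (shift₃ j p)

        ∈forward₁ : window v origin (suc m) ∈ list forward₁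
        ∈forward₁ = ∈-detW {W = base} {viaNewest F} {B} {length-viaNewest length-F≤B} (∈-evenW 4≤ C j origin)
          (subst₂ (λ w x → x ∈ viaNewest F w) (sym unfolded) (sym fresh₁) (Strong′.next∈ st))

        two-strong : Strong′ (1 + p) → InW
        two-strong st′ = origin , Mₚ.∈-++⁺ˡ (Mₚ.∈-++⁺ˡ (∈-detW {W = forward₁} {viaNewest F} {B} {length-viaNewest length-F≤B} ∈forward₁
          (subst₂ (λ w x → x ∈ viaNewest F w) (sym (cong₂ _∷_ fresh₁ unfolded)) (sym fresh₂) (Strong′.next∈ st′))))

        strong-between : Between′ (2 + p) → InW
        strong-between b = origin , Mₚ.∈-++⁺ˡ (Mₚ.∈-++⁺ʳ (list forward₂) (∈-detW {W = forward₁} {viaEnds Bs} {betweenBound} {length-viaEnds length-Bs} ∈forward₁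
          (∈-viaEnds {f = Bs} v origin m (subst₂ (λ x u → x ∈ Bs u (v origin)) (sym fresh₂) (sym fresh₁) b))))

      -- If no case determines two vertices, every other vertex lies between two vertices with many
      -- common neighbours, and can be rerouted.
      strong-chain : ∀ p r → Strong′ p → InW ⊎ (∀ i → i ≤ r → Strong′ (i + i + p))
      strong-chain p zero st = inj₂ λ { zero _ → st }
      strong-chain p (suc r) st = go (middle′ (1 + p)) (middle′ (2 + p))
        where
        go : Between′ (1 + p) ⊎ Strong′ (1 + p) → Between′ (2 + p) ⊎ Strong′ (2 + p) → InW ⊎ (∀ i → i ≤ suc r → Strong′ (i + i + p))
        go (inj₂ st′) _ = inj₁ (two-strong p st st′)
        go (inj₁ _) (inj₁ b) = inj₁ (strong-between p st b)
        go (inj₁ _) (inj₂ st″) = go′ (strong-chain (2 + p) r st″)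
          where
          go′ : InW ⊎ (∀ i → i ≤ r → Strong′ (i + i + (2 + p))) → InW ⊎ (∀ i → i ≤ suc r → Strong′ (i + i + p))
          go′ (inj₁ h) = inj₁ h
          go′ (inj₂ h) = inj₂ λ { zero _ → st ; (suc i) (s≤s i≤) → subst Strong′ (arith i p) (h i i≤) }
            where
            arith : ∀ i p → i + i + (2 + p) ≡ suc i + suc i + p
            arith = solve-∀

      all-strong : ∀ p → (∀ i → i ≤ suc (suc j) → Strong′ (i + i + p)) → ⊥
      all-strong p h = nr (subst (RainbowCycle G c) (arith j) (reroute-cycle t r z z-inj rich (bound₁ j) (bound₂ j) (s≤s z≤n) rich₀))
        where
        r : ℕ
        r = suc (suc j)
        z : ℕ → Fin n
        z i = v (i + i + p)
        arith : ∀ j → suc (suc (suc (suc j) + suc (suc j))) ≡ suc j + suc j + 4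
        arith = solve-∀
        arith′ : ∀ i p → 2 + (i + i + p) ≡ suc i + suc i + p
        arith′ = solve-∀
        bound₁ : ∀ j → suc (suc (suc j)) ≤ suc j + suc j + 4
        bound₁ j = subst (suc (suc (suc j)) ≤_) (arith₁ j) (ℕₚ.m≤m+n (suc (suc (suc j))) (3 + j))
          where
          arith₁ : ∀ j → suc (suc (suc j)) + (3 + j) ≡ suc j + suc j + 4
          arith₁ = solve-∀
        bound₂ : ∀ j → suc (suc j) + suc (suc j) ≤ suc j + suc j + 4
        bound₂ j = subst (suc (suc j) + suc (suc j) ≤_) (arith₁ j) (ℕₚ.m≤m+n (suc (suc j) + suc (suc j)) 2)
          where
          arith₁ : ∀ j → suc (suc j) + suc (suc j) + 2 ≡ suc j + suc j + 4
          arith₁ = solve-∀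
        rich : ∀ i → i < r → room t ≤ length (common (z i) (z (suc i)))
        rich i i< = subst (λ k → room t ≤ length (common (z i) (v k))) (arith′ i p) (Strong′.rich (h i (ℕₚ.<⇒≤ i<)))
        rich₀ : room t ≤ length (common (z r) (z 0))
        rich₀ = subst (λ x → room t ≤ length (common (z r) x)) (back _ p (arith₁ j p)) (Strong′.rich (h r ℕₚ.≤-refl))
          where
          arith₁ : ∀ j p → 2 + (suc (suc j) + suc (suc j) + p) ≡ suc (suc (j + j + 4)) + p
          arith₁ = solve-∀
        z-< : ∀ i d → i + suc d ≤ r → z i ≢ z (i + suc d)
        z-< i d le eq = seq-≢ C (suc d + suc d) (s≤s z≤n) (ℕₚ.≤-trans (s≤s (ℕₚ.+-mono-≤ d≤ d≤)) (subst (suc (r + r) ≤_) (arith₁ j) (ℕₚ.m≤m+n (suc (r + r)) 1)))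
          (trans (cong v (arith₂ i d p)) (sym eq))
          where
          d≤ : suc d ≤ r
          d≤ = ℕₚ.≤-trans (ℕₚ.m≤n+m (suc d) i) le
          arith₁ : ∀ j → suc (suc (suc j) + suc (suc j)) + 1 ≡ suc (suc (j + j + 4))
          arith₁ = solve-∀
          arith₂ : ∀ i d p → suc d + suc d + (i + i + p) ≡ i + suc d + (i + suc d) + p
          arith₂ = solve-∀
        z-inj : ∀ i i′ → i ≤ r → i′ ≤ r → z i ≡ z i′ → i ≡ i′
        z-inj i i′ i≤ i′≤ eq with ℕₚ.<-cmp i i′
        ... | tri≈ _ h _ = h
        ... | tri< lt _ _ with ℕₚ.m≤n⇒∃[o]m+o≡n lt
        ... | d , refl = contradiction (trans eq (cong z (sym (ℕₚ.+-suc i d)))) (z-< i d (subst (_≤ r) (sym (ℕₚ.+-suc i d)) i′≤))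
        z-inj i i′ i≤ i′≤ eq | tri> _ _ gt with ℕₚ.m≤n⇒∃[o]m+o≡n gt
        ... | d , refl = contradiction (trans (sym eq) (cong z (sym (ℕₚ.+-suc i′ d)))) (z-< i′ d (subst (_≤ r) (sym (ℕₚ.+-suc i′ d)) i≤))

      from-strong : ∀ p → Strong′ p → InW
      from-strong p st = go (strong-chain p (suc (suc j)) st)
        where
        go : InW ⊎ (∀ i → i ≤ suc (suc j) → Strong′ (i + i + p)) → InW
        go (inj₁ h) = h
        go (inj₂ h) = ⊥-elim (all-strong p h)

      -- The window omits v (1 + b) and v (2 + b). It contains v b and both ends of an edge with the
      -- colour of the edge from v b to v (1 + b), so this colour gives the first omitted vertex.
      by-colour : ∀ b d → suc d < m → e b ≡ e (d + (3 + b)) → Between′ (1 + b) → InW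
      by-colour b d d< eq bt = 3 + b , Mₚ.∈-++⁺ʳ (list forward₂ ++ list forwardBetween)
        (∈-detW {W = colour₁} {viaEnds Bs} {betweenBound} {length-viaEnds length-Bs} ∈colour₁
          (∈-viaEnds {f = Bs} v (3 + b) m (subst₂ (λ x u → x ∈ Bs u (v (3 + b))) (sym new₂) (sym new₁) bt)))
        where
        new₁ : v (m + (3 + b)) ≡ v (1 + b)
        new₁ = back _ (1 + b) (a j b)
          where
          a : ∀ j p → j + j + 4 + (3 + p) ≡ suc (suc (j + j + 4)) + (1 + p)
          a = solve-∀
        new₂ : v (suc m + (3 + b)) ≡ v (2 + b)
        new₂ = back _ (2 + b) (a j b)
          where
          a : ∀ j p → suc (j + j + 4) + (3 + p) ≡ suc (suc (j + j + 4)) + (2 + p)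
          a = solve-∀
        windowed : window v (3 + b) m ≡ v b ∷ window v (3 + b) (j + j + 3)
        windowed = trans (cong (window v (3 + b)) (ℕₚ.+-suc (j + j) 3)) (cong (_∷ window v (3 + b) (j + j + 3)) (back _ b (a j b)))
          where
          a : ∀ j p → j + j + 3 + (3 + p) ≡ suc (suc (j + j + 4)) + p
          a = solve-∀
        colour∈ : e (d + (3 + b)) ∈ coloursOf t (window v (3 + b) m)
        colour∈ = ∈-coloursOf v (3 + b) m t d d< (ℕₚ.≤-trans (ℕₚ.m≤n+m m 2) (ℕₚ.≤-reflexive (sym t≡)))
        ∈colour₁ : window v (3 + b) (suc m) ∈ list colour₁
        ∈colour₁ = ∈-detW {W = base} {colourDet t} {t * 1} {length-colourDet t} (∈-evenW 4≤ C j (3 + b))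
          (subst₂ (λ w x → x ∈ colourDet t w) (sym windowed) (sym new₁)
            (∈-colourDet (seq-adj C b) (subst (λ w → e (d + (3 + b)) ∈ coloursOf t w) windowed colour∈) eq))

      by-coincidence : ∀ b d → suc d < m → e b ≡ e (d + (3 + b)) → InW
      by-coincidence b d d< eq = go (middle′ (1 + b))
        where
        go : Between′ (1 + b) ⊎ Strong′ (1 + b) → InW
        go (inj₁ bt) = by-colour b d d< eq bt
        go (inj₂ st) = from-strong (1 + b) st

      covered : InW
      covered = go (coincidence? 0)
        where
        -- The two sides between the equal edges have g and h inner vertices with g + h = m - 2 ≥ 2,
        -- so one side is not empty. The edge before that side serves as b; then v (2 + b) is on
        -- neither edge.
        go″ : ∀ α g h → suc (suc m) ≡ 4 + (g + h) → e (α + 0) ≡ e (2 + g + α + 0) → InW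
        go″ α g (suc h) eq ee = by-coincidence (2 + g + α + 0) h h<m
            (trans (sym ee) (trans (sym (e-period (α + 0))) (cong e (trans (cong (_+ (α + 0)) eq) (arith g h α)))))
          where
          arith : ∀ g h α → 4 + (g + suc h) + (α + 0) ≡ h + (3 + (2 + g + α + 0))
          arith = solve-∀
          h<m : suc h < m
          h<m = ℕₚ.≤-trans (s≤s (ℕₚ.m≤n+m (suc h) (suc g))) (ℕₚ.≤-reflexive (sym (ℕₚ.suc-injective (ℕₚ.suc-injective eq))))
        go″ α zero zero eq ee = contradiction (ℕₚ.suc-injective (ℕₚ.suc-injective eq)) (ℕₚ.>⇒≢ (ℕₚ.≤-trans (s≤s (s≤s (s≤s z≤n))) (ℕₚ.m≤n+m 4 (j + j))))
        go″ α (suc g) zero eq ee = by-coincidence (α + 0) g g<m (trans ee (cong e (arith g α)))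
          where
          arith : ∀ g α → 2 + suc g + α + 0 ≡ g + (3 + (α + 0))
          arith = solve-∀
          g<m : suc g < m
          g<m = ℕₚ.≤-trans (s≤s (ℕₚ.≤-trans (ℕₚ.m≤m+n (suc g) 0) (ℕₚ.n≤1+n _))) (ℕₚ.≤-reflexive (sym (ℕₚ.suc-injective (ℕₚ.suc-injective eq))))
        go′ : (∃ λ α → ∃ λ g → ∃ λ h → suc (suc m) ≡ 4 + (g + h) × e (α + 0) ≡ e (2 + g + α + 0)) → InW
        go′ (α , g , h , eq , ee) = go″ α g h eq ee
        go : Coincidence 0 ⊎ AllDistinct 0 → InW
        go (inj₁ co) = go′ (gaps co)
        go (inj₂ distinct) = ⊥-elim (nr (subst (RainbowCycle G c) (sym t≡) (rainbow distinct)))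

  self-upper : Upper (suc (suc (j + j + 4))) t (j + 2 + (j + 2))
  self-upper = cover⇒upper (suc (j + j + 4)) t selfK (j + 2) λ _ G c adj? nr →
    SelfCover.selfW G c adj? nr , λ C → SelfCover.covered G c adj? nr C

-- The upper bound for s ≤ t odd

module PairCores {n : ℕ} (G : Graph n) (c : ProperColouring G) (adj? : ∀ u v → Dec (Adj G u v)) (q b : ℕ)
  (nr : ¬ RainbowCycle G c (b + b + (q + 3))) where

  open Rainbow G c
  open Cores G c adj?

  t : ℕ
  t = b + b + (q + 3)

  end≢start : ∀ {Ac a u ℓ vs cs} → RPath Ac a u (suc ℓ) vs cs → u ≢ a
  end≢start (step p _ w∉ _ _) refl = w∉ (start∈ p)

  module _ (u w : Fin n) where

    E : Fin n → Fin n → Set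
    E x y = u ~ x × x ~ y × y ~ w

    module P = DegreePeeling (room t) E (λ x y → adj? u x ×-dec (adj? x y ×-dec adj? y w)) (proj₁ ∘ proj₂)
    open DenseCore P.core

    right-inj : ∀ {x y y′} → y ∈ right x → y′ ∈ right x → κ y w ≡ κ y′ w → y ≡ y′
    right-inj {x} h h′ = properAt′ (adjSym G (~w h)) (adjSym G (~w h′))
      where
      ~w : ∀ {y} → y ∈ right x → y ~ w
      ~w {y} h = proj₂ (proj₂ (proj₂ (Mₚ.∈-filter⁻ (P.E?′ x) {xs = R} h)))

    close-up : ∀ {ℓ} → suc (suc (suc ℓ)) ≡ t → RPathInto [] w (suc ℓ) L → ⊥
    close-up {ℓ} eq (into {x} {vs} {cs} x∈ p) = go (extend p (right x) (right-unique x∈) (λ h → H⇒~ (proj₁ (right⊆ x∈ h)))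
        es (ℕₚ.<-≤-trans (room-< len-es ℓ≤t z≤n) (right-long x∈)))
      where
      es : List (Constraint (right x))
      es = keyConstraints ℕₚ._≟_ (λ y → κ y w) right-inj cs
      ℓ≤t : suc ℓ ≤ t
      ℓ≤t = subst (suc ℓ ≤_) eq (ℕₚ.m≤n+m (suc ℓ) 2)
      len-es : length es ≤ 5 * t + 5
      len-es = length-map-≤ _ {cs} (ℕₚ.≤-trans (ℕₚ.≤-reflexive (length-cs p)) (ℕₚ.≤-trans ℓ≤t (ℕₚ.≤-trans (ℕₚ.m≤m+n t _) (ℕₚ.m≤m+n (5 * t) 5))))
      go : (∃ λ y → y ∈ right x × RPath [] w y (suc (suc ℓ)) (y ∷ vs) (κ x y ∷ cs) × All (λ c → ¬ Bad c y) es) → ⊥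
      go (y , y∈ , p′ , h) = nr (subst (RainbowCycle G c) eq (close p′ y~w λ where
          (here e) → end≢start p (sym (properAt y~w (adjSym G x~y) (trans e (colSym c x~y))))
          (there e) → keyConstraints-∉ ℕₚ._≟_ (λ y → κ y w) right-inj cs h e))
        where
        Exy : E x y
        Exy = proj₁ (right⊆ x∈ y∈)
        x~y : x ~ y
        x~y = proj₁ (proj₂ Exy)
        y~w : y ~ w
        y~w = proj₂ (proj₂ Exy)

    -- The given path from w to u, an edge into L, b round trips, a step to R and the edge to w make
    -- q + 1 + 2b + 1 + 1 = t edges. Since q need not have a particular parity, s ≤ t of equal
    -- parity is what matters: t - s = 2b for q = s - 3.
    core-empty : ∀ {vs cs x} → RPath [] w u q vs cs → x ∈ L → ⊥
    core-empty {vs} {cs} {x} p x∈ = go (P.right-nonempty x∈)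
      where
      q≤t : q ≤ t
      q≤t = ℕₚ.≤-trans (ℕₚ.m≤m+n q 3) (ℕₚ.m≤n+m (q + 3) (b + b))
      eq : suc (suc (b + b + suc q)) ≡ t
      eq = arith b q
        where
        arith : ∀ b q → suc (suc (b + b + suc q)) ≡ b + b + (q + 3)
        arith = solve-∀
      bound : b + b + suc q ≤ t
      bound = subst (b + b + suc q ≤_) eq (ℕₚ.m≤n+m (b + b + suc q) 2)
      go : (∃ λ y → y ∈ right x) → ⊥
      go (y , y∈) = go′ (extend p (left y) (left-unique y∈R) (λ h → proj₁ (proj₁ (left⊆ y∈R h))) []
          (ℕₚ.<-≤-trans (room-< z≤n q≤t z≤n) (left-long y∈R)))
        where
        y∈R : y ∈ R
        y∈R = proj₂ (right⊆ x∈ y∈)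
        go′ : (∃ λ x → x ∈ left y × RPath [] w x (suc q) (x ∷ vs) (κ u x ∷ cs) × All (λ c → ¬ Bad c x) []) → ⊥
        go′ (x′ , x′∈ , p′ , _) = close-up (trans (cong (λ k → suc (suc k)) (sym (ℕₚ.+-suc (b + b) q))) eq)
          (subst (λ m → RPathInto [] w m L) (ℕₚ.+-suc (b + b) q)
            (double-steps P.core b (into (proj₂ (left⊆ y∈R x′∈)) p′) bound z≤n))

  recL recR : Fin n → Fin n → Fin n → List (Fin n)
  recL u w = P.recL u w
  recR u w = P.recR u w

  length-recL : ∀ u w x → length (recL u w x) ≤ room t
  length-recL u w x = ℕₚ.≤-pred (P.weakL u w x)

  length-recR : ∀ u w x → length (recR u w x) ≤ room t
  length-recR u w x = ℕₚ.≤-pred (P.weakR u w x)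

  pair-determined : ∀ {u x y w vs cs} → u ~ x → x ~ y → y ~ w → RPath [] w u q vs cs → y ∈ recL u w x ⊎ x ∈ recR u w y
  pair-determined {u} {x} {y} {w} e f g p = go (P.covers u w (Mₚ.∈-allFin x) (Mₚ.∈-allFin y) (e , f , g))
    where
    go : _ ⊎ (y ∈ recL u w x ⊎ x ∈ recR u w y) → y ∈ recL u w x ⊎ x ∈ recR u w y
    go (inj₁ (x∈ , _)) = ⊥-elim (core-empty u w p x∈)
    go (inj₂ h) = h

module OddSelf (a b : ℕ) where

  -- Here s = 2a + 5 and t = s + 2b, and q = s - 3 is the length of what remains of the cycle after
  -- three consecutive edges.
  q′ q s t : ℕ
  q′ = a + suc a
  q = suc q′
  s = suc (suc (suc q))
  t = b + b + (q + 3)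

  private R = room t

  blockK colourK shortK : ℕ
  blockK = R * R + (R * R + R * R)
  colourK = s * 1 + s * 1
  shortK = q * (R * colourK)

  coverK : ℕ
  coverK = 1 * blockK + shortK

  module Cover {n : ℕ} (G : Graph n) (c : ProperColouring G) (adj? : ∀ u v → Dec (Adj G u v))
    (nr : ¬ RainbowCycle G c t) where
    open Rainbow G c
    open Rerouting G c adj?
    open WindowColours G c adj?
    open Cores G c adj? using (colourNbrs; length-colourNbrs; ∈-colourNbrs)
    open PairCores G c adj? q b nr using (recL; recR; length-recL; length-recR; pair-determined)
    open WindowLists n

    castW : ∀ {K K′ e e′} → K ≡ K′ → e ≡ e′ → WList K e → WList K′ e′
    castW eK eq W = wlist (list W) (subst₂ (λ K e → length (list W) ≤ K * n ^ e) eK eq (bound W))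

    Quad : Set
    Quad = Fin n × Fin n × Fin n × Fin n

    -- Four consecutive vertices between h and l are recovered from two of them: the first and
    -- third, the inner two, or the second and fourth.
    block₁ block₂ block₃ blocksAt : Fin n → Fin n → Fin n → Fin n → List Quad
    block₁ h l x y = concatMap (λ z → map (λ w → x , z , y , w) (recL z l y)) (recL h y x)
    block₂ h l x y = concatMap (λ z → map (λ w → z , x , y , w) (recL x l y)) (recR h y x)
    block₃ h l x y = concatMap (λ z → map (λ w → w , x , z , y) (recR h z x)) (recR x l y)
    blocksAt h l x y = block₁ h l x y ++ block₂ h l x y ++ block₃ h l x y

    length-blocksAt : ∀ h l x y → length (blocksAt h l x y) ≤ blockK
    length-blocksAt h l x y = length-++-≤ (block₁ h l x y)
      (length-concatMap-≤ (λ z → map (λ w → x , z , y , w) (recL z l y)) (recL h y x) (length-recL h y x)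
        (λ z → length-map-≤ (λ w → x , z , y , w) {recL z l y} (length-recL z l y)))
      (length-++-≤ (block₂ h l x y)
        (length-concatMap-≤ (λ z → map (λ w → z , x , y , w) (recL x l y)) (recR h y x) (length-recR h y x)
          (λ z → length-map-≤ (λ w → z , x , y , w) {recL x l y} (length-recL x l y)))
        (length-concatMap-≤ (λ z → map (λ w → w , x , z , y) (recR h z x)) (recR x l y) (length-recR x l y)
          (λ z → length-map-≤ (λ w → w , x , z , y) {recR h z x} (length-recR h z x))))

    blocks : Fin n → Fin n → List Quad
    blocks h l = concatMap (λ (x , y) → blocksAt h l x y) (allPairs n)

    blockW : ∀ {K e} → WList K e → WList (K * blockK) (suc (suc e))
    blockW {K} {e} (wlist L h) = wlist (concatMap f L) (ℕₚ.≤-trans (length-concatMap-≤ f L h f-bound) (ℕₚ.≤-reflexive (arith K (n ^ e) n blockK)))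
      where
      f : List (Fin n) → List (List (Fin n))
      f [] = []
      f (u ∷ w) = map (λ (x₁ , x₂ , x₃ , x₄) → x₄ ∷ x₃ ∷ x₂ ∷ x₁ ∷ u ∷ w) (blocks u (lastOf u w))
      f-bound : ∀ w → length (f w) ≤ n * n * blockK
      f-bound [] = z≤n
      f-bound (u ∷ w) = length-map-≤ _ {blocks u (lastOf u w)} (length-concatMap-≤ (λ (x , y) → blocksAt u (lastOf u w) x y) (allPairs n)
        (length-allPairs n) (λ (x , y) → length-blocksAt u (lastOf u w) x y))
      arith : ∀ K N n b → K * N * (n * n * b) ≡ K * b * (n * (n * N))
      arith = solve-∀

    ∈-blockW : ∀ {K e u w x₁ x₂ x₃ x₄} {W : WList K e} → u ∷ w ∈ list W → (x₁ , x₂ , x₃ , x₄) ∈ blocks u (lastOf u w) →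
      x₄ ∷ x₃ ∷ x₂ ∷ x₁ ∷ u ∷ w ∈ list (blockW W)
    ∈-blockW {u = u} {w} h h′ = ∈-concatMap h (Mₚ.∈-map⁺ (λ (x₁ , x₂ , x₃ , x₄) → x₄ ∷ x₃ ∷ x₂ ∷ x₁ ∷ u ∷ w) h′)

    shortCommon : ∀ u w → Dec (length (common u w) < R) → List (Fin n)
    shortCommon u w (yes _) = common u w
    shortCommon u w (no _) = []

    length-shortCommon : ∀ u w d → length (shortCommon u w d) ≤ R
    length-shortCommon u w (yes h) = ℕₚ.<⇒≤ h
    length-shortCommon u w (no _) = z≤n

    startAt : Fin n × Fin n → List (List (Fin n))
    startAt (u , w) = map (λ x → w ∷ x ∷ u ∷ []) (shortCommon u w (length (common u w) ℕₚ.<? R))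

    -- Ends with few common neighbours determine the vertex between them. This saves one factor n,
    -- and a colour coincidence saves the other.
    startW : WList R 2
    startW = wlist (concatMap startAt (allPairs n)) (ℕₚ.≤-trans (length-concatMap-≤ startAt (allPairs n) (length-allPairs n)
      (λ (u , w) → length-map-≤ (λ x → w ∷ x ∷ u ∷ []) {shortCommon u w (length (common u w) ℕₚ.<? R)} (length-shortCommon u w (length (common u w) ℕₚ.<? R))))
      (ℕₚ.≤-reflexive (arith n R)))
      where
      arith : ∀ n R → n * n * R ≡ R * (n * (n * 1))
      arith = solve-∀

    -- The second list starts from the oldest vertex; it serves the case in which the later of two
    -- equally coloured edges closes the cycle.
    colourDets : List (Fin n) → List (Fin n)
    colourDets [] = []
    colourDets (u ∷ w) = colourDet s (u ∷ w) ++ concatMap (colourNbrs (lastOf u w)) (coloursOf s (u ∷ w))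

    length-colourDets : ∀ w → length (colourDets w) ≤ colourK
    length-colourDets [] = z≤n
    length-colourDets (u ∷ w) = length-++-≤ (colourDet s (u ∷ w)) (length-colourDet s (u ∷ w))
      (length-concatMap-≤ (colourNbrs (lastOf u w)) (coloursOf s (u ∷ w)) (length-coloursOf s (u ∷ w)) (length-colourNbrs (lastOf u w)))

    freeFrom : ∀ m → WList R (suc (m + 1))
    freeFrom zero = startW
    freeFrom (suc m) = freeW (freeFrom m)

    -- Windows of length 3 + m one of whose later vertices is determined by a colour.
    colouredFrom : ∀ m → WList (m * (R * colourK)) (m + 1)
    colouredFrom zero = wlist [] z≤n
    colouredFrom (suc m) = unionW (detW colourDets colourK length-colourDets (freeFrom m)) (freeW (colouredFrom m))

    W₁ : WList (1 * blockK) (q + 1)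
    W₁ = castW refl (arith q′) (blockW (allW q′))
      where
      arith : ∀ q′ → suc (suc q′) ≡ suc q′ + 1
      arith = solve-∀

    W₂ : WList shortK (q + 1)
    W₂ = colouredFrom q

    coverW : WList coverK (q + 1)
    coverW = unionW W₁ W₂

    module _ (C : CycleIn G s) where

      4≤ : 4 ≤ s
      4≤ = s≤s (s≤s (s≤s (s≤s z≤n)))

      open CycleColours c (ℕₚ.≤-trans (ℕₚ.n≤1+n 3) 4≤) C

      InW : Set
      InW = ∃ λ i → window v i s ∈ list coverW

      back : ∀ x y → x ≡ s + y → v x ≡ v y
      back x y h = trans (cong v h) (seq-period C y)

      -- The hypothesis of `pair-determined` for the two vertices after v p. The rainbow path need
      -- not follow the cycle, which leaves room for rerouting.
      Usable : ℕ → Set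
      Usable p = ∃ λ vs → ∃ λ cs → RPath [] (v (3 + p)) (v p) q vs cs

      Forward Backward : ℕ → Set
      Forward p = v (2 + p) ∈ recL (v p) (v (3 + p)) (v (1 + p))
      Backward p = v (1 + p) ∈ recR (v p) (v (3 + p)) (v (2 + p))

      usable⇒ : ∀ p → Usable p → Forward p ⊎ Backward p
      usable⇒ p (_ , _ , π) = pair-determined (seq-adj C p) (seq-adj C (1 + p)) (seq-adj C (2 + p)) π

      in-block : ∀ p → (v (1 + p) , v (2 + p) , v (3 + p) , v (4 + p)) ∈ blocks (v p) (v (5 + p)) → InW
      in-block p h = 5 + p , Mₚ.∈-++⁺ˡ (subst (_∈ list (blockW (allW q′))) (sym windowed)
          (∈-blockW {W = allW q′} (subst (_∈ list (allW q′)) inner (∈-allW v (5 + p) q′))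
            (subst (λ z → (v (1 + p) , v (2 + p) , v (3 + p) , v (4 + p)) ∈ blocks (v p) z) (sym last≡) h)))
        where
        q″ : ℕ
        q″ = a + a
        q′≡ : q′ ≡ suc q″
        q′≡ = ℕₚ.+-suc a a
        rest : List (Fin n)
        rest = window v (5 + p) q″
        head≡ : v (q″ + (5 + p)) ≡ v p
        head≡ = back _ p (arith a p)
          where
          arith : ∀ a p → a + a + (5 + p) ≡ suc (suc (suc (suc (a + suc a)))) + p
          arith = solve-∀
        inner : window v (5 + p) q′ ≡ v p ∷ rest
        inner = trans (cong (window v (5 + p)) q′≡) (cong (_∷ rest) head≡)
        last≡ : lastOf (v p) rest ≡ v (5 + p)
        last≡ = trans (cong (λ z → lastOf z rest) (sym head≡)) (lastOf-window v (5 + p) q″)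
        windowed : window v (5 + p) s ≡ v (4 + p) ∷ v (3 + p) ∷ v (2 + p) ∷ v (1 + p) ∷ v p ∷ rest
        windowed = cong₂ _∷_ (back _ (4 + p) (arith₄ q′ p)) (cong₂ _∷_ (back _ (3 + p) (arith₃ q′ p))
          (cong₂ _∷_ (back _ (2 + p) (arith₂ q′ p)) (cong₂ _∷_ (back _ (1 + p) (arith₁ q′ p)) inner)))
          where
          arith₄ : ∀ q p → suc (suc (suc q)) + (5 + p) ≡ suc (suc (suc (suc q))) + (4 + p)
          arith₄ = solve-∀
          arith₃ : ∀ q p → suc (suc q) + (5 + p) ≡ suc (suc (suc (suc q))) + (3 + p)
          arith₃ = solve-∀
          arith₂ : ∀ q p → suc q + (5 + p) ≡ suc (suc (suc (suc q))) + (2 + p)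
          arith₂ = solve-∀
          arith₁ : ∀ q p → q + (5 + p) ≡ suc (suc (suc (suc q))) + (1 + p)
          arith₁ = solve-∀

      ∈-blocks : ∀ {h l Q} x y → Q ∈ blocksAt h l x y → Q ∈ blocks h l
      ∈-blocks {h} {l} x y Q∈ = ∈-concatMap {f = λ (x , y) → blocksAt h l x y} (∈-allPairs x y) Q∈

      module _ (p : ℕ) where
        x₁ x₂ x₃ x₄ h l : Fin n
        x₁ = v (1 + p)
        x₂ = v (2 + p)
        x₃ = v (3 + p)
        x₄ = v (4 + p)
        h = v p
        l = v (5 + p)

        forward-forward : Forward p → Forward (2 + p) → InW
        forward-forward f g = in-block p (∈-blocks x₁ x₃ (Mₚ.∈-++⁺ˡ
          (∈-concatMap {f = λ z → map (λ w → x₁ , z , x₃ , w) (recL z l x₃)} f (Mₚ.∈-map⁺ (λ w → x₁ , x₂ , x₃ , w) g))))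

        backward-forward : Backward p → Forward (2 + p) → InW
        backward-forward f g = in-block p (∈-blocks x₂ x₃ (Mₚ.∈-++⁺ʳ (block₁ h l x₂ x₃) (Mₚ.∈-++⁺ˡ
          (∈-concatMap {f = λ z → map (λ w → z , x₂ , x₃ , w) (recL x₂ l x₃)} f (Mₚ.∈-map⁺ (λ w → x₁ , x₂ , x₃ , w) g)))))

        backward-backward : Backward p → Backward (2 + p) → InW
        backward-backward f g = in-block p (∈-blocks x₂ x₄ (Mₚ.∈-++⁺ʳ (block₁ h l x₂ x₄) (Mₚ.∈-++⁺ʳ (block₂ h l x₂ x₄)
          (∈-concatMap {f = λ z → map (λ w → w , x₂ , z , x₄) (recR h z x₂)} g (Mₚ.∈-map⁺ (λ w → w , x₂ , x₃ , x₄) f)))))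

      -- Forward p and Backward (2 + p) determine v (2 + p) and v (3 + p) by one another; then
      -- the pair at 2 + p is combined with the pair at 4 + p instead.
      from-usable : ∀ p → Usable p → Usable (2 + p) → Usable (4 + p) → InW
      from-usable p u₀ u₂ u₄ = go (usable⇒ p u₀) (usable⇒ (2 + p) u₂) (usable⇒ (4 + p) u₄)
        where
        go : Forward p ⊎ Backward p → Forward (2 + p) ⊎ Backward (2 + p) → Forward (4 + p) ⊎ Backward (4 + p) → InW
        go (inj₁ f) (inj₁ g) _ = forward-forward p f g
        go (inj₂ f) (inj₁ g) _ = backward-forward p f g
        go (inj₂ f) (inj₂ g) _ = backward-backward p f g
        go (inj₁ _) (inj₂ g) (inj₁ h) = backward-forward (2 + p) g h
        go (inj₁ _) (inj₂ g) (inj₂ h) = backward-backward (2 + p) g h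

      Rich Poor : ℕ → Set
      Rich p = R ≤ length (common (v p) (v (2 + p)))
      Poor p = length (common (v p) (v (2 + p))) < R

      poor-or-rich : ∀ p → Poor p ⊎ Rich p
      poor-or-rich p with length (common (v p) (v (2 + p))) ℕₚ.<? R
      ... | yes h = inj₁ h
      ... | no h = inj₂ (ℕₚ.≮⇒≥ h)

      rich-everywhere : (∀ p → p < s → Rich p) → ∀ p → Rich p
      rich-everywhere h p = subst₂ (λ x y → R ≤ length (common x y)) (seq-cong C (p % s) p (DM.m%n%n≡m%n p s))
        (seq-cong C (2 + p % s) (2 + p) (trans (cong (_% s) (ℕₚ.+-comm 2 (p % s)))
          (trans (+-%-cong (p % s) p 2 (DM.m%n%n≡m%n p s)) (cong (_% s) (ℕₚ.+-comm p 2)))))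
        (h (p % s) (DM.m%n<n p s))

      rich⇒usable : (∀ p → Rich p) → ∀ p → Usable p
      rich⇒usable rich p = go (reroute t r z z-inj (λ i i< → subst (λ k → R ≤ length (common (z i) (v k))) (arith′ i p) (rich (i + i + (3 + p)))) r<t 2r≤t r ℕₚ.≤-refl)
        where
        r : ℕ
        r = suc a
        z : ℕ → Fin n
        z i = v (i + i + (3 + p))
        arith′ : ∀ i p → 2 + (i + i + (3 + p)) ≡ suc i + suc i + (3 + p)
        arith′ = solve-∀
        r<t : suc r ≤ t
        r<t = ℕₚ.≤-trans (subst (suc r ≤_) (arith a) (ℕₚ.m≤m+n (suc r) (3 + a))) (ℕₚ.m≤n+m (q + 3) (b + b))
          where
          arith : ∀ a → suc (suc a) + (3 + a) ≡ suc (a + suc a) + 3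
          arith = solve-∀
        2r≤t : r + r ≤ t
        2r≤t = ℕₚ.≤-trans (ℕₚ.m≤m+n (r + r) 3) (ℕₚ.m≤n+m (q + 3) (b + b))
        z-< : ∀ i d → i + suc d ≤ r → z i ≢ z (i + suc d)
        z-< i d le eq = seq-≢ C (suc d + suc d) (s≤s z≤n) (ℕₚ.≤-trans (s≤s (ℕₚ.+-mono-≤ d≤ d≤)) (ℕₚ.≤-trans (ℕₚ.n≤1+n _) (ℕₚ.n≤1+n _)))
          (trans (cong v (arith₂ i d p)) (sym eq))
          where
          d≤ : suc d ≤ r
          d≤ = ℕₚ.≤-trans (ℕₚ.m≤n+m (suc d) i) le
          arith₂ : ∀ i d p → suc d + suc d + (i + i + (3 + p)) ≡ i + suc d + (i + suc d) + (3 + p)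
          arith₂ = solve-∀
        z-inj : ∀ i i′ → i ≤ r → i′ ≤ r → z i ≡ z i′ → i ≡ i′
        z-inj i i′ i≤ i′≤ eq with ℕₚ.<-cmp i i′
        ... | tri≈ _ h _ = h
        ... | tri< lt _ _ with ℕₚ.m≤n⇒∃[o]m+o≡n lt
        ... | d , refl = contradiction (trans eq (cong z (sym (ℕₚ.+-suc i d)))) (z-< i d (subst (_≤ r) (sym (ℕₚ.+-suc i d)) i′≤))
        z-inj i i′ i≤ i′≤ eq | tri> _ _ gt with ℕₚ.m≤n⇒∃[o]m+o≡n gt
        ... | d , refl = contradiction (trans (sym eq) (cong z (sym (ℕₚ.+-suc i′ d)))) (z-< i′ d (subst (_≤ r) (sym (ℕₚ.+-suc i′ d)) i≤))
        go : (∃ λ vs → ∃ λ cs → RPath [] (v (3 + p)) (z r) (r + r) vs cs × (∀ i → r < i → i ≤ r → z i ∉ vs)) → Usable p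
        go (vs , cs , π , _) = vs , cs , subst (λ x → RPath [] (v (3 + p)) x q vs cs) (back _ p (arith a p)) π
          where
          arith : ∀ a p → suc a + suc a + (3 + p) ≡ suc (suc (suc (suc (a + suc a)))) + p
          arith = solve-∀

      ∈-window⇒ : ∀ {A : Set} (f : ℕ → A) {x} o m → x ∈ window f o m → ∃ λ k → k < m × x ≡ f (k + o)
      ∈-window⇒ f o (suc m) (here h) = m , ℕₚ.≤-refl , h
      ∈-window⇒ f o (suc m) (there h) = let k , k< , eq = ∈-window⇒ f o m h in k , ℕₚ.m≤n⇒m≤1+n k< , eq

      module _ (i : ℕ) (distinct : AllDistinct i) where

        distinct-mod : ∀ x y → e (x + i) ≡ e (y + i) → x % s ≡ y % s
        distinct-mod x y h = distinct (x % s) (y % s) (DM.m%n<n x s) (DM.m%n<n y s)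
          (trans (e-cong (x % s + i) (x + i) (+-%-cong (x % s) x i (DM.m%n%n≡m%n x s)))
            (trans h (sym (e-cong (y % s + i) (y + i) (+-%-cong (y % s) y i (DM.m%n%n≡m%n y s))))))

        along : ∀ d m → m < s → RPath [] (v (d + i)) (v (m + (d + i))) m (window v (d + i) (suc m)) (window e (d + i) m)
        along d zero m< = start
        along d (suc m) m< = step (along d m (ℕₚ.<⇒≤ m<)) (seq-adj C (m + (d + i)))
            (λ h → fresh-vertex (∈-window⇒ v (d + i) (suc m) h)) (λ h → fresh-colour (∈-window⇒ e (d + i) m h)) λ ()
          where
          apart : ∀ k m′ → k < m′ → m′ < s → (m′ + d) % s ≢ (k + d) % s
          apart k m′ k< m′< h = contradiction (%-+-injective (m′ ∸ k) (k + d) (ℕₚ.≤-<-trans (ℕₚ.m∸n≤m m′ k) m′<)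
            (trans (cong (_% s) (trans (sym (ℕₚ.+-assoc (m′ ∸ k) k d)) (cong (_+ d) (ℕₚ.m∸n+n≡m (ℕₚ.<⇒≤ k<))))) h))
            (ℕₚ.>⇒≢ (ℕₚ.m<n⇒0<n∸m k<))
          fresh-vertex : (∃ λ k → k < suc m × v (suc m + (d + i)) ≡ v (k + (d + i))) → ⊥
          fresh-vertex (k , k< , h) = contradiction (%-+-injective (suc m ∸ k) (k + (d + i)) (ℕₚ.≤-<-trans (ℕₚ.m∸n≤m (suc m) k) m<)
            (trans (cong (_% s) (trans (sym (ℕₚ.+-assoc (suc m ∸ k) k (d + i))) (cong (_+ (d + i)) (ℕₚ.m∸n+n≡m (ℕₚ.<⇒≤ k<)))))
              (seq-injective C (suc m + (d + i)) (k + (d + i)) h)))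
            (ℕₚ.>⇒≢ (ℕₚ.m<n⇒0<n∸m k<))
          fresh-colour : (∃ λ k → k < m × e (m + (d + i)) ≡ e (k + (d + i))) → ⊥
          fresh-colour (k , k< , h) = apart k m k< (ℕₚ.<⇒≤ m<) (distinct-mod (m + d) (k + d)
            (trans (cong e (ℕₚ.+-assoc m d i)) (trans h (cong e (sym (ℕₚ.+-assoc k d i))))))

        distinct⇒usable : ∀ d → Usable (d + i)
        distinct⇒usable d = _ , _ , subst (λ x → RPath [] (v (3 + (d + i))) x q (window v (3 + (d + i)) (suc q)) (window e (3 + (d + i)) q)) (back _ (d + i) (arith q (d + i)))
          (along (3 + d) q (s≤s (ℕₚ.≤-trans (ℕₚ.n≤1+n q) (ℕₚ.n≤1+n (suc q)))))
          where
          arith : ∀ q p → q + (3 + p) ≡ suc (suc (suc q)) + p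
          arith = solve-∀

      module _ (i : ℕ) (poor : Poor i) where

        ∈-startW : window v i 3 ∈ list startW
        ∈-startW = ∈-concatMap {f = startAt} (∈-allPairs (v i) (v (2 + i)))
          (Mₚ.∈-map⁺ (λ x → v (2 + i) ∷ x ∷ v i ∷ []) (go (length (common (v i) (v (2 + i))) ℕₚ.<? R)))
          where
          go : (d : Dec (length (common (v i) (v (2 + i))) < R)) → v (1 + i) ∈ shortCommon (v i) (v (2 + i)) d
          go (yes _) = ∈-common (seq-adj C i) (seq-adj C (1 + i))
          go (no h) = contradiction poor h

        ∈-freeFrom : ∀ m → window v i (3 + m) ∈ list (freeFrom m)
        ∈-freeFrom zero = ∈-startW
        ∈-freeFrom (suc m) = ∈-freeW {W = freeFrom m} (v (3 + m + i)) (∈-freeFrom m)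

        ∈-colouredFrom-det : ∀ m → v (3 + m + i) ∈ colourDets (window v i (3 + m)) → window v i (4 + m) ∈ list (colouredFrom (suc m))
        ∈-colouredFrom-det m h = Mₚ.∈-++⁺ˡ (∈-detW {W = freeFrom m} {colourDets} {colourK} {length-colourDets} (∈-freeFrom m) h)

        ∈-colouredFrom-free : ∀ m k → window v i (3 + m) ∈ list (colouredFrom m) → window v i (3 + (k + m)) ∈ list (colouredFrom (k + m))
        ∈-colouredFrom-free m zero h = h
        ∈-colouredFrom-free m (suc k) h = Mₚ.∈-++⁺ʳ (list (detW colourDets colourK length-colourDets (freeFrom (k + m))))
          (∈-freeW {W = colouredFrom (k + m)} (v (3 + (k + m) + i)) (∈-colouredFrom-free m k h))

        finish : ∀ m k → k + suc m ≡ q → v (3 + m + i) ∈ colourDets (window v i (3 + m)) → InW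
        finish m k eq h = i , Mₚ.∈-++⁺ʳ (list W₁) (subst (λ r → window v i (3 + r) ∈ list (colouredFrom r)) eq
          (∈-colouredFrom-free (suc m) k (∈-colouredFrom-det m h)))

        ∈colours : ∀ α m → suc α < 3 + m → 3 + m ≤ s → e (α + i) ∈ coloursOf s (window v i (3 + m))
        ∈colours α m h h′ = ∈-coloursOf v i (3 + m) s α h h′

        inner-edge : ∀ α g k → e (α + i) ≡ e (2 + g + α + i) → k + suc (g + α) ≡ q → InW
        inner-edge α g k eq h = finish (g + α) k h (Mₚ.∈-++⁺ˡ (∈-colourDet (seq-adj C (2 + (g + α) + i))
            (∈colours α (g + α) (s≤s (s≤s (ℕₚ.≤-trans (ℕₚ.m≤n+m α g) (ℕₚ.n≤1+n _)))) (s≤s (s≤s (s≤s m≤))))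
            (sym eq)))
          where
          m≤ : g + α ≤ q
          m≤ = ℕₚ.≤-trans (ℕₚ.n≤1+n _) (subst (suc (g + α) ≤_) h (ℕₚ.m≤n+m (suc (g + α)) k))

        closing-edge : ∀ α g → e (suc α + i) ≡ e (2 + g + suc α + i) → g + suc α ≡ q → InW
        closing-edge α g eq h = finish (g + α) 0 (trans (sym (ℕₚ.+-suc g α)) h)
            (Mₚ.∈-++⁺ʳ (colourDet s (window v i (3 + (g + α)))) (∈-concatMap {f = colourNbrs (lastOf (v (2 + (g + α) + i)) (window v i (2 + (g + α))))}
              (∈colours (suc α) (g + α) (s≤s (s≤s (s≤s (ℕₚ.m≤n+m α g)))) (s≤s (s≤s (s≤s m≤))))
              (subst (λ z → v (3 + (g + α) + i) ∈ colourNbrs z (e (suc α + i))) (sym (lastOf-window v i (2 + (g + α))))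
                (∈-colourNbrs edge col≡))))
          where
          m≤ : g + α ≤ q
          m≤ = ℕₚ.≤-trans (ℕₚ.n≤1+n _) (ℕₚ.≤-reflexive (trans (sym (ℕₚ.+-suc g α)) h))
          idx : 2 + g + suc α + i ≡ 3 + (g + α) + i
          idx = cong (λ k → 2 + k + i) (ℕₚ.+-suc g α)
          next≡ : v (suc (3 + (g + α) + i)) ≡ v i
          next≡ = back _ i (cong (λ k → suc (2 + k + i)) (trans (sym (ℕₚ.+-suc g α)) h))
          edge : v i ~ v (3 + (g + α) + i)
          edge = adjSym G (subst (v (3 + (g + α) + i) ~_) next≡ (seq-adj C (3 + (g + α) + i)))
          col≡ : κ (v i) (v (3 + (g + α) + i)) ≡ e (suc α + i)
          col≡ = trans (colSym c edge) (trans (cong (κ (v (3 + (g + α) + i))) (sym next≡)) (trans (cong e (sym idx)) (sym eq)))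

        -- Equally coloured edges are not adjacent, so the vertex determined through the later edge
        -- lies beyond the first three vertices, and the two savings concern different vertices.
        from-coincidence : Coincidence i → InW
        from-coincidence (α , β , α<β , β<s , eq) = go (ℕₚ.m≤n⇒∃[o]m+o≡n α<β) (ℕₚ.m≤n⇒∃[o]m+o≡n β<s)
          where
          go : (∃ λ k → suc α + k ≡ β) → (∃ λ k → suc β + k ≡ s) → InW
          go (zero , refl) _ = contradiction (trans eq (cong (λ k → e (suc k + i)) (ℕₚ.+-identityʳ α))) (adjacent-≢ (α + i))
          go (suc g , refl) (suc k , h) = inner-edge α g k (trans eq (cong (λ k → e (k + i)) (arith₂ α g)))
              (ℕₚ.suc-injective (ℕₚ.suc-injective (ℕₚ.suc-injective (trans (arith₁ α g k) h))))
            where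
            arith₁ : ∀ α g k → 3 + (k + suc (g + α)) ≡ suc (suc α + suc g) + suc k
            arith₁ = solve-∀
            arith₂ : ∀ α g → suc α + suc g ≡ 2 + g + α
            arith₂ = solve-∀
          go (suc g , refl) (zero , h) = closing α h eq
            where
            closing : ∀ α → suc (suc α + suc g) + 0 ≡ s → e (α + i) ≡ e (suc α + suc g + i) → InW
            closing zero h eq = contradiction (trans (sym eq) (trans (sym (e-period i)) (cong (λ k → e (k + i)) (trans (sym h) (ℕₚ.+-identityʳ _)))))
              (adjacent-≢ (suc (suc g) + i))
            closing (suc α) h eq = closing-edge α g (trans eq (cong (λ k → e (k + i)) (arith₂ α g)))
                (ℕₚ.suc-injective (ℕₚ.suc-injective (ℕₚ.suc-injective (trans (arith₁ α g) h))))
              where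
              arith₁ : ∀ α g → 3 + (g + suc α) ≡ suc (suc (suc α) + suc g) + 0
              arith₁ = solve-∀
              arith₂ : ∀ α g → suc (suc α) + suc g ≡ 2 + g + suc α
              arith₂ = solve-∀

      -- If all pairs at distance two are rich, rerouting makes every position usable. Otherwise the
      -- count starts at a poor pair: a rainbow cycle provides the required paths itself, and a
      -- colour coincidence gives the second saving.
      covered : InW
      covered = go (any-or-all poor-or-rich s)
        where
        go : (∃ λ p → Poor p) ⊎ (∀ p → p < s → Rich p) → InW
        go (inj₂ rich) = from-usable 0 (usable 0) (usable 2) (usable 4)
          where
          usable : ∀ p → Usable p
          usable = rich⇒usable (rich-everywhere rich)
        go (inj₁ (i , poor)) = go′ (coincidence? i)
          where
          go′ : Coincidence i ⊎ AllDistinct i → InW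
          go′ (inj₁ co) = from-coincidence i poor co
          go′ (inj₂ d) = from-usable i (distinct⇒usable i d 0) (distinct⇒usable i d 2) (distinct⇒usable i d 4)

  odd-self-upper : Upper s t (q + 1 + (q + 1))
  odd-self-upper = cover⇒upper (suc (suc q)) t coverK (q + 1) λ _ G c adj? nr →
    Cover.coverW G c adj? nr , λ C → Cover.covered G c adj? nr C

-- Primes between X and 9X, for X = 4^i

binomial : ℕ → ℕ → ℕ
binomial n zero = 1
binomial zero (suc k) = 0
binomial (suc n) (suc k) = binomial n k + binomial n (suc k)

module _ where
  private
    b = binomial

  absorption : ∀ n k → suc k * b n (suc k) + k * b n k ≡ n * b n k
  absorption zero zero = refl
  absorption zero (suc k) = trans (cong₂ _+_ (ℕₚ.*-zeroʳ k) (ℕₚ.*-zeroʳ k)) refl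
  absorption (suc n) zero = trans (arith (b n 1)) (cong suc (absorption n 0))
    where
    arith : ∀ x → 1 * (1 + x) + 0 * 1 ≡ suc (1 * x + 0 * 1)
    arith = solve-∀
  absorption (suc n) (suc k) = trans (lhs k (b n k) (b n (suc k)) (b n (suc (suc k))))
    (trans (cong₂ (λ x y → x + y + (b n (suc k) + b n k)) (absorption n (suc k)) (absorption n k)) (rhs n (b n k) (b n (suc k))))
    where
    lhs : ∀ k x y z → suc (suc k) * (y + z) + suc k * (x + y) ≡ (suc (suc k) * z + suc k * y) + (suc k * y + k * x) + (y + x)
    lhs = solve-∀
    rhs : ∀ n x y → n * y + n * x + (y + x) ≡ suc n * (x + y)
    rhs = solve-∀

  absorption′ : ∀ n k → suc n * b n k + k * b (suc n) k ≡ suc n * b (suc n) k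
  absorption′ n zero = arith n
    where
    arith : ∀ n → suc n * 1 + 0 * 1 ≡ suc n * 1
    arith = solve-∀
  absorption′ n (suc k) = trans (lhs n k (b n k) (b n (suc k)))
    (trans (cong (λ x → suc n * b n (suc k) + (x + b n k)) (absorption n k)) (rhs n (b n k) (b n (suc k))))
    where
    lhs : ∀ n k x y → suc n * y + suc k * (x + y) ≡ suc n * y + ((suc k * y + k * x) + x)
    lhs = solve-∀
    rhs : ∀ n x y → suc n * y + (n * x + x) ≡ suc n * (x + y)
    rhs = solve-∀

  binomial-pos : ∀ {n k} → k ≤ n → 1 ≤ b n k
  binomial-pos {n} {zero} _ = s≤s z≤n
  binomial-pos {suc n} {suc k} (s≤s h) = ℕₚ.≤-trans (binomial-pos h) (ℕₚ.m≤m+n _ _)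

  binomial≤2^ : ∀ n k → b n k ≤ 2 ^ n
  binomial≤2^ n zero = ℕₚ.m^n>0 2 n
  binomial≤2^ zero (suc k) = z≤n
  binomial≤2^ (suc n) (suc k) = ℕₚ.≤-trans (ℕₚ.+-mono-≤ (binomial≤2^ n k) (binomial≤2^ n (suc k)))
    (ℕₚ.≤-reflexive (cong (2 ^ n +_) (sym (ℕₚ.+-identityʳ (2 ^ n)))))

  2^≤central : ∀ n → 2 ^ n ≤ b (n + n) n
  2^≤central zero = s≤s z≤n
  2^≤central (suc n) = ℕₚ.≤-trans (ℕₚ.+-mono-≤ (2^≤central n) (ℕₚ.≤-trans (ℕₚ.≤-reflexive (ℕₚ.+-identityʳ (2 ^ n))) (2^≤central n)))
    (subst (λ m → b (n + n) n + b (n + n) n ≤ b m n + b m (suc n)) (sym (ℕₚ.+-suc n n))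
      (ℕₚ.+-mono-≤ (row n) (ℕₚ.m≤m+n _ _)))
    where
    row : ∀ k {m} → b m k ≤ b (suc m) k
    row zero = ℕₚ.≤-refl
    row (suc k) = ℕₚ.m≤n+m _ _

  binomial-factorial : ∀ m k → b (m + k) k * (k ! * m !) ≡ (m + k) !
  binomial-factorial m zero = trans (arith (m !)) (cong _! (sym (ℕₚ.+-identityʳ m)))
    where
    arith : ∀ x → 1 * (1 * x) ≡ x
    arith = solve-∀
  binomial-factorial m (suc k) = trans (step₁ (b (m + suc k) (suc k)) k (k !) (m !))
    (trans (cong (λ x → x * (k ! * m !)) top) (trans (step₂ (m + k) (b (m + k) k) (k ! * m !))
      (trans (cong (suc (m + k) *_) (binomial-factorial m k)) (cong _! (sym (ℕₚ.+-suc m k))))))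
    where
    step₁ : ∀ x k f g → x * ((suc k * f) * g) ≡ suc k * x * (f * g)
    step₁ = solve-∀
    step₂ : ∀ n x f → suc n * x * f ≡ suc n * (x * f)
    step₂ = solve-∀
    top : suc k * b (m + suc k) (suc k) ≡ suc (m + k) * b (m + k) k
    top = trans (cong (λ n → suc k * b n (suc k)) (ℕₚ.+-suc m k))
      (trans (arith₁ k (b (m + k) k) (b (m + k) (suc k))) (trans (cong (_+ b (m + k) k) (absorption (m + k) k)) (arith₂ (m + k) (b (m + k) k))))
      where
      arith₁ : ∀ k x y → suc k * (x + y) ≡ suc k * y + k * x + x
      arith₁ = solve-∀
      arith₂ : ∀ n x → n * x + x ≡ suc n * x
      arith₂ = solve-∀

  -- The entries of Leibniz's harmonic triangle are 1 / ((n+1) C(n,k)), and each is the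
  -- difference of two earlier ones.
  leibniz : ∀ D n k → k ≤ n → (∀ i → 1 ≤ i → i ≤ suc n → i ∣ D) → suc n * b n k ∣ D
  leibniz D n zero _ h = subst (_∣ D) (sym (ℕₚ.*-identityʳ (suc n))) (h (suc n) (s≤s z≤n) ℕₚ.≤-refl)
  leibniz D (suc n) (suc k) (s≤s k≤n) h = go (leibniz D (suc n) k (ℕₚ.m≤n⇒m≤1+n k≤n) h)
      (leibniz D n k k≤n (λ i 1≤i i≤ → h i 1≤i (ℕₚ.m≤n⇒m≤1+n i≤))) (ℕₚ.m≤n⇒∃[o]m+o≡n k≤n)
    where
    β γ : ℕ
    β = b (suc n) k
    γ = b (suc n) (suc k)
    go : suc (suc n) * β ∣ D → suc n * b n k ∣ D → (∃ λ m → k + m ≡ n) → suc (suc n) * γ ∣ D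
    go (divides x eqx) (divides y eqy) (m , k+m≡n) = go′ (ℕₚ.m≤n⇒∃[o]m+o≡n x≤y)
      where
      instance
        β≢0 : NonZero β
        β≢0 = Data.Nat.>-nonZero (binomial-pos (ℕₚ.m≤n⇒m≤1+n k≤n))
      cancel-k : ∀ {a b} → a + k * β ≡ b + k * β → a ≡ b
      cancel-k {a} {b} = ℕₚ.+-cancelʳ-≡ (k * β) a b
      sucn : suc n * β ≡ suc m * β + k * β
      sucn = trans (cong (λ z → suc z * β) (sym k+m≡n)) (arith k m β)
        where
        arith : ∀ k m β → suc (k + m) * β ≡ suc m * β + k * β
        arith = solve-∀
      lower : suc n * b n k ≡ suc m * β
      lower = cancel-k (trans (absorption′ n k) sucn)
      right : suc k * γ ≡ suc m * β
      right = cancel-k (trans (absorption (suc n) k) sucn)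
      balance : y * suc m ≡ x * suc (suc n)
      balance = ℕₚ.*-cancelʳ-≡ (y * suc m) (x * suc (suc n)) β
        (trans (ℕₚ.*-assoc y (suc m) β) (trans (cong (y *_) (sym lower)) (trans (sym eqy) (trans eqx (sym (ℕₚ.*-assoc x (suc (suc n)) β))))))
      x≤y : x ≤ y
      x≤y = ℕₚ.*-cancelʳ-≤ x y (suc m) (ℕₚ.≤-trans (ℕₚ.*-monoʳ-≤ x (s≤s (ℕₚ.≤-trans (subst (m ≤_) k+m≡n (ℕₚ.m≤n+m m k)) (ℕₚ.n≤1+n n))))
        (ℕₚ.≤-reflexive (sym balance)))
      go′ : (∃ λ z → x + z ≡ y) → suc (suc n) * γ ∣ D
      go′ (z , refl) = divides z (ℕₚ.*-cancelˡ-≡ D (z * (suc (suc n) * γ)) (suc k) (trans (cong (suc k *_) eqx)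
          (trans (arith₁ (suc k) x (suc (suc n)) β) (trans (cong (λ w → w * (suc (suc n) * β)) (sym zm))
          (trans (arith₂ z (suc m) (suc (suc n)) β) (trans (cong (λ w → z * (suc (suc n) * w)) (sym right)) (arith₃ z (suc (suc n)) (suc k) γ)))))))
        where
        zm : z * suc m ≡ suc k * x
        zm = ℕₚ.+-cancelˡ-≡ (x * suc m) (z * suc m) (suc k * x)
          (trans (sym (ℕₚ.*-distribʳ-+ (suc m) x z)) (trans balance (trans (cong (λ w → x * suc (suc w)) (sym k+m≡n)) (arith x k m))))
          where
          arith : ∀ x k m → x * suc (suc (k + m)) ≡ x * suc m + suc k * x
          arith = solve-∀
        arith₁ : ∀ k x n β → k * (x * (n * β)) ≡ k * x * (n * β)
        arith₁ = solve-∀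
        arith₂ : ∀ z m n β → z * m * (n * β) ≡ z * (n * (m * β))
        arith₂ = solve-∀
        arith₃ : ∀ z n k γ → z * (n * (k * γ)) ≡ k * (z * (n * γ))
        arith₃ = solve-∀

primeOr1 : ℕ → ℕ
primeOr1 m with prime? m
... | yes _ = m
... | no _ = 1

primeOr1-cases : ∀ m → (Prime m × primeOr1 m ≡ m) ⊎ (¬ Prime m × primeOr1 m ≡ 1)
primeOr1-cases m with prime? m
... | yes p = inj₁ (p , refl)
... | no ¬p = inj₂ (¬p , refl)

-- The product of the primes in (n, n + d]; a primorial for n = 0.
primesIn : ℕ → ℕ → ℕ
primesIn n zero = 1
primesIn n (suc d) = primeOr1 (suc (n + d)) * primesIn n d

primesIn-+ : ∀ n d e → primesIn n (d + e) ≡ primesIn n d * primesIn (n + d) e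
primesIn-+ n d zero = trans (cong (primesIn n) (ℕₚ.+-identityʳ d)) (sym (ℕₚ.*-identityʳ _))
primesIn-+ n d (suc e) = trans (cong (primesIn n) (ℕₚ.+-suc d e))
  (trans (cong₂ (λ m x → primeOr1 (suc m) * x) (sym (ℕₚ.+-assoc n d e)) (primesIn-+ n d e))
    (arith (primeOr1 (suc (n + d + e))) (primesIn n d) (primesIn (n + d) e)))
  where
  arith : ∀ a b c → a * (b * c) ≡ b * (a * c)
  arith = solve-∀

prime∤1 : ∀ {p} → Prime p → ¬ p ∣ 1
prime∤1 pr h = ¬prime[1] (subst Prime (Dv.∣1⇒≡1 h) pr)

prime∤primesIn : ∀ {p} n d → Prime p → n + d < p → ¬ p ∣ primesIn n d
prime∤primesIn n zero pr lt h = prime∤1 pr h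
prime∤primesIn {p} n (suc d) pr lt h = go (euclidsLemma (primeOr1 (suc (n + d))) (primesIn n d) pr h)
  where
  lt′ : suc (n + d) < p
  lt′ = subst (_< p) (ℕₚ.+-suc n d) lt
  go : p ∣ primeOr1 (suc (n + d)) ⊎ p ∣ primesIn n d → ⊥
  go (inj₂ h) = prime∤primesIn n d pr (ℕₚ.<⇒≤ lt′) h
  go (inj₁ h) with primeOr1-cases (suc (n + d))
  ... | inj₁ (_ , eq) = ℕₚ.<⇒≱ lt′ (Dv.∣⇒≤ (subst (p ∣_) eq h))
  ... | inj₂ (_ , eq) = prime∤1 pr (subst (p ∣_) eq h)

-- The next prime exceeds all earlier ones and does not divide their product, so by Euclid's lemma
-- it divides the cofactor.
primesIn-∣ : ∀ {X} n d → (∀ p → Prime p → n < p → p ≤ n + d → p ∣ X) → primesIn n d ∣ X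
primesIn-∣ n zero h = Dv.1∣ _
primesIn-∣ {X} n (suc d) h = go (primesIn-∣ {X} n d λ p pr lt le → h p pr lt (ℕₚ.≤-trans le (ℕₚ.+-monoʳ-≤ n (ℕₚ.n≤1+n d))))
                                (primeOr1-cases (suc (n + d)))
  where
  go : primesIn n d ∣ X → (Prime (suc (n + d)) × primeOr1 (suc (n + d)) ≡ suc (n + d)) ⊎ (¬ Prime (suc (n + d)) × primeOr1 (suc (n + d)) ≡ 1) →
    primeOr1 (suc (n + d)) * primesIn n d ∣ X
  go R∣X (inj₂ (_ , eq)) = subst (λ m → m * primesIn n d ∣ X) (sym eq) (subst (_∣ X) (sym (ℕₚ.*-identityˡ (primesIn n d))) R∣X)
  go (divides y eqy) (inj₁ (pr , eq)) = subst (λ m → m * primesIn n d ∣ X) (sym eq)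
      (go′ (euclidsLemma y (primesIn n d) pr (subst (suc (n + d) ∣_) eqy (h _ pr (s≤s (ℕₚ.m≤m+n n d)) (ℕₚ.≤-reflexive (sym (ℕₚ.+-suc n d)))))))
    where
    go′ : suc (n + d) ∣ y ⊎ suc (n + d) ∣ primesIn n d → suc (n + d) * primesIn n d ∣ X
    go′ (inj₁ p∣y) = subst (suc (n + d) * primesIn n d ∣_) (sym eqy) (Dv.*-monoˡ-∣ (primesIn n d) p∣y)
    go′ (inj₂ p∣R) = contradiction p∣R (prime∤primesIn n d pr ℕₚ.≤-refl)

∣! : ∀ {p m} → 1 ≤ p → p ≤ m → p ∣ m !
∣! {suc p} _ h = Dv.∣-trans (Dv.m∣m*n (p !)) (Dv.m≤n⇒m!∣n! h)

prime∣!⇒≤ : ∀ {p} n → Prime p → p ∣ n ! → p ≤ n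
prime∣!⇒≤ zero pr h = contradiction h (prime∤1 pr)
prime∣!⇒≤ (suc n) pr h with euclidsLemma (suc n) (n !) pr h
... | inj₁ h′ = Dv.∣⇒≤ h′
... | inj₂ h′ = ℕₚ.m≤n⇒m≤1+n (prime∣!⇒≤ n pr h′)

-- A prime in (n, 2n] divides (2n)! but not n!, hence it divides the central binomial coefficient.
primesIn≤4^ : ∀ n → primesIn n n ≤ 2 ^ (n + n)
primesIn≤4^ n = ℕₚ.≤-trans (Dv.∣⇒≤ {{Data.Nat.>-nonZero (binomial-pos {n + n} {n} (ℕₚ.m≤m+n n n))}} (primesIn-∣ n n divs)) (binomial≤2^ (n + n) n)
  where
  divs : ∀ p → Prime p → n < p → p ≤ n + n → p ∣ binomial (n + n) n
  divs p pr n<p p≤ with euclidsLemma (binomial (n + n) n) (n ! * n !) pr (subst (p ∣_) (sym (binomial-factorial n n)) (∣! (ℕₚ.≤-trans (s≤s z≤n) n<p) p≤))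
  ... | inj₁ h = h
  ... | inj₂ h with euclidsLemma (n !) (n !) pr h
  ... | inj₁ h′ = contradiction (prime∣!⇒≤ n pr h′) (ℕₚ.<⇒≱ n<p)
  ... | inj₂ h′ = contradiction (prime∣!⇒≤ n pr h′) (ℕₚ.<⇒≱ n<p)

∣primesIn : ∀ {p} n d → Prime p → n < p → p ≤ n + d → p ∣ primesIn n d
∣primesIn {p} n zero pr lt le = contradiction (subst (p ≤_) (ℕₚ.+-identityʳ n) le) (ℕₚ.<⇒≱ lt)
∣primesIn {p} n (suc d) pr lt le with p ℕₚ.≟ suc (n + d)
... | no ne = Dv.∣n⇒∣m*n (primeOr1 (suc (n + d)))
        (∣primesIn n d pr lt (ℕₚ.≤-pred (ℕₚ.≤∧≢⇒< (subst (p ≤_) (ℕₚ.+-suc n d) le) ne)))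
... | yes refl with primeOr1-cases (suc (n + d))
... | inj₁ (_ , eq) = subst (λ m → suc (n + d) ∣ m * primesIn n d) (sym eq) (Dv.m∣m*n (primesIn n d))
... | inj₂ (¬pr , _) = contradiction pr ¬pr

primorial≤ : ∀ j → primesIn 0 (2 ^ j) ≤ 2 ^ (2 ^ j + 2 ^ j)
primorial≤ zero with primeOr1-cases 1
... | inj₁ (pr , _) = contradiction pr ¬prime[1]
... | inj₂ (_ , eq) = ℕₚ.≤-trans (ℕₚ.≤-reflexive (cong (_* 1) eq)) (s≤s z≤n)
primorial≤ (suc j) = subst (λ m → primesIn 0 m ≤ 2 ^ (m + m)) (cong (2 ^ j +_) (sym (ℕₚ.+-identityʳ (2 ^ j))))
  (ℕₚ.≤-trans (ℕₚ.≤-reflexive (primesIn-+ 0 (2 ^ j) (2 ^ j))) (ℕₚ.≤-trans (ℕₚ.*-mono-≤ (primorial≤ j) (primesIn≤4^ (2 ^ j)))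
    (ℕₚ.≤-reflexive (sym (ℕₚ.^-distribˡ-+-* 2 (2 ^ j + 2 ^ j) (2 ^ j + 2 ^ j))))))

^-∣ : ∀ m {a b} → a ≤ b → m ^ a ∣ m ^ b
^-∣ m {a} h with ℕₚ.m≤n⇒∃[o]m+o≡n h
... | c , refl = subst (m ^ a ∣_) (sym (ℕₚ.^-distribˡ-+-* m a c)) (Dv.m∣m*n (m ^ c))

prime≥2 : ∀ {p} → Prime p → 2 ≤ p
prime≥2 {p} pr = Data.Nat.nonTrivial⇒n>1 p {{prime⇒nonTrivial pr}}

product-pos : ∀ {ps} → All Prime ps → 1 ≤ product ps
product-pos [] = s≤s z≤n
product-pos (pr ∷ prs) = ℕₚ.*-mono-≤ (ℕₚ.<⇒≤ (prime≥2 pr)) (product-pos prs)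

2^length≤ : ∀ {ps} → All Prime ps → 2 ^ length ps ≤ product ps
2^length≤ [] = s≤s z≤n
2^length≤ (pr ∷ prs) = ℕₚ.*-mono-≤ (prime≥2 pr) (2^length≤ prs)

module _ (N r θ : ℕ) (N≤r² : N ≤ r * r) (∣θ : ∀ p → Prime p → p ≤ N → p ∣ θ) where

  smooth-∣ : ∀ {ps} → All Prime ps → All (_≤ r) ps → product ps ∣ (r !) ^ length ps
  smooth-∣ [] [] = Dv.1∣ 1
  smooth-∣ (pr ∷ prs) (h ∷ hs) = Dv.*-pres-∣ (∣! (ℕₚ.<⇒≤ (prime≥2 pr)) h) (smooth-∣ prs hs)

  -- At most one prime factor of a number up to N exceeds r.
  factors-∣ : ∀ {ps} → All Prime ps → product ps ≤ N → product ps ∣ (r !) ^ length ps * θ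
  factors-∣ [] _ = Dv.1∣ _
  factors-∣ {p ∷ ps} (pr ∷ prs) h with p ℕₚ.≤? r
  ... | yes p≤r = subst (p * product ps ∣_) (sym (ℕₚ.*-assoc (r !) ((r !) ^ length ps) θ))
          (Dv.*-pres-∣ (∣! (ℕₚ.<⇒≤ (prime≥2 pr)) p≤r) (factors-∣ prs
            (ℕₚ.≤-trans (ℕₚ.m≤n*m (product ps) p {{prime⇒nonZero pr}}) h)))
  ... | no p≰r = subst (p * product ps ∣_) (ℕₚ.*-comm θ (r ! * (r !) ^ length ps))
          (Dv.*-pres-∣ (∣θ p pr (ℕₚ.≤-trans (ℕₚ.m≤m*n p (product ps) {{Data.Nat.>-nonZero (product-pos prs)}}) h))
            (Dv.∣n⇒∣m*n (r !) (smooth-∣ prs (All.tabulate small))))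
    where
    product-≥ : ∀ {ps x} → All Prime ps → x ∈ ps → x ≤ product ps
    product-≥ {x ∷ ps} (pr ∷ prs) (here refl) = ℕₚ.m≤m*n x (product ps) {{Data.Nat.>-nonZero (product-pos prs)}}
    product-≥ {y ∷ ps} (pr ∷ prs) (there x∈) = ℕₚ.≤-trans (product-≥ prs x∈) (ℕₚ.m≤n*m (product ps) y {{prime⇒nonZero pr}})
    small : ∀ {x} → x ∈ ps → x ≤ r
    small {x} x∈ with x ℕₚ.≤? r
    ... | yes x≤r = x≤r
    ... | no x≰r = contradiction (ℕₚ.≤-trans (ℕₚ.*-monoʳ-≤ p (product-≥ prs x∈)) (ℕₚ.≤-trans h N≤r²))
                     (ℕₚ.<⇒≱ (ℕₚ.*-mono-< (ℕₚ.≰⇒> p≰r) (ℕₚ.≰⇒> x≰r)))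

  -- A number up to 2^L has at most L prime factors. Those up to r each divide r!, and the at most
  -- one larger factor divides θ.
  common-multiple : ∀ L → N ≤ 2 ^ L → ∀ k → 1 ≤ k → k ≤ N → k ∣ (r !) ^ L * θ
  common-multiple L N≤ k 1≤k k≤N = Dv.∣-trans
      (subst (_∣ (r !) ^ length ps * θ) (sym k≡) (factors-∣ prs (subst (_≤ N) k≡ k≤N)))
      (Dv.*-monoˡ-∣ θ (^-∣ (r !) few))
    where
    fac : PrimeFactorisation k
    fac = factorise k {{Data.Nat.>-nonZero 1≤k}}
    ps : List ℕ
    ps = PrimeFactorisation.factors fac
    k≡ : k ≡ product ps
    k≡ = PrimeFactorisation.isFactorisation fac
    prs : All Prime ps
    prs = PrimeFactorisation.factorsPrime fac
    few : length ps ≤ L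
    few with length ps ℕₚ.≤? L
    ... | yes h = h
    ... | no h = contradiction (ℕₚ.≤-trans (2^length≤ prs) (ℕₚ.≤-trans (subst (_≤ N) k≡ k≤N) N≤))
                   (ℕₚ.<⇒≱ (ℕₚ.^-monoʳ-< 2 (s≤s (s≤s z≤n)) (ℕₚ.≰⇒> h)))

!≤^ : ∀ n {m} → n ≤ m → n ! ≤ m ^ n
!≤^ zero h = s≤s z≤n
!≤^ (suc n) h = ℕₚ.*-mono-≤ h (!≤^ n (ℕₚ.<⇒≤ h))

square<2^ : ∀ k → 4 * ((12 + k) * (12 + k)) < 2 ^ (10 + k)
square<2^ zero = ℕₚ.m≤m+n 577 447
square<2^ (suc k) = ℕₚ.≤-<-trans (ℕₚ.≤-trans (ℕₚ.m≤m+n _ (4 * (k * k) + 88 * k + 476)) (ℕₚ.≤-reflexive (arith k)))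
  (ℕₚ.*-monoʳ-< 2 (square<2^ k))
  where
  arith : ∀ k → 4 * ((12 + suc k) * (12 + suc k)) + (4 * (k * k) + 88 * k + 476) ≡ 2 * (4 * ((12 + k) * (12 + k)))
  arith = solve-∀

-- Without a prime in (X, N], the number D = (r!)^L θ is a multiple of 1, ..., N, hence of N C(2n,
-- n) ≥ 2^n with n = 4X. The choices r = 4Y and L = 4 + 2i satisfy r^2 = 2^L = 16X ≥ N. Comparing
-- 2^(4X) with r^(rL) 2^(2X) gives Y ≤ 4 (2 + i)^2, against the hypothesis.
prime-between : ∀ i → 4 * ((2 + i) * (2 + i)) < 2 ^ i → ∃ λ p → Prime p × 2 ^ i * 2 ^ i < p × p ≤ 9 * (2 ^ i * 2 ^ i)
prime-between i large = go (ℕₚ.anyUpTo? (λ p → prime? p ×-dec (X ℕₚ.<? p)) (suc N))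
  where
  Y X n N r L θ : ℕ
  Y = 2 ^ i
  X = Y * Y
  n = 4 * X
  N = suc (n + n)
  r = 4 * Y
  L = 4 + (i + i)
  θ = primesIn 0 X
  1≤Y : 1 ≤ Y
  1≤Y = ℕₚ.m^n>0 2 i
  1≤X : 1 ≤ X
  1≤X = ℕₚ.*-mono-≤ 1≤Y 1≤Y
  N≤9X : N ≤ 9 * X
  N≤9X = ℕₚ.≤-trans (ℕₚ.+-monoˡ-≤ (n + n) 1≤X) (ℕₚ.≤-reflexive (arith X))
    where
    arith : ∀ X → X + (4 * X + 4 * X) ≡ 9 * X
    arith = solve-∀
  2^L : 2 ^ L ≡ 16 * X
  2^L = trans (ℕₚ.^-distribˡ-+-* 2 4 (i + i)) (cong (16 *_) (ℕₚ.^-distribˡ-+-* 2 i i))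
  9X≤16X : 9 * X ≤ 16 * X
  9X≤16X = ℕₚ.*-monoˡ-≤ X (ℕₚ.m≤m+n 9 7)
  r² : r * r ≡ 16 * X
  r² = arith Y
    where
    arith : ∀ Y → 4 * Y * (4 * Y) ≡ 16 * (Y * Y)
    arith = solve-∀
  r≡ : r ≡ 2 ^ (2 + i)
  r≡ = sym (ℕₚ.^-distribˡ-+-* 2 2 i)
  θ≤ : θ ≤ 2 ^ (X + X)
  θ≤ = subst (λ x → primesIn 0 x ≤ 2 ^ (x + x)) (ℕₚ.^-distribˡ-+-* 2 i i) (primorial≤ (i + i))
  none⇒⊥ : (∀ p → Prime p → p ≤ N → p ≤ X) → ⊥
  none⇒⊥ h = ℕₚ.<⇒≱ large (ℕₚ.*-cancelʳ-≤ Y (4 * ((2 + i) * (2 + i))) Y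
      {{Data.Nat.>-nonZero 1≤Y}} (ℕₚ.*-cancelˡ-≤ 2 (ℕₚ.+-cancelʳ-≤ (X + X) _ _ exponents)))
    where
    D : ℕ
    D = (r !) ^ L * θ
    D>0 : 1 ≤ D
    D>0 = ℕₚ.*-mono-≤ (ℕₚ.≤-trans (ℕₚ.≤-reflexive (sym (ℕₚ.^-zeroˡ L))) (ℕₚ.^-monoˡ-≤ L (ℕₚ.1≤n! r))) (θ-pos X)
      where
      θ-pos : ∀ d → 1 ≤ primesIn 0 d
      θ-pos zero = s≤s z≤n
      θ-pos (suc d) = ℕₚ.*-mono-≤ (go (primeOr1-cases (suc d))) (θ-pos d)
        where
        go : (Prime (suc d) × primeOr1 (suc d) ≡ suc d) ⊎ (¬ Prime (suc d) × primeOr1 (suc d) ≡ 1) → 1 ≤ primeOr1 (suc d)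
        go (inj₁ (_ , eq)) = subst (1 ≤_) (sym eq) (s≤s z≤n)
        go (inj₂ (_ , eq)) = ℕₚ.≤-reflexive (sym eq)
    divides-D : suc (n + n) * binomial (n + n) n ∣ D
    divides-D = leibniz D (n + n) n (ℕₚ.m≤m+n n n) (common-multiple N r θ
      (ℕₚ.≤-trans N≤9X (ℕₚ.≤-trans 9X≤16X (ℕₚ.≤-reflexive (sym r²))))
      (λ p pr p≤N → ∣primesIn 0 X pr (ℕₚ.<⇒≤ (prime≥2 pr)) (h p pr p≤N))
      L (ℕₚ.≤-trans N≤9X (ℕₚ.≤-trans 9X≤16X (ℕₚ.≤-reflexive (sym 2^L)))))
    powers : 2 ^ n ≤ 2 ^ ((2 + i) * r * L + (X + X))
    powers = begin
      2 ^ n                                           ≤⟨ 2^≤central n ⟩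
      binomial (n + n) n                              ≤⟨ ℕₚ.m≤n*m (binomial (n + n) n) (suc (n + n)) ⟩
      suc (n + n) * binomial (n + n) n                ≤⟨ Dv.∣⇒≤ {{Data.Nat.>-nonZero D>0}} divides-D ⟩
      (r !) ^ L * θ                                     ≤⟨ ℕₚ.*-mono-≤ (ℕₚ.^-monoˡ-≤ L (!≤^ r ℕₚ.≤-refl)) θ≤ ⟩
      (r ^ r) ^ L * 2 ^ (X + X)                       ≡⟨ cong (λ x → (x ^ r) ^ L * 2 ^ (X + X)) r≡ ⟩
      ((2 ^ (2 + i)) ^ r) ^ L * 2 ^ (X + X)           ≡⟨ cong (_* 2 ^ (X + X)) (trans (cong (_^ L) (ℕₚ.^-*-assoc 2 (2 + i) r)) (ℕₚ.^-*-assoc 2 ((2 + i) * r) L)) ⟩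
      2 ^ ((2 + i) * r * L) * 2 ^ (X + X)             ≡⟨ sym (ℕₚ.^-distribˡ-+-* 2 ((2 + i) * r * L) (X + X)) ⟩
      2 ^ ((2 + i) * r * L + (X + X))                 ∎
      where open ℕₚ.≤-Reasoning
    exponents : 2 * (Y * Y) + (X + X) ≤ 2 * (4 * ((2 + i) * (2 + i)) * Y) + (X + X)
    exponents = subst₂ _≤_ (arith₁ Y) (arith₂ i Y) compare
      where
      compare : n ≤ (2 + i) * r * L + (X + X)
      compare with n ℕₚ.≤? (2 + i) * r * L + (X + X)
      ... | yes le = le
      ... | no ¬le = contradiction powers (ℕₚ.<⇒≱ (ℕₚ.^-monoʳ-< 2 (s≤s (s≤s z≤n)) (ℕₚ.≰⇒> ¬le)))
      arith₁ : ∀ Y → 4 * (Y * Y) ≡ 2 * (Y * Y) + (Y * Y + Y * Y)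
      arith₁ = solve-∀
      arith₂ : ∀ i Y → (2 + i) * (4 * Y) * (4 + (i + i)) + (Y * Y + Y * Y) ≡ 2 * (4 * ((2 + i) * (2 + i)) * Y) + (Y * Y + Y * Y)
      arith₂ = solve-∀
  go : Dec (∃ λ p → p < suc N × Prime p × X < p) → ∃ λ p → Prime p × X < p × p ≤ 9 * X
  go (yes (p , p≤ , pr , lt)) = p , pr , lt , ℕₚ.≤-trans (ℕₚ.≤-pred p≤) N≤9X
  go (no none) = ⊥-elim (none⇒⊥ λ p pr p≤N → ℕₚ.≮⇒≥ λ lt → none (p , s≤s p≤N , pr , lt))

-- Lower bounds from blow-ups of cycles

%-cancelʳ : ∀ {s} .{{_ : NonZero s}} x y z → (x + z) % s ≡ (y + z) % s → x % s ≡ y % s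
%-cancelʳ {s} x y z h = trans (sym (undo x)) (trans (+-%-cong (x + z) (y + z) e h) (undo y))
  where
  e : ℕ
  e = s * z ∸ z
  z+e : z + e ≡ z * s
  z+e = trans (ℕₚ.m+[n∸m]≡n (ℕₚ.m≤n*m z s)) (ℕₚ.*-comm s z)
  undo : ∀ x → (x + z + e) % s ≡ x % s
  undo x = trans (cong (_% s) (trans (ℕₚ.+-assoc x z e) (cong (x +_) z+e))) (DM.[m+kn]%n≡m%n x z s)

suc-%-injective : ∀ {s} .{{_ : NonZero s}} {x y} → x < s → y < s → suc x % s ≡ suc y % s → x ≡ y
suc-%-injective {s} {x} {y} x< y< h = trans (sym (DM.m<n⇒m%n≡m x<)) (trans (%-cancelʳ x y 1
  (trans (cong (_% s) (ℕₚ.+-comm x 1)) (trans h (cong (_% s) (ℕₚ.+-comm 1 y))))) (DM.m<n⇒m%n≡m y<))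

-- Graphs that map to the cycle of length s: the vertex u is in part u % s and has index u / s
-- there; E i a b says that index a in part i is adjacent to index b in the next part.
module CyclicGraph (s₀ n : ℕ) (3≤s : 3 ≤ suc s₀) (E : ℕ → ℕ → ℕ → Set) where

  s : ℕ
  s = suc s₀

  part idx : Fin n → ℕ
  part u = toℕ u % s
  idx u = toℕ u / s

  part< : ∀ u → part u < s
  part< u = DM.m%n<n (toℕ u) s

  record Up (u v : Fin n) : Set where
    constructor up
    field
      part≡ : suc (part u) % s ≡ part v
      edge : E (part u) (idx u) (idx v)
  open Up public

  G : Graph n
  G = record
    { Adj = λ u v → Up u v ⊎ Up v u
    ; sym = λ { (inj₁ h) → inj₂ h ; (inj₂ h) → inj₁ h }
    ; irref = λ {u} → λ { (inj₁ h) → loop u (part≡ h) ; (inj₂ h) → loop u (part≡ h) } }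
    where
    loop : ∀ u → suc (part u) % s ≡ part u → ⊥
    loop u h = contradiction (%-+-injective {s} 1 (part u) (ℕₚ.≤-trans (s≤s (s≤s z≤n)) 3≤s) (trans h (sym (DM.m<n⇒m%n≡m (part< u))))) λ ()

  vertex≡ : ∀ {u v} → part u ≡ part v → idx u ≡ idx v → u ≡ v
  vertex≡ {u} {v} p i = Fₚ.toℕ-injective (trans (DM.m≡m%n+[m/n]*n (toℕ u) s)
    (trans (cong₂ (λ a b → a + b * s) p i) (sym (DM.m≡m%n+[m/n]*n (toℕ v) s))))

  ≢suc² : ∀ {i} → i < s → suc (suc i % s) % s ≢ i
  ≢suc² {i} i< h = contradiction (%-+-injective {s} 2 i 3≤s (trans (sym (suc-suc i)) (trans h (sym (DM.m<n⇒m%n≡m i<))))) λ ()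
    where
    suc-suc : ∀ i → suc (suc i % s) % s ≡ (2 + i) % s
    suc-suc i = trans (cong (_% s) (ℕₚ.+-comm 1 (suc i % s))) (trans (+-%-cong (suc i % s) (suc i) 1 (DM.m%n%n≡m%n (suc i) s))
      (cong (_% s) (ℕₚ.+-comm (suc i) 1)))

  module Copies (q : ℕ) (qs≤n : q * s ≤ n) where

    position< : ∀ {i a} → i < s → a < q → i + a * s < n
    position< {i} {a} i< a< = ℕₚ.<-≤-trans (ℕₚ.+-monoˡ-< (a * s) i<) (ℕₚ.≤-trans (ℕₚ.*-monoˡ-≤ s a<) qs≤n)

    vertex : ∀ {i a} → i < s → a < q → Fin n
    vertex i< a< = fromℕ< (position< i< a<)

    part-vertex : ∀ {i a} (i< : i < s) (a< : a < q) → part (vertex i< a<) ≡ i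
    part-vertex {i} {a} i< a< = trans (cong (_% s) (Fₚ.toℕ-fromℕ< (position< i< a<))) (trans (DM.[m+kn]%n≡m%n i a s) (DM.m<n⇒m%n≡m i<))

    idx-vertex : ∀ {i a} (i< : i < s) (a< : a < q) → idx (vertex i< a<) ≡ a
    idx-vertex {i} {a} i< a< = trans (cong (_/ s) (Fₚ.toℕ-fromℕ< (position< i< a<)))
      (trans (DM.+-distrib-/-∣ʳ i (divides a refl)) (cong₂ _+_ (DM.m<n⇒m/n≡0 i<) (DM.m*n/n≡m a s)))

    module _ (f : ℕ → ℕ) (f< : ∀ i → f i < q) (edges : ∀ i → i < s → E i (f i) (f (suc i % s))) where

      copy : CycleIn G s
      copy = record { vtx = vtx′ ; inj = inj′ ; adj = adj′ }
        where
        vtx′ : Fin s → Fin n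
        vtx′ k = vertex (Fₚ.toℕ<n k) (f< (toℕ k))
        part′ : ∀ k → part (vtx′ k) ≡ toℕ k
        part′ k = part-vertex (Fₚ.toℕ<n k) (f< (toℕ k))
        idx′ : ∀ k → idx (vtx′ k) ≡ f (toℕ k)
        idx′ k = idx-vertex (Fₚ.toℕ<n k) (f< (toℕ k))
        inj′ : ∀ {k l} → vtx′ k ≡ vtx′ l → k ≡ l
        inj′ {k} {l} h = Fₚ.toℕ-injective (trans (sym (part′ k)) (trans (cong part h) (part′ l)))
        adj′ : ∀ k → Adj G (vtx′ k) (vtx′ (next k))
        adj′ k = inj₁ (up (trans (cong (λ i → suc i % s) (part′ k)) (trans (sym (toℕ-next k)) (sym (part′ (next k)))))
          (subst₂ (λ i j → E i j (idx (vtx′ (next k)))) (sym (part′ k)) (sym (idx′ k))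
            (subst (E (toℕ k) (f (toℕ k))) (sym (trans (idx′ (next k)) (cong f (toℕ-next k)))) (edges (toℕ k) (Fₚ.toℕ<n k)))))

      part-copy : ∀ k → part (vtx copy k) ≡ toℕ k
      part-copy k = part-vertex (Fₚ.toℕ<n k) (f< (toℕ k))

      idx-copy : ∀ k → idx (vtx copy k) ≡ f (toℕ k)
      idx-copy k = idx-vertex (Fₚ.toℕ<n k) (f< (toℕ k))

    sameCopy⇒≡ : ∀ {f f< ef g g< eg} → SameCopy (copy f f< ef) (copy g g< eg) → ∀ i → i < s → f i ≡ g i
    sameCopy⇒≡ {f} {f<} {ef} {g} {g<} {eg} h i i< = go (Equivalence.to (h (vtx C k) (vtx C (next k))) (k , inj₁ (refl , refl)))
      where
      C D : CycleIn G s
      C = copy f f< ef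
      D = copy g g< eg
      k : Fin s
      k = fromℕ< i<
      toℕk : toℕ k ≡ i
      toℕk = Fₚ.toℕ-fromℕ< i<
      meet : ∀ l → vtx D l ≡ vtx C k → f i ≡ g i
      meet l e = trans (cong f (sym toℕk)) (trans (sym (idx-copy f f< ef k)) (trans (cong idx (sym e)) (trans (idx-copy g g< eg l)
        (cong g (trans (sym (part-copy g g< eg l)) (trans (cong part e) (trans (part-copy f f< ef k) toℕk)))))))
      go : EdgeOf D (vtx C k) (vtx C (next k)) → f i ≡ g i
      go (l , inj₁ (e , _)) = meet l e
      go (l , inj₂ (_ , e)) = meet (next l) e

    distinct-copies : ∀ m (F : Fin m → ℕ → ℕ) → (F< : ∀ k i → F k i < q) → (∀ k i → i < s → E i (F k i) (F k (suc i % s))) →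
      (∀ k l → (∀ i → i < s → F k i ≡ F l i) → k ≡ l) → DistinctCopies G s m
    distinct-copies m F F< edges injective = (λ k → copy (F k) (F< k) (edges k)) ,
      λ k l ne same → ne (injective k l (sameCopy⇒≡ {F k} {F< k} {edges k} {F l} {F< l} {edges l} same))

  -- Edges between the parts i and i + 1 with Sp i get the colour 0.
  module Colouring (Sp : ℕ → Set) (Sp? : ∀ i → Dec (Sp i)) (matching : ∀ {i a b} → Sp i → E i a b → a ≡ b)
    (apart : ∀ {i} → Sp i → ¬ Sp (suc i % s)) where

    Special : Fin n → Fin n → Set
    Special u v = (suc (part u) % s ≡ part v × Sp (part u)) ⊎ (suc (part v) % s ≡ part u × Sp (part v))

    special? : ∀ u v → Dec (Special u v)
    special? u v = (suc (part u) % s ℕₚ.≟ part v ×-dec Sp? (part u)) ⊎-dec (suc (part v) % s ℕₚ.≟ part u ×-dec Sp? (part v))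

    swap : ∀ u v → Special u v → Special v u
    swap u v (inj₁ h) = inj₂ h
    swap u v (inj₂ h) = inj₁ h

    -- The sum of the end points is a proper colouring of the complete graph; the successor keeps 0
    -- for the special edges.
    colour : ∀ u v → Dec (Special u v) → ℕ
    colour u v (yes _) = 0
    colour u v (no _) = suc (toℕ u + toℕ v)

    colour-special : ∀ {u v} → Special u v → colour u v (special? u v) ≡ 0
    colour-special {u} {v} h = go (special? u v)
      where
      go : (d : Dec (Special u v)) → colour u v d ≡ 0
      go (yes _) = refl
      go (no ¬h) = contradiction h ¬h

    same-index : ∀ {u v} → Adj G u v → Special u v → idx u ≡ idx v
    same-index (inj₁ h) (inj₁ (_ , sp)) = matching sp (edge h)
    same-index (inj₂ h) (inj₂ (_ , sp)) = sym (matching sp (edge h))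
    same-index {u} {v} (inj₁ h) (inj₂ (p , _)) = contradiction (trans (cong (λ i → suc i % s) (part≡ h)) p) (≢suc² (part< u))
    same-index {u} {v} (inj₂ h) (inj₁ (p , _)) = contradiction (trans (cong (λ i → suc i % s) (part≡ h)) p) (≢suc² (part< v))

    special-unique : ∀ {u v w} → Adj G u v → Adj G u w → Special u v → Special u w → v ≡ w
    special-unique {u} {v} {w} e f h g = vertex≡ (same-part h g) (trans (sym (same-index e h)) (same-index f g))
      where
      same-part : Special u v → Special u w → part v ≡ part w
      same-part (inj₁ (p , _)) (inj₁ (p′ , _)) = trans (sym p) p′
      same-part (inj₂ (p , _)) (inj₂ (p′ , _)) = suc-%-injective {s} (part< v) (part< w) (trans p (sym p′))
      same-part (inj₁ (_ , sp)) (inj₂ (p′ , sp′)) = contradiction (subst Sp (sym p′) sp) (apart sp′)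
      same-part (inj₂ (p , sp)) (inj₁ (_ , sp′)) = contradiction (subst Sp (sym p) sp′) (apart sp)

    symmetric : ∀ u v (d : Dec (Special u v)) (d′ : Dec (Special v u)) → colour u v d ≡ colour v u d′
    symmetric u v (yes _) (yes _) = refl
    symmetric u v (no _) (no _) = cong suc (ℕₚ.+-comm (toℕ u) (toℕ v))
    symmetric u v (yes h) (no ¬h) = contradiction (swap u v h) ¬h
    symmetric u v (no ¬h) (yes h) = contradiction (swap v u h) ¬h

    distinct : ∀ u v w → Adj G u v → Adj G u w → v ≢ w → (d : Dec (Special u v)) (d′ : Dec (Special u w)) → colour u v d ≢ colour u w d′
    distinct u v w e f ne (yes h) (yes h′) _ = ne (special-unique e f h h′)
    distinct u v w e f ne (no _) (no _) eq = ne (Fₚ.toℕ-injective (ℕₚ.+-cancelˡ-≡ (toℕ u) _ _ (ℕₚ.suc-injective eq)))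
    distinct u v w e f ne (yes _) (no _) ()
    distinct u v w e f ne (no _) (yes _) ()

    colouring : ProperColouring G
    colouring = record
      { col = λ u v → colour u v (special? u v)
      ; colSym = λ {u} {v} _ → symmetric u v (special? u v) (special? v u)
      ; proper = λ {u} {v} {w} e f ne → distinct u v w e f ne (special? u v) (special? u w) }

  Joins : ℕ → Fin n → Fin n → Set
  Joins e u v = (part u ≡ e × part v ≡ suc e % s) ⊎ (part v ≡ e × part u ≡ suc e % s)

  joins? : ∀ e u v → Dec (Joins e u v)
  joins? e u v = (part u ℕₚ.≟ e ×-dec part v ℕₚ.≟ suc e % s) ⊎-dec (part v ℕₚ.≟ e ×-dec part u ℕₚ.≟ suc e % s)

  joins-unique : ∀ {e e′ u v} → e < s → e′ < s → Joins e u v → Joins e′ u v → e ≡ e′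
  joins-unique e< e′< (inj₁ (p , _)) (inj₁ (p′ , _)) = trans (sym p) p′
  joins-unique e< e′< (inj₂ (p , _)) (inj₂ (p′ , _)) = trans (sym p) p′
  joins-unique {e} {e′} e< e′< (inj₁ (p , q)) (inj₂ (p′ , q′)) = contradiction
    (trans (cong (λ i → suc i % s) (trans (sym q) p′)) (trans (sym q′) p)) (≢suc² e<)
  joins-unique {e} {e′} e< e′< (inj₂ (p , q)) (inj₁ (p′ , q′)) = contradiction
    (trans (cong (λ i → suc i % s) (trans (sym q) p′)) (trans (sym q′) p)) (≢suc² e<)

odd? : ℕ → Bool
odd? zero = false
odd? (suc n) = not (odd? n)

odd?-2* : ∀ k → odd? (k * 2) ≡ false
odd?-2* zero = refl
odd?-2* (suc k) = trans (not-involutive _) (odd?-2* k)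

even-or-odd : ∀ n → (∃ λ k → n ≡ k + k) ⊎ (∃ λ k → n ≡ suc (k + k))
even-or-odd zero = inj₁ (0 , refl)
even-or-odd (suc n) with even-or-odd n
... | inj₁ (k , refl) = inj₂ (k , refl)
... | inj₂ (k , refl) = inj₁ (suc k , cong suc (sym (ℕₚ.+-suc k k)))

k+k≡k*2 : ∀ k → k + k ≡ k * 2
k+k≡k*2 = solve-∀

odd-form : ∀ {n} → Odd n → ∃ λ k → n ≡ suc (k + k)
odd-form {n} h with even-or-odd n
... | inj₁ (k , eq) = contradiction (divides k (trans eq (k+k≡k*2 k))) h
... | inj₂ p = p

even-form : ∀ {n} → Even n → ∃ λ k → n ≡ k + k
even-form (divides k eq) = k , trans eq (sym (k+k≡k*2 k))

odd?-odd : ∀ {n} → Odd n → odd? n ≡ true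
odd?-odd {n} h = go (odd-form h)
  where
  go : (∃ λ k → n ≡ suc (k + k)) → odd? n ≡ true
  go (k , eq) = trans (cong odd? eq) (cong not (trans (cong odd? (k+k≡k*2 k)) (odd?-2* k)))

no-alternation : ∀ {n t} {G : Graph n} (C : CycleIn G t) → Odd t → (φ : Fin n → Bool) → (∀ k → φ (vtx C (next k)) ≡ not (φ (vtx C k))) → ⊥
no-alternation {t = zero} C h φ alt = h (divides 0 refl)
no-alternation {t = suc t} C h φ alt = clash (φ (seq C 0)) (trans (sym (cong φ (seq-period C 0)))
    (trans (walk (suc t + 0)) (cong (λ b → b xor φ (seq C 0)) (trans (cong odd? (ℕₚ.+-identityʳ (suc t))) (odd?-odd h)))))
  where
  walk : ∀ i → φ (seq C i) ≡ odd? i xor φ (seq C 0)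
  walk zero = refl
  walk (suc i) = trans (cong φ (sym (seq-next C i))) (trans (alt _) (trans (cong not (walk i)) (not-xor (odd? i) _)))
    where
    not-xor : ∀ a b → not (a xor b) ≡ not a xor b
    not-xor true b = not-involutive b
    not-xor false b = refl
  clash : ∀ b → b ≡ true xor b → ⊥
  clash true ()
  clash false ()

module ClosedWalks (s₀ n : ℕ) (3≤s : 3 ≤ suc s₀) (E : ℕ → ℕ → ℕ → Set) where
  open CyclicGraph s₀ n 3≤s E

  next-part : ∀ {i} → i < s → (suc i < s × suc i % s ≡ suc i) ⊎ (suc i ≡ s × suc i % s ≡ 0)
  next-part {i} i< with suc i ℕₚ.≟ s
  ... | yes refl = inj₂ (refl , DM.n%n≡0 s)
  ... | no ne = let lt = ℕₚ.≤∧≢⇒< i< ne in inj₁ (lt , DM.m<n⇒m%n≡m lt)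

  no-odd-cycle : Even s → ∀ {t} → Odd t → CycleIn G t → ⊥
  no-odd-cycle even odd C = no-alternation C odd φ λ k → alt (adj C k)
    where
    φ : Fin n → Bool
    φ u = odd? (part u)
    flip-up : ∀ {u v} → Up u v → φ v ≡ not (φ u)
    flip-up {u} {v} h = go (next-part (part< u))
      where
      go : (suc (part u) < s × suc (part u) % s ≡ suc (part u)) ⊎ (suc (part u) ≡ s × suc (part u) % s ≡ 0) → φ v ≡ not (φ u)
      go (inj₁ (_ , eq)) = cong odd? (trans (sym (part≡ h)) eq)
      go (inj₂ (last , eq)) = trans (cong odd? (trans (sym (part≡ h)) eq)) (sym (trans (cong odd? last) s-even))
        where
        s-even : odd? s ≡ false
        s-even = let k , eq = even-form even in trans (cong odd? (trans eq (k+k≡k*2 k))) (odd?-2* k)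
    alt : ∀ {u v} → Adj G u v → φ v ≡ not (φ u)
    alt (inj₁ h) = flip-up h
    alt {u} {v} (inj₂ h) = trans (sym (not-involutive (φ v))) (cong not (sym (flip-up h)))

  -- Otherwise the walk would live on the bipartite graph obtained by cutting the cycle at e.
  odd-cycle-joins : Odd s → ∀ {t} → Odd t → (C : CycleIn G t) → ∀ e → e < s → ∃ λ k → Joins e (vtx C k) (vtx C (next k))
  odd-cycle-joins odd-s {t} odd C e e< with Fₚ.any? (λ k → joins? e (vtx C k) (vtx C (next k)))
  ... | yes p = p
  ... | no none = ⊥-elim (no-alternation C odd φ λ k → alt (adj C k) (λ h → none (k , h)))
    where
    -- Labels after e are shifted by one, so that parity fails to change only across e. The last
    -- part then has the odd label s, and the step from it to part 0 changes parity too.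
    label : ∀ i → Dec (i ≤ e) → ℕ
    label i (yes _) = i
    label i (no _) = suc i
    φ : Fin n → Bool
    φ u = odd? (label (part u) (part u ℕₚ.≤? e))
    label-≤ : ∀ {i} → i ≤ e → (d : Dec (i ≤ e)) → label i d ≡ i
    label-≤ h (yes _) = refl
    label-≤ h (no ¬h) = contradiction h ¬h
    label-> : ∀ {i} → e < i → (d : Dec (i ≤ e)) → label i d ≡ suc i
    label-> h (yes h′) = contradiction h′ (ℕₚ.<⇒≱ h)
    label-> h (no _) = refl
    flip-up : ∀ {u v} → Up u v → part u ≢ e → φ v ≡ not (φ u)
    flip-up {u} {v} h ne = go (next-part (part< u)) (ℕₚ.<-cmp (part u) e)
      where
      go : (suc (part u) < s × suc (part u) % s ≡ suc (part u)) ⊎ (suc (part u) ≡ s × suc (part u) % s ≡ 0) → _ → φ v ≡ not (φ u)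
      go _ (tri≈ _ eq _) = contradiction eq ne
      go (inj₁ (_ , eq)) (tri< lt _ _) = trans (cong odd? (trans (label-≤ (subst (_≤ e) (trans (sym eq) (part≡ h)) lt) (part v ℕₚ.≤? e)) (trans (sym (part≡ h)) eq)))
        (cong (not ∘ odd?) (sym (label-≤ (ℕₚ.<⇒≤ lt) (part u ℕₚ.≤? e))))
      go (inj₁ (_ , eq)) (tri> _ _ gt) = trans (cong odd? (trans (label-> (subst (e <_) (trans (sym eq) (part≡ h)) (ℕₚ.m<n⇒m<1+n gt)) (part v ℕₚ.≤? e)) (cong suc (trans (sym (part≡ h)) eq))))
        (cong (not ∘ odd?) (sym (label-> gt (part u ℕₚ.≤? e))))
      go (inj₂ (last , eq)) (tri< lt _ _) = contradiction (ℕₚ.≤-trans (s≤s lt) e<) (ℕₚ.<⇒≱ (s≤s (ℕₚ.≤-reflexive (sym last))))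
      go (inj₂ (last , eq)) (tri> _ _ gt) = trans (cong odd? (trans (label-≤ (subst (_≤ e) (sym part0) z≤n) (part v ℕₚ.≤? e)) part0))
        (trans (cong not (sym (odd?-odd odd-s))) (cong (not ∘ odd?) (sym (trans (label-> gt (part u ℕₚ.≤? e)) last))))
        where
        part0 : part v ≡ 0
        part0 = trans (sym (part≡ h)) eq
    alt : ∀ {u v} → Adj G u v → ¬ Joins e u v → φ v ≡ not (φ u)
    alt (inj₁ h) none = flip-up h λ eq → none (inj₁ (eq , trans (sym (part≡ h)) (cong (λ i → suc i % s) eq)))
    alt {u} {v} (inj₂ h) none = trans (sym (not-involutive (φ v)))
      (cong not (sym (flip-up h λ eq → none (inj₂ (eq , trans (sym (part≡ h)) (cong (λ i → suc i % s) eq))))))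

  all-joined⇒s≤t : ∀ {t} (C : CycleIn G t) → (∀ e → e < s → ∃ λ k → Joins e (vtx C k) (vtx C (next k))) → s ≤ t
  all-joined⇒s≤t {t} C h = Fₚ.injective⇒≤ {f = f} f-injective
    where
    f : Fin s → Fin t
    f e = proj₁ (h (toℕ e) (Fₚ.toℕ<n e))
    f-injective : ∀ {e e′} → f e ≡ f e′ → e ≡ e′
    f-injective {e} {e′} eq = Fₚ.toℕ-injective (joins-unique {u = vtx C (f e)} {vtx C (next (f e))} (Fₚ.toℕ<n e) (Fₚ.toℕ<n e′)
      (proj₂ (h (toℕ e) (Fₚ.toℕ<n e))) (subst (λ k → Joins (toℕ e′) (vtx C k) (vtx C (next k))) (sym eq) (proj₂ (h (toℕ e′) (Fₚ.toℕ<n e′)))))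

-- Blow-ups of the cycle in which the parts with Sing consist of a single vertex.
SinglesEdge : (s : ℕ) → (ℕ → Set) → .{{_ : NonZero s}} → ℕ → ℕ → ℕ → Set
SinglesEdge s Sing i a b = (Sing i → a ≡ 0) × (Sing (suc i % s) → b ≡ 0)

module Singles (s₀ n : ℕ) (3≤s : 3 ≤ suc s₀) (Sing : ℕ → Set)
  (cover : ∀ i → i < suc s₀ → Sing i ⊎ Sing (suc i % suc s₀)) where

  open CyclicGraph s₀ n 3≤s (SinglesEdge (suc s₀) Sing)

  index-zero : ∀ {u v} → Adj G u v → Sing (part u) → idx u ≡ 0
  index-zero (inj₁ h) sg = proj₁ (edge h) sg
  index-zero (inj₂ h) sg = proj₂ (edge h) (subst Sing (sym (part≡ h)) sg)

  single-unique : ∀ {u u′ v v′} → Adj G u v → Adj G u′ v′ → part u ≡ part u′ → Sing (part u) → u ≡ u′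
  single-unique e e′ p sg = vertex≡ p (trans (index-zero e sg) (sym (index-zero e′ (subst Sing p sg))))

  module _ {a₀ a₁ a₂ a₃ a₄ : Fin n} (e₀ : Adj G a₀ a₁) (e₁ : Adj G a₁ a₂) (e₂ : Adj G a₂ a₃) (e₃ : Adj G a₃ a₄)
    (ne₀₂ : a₀ ≢ a₂) (ne₁₃ : a₁ ≢ a₃) (ne₂₄ : a₂ ≢ a₄) (ne₀₄ : a₀ ≢ a₄) where

    -- At a turn a₁ and a₃ share a part that is not single, so the part of a₂ is single. Then
    -- neither a₀ nor a₄ can lie there, both lie one part below a₁, and that part or the part of a₁
    -- is single: a₀ = a₄ or a₁ = a₃. In a 4-cycle a₀ = a₄ would be harmless.
    no-turn-down : Up a₁ a₂ → Up a₃ a₂ → ⊥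
    no-turn-down h h′ = go (cover (part a₁) (part< a₁))
      where
      p₁₃ : part a₁ ≡ part a₃
      p₁₃ = suc-%-injective {s} (part< a₁) (part< a₃) (trans (part≡ h) (sym (part≡ h′)))
      go : Sing (part a₁) ⊎ Sing (suc (part a₁) % s) → ⊥
      go (inj₁ sg) = ne₁₃ (single-unique e₁ (adjSym G e₂) p₁₃ sg)
      go (inj₂ sg) = outer e₀ e₃
        where
        sg₂ : Sing (part a₂)
        sg₂ = subst Sing (part≡ h) sg
        outer : Adj G a₀ a₁ → Adj G a₃ a₄ → ⊥
        outer (inj₂ u) _ = ne₀₂ (sym (single-unique e₂ e₀ (trans (sym (part≡ h)) (part≡ u)) sg₂))
        outer (inj₁ _) (inj₁ u) = ne₂₄ (single-unique e₂ (adjSym G e₃) (trans (sym (part≡ h′)) (part≡ u)) sg₂)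
        outer (inj₁ u) (inj₂ u′) = go′ (cover (part a₀) (part< a₀))
          where
          go′ : Sing (part a₀) ⊎ Sing (suc (part a₀) % s) → ⊥
          go′ (inj₁ sg₀) = ne₀₄ (single-unique e₀ (adjSym G e₃)
            (suc-%-injective {s} (part< a₀) (part< a₄) (trans (part≡ u) (trans p₁₃ (sym (part≡ u′))))) sg₀)
          go′ (inj₂ sg₁) = ne₁₃ (single-unique e₁ (adjSym G e₂) p₁₃ (subst Sing (part≡ u) sg₁))

    no-turn-up : Up a₂ a₁ → Up a₂ a₃ → ⊥
    no-turn-up h h′ = go (cover (part a₂) (part< a₂))
      where
      p₁₃ : part a₁ ≡ part a₃
      p₁₃ = trans (sym (part≡ h)) (part≡ h′)
      go : Sing (part a₂) ⊎ Sing (suc (part a₂) % s) → ⊥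
      go (inj₂ sg) = ne₁₃ (single-unique e₁ (adjSym G e₂) p₁₃ (subst Sing (part≡ h) sg))
      go (inj₁ sg₂) = outer e₀ e₃
        where
        outer : Adj G a₀ a₁ → Adj G a₃ a₄ → ⊥
        outer (inj₁ u) _ = ne₀₂ (sym (single-unique e₂ e₀ (suc-%-injective {s} (part< a₂) (part< a₀) (trans (part≡ h) (sym (part≡ u)))) sg₂))
        outer (inj₂ _) (inj₂ u) = ne₂₄ (single-unique e₂ (adjSym G e₃) (suc-%-injective {s} (part< a₂) (part< a₄) (trans (part≡ h′) (sym (part≡ u)))) sg₂)
        outer (inj₂ u) (inj₁ u′) = go′ (cover (part a₁) (part< a₁))
          where
          go′ : Sing (part a₁) ⊎ Sing (suc (part a₁) % s) → ⊥
          go′ (inj₁ sg₁) = ne₁₃ (single-unique e₁ (adjSym G e₂) p₁₃ sg₁)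
          go′ (inj₂ sg) = ne₀₄ (single-unique e₀ (adjSym G e₃)
            (trans (sym (part≡ u)) (trans (cong (λ i → suc i % s) p₁₃) (part≡ u′))) (subst Sing (part≡ u) sg))

  -- A cycle of length at least 5 never turns back, so it winds around exactly once.
  module Winding {t₀ : ℕ} (5≤t : 5 ≤ suc t₀) (C : CycleIn G (suc t₀)) where
    t : ℕ
    t = suc t₀
    y : ℕ → Fin n
    y = seq C
    P : ℕ → ℕ
    P j = part (y (1 + j))

    ne : ∀ d {i} → 0 < d → d < 5 → y i ≢ y (d + i)
    ne d 0<d d< h = seq-≢ C d 0<d (ℕₚ.<-≤-trans d< 5≤t) (sym h)

    ne₂ : ∀ i → y i ≢ y (2 + i)
    ne₂ i = ne 2 (s≤s z≤n) (s≤s (s≤s (s≤s z≤n)))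

    ne₄ : ∀ i → y i ≢ y (4 + i)
    ne₄ i = ne 4 (s≤s z≤n) (s≤s (s≤s (s≤s (s≤s (s≤s z≤n)))))

    AllUp AllDown : Set
    AllUp = ∀ j → Up (y (1 + j)) (y (2 + j))
    AllDown = ∀ j → Up (y (2 + j)) (y (1 + j))

    direction : AllUp ⊎ AllDown
    direction = go (seq-adj C 1)
      where
      go : Adj G (y 1) (y 2) → AllUp ⊎ AllDown
      go (inj₁ h) = inj₁ ups
        where
        ups : AllUp
        ups zero = h
        ups (suc j) = next-up (seq-adj C (2 + j))
          where
          next-up : Adj G (y (2 + j)) (y (3 + j)) → Up (y (2 + j)) (y (3 + j))
          next-up (inj₁ u) = u
          next-up (inj₂ u) = ⊥-elim (no-turn-down (seq-adj C j) (seq-adj C (1 + j)) (seq-adj C (2 + j)) (seq-adj C (3 + j))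
            (ne₂ j) (ne₂ (1 + j)) (ne₂ (2 + j)) (ne₄ j) (ups j) u)
      go (inj₂ h) = inj₂ downs
        where
        downs : AllDown
        downs zero = h
        downs (suc j) = next-down (seq-adj C (2 + j))
          where
          next-down : Adj G (y (2 + j)) (y (3 + j)) → Up (y (3 + j)) (y (2 + j))
          next-down (inj₂ u) = u
          next-down (inj₁ u) = ⊥-elim (no-turn-up (seq-adj C j) (seq-adj C (1 + j)) (seq-adj C (2 + j)) (seq-adj C (3 + j))
            (ne₂ j) (ne₂ (1 + j)) (ne₂ (2 + j)) (ne₄ j) (downs j) u)

    P<s : ∀ j → P j < s
    P<s j = part< (y (1 + j))

    P-% : ∀ j → P j % s ≡ P j
    P-% j = DM.m<n⇒m%n≡m (P<s j)

    suc-+-% : ∀ x z → (suc x % s + z) % s ≡ (x + suc z) % s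
    suc-+-% x z = trans (+-%-cong (suc x % s) (suc x) z (DM.m%n%n≡m%n (suc x) s)) (cong (_% s) (sym (ℕₚ.+-suc x z)))

    up-formula : AllUp → ∀ j → P j ≡ (P 0 + j) % s
    up-formula h zero = trans (sym (P-% 0)) (cong (_% s) (sym (ℕₚ.+-identityʳ (P 0))))
    up-formula h (suc j) = trans (sym (part≡ (h j))) (trans (cong (λ i → suc i % s) (up-formula h j))
      (trans (cong (_% s) (ℕₚ.+-comm 1 ((P 0 + j) % s))) (trans (+-%-cong ((P 0 + j) % s) (P 0 + j) 1 (DM.m%n%n≡m%n (P 0 + j) s))
        (cong (_% s) (arith (P 0) j)))))
      where
      arith : ∀ a b → a + b + 1 ≡ a + suc b
      arith = solve-∀

    down-formula : AllDown → ∀ j → (P j + j) % s ≡ P 0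
    down-formula h zero = trans (cong (_% s) (ℕₚ.+-identityʳ (P 0))) (P-% 0)
    down-formula h (suc j) = trans (sym (suc-+-% (P (suc j)) j)) (trans (cong (λ i → (i + j) % s) (part≡ (h j))) (down-formula h j))

    P-period : P t ≡ P 0
    P-period = cong part (trans (cong y (ℕₚ.+-comm 1 t)) (seq-period C 1))

    shift-formula : AllUp ⊎ AllDown → ∀ j → P (j + s) ≡ P j
    shift-formula (inj₁ h) j = trans (up-formula h (j + s)) (trans (cong (_% s) (sym (ℕₚ.+-assoc (P 0) j s)))
      (trans (DM.[m+n]%n≡m%n (P 0 + j) s) (sym (up-formula h j))))
    shift-formula (inj₂ h) j = trans (sym (P-% (j + s))) (trans (%-cancelʳ (P (j + s)) (P j) j
      (trans (sym (DM.[m+n]%n≡m%n (P (j + s) + j) s)) (trans (cong (_% s) (ℕₚ.+-assoc (P (j + s)) j s))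
        (trans (down-formula h (j + s)) (sym (down-formula h j)))))) (P-% j))

    s∣t : s ∣ t
    s∣t = Dv.m%n≡0⇒n∣m t s (%-cancelʳ t 0 (P 0) (trans (cong (_% s) (ℕₚ.+-comm t (P 0))) (trans (go direction) (sym (P-% 0)))))
      where
      go : AllUp ⊎ AllDown → (P 0 + t) % s ≡ P 0
      go (inj₁ h) = trans (sym (up-formula h t)) P-period
      go (inj₂ h) = trans (cong (λ p → (p + t) % s) (sym P-period)) (down-formula h t)

    single-visit : ∃ λ j → Sing (P j)
    single-visit = go direction
      where
      up-case : AllUp → Sing (P 0) ⊎ Sing (suc (P 0) % s) → ∃ λ j → Sing (P j)
      up-case h (inj₁ sg) = 0 , sg
      up-case h (inj₂ sg) = 1 , subst Sing (part≡ (h 0)) sg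
      down-case : AllDown → Sing (P 1) ⊎ Sing (suc (P 1) % s) → ∃ λ j → Sing (P j)
      down-case h (inj₁ sg) = 1 , sg
      down-case h (inj₂ sg) = 0 , subst Sing (part≡ (h 0)) sg
      go : AllUp ⊎ AllDown → ∃ λ j → Sing (P j)
      go (inj₁ h) = up-case h (cover (P 0) (P<s 0))
      go (inj₂ h) = down-case h (cover (P 1) (P<s 1))

    -- After s steps the walk is in the same part again. At a single part this means the same
    -- vertex, so s is a multiple of the period t of the cycle.
    t∣s : t ∣ s
    t∣s = go single-visit
      where
      go : (∃ λ j → Sing (P j)) → t ∣ s
      go (j , sg) = Dv.m%n≡0⇒n∣m s t (%-cancelʳ {t} s 0 (suc j) (trans (cong (_% t) (ℕₚ.+-comm s (suc j)))
        (sym (seq-injective C (suc j) (suc j + s) (single-unique (seq-adj C (1 + j)) (seq-adj C (1 + (j + s))) (sym (shift-formula direction j)) sg)))))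

    t≡s : t ≡ s
    t≡s = Dv.∣-antisym t∣s s∣t

    visits : ∀ e → e < s → ∃ λ j → P j ≡ e
    visits e e< = go direction
      where
      go : AllUp ⊎ AllDown → ∃ λ j → P j ≡ e
      go (inj₁ h) = e + (s ∸ P 0) , trans (up-formula h (e + (s ∸ P 0)))
        (trans (cong (_% s) (trans (arith (P 0) e (s ∸ P 0)) (cong (e +_) (ℕₚ.m+[n∸m]≡n (ℕₚ.<⇒≤ (P<s 0))))))
          (trans (DM.[m+n]%n≡m%n e s) (DM.m<n⇒m%n≡m e<)))
        where
        arith : ∀ a b c → a + (b + c) ≡ b + (a + c)
        arith = solve-∀
      go (inj₂ h) = j , trans (sym (P-% j)) (trans (%-cancelʳ (P j) e j (trans (down-formula h j) (sym total))) (DM.m<n⇒m%n≡m e<))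
        where
        j : ℕ
        j = P 0 + (s ∸ e)
        total : (e + j) % s ≡ P 0
        total = trans (cong (_% s) (trans (arith e (P 0) (s ∸ e)) (cong (P 0 +_) (ℕₚ.m+[n∸m]≡n (ℕₚ.<⇒≤ e<)))))
          (trans (DM.[m+n]%n≡m%n (P 0) s) (P-% 0))
          where
          arith : ∀ a b c → a + (b + c) ≡ b + (a + c)
          arith = solve-∀

    all-joined : ∀ e → e < s → ∃ λ k → Joins e (vtx C k) (vtx C (next k))
    all-joined e e< = go direction (visits e e<)
      where
      at : ∀ j → Joins e (y (1 + j)) (y (2 + j)) → ∃ λ k → Joins e (vtx C k) (vtx C (next k))
      at j h = suc j DM.mod t , subst (Joins e (y (1 + j))) (sym (seq-next C (1 + j))) h
      go : AllUp ⊎ AllDown → (∃ λ j → P j ≡ e) → ∃ λ k → Joins e (vtx C k) (vtx C (next k))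
      go (inj₁ h) (j , eq) = at j (inj₁ (eq , trans (sym (part≡ (h j))) (cong (λ i → suc i % s) eq)))
      go (inj₂ h) (j , eq) = at (j + s₀) (inj₂ (eq′ , trans (sym (part≡ (h (j + s₀)))) (cong (λ i → suc i % s) eq′)))
        where
        eq′ : P (suc (j + s₀)) ≡ e
        eq′ = trans (cong P (sym (ℕₚ.+-suc j s₀))) (trans (shift-formula direction j) eq)

-- Counting parametrised copies; the lower bounds from blow-ups

module _ {q r : ℕ} where

  digit : Fin (q ^ r) → ℕ → ℕ
  digit k x with x ℕₚ.<? r
  ... | yes x<r = toℕ (finToFun k (fromℕ< x<r))
  ... | no _ = 0

  digit< : 1 ≤ q → ∀ k x → digit k x < q
  digit< 1≤q k x with x ℕₚ.<? r
  ... | yes x<r = Fₚ.toℕ<n (finToFun k (fromℕ< x<r))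
  ... | no _ = 1≤q

  digit-zero : ∀ k x → r ≤ x → digit k x ≡ 0
  digit-zero k x r≤x with x ℕₚ.<? r
  ... | yes x<r = contradiction r≤x (ℕₚ.<⇒≱ x<r)
  ... | no _ = refl

  digit-Fin : ∀ k (x : Fin r) → digit k (toℕ x) ≡ toℕ (finToFun {q} k x)
  digit-Fin k x with toℕ x ℕₚ.<? r
  ... | yes x<r = cong (λ y → toℕ (finToFun {q} k y)) (Fₚ.fromℕ<-toℕ x x<r)
  ... | no ¬x<r = contradiction (Fₚ.toℕ<n x) ¬x<r

funToFin-cong : ∀ {m n} {f g : Fin m → Fin n} → (∀ i → f i ≡ g i) → funToFin f ≡ funToFin g
funToFin-cong {zero} h = refl
funToFin-cong {suc m} h = cong₂ combine (h zero) (funToFin-cong (h ∘ suc))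

digit-injective : ∀ {q r} (k l : Fin (q ^ r)) → (∀ x → x < r → digit {q} {r} k x ≡ digit {q} {r} l x) → k ≡ l
digit-injective {q} {r} k l h = trans (sym (Fₚ.funToFin-finToFin {r} {q} k)) (trans (funToFin-cong {r} {q} λ x → Fₚ.toℕ-injective
  (trans (sym (digit-Fin {q} {r} k x)) (trans (h (toℕ x) (Fₚ.toℕ<n x)) (digit-Fin {q} {r} l x)))) (Fₚ.funToFin-finToFin {r} {q} l))

Lower : (s t d : ℕ) → Set₁
Lower s t d = ∃[ k ] ∃[ N ] ∀ n → n ≥ N → Σ (Graph n) λ G → Σ (ProperColouring G) λ c →
  ¬ RainbowCycle G c t × (∃[ m ] (DistinctCopies G s m × n ^ d ≤ k * (m * m)))

n≤2s*q : ∀ n s .{{_ : NonZero s}} → s ≤ n → n ≤ 2 * s * (n / s)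
n≤2s*q n s s≤n = begin
  n                             ≡⟨ DM.m≡m%n+[m/n]*n n s ⟩
  n % s + n / s * s             ≤⟨ ℕₚ.+-monoˡ-≤ (n / s * s) (ℕₚ.<⇒≤ (DM.m%n<n n s)) ⟩
  s + n / s * s                 ≤⟨ ℕₚ.+-monoˡ-≤ (n / s * s) (ℕₚ.m≤n*m s (n / s) {{Data.Nat.>-nonZero (DM.m≥n⇒m/n>0 s≤n)}}) ⟩
  n / s * s + n / s * s         ≡⟨ arith s (n / s) ⟩
  2 * s * (n / s)               ∎
  where
  open ℕₚ.≤-Reasoning
  arith : ∀ s q → q * s + q * s ≡ 2 * s * q
  arith = solve-∀

^-distribʳ-* : ∀ a b k → (a * b) ^ k ≡ a ^ k * b ^ k
^-distribʳ-* a b zero = refl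
^-distribʳ-* a b (suc k) = trans (cong (a * b *_) (^-distribʳ-* a b k)) (arith a b (a ^ k) (b ^ k))
  where
  arith : ∀ a b x y → a * b * (x * y) ≡ a * x * (b * y)
  arith = solve-∀

power-bound : ∀ {n a q} r → n ≤ a * q → n ^ (r + r) ≤ a ^ (r + r) * (q ^ r * q ^ r)
power-bound {n} {a} {q} r h = begin
  n ^ (r + r)                       ≤⟨ ℕₚ.^-monoˡ-≤ (r + r) h ⟩
  (a * q) ^ (r + r)                 ≡⟨ ^-distribʳ-* a q (r + r) ⟩
  a ^ (r + r) * q ^ (r + r)         ≡⟨ cong (a ^ (r + r) *_) (ℕₚ.^-distribˡ-+-* q r r) ⟩
  a ^ (r + r) * (q ^ r * q ^ r)     ∎
  where open ℕₚ.≤-Reasoning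

module CyclicLower (s₀ : ℕ) (3≤s : 3 ≤ suc s₀) (E : ℕ → ℕ → ℕ → Set)
  (Sp : ℕ → Set) (Sp? : ∀ i → Dec (Sp i)) (matching : ∀ {i a b} → Sp i → E i a b → a ≡ b)
  (apart : ∀ {i} → Sp i → ¬ Sp (suc i % suc s₀)) where

  private
    s = suc s₀

  module At (n : ℕ) where
    open CyclicGraph s₀ n 3≤s E hiding (s) public
    open Colouring Sp Sp? matching apart public

    joins⇒special : ∀ {e} u v → Sp e → Joins e u v → Special u v
    joins⇒special u v sp (inj₁ (p , q)) = inj₁ (trans (cong (λ i → suc i % s) p) (sym q) , subst Sp (sym p) sp)
    joins⇒special u v sp (inj₂ (p , q)) = inj₂ (trans (cong (λ i → suc i % s) p) (sym q) , subst Sp (sym p) sp)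

    two-special : ∀ {t e e′} → e < s → e′ < s → e ≢ e′ → Sp e → Sp e′ → ((C , _) : RainbowCycle G colouring t) →
      (∀ e → e < s → ∃ λ k → Joins e (vtx C k) (vtx C (next k))) → ⊥
    two-special {e = e} {e′} e< e′< ne sp sp′ (C , rainbow) joined =
      rainbow k k′ (λ eq → ne (joins-unique {u = vtx C k} {vtx C (next k)} e< e′< j
          (subst (λ k → Joins e′ (vtx C k) (vtx C (next k))) (sym eq) j′)))
        (trans (colour-special (joins⇒special (vtx C k) (vtx C (next k)) sp j))
          (sym (colour-special (joins⇒special (vtx C k′) (vtx C (next k′)) sp′ j′))))
      where
      k k′ : Fin _
      k = proj₁ (joined e e<)
      k′ = proj₁ (joined e′ e′<)
      j : Joins e (vtx C k) (vtx C (next k))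
      j = proj₂ (joined e e<)
      j′ : Joins e′ (vtx C k′) (vtx C (next k′))
      j′ = proj₂ (joined e′ e′<)

  -- Copies are parametrised by r free indices; position i uses the index number π i, or the
  -- index 0 if π i ≥ r.
  lower : ∀ t r (π : ℕ → ℕ) → (∀ x → x < r → ∃ λ i → i < s × π i ≡ x) →
    (∀ f → (∀ x → r ≤ x → f x ≡ 0) → ∀ i → i < s → E i (f (π i)) (f (π (suc i % s)))) →
    (∀ n → ¬ RainbowCycle (At.G n) (At.colouring n) t) → Lower s t (r + r)
  lower t r π onto edges nr = (2 * s) ^ (r + r) , s , λ n s≤n →
    At.G n , At.colouring n , nr n , (n / s) ^ r , family n s≤n , power-bound r (n≤2s*q n s s≤n)
    where
    family : ∀ n → s ≤ n → DistinctCopies (At.G n) s ((n / s) ^ r)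
    family n s≤n = Copies.distinct-copies q (DM.m/n*n≤m n s) (q ^ r) (λ k i → digit {q} {r} k (π i))
        (λ k i → digit< {q} {r} (DM.m≥n⇒m/n>0 s≤n) k (π i))
        (λ k i i< → edges (digit {q} {r} k) (digit-zero {q} {r} k) i i<)
        (λ k l h → digit-injective {q} {r} k l λ x x< → recover k l h (onto x x<))
      where
      open At n
      q : ℕ
      q = n / s
      recover : ∀ k l → (∀ i → i < s → digit {q} {r} k (π i) ≡ digit {q} {r} l (π i)) → ∀ {x} → (∃ λ i → i < s × π i ≡ x) →
        digit {q} {r} k x ≡ digit {q} {r} l x
      recover k l h (i , i< , refl) = h i i<

-- t odd, and s > t or s even: the complete blow-up.
blow-up-lower : ∀ s t → 4 ≤ s → Odd t → (s > t ⊎ Even s) → Lower s t (s + s)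
blow-up-lower (suc s₀) t 4≤s odd-t cond = lower t (suc s₀) id (λ x x< → x , x< , refl) (λ _ _ _ _ → tt) nr
  where
  3≤s : 3 ≤ suc s₀
  3≤s = ℕₚ.≤-trans (ℕₚ.n≤1+n 3) 4≤s
  open CyclicLower s₀ 3≤s (λ _ _ _ → ⊤) (λ _ → ⊥) (λ _ → no id) (λ ()) (λ ())
  nr : ∀ n → ¬ RainbowCycle (At.G n) (At.colouring n) t
  nr n (C , _) = go (even-or-odd (suc s₀)) cond
    where
    open ClosedWalks s₀ n 3≤s (λ _ _ _ → ⊤)
    go : (∃ λ k → suc s₀ ≡ k + k) ⊎ (∃ λ k → suc s₀ ≡ suc (k + k)) → suc s₀ > t ⊎ Even (suc s₀) → ⊥
    go (inj₁ (k , eq)) _ = no-odd-cycle (divides k (trans eq (k+k≡k*2 k))) odd-t C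
    go (inj₂ _) (inj₂ even) = no-odd-cycle even odd-t C
    go (inj₂ (k , eq)) (inj₁ t<s) = ℕₚ.<⇒≱ t<s (all-joined⇒s≤t C (odd-cycle-joins odd-s odd-t C))
      where
      odd-s : Odd (suc s₀)
      odd-s even = contradiction (trans (sym (odd?-even even)) (trans (cong odd? eq) (cong not (trans (cong odd? (k+k≡k*2 k)) (odd?-2* k))))) λ ()
        where
        odd?-even : ∀ {n} → Even n → odd? n ≡ false
        odd?-even (divides k refl) = odd?-2* k

-- s ≤ t odd: the blow-up with two equally coloured perfect matchings, both of which every odd
-- cycle uses.
matching-lower : ∀ s₁ t → Odd (5 + s₁) → Odd t → Lower (5 + s₁) t (3 + s₁ + (3 + s₁))
matching-lower s₁ t odd-s odd-t = lower t (3 + s₁) π onto edges nr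
  where
  Sp : ℕ → Set
  Sp i = i ≡ 0 ⊎ i ≡ 2
  Sp? : ∀ i → Dec (Sp i)
  Sp? i = (i ℕₚ.≟ 0) ⊎-dec (i ℕₚ.≟ 2)
  E : ℕ → ℕ → ℕ → Set
  E i a b = Sp i → a ≡ b
  apart : ∀ {i} → Sp i → ¬ Sp (suc i % (5 + s₁))
  apart (inj₁ refl) (inj₁ ())
  apart (inj₁ refl) (inj₂ ())
  apart (inj₂ refl) (inj₁ ())
  apart (inj₂ refl) (inj₂ ())
  open CyclicLower (4 + s₁) (s≤s (s≤s (s≤s z≤n))) E Sp Sp? (λ sp h → h sp) (λ {i} → apart {i})
  -- The matchings force the parts 0, 1 to share an index and likewise the parts 2, 3, which leaves
  -- s - 2 free indices.
  π : ℕ → ℕ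
  π 0 = 0
  π 1 = 0
  π 2 = 1
  π 3 = 1
  π (suc (suc (suc (suc i)))) = 2 + i
  onto : ∀ x → x < 3 + s₁ → ∃ λ i → i < 5 + s₁ × π i ≡ x
  onto 0 _ = 0 , s≤s z≤n , refl
  onto 1 _ = 2 , s≤s (s≤s (s≤s z≤n)) , refl
  onto (suc (suc x)) x< = 4 + x , s≤s (s≤s x<) , refl
  edges : ∀ f → (∀ x → 3 + s₁ ≤ x → f x ≡ 0) → ∀ i → i < 5 + s₁ → E i (f (π i)) (f (π (suc i % (5 + s₁))))
  edges f _ i _ (inj₁ refl) = refl
  edges f _ i _ (inj₂ refl) = refl
  nr : ∀ n → ¬ RainbowCycle (At.G n) (At.colouring n) t
  nr n R@(C , _) = At.two-special n {e = 0} {2} (s≤s z≤n) (s≤s (s≤s (s≤s z≤n))) (λ ()) (inj₁ refl) (inj₂ refl) R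
    (ClosedWalks.odd-cycle-joins (4 + s₁) n (s≤s (s≤s (s≤s z≤n))) E odd-s odd-t C)

half : ℕ → ℕ
half zero = zero
half (suc zero) = zero
half (suc (suc n)) = suc (half n)

half-double : ∀ x → half (x + x) ≡ x
half-double zero = refl
half-double (suc x) = trans (cong (λ k → half (suc k)) (ℕₚ.+-suc x x)) (cong suc (half-double x))

half-suc-double : ∀ x → half (suc (x + x)) ≡ x
half-suc-double zero = refl
half-suc-double (suc x) = trans (cong (λ k → half (suc (suc k))) (ℕₚ.+-suc x x)) (cong suc (half-suc-double x))

odd?-double : ∀ x → odd? (x + x) ≡ false
odd?-double x = trans (cong odd? (k+k≡k*2 x)) (odd?-2* x)

choose : Bool → ℕ → ℕ → ℕ
choose true x y = x
choose false x y = y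

-- Even parts are single vertices; the cycles of the graph have length 4 or s.
alternating-lower : ∀ s₀ t r → 4 ≤ suc s₀ → 5 ≤ t → suc s₀ ≢ t → suc s₀ ≡ r + r ⊎ suc s₀ ≡ suc (r + r) → Lower (suc s₀) t (r + r)
alternating-lower s₀ (suc t₀) r 4≤s 5≤t s≢t form = lower (suc t₀) r π onto edges nr
  where
  s : ℕ
  s = suc s₀
  3≤s : 3 ≤ s
  3≤s = ℕₚ.≤-trans (ℕₚ.n≤1+n 3) 4≤s
  Sing : ℕ → Set
  Sing i = odd? i ≡ false
  cover : ∀ i → i < s → Sing i ⊎ Sing (suc i % s)
  cover i i< with odd? i in eq
  ... | false = inj₁ refl
  ... | true with suc i ℕₚ.≟ s
  ... | yes refl = inj₂ (cong odd? (DM.n%n≡0 s))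
  ... | no ne = inj₂ (trans (cong odd? (DM.m<n⇒m%n≡m (ℕₚ.≤∧≢⇒< i< ne))) (cong not eq))
  E : ℕ → ℕ → ℕ → Set
  E = SinglesEdge s Sing
  open CyclicLower s₀ 3≤s E (λ _ → ⊥) (λ _ → no id) (λ ()) (λ ())
  -- Odd parts are numbered consecutively, and even parts get the number r, which stands for index
  -- 0. For odd s the parts s - 1 and 0 are both single.
  π : ℕ → ℕ
  π i = choose (odd? i) (half i) r
  2r≤s : r + r ≤ s
  2r≤s = go form
    where
    go : s ≡ r + r ⊎ s ≡ suc (r + r) → r + r ≤ s
    go (inj₁ eq) = ℕₚ.≤-reflexive (sym eq)
    go (inj₂ eq) = ℕₚ.≤-trans (ℕₚ.n≤1+n _) (ℕₚ.≤-reflexive (sym eq))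
  onto : ∀ x → x < r → ∃ λ i → i < s × π i ≡ x
  onto x x< = suc (x + x) , ℕₚ.≤-trans (subst (_≤ r + r) (cong suc (ℕₚ.+-suc x x)) (ℕₚ.+-mono-≤ x< x<)) 2r≤s ,
    trans (cong (λ b → choose (not b) (half (suc (x + x))) r) (odd?-double x)) (half-suc-double x)
  edges : ∀ f → (∀ x → r ≤ x → f x ≡ 0) → ∀ i → i < s → E i (f (π i)) (f (π (suc i % s)))
  edges f zeros i _ = zero-at i , zero-at (suc i % s)
    where
    zero-at : ∀ i → Sing i → f (π i) ≡ 0
    zero-at i sg = trans (cong (λ b → f (choose b (half i) r)) sg) (zeros r ℕₚ.≤-refl)
  nr : ∀ n → ¬ RainbowCycle (At.G n) (At.colouring n) (suc t₀)
  nr n (C , _) = s≢t (sym (Singles.Winding.t≡s s₀ n 3≤s Sing cover 5≤t C))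

-- s = t = 6 + 2j: the single parts are 0, 1, 3 and the even ones from 4 on; the edges joining
-- the parts 0, 1 and the parts 3, 4 get the same colour.
self-lower : ∀ j → Lower (6 + (j + j)) (6 + (j + j)) (2 + j + (2 + j))
self-lower j = lower s (2 + j) π onto edges nr
  where
  s₀ s : ℕ
  s₀ = 5 + (j + j)
  s = suc s₀
  Sing : ℕ → Set
  Sing 2 = ⊥
  Sing (suc (suc (suc (suc (suc i))))) = odd? i ≡ true
  Sing _ = ⊤
  cover : ∀ i → i < s → Sing i ⊎ Sing (suc i % s)
  cover 0 _ = inj₁ tt
  cover 1 _ = inj₁ tt
  cover 2 _ = inj₂ tt
  cover 3 _ = inj₁ tt
  cover 4 _ = inj₁ tt
  cover (suc (suc (suc (suc (suc i))))) i< with odd? i in eq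
  ... | true = inj₁ refl
  ... | false with suc (5 + i) ℕₚ.≟ s
  ... | yes last = inj₂ (subst Sing (sym (trans (cong (_% s) last) (DM.n%n≡0 s))) tt)
  ... | no ne = inj₂ (subst Sing (sym (DM.m<n⇒m%n≡m (ℕₚ.≤∧≢⇒< i< ne))) (cong not eq))
  E : ℕ → ℕ → ℕ → Set
  E = SinglesEdge s Sing
  Sp : ℕ → Set
  Sp i = i ≡ 0 ⊎ i ≡ 3
  Sp? : ∀ i → Dec (Sp i)
  Sp? i = (i ℕₚ.≟ 0) ⊎-dec (i ℕₚ.≟ 3)
  matching : ∀ {i a b} → Sp i → E i a b → a ≡ b
  matching (inj₁ refl) (h , h′) = trans (h tt) (sym (h′ tt))
  matching (inj₂ refl) (h , h′) = trans (h tt) (sym (h′ tt))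
  apart : ∀ {i} → Sp i → ¬ Sp (suc i % s)
  apart (inj₁ refl) (inj₁ ())
  apart (inj₁ refl) (inj₂ ())
  apart (inj₂ refl) (inj₁ ())
  apart (inj₂ refl) (inj₂ ())
  3≤s : 3 ≤ s
  3≤s = s≤s (s≤s (s≤s z≤n))
  open CyclicLower s₀ 3≤s E Sp Sp? (λ {i} → matching {i}) (λ {i} → apart {i})
  -- The parts 2, 5, 7, ... that are not single get the numbers 0, 1, 2, ...; there are s/2 - 1 of
  -- them.
  π : ℕ → ℕ
  π 2 = 0
  π (suc (suc (suc (suc (suc i))))) = choose (odd? i) (2 + j) (suc (half i))
  π _ = 2 + j
  onto : ∀ x → x < 2 + j → ∃ λ i → i < s × π i ≡ x
  onto zero _ = 2 , s≤s (s≤s (s≤s z≤n)) , refl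
  onto (suc x) (s≤s (s≤s x≤)) = 5 + (x + x) , s≤s (s≤s (s≤s (s≤s (s≤s (s≤s (ℕₚ.+-mono-≤ x≤ x≤)))))) ,
    trans (cong (λ b → choose b (2 + j) (suc (half (x + x)))) (odd?-double x)) (cong suc (half-double x))
  edges : ∀ f → (∀ x → 2 + j ≤ x → f x ≡ 0) → ∀ i → i < s → E i (f (π i)) (f (π (suc i % s)))
  edges f zeros i _ = zero-at i , zero-at (suc i % s)
    where
    zero-at : ∀ i → Sing i → f (π i) ≡ 0
    zero-at 0 _ = zeros _ ℕₚ.≤-refl
    zero-at 1 _ = zeros _ ℕₚ.≤-refl
    zero-at 3 _ = zeros _ ℕₚ.≤-refl
    zero-at 4 _ = zeros _ ℕₚ.≤-refl
    zero-at (suc (suc (suc (suc (suc i))))) sg = trans (cong (λ b → f (choose b (2 + j) (suc (half i)))) sg) (zeros _ ℕₚ.≤-refl)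
  nr : ∀ n → ¬ RainbowCycle (At.G n) (At.colouring n) s
  nr n R@(C , _) = At.two-special n {e = 0} {3} (s≤s z≤n) (s≤s (s≤s (s≤s (s≤s z≤n)))) (λ ()) (inj₁ refl) (inj₂ refl) R
    (Singles.Winding.all-joined s₀ n 3≤s Sing cover (s≤s (s≤s (s≤s (s≤s (s≤s z≤n))))) C)

open import Data.Integer using (+_)

-- The Sidon set {(u, u²)} modulo p

sg : Bool → ℤ
sg true = + 1
sg false = ℤ.- (+ 1)

⊕-cancelˡ : ∀ a {b c} → a ⊕ b ≡ a ⊕ c → b ≡ c
⊕-cancelˡ a {b} {c} e = trans (sym (undo a b)) (trans (cong (_⊝ a) e) (undo a c))
  where
  undo : ∀ a b → a ⊕ b ⊝ a ≡ b
  undo = ℤSolver.solve-∀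

module Sidon (p : ℕ) (prime-p : Prime p) (3≤p : 3 ≤ p) where

  ≡-from-∣ : ∀ {u w} → u < p → w < p → + p ∣ℤ + u ⊝ + w → u ≡ w
  ≡-from-∣ {u} {w} u< w< h = ℤₚ.+-injective (ℤₚ.i-j≡0⇒i≡j (+ u) (+ w) (ℤₚ.∣i∣≡0⇒i≡0 (small (ℤ.∣ + u ⊝ + w ∣) lt (ℤDv.∣⇒∣ᵤ h))))
    where
    lt : ℤ.∣ + u ⊝ + w ∣ < p
    lt = ℕₚ.≤-<-trans (ℕₚ.≤-trans (ℕₚ.≤-reflexive (cong ℤ.∣_∣ (ℤₚ.m-n≡m⊖n u w))) (ℤₚ.∣m⊝n∣≤m⊔n u w)) (ℕₚ.⊔-pres-<m u< w<)
    small : ∀ m → m < p → p ∣ m → m ≡ 0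
    small zero _ _ = refl
    small (suc m) lt h = contradiction (Dv.∣⇒≤ h) (ℕₚ.<⇒≱ lt)

  euclid : ∀ a b → + p ∣ℤ a ⊛ b → + p ∣ℤ a ⊎ + p ∣ℤ b
  euclid a b h with euclidsLemma ℤ.∣ a ∣ ℤ.∣ b ∣ prime-p (subst (p ∣_) (ℤₚ.abs-* a b) (ℤDv.∣⇒∣ᵤ h))
  ... | inj₁ h′ = inj₁ (ℤDv.∣ᵤ⇒∣ h′)
  ... | inj₂ h′ = inj₂ (ℤDv.∣ᵤ⇒∣ h′)

  -- Subtracting (w + u′ + w′ - u) times the linear relation from the quadratic one leaves 2 (u -
  -- u′)(u - w′), and p is odd.
  sidon : ∀ {u w u′ w′} → u < p → u′ < p → w′ < p → + p ∣ℤ + u ⊕ + w ⊝ + u′ ⊝ + w′ →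
    + p ∣ℤ + u ⊛ + u ⊕ + w ⊛ + w ⊝ + u′ ⊛ + u′ ⊝ + w′ ⊛ + w′ → u ≡ u′ ⊎ u ≡ w′
  sidon {u} {w} {u′} {w′} u< u′< w′< hA hB = go (euclid (+ 2) ((+ u ⊝ + u′) ⊛ (+ u ⊝ + w′)) (subst (+ p ∣ℤ_) (arith (+ u) (+ w) (+ u′) (+ w′))
      (ℤDv.∣m∣n⇒∣m-n hB (ℤDv.∣m⇒∣m*n (+ w ⊕ + u′ ⊕ + w′ ⊝ + u) hA))))
    where
    arith : ∀ u w u′ w′ → (u ⊛ u ⊕ w ⊛ w ⊝ u′ ⊛ u′ ⊝ w′ ⊛ w′) ⊝ (u ⊕ w ⊝ u′ ⊝ w′) ⊛ (w ⊕ u′ ⊕ w′ ⊝ u) ≡ + 2 ⊛ ((u ⊝ u′) ⊛ (u ⊝ w′))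
    arith = ℤSolver.solve-∀
    go′ : + p ∣ℤ + u ⊝ + u′ ⊎ + p ∣ℤ + u ⊝ + w′ → u ≡ u′ ⊎ u ≡ w′
    go′ (inj₁ h) = inj₁ (≡-from-∣ u< u′< h)
    go′ (inj₂ h) = inj₂ (≡-from-∣ u< w′< h)
    go : + p ∣ℤ + 2 ⊎ + p ∣ℤ (+ u ⊝ + u′) ⊛ (+ u ⊝ + w′) → u ≡ u′ ⊎ u ≡ w′
    go (inj₁ h) = contradiction (Dv.∣⇒≤ (ℤDv.∣⇒∣ᵤ h)) (ℕₚ.<⇒≱ 3≤p)
    go (inj₂ h) = go′ (euclid (+ u ⊝ + u′) (+ u ⊝ + w′) h)

  module _ {s : ℕ} (5≤s : 5 ≤ s) where

    multiple-small : ∀ {k} X → + k ≡ + s ⊛ X ⊎ ℤ.- (+ k) ≡ + s ⊛ X → 1 ≤ k → k ≤ 4 → ⊥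
    multiple-small {suc k} X h _ k≤ = ℕₚ.<⇒≱ (ℕₚ.≤-trans (s≤s k≤) 5≤s) (Dv.∣⇒≤ (divides ℤ.∣ X ∣ (trans (go h) (ℕₚ.*-comm s ℤ.∣ X ∣))))
      where
      go : + suc k ≡ + s ⊛ X ⊎ ℤ.- (+ suc k) ≡ + s ⊛ X → suc k ≡ s * ℤ.∣ X ∣
      go (inj₁ e) = trans (cong ℤ.∣_∣ e) (ℤₚ.abs-* (+ s) X)
      go (inj₂ e) = trans (cong ℤ.∣_∣ e) (ℤₚ.abs-* (+ s) X)

    zero-multiple : ∀ X → + 0 ≡ + s ⊛ X → X ≡ + 0
    zero-multiple X e with ℤₚ.i*j≡0⇒i≡0∨j≡0 (+ s) (sym e)
    ... | inj₁ h = contradiction (ℤₚ.+-injective h) (ℕₚ.>⇒≢ (ℕₚ.≤-trans (s≤s z≤n) 5≤s))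
    ... | inj₂ h = h

    module _ (u₀ u₁ u₂ u₃ : ℕ) (u₀< : u₀ < p) (u₁< : u₁ < p) (u₂< : u₂ < p) (u₃< : u₃ < p) where

      signedSum : (Bool × Bool × Bool × Bool) → (ℕ → ℤ) → ℤ
      signedSum (b₀ , b₁ , b₂ , b₃) f = sg b₀ ⊛ f u₀ ⊕ sg b₁ ⊛ f u₁ ⊕ sg b₂ ⊛ f u₂ ⊕ sg b₃ ⊛ f u₃

      Match : (Bool × Bool × Bool × Bool) → Set
      Match (b₀ , b₁ , b₂ , b₃) = (b₁ ≡ not b₀ × u₁ ≡ u₀) ⊎ (b₂ ≡ not b₁ × u₂ ≡ u₁) ⊎ (b₃ ≡ not b₂ × u₃ ≡ u₂) ⊎
        (b₀ ≡ not b₃ × u₀ ≡ u₃) ⊎ (b₂ ≡ not b₀ × u₂ ≡ u₀)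

      sq : ℕ → ℤ
      sq u = + u ⊛ + u

      -- A sum of four signs that is a multiple of s ≥ 5 vanishes, so X = 0 and two edges run in
      -- each direction. The two congruences then hold without twist, and the Sidon property pairs
      -- the labels.
      match : ∀ b₀ b₁ b₂ b₃ X → sg b₀ ⊕ sg b₁ ⊕ sg b₂ ⊕ sg b₃ ≡ + s ⊛ X →
        (X ≡ + 0 → + p ∣ℤ signedSum (b₀ , b₁ , b₂ , b₃) (λ u → + u)) → (X ≡ + 0 → + p ∣ℤ signedSum (b₀ , b₁ , b₂ , b₃) sq) → Match (b₀ , b₁ , b₂ , b₃)
      match true true false false X e h h′ = go (sidon {u₀} {u₁} {u₂} {u₃} u₀< u₂< u₃< (subst (+ p ∣ℤ_) (arith (+ u₀) (+ u₁) (+ u₂) (+ u₃)) (h X0)) (subst (+ p ∣ℤ_) (arith (sq u₀) (sq u₁) (sq u₂) (sq u₃)) (h′ X0)))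
        where
        X0 : X ≡ + 0
        X0 = zero-multiple X e
        arith : ∀ a b c d → + 1 ⊛ a ⊕ + 1 ⊛ b ⊕ (ℤ.- (+ 1)) ⊛ c ⊕ (ℤ.- (+ 1)) ⊛ d ≡ a ⊕ b ⊝ c ⊝ d
        arith = ℤSolver.solve-∀
        go : u₀ ≡ u₂ ⊎ u₀ ≡ u₃ → _
        go (inj₁ q) = inj₂ (inj₂ (inj₂ (inj₂ (refl , sym q))))
        go (inj₂ q) = inj₂ (inj₂ (inj₂ (inj₁ (refl , q))))
      match true false true false X e h h′ = go (sidon {u₀} {u₂} {u₁} {u₃} u₀< u₁< u₃< (subst (+ p ∣ℤ_) (arith (+ u₀) (+ u₁) (+ u₂) (+ u₃)) (h X0)) (subst (+ p ∣ℤ_) (arith (sq u₀) (sq u₁) (sq u₂) (sq u₃)) (h′ X0)))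
        where
        X0 : X ≡ + 0
        X0 = zero-multiple X e
        arith : ∀ a b c d → + 1 ⊛ a ⊕ (ℤ.- (+ 1)) ⊛ b ⊕ + 1 ⊛ c ⊕ (ℤ.- (+ 1)) ⊛ d ≡ a ⊕ c ⊝ b ⊝ d
        arith = ℤSolver.solve-∀
        go : u₀ ≡ u₁ ⊎ u₀ ≡ u₃ → _
        go (inj₁ q) = inj₁ (refl , sym q)
        go (inj₂ q) = inj₂ (inj₂ (inj₂ (inj₁ (refl , q))))
      match true false false true X e h h′ = go (sidon {u₀} {u₃} {u₁} {u₂} u₀< u₁< u₂< (subst (+ p ∣ℤ_) (arith (+ u₀) (+ u₁) (+ u₂) (+ u₃)) (h X0)) (subst (+ p ∣ℤ_) (arith (sq u₀) (sq u₁) (sq u₂) (sq u₃)) (h′ X0)))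
        where
        X0 : X ≡ + 0
        X0 = zero-multiple X e
        arith : ∀ a b c d → + 1 ⊛ a ⊕ (ℤ.- (+ 1)) ⊛ b ⊕ (ℤ.- (+ 1)) ⊛ c ⊕ + 1 ⊛ d ≡ a ⊕ d ⊝ b ⊝ c
        arith = ℤSolver.solve-∀
        go : u₀ ≡ u₁ ⊎ u₀ ≡ u₂ → _
        go (inj₁ q) = inj₁ (refl , sym q)
        go (inj₂ q) = inj₂ (inj₂ (inj₂ (inj₂ (refl , sym q))))
      match false false true true X e h h′ = go (sidon {u₂} {u₃} {u₀} {u₁} u₂< u₀< u₁< (subst (+ p ∣ℤ_) (arith (+ u₀) (+ u₁) (+ u₂) (+ u₃)) (h X0)) (subst (+ p ∣ℤ_) (arith (sq u₀) (sq u₁) (sq u₂) (sq u₃)) (h′ X0)))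
        where
        X0 : X ≡ + 0
        X0 = zero-multiple X e
        arith : ∀ a b c d → (ℤ.- (+ 1)) ⊛ a ⊕ (ℤ.- (+ 1)) ⊛ b ⊕ + 1 ⊛ c ⊕ + 1 ⊛ d ≡ c ⊕ d ⊝ a ⊝ b
        arith = ℤSolver.solve-∀
        go : u₂ ≡ u₀ ⊎ u₂ ≡ u₁ → _
        go (inj₁ q) = inj₂ (inj₂ (inj₂ (inj₂ (refl , q))))
        go (inj₂ q) = inj₂ (inj₁ (refl , q))
      match false true false true X e h h′ = go (sidon {u₁} {u₃} {u₀} {u₂} u₁< u₀< u₂< (subst (+ p ∣ℤ_) (arith (+ u₀) (+ u₁) (+ u₂) (+ u₃)) (h X0)) (subst (+ p ∣ℤ_) (arith (sq u₀) (sq u₁) (sq u₂) (sq u₃)) (h′ X0)))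
        where
        X0 : X ≡ + 0
        X0 = zero-multiple X e
        arith : ∀ a b c d → (ℤ.- (+ 1)) ⊛ a ⊕ + 1 ⊛ b ⊕ (ℤ.- (+ 1)) ⊛ c ⊕ + 1 ⊛ d ≡ b ⊕ d ⊝ a ⊝ c
        arith = ℤSolver.solve-∀
        go : u₁ ≡ u₀ ⊎ u₁ ≡ u₂ → _
        go (inj₁ q) = inj₁ (refl , q)
        go (inj₂ q) = inj₂ (inj₁ (refl , sym q))
      match false true true false X e h h′ = go (sidon {u₂} {u₁} {u₀} {u₃} u₂< u₀< u₃< (subst (+ p ∣ℤ_) (arith (+ u₀) (+ u₁) (+ u₂) (+ u₃)) (h X0)) (subst (+ p ∣ℤ_) (arith (sq u₀) (sq u₁) (sq u₂) (sq u₃)) (h′ X0)))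
        where
        X0 : X ≡ + 0
        X0 = zero-multiple X e
        arith : ∀ a b c d → (ℤ.- (+ 1)) ⊛ a ⊕ + 1 ⊛ b ⊕ + 1 ⊛ c ⊕ (ℤ.- (+ 1)) ⊛ d ≡ c ⊕ b ⊝ a ⊝ d
        arith = ℤSolver.solve-∀
        go : u₂ ≡ u₀ ⊎ u₂ ≡ u₃ → _
        go (inj₁ q) = inj₂ (inj₂ (inj₂ (inj₂ (refl , q))))
        go (inj₂ q) = inj₂ (inj₂ (inj₁ (refl , sym q)))
      match true true true true X e _ _ = ⊥-elim (multiple-small {4} X (inj₁ e) (s≤s z≤n) (s≤s (s≤s (s≤s (s≤s z≤n)))))
      match true true true false X e _ _ = ⊥-elim (multiple-small {2} X (inj₁ e) (s≤s z≤n) (s≤s (s≤s z≤n)))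
      match true true false true X e _ _ = ⊥-elim (multiple-small {2} X (inj₁ e) (s≤s z≤n) (s≤s (s≤s z≤n)))
      match true false true true X e _ _ = ⊥-elim (multiple-small {2} X (inj₁ e) (s≤s z≤n) (s≤s (s≤s z≤n)))
      match false true true true X e _ _ = ⊥-elim (multiple-small {2} X (inj₁ e) (s≤s z≤n) (s≤s (s≤s z≤n)))
      match true false false false X e _ _ = ⊥-elim (multiple-small {2} X (inj₂ e) (s≤s z≤n) (s≤s (s≤s z≤n)))
      match false true false false X e _ _ = ⊥-elim (multiple-small {2} X (inj₂ e) (s≤s z≤n) (s≤s (s≤s z≤n)))
      match false false true false X e _ _ = ⊥-elim (multiple-small {2} X (inj₂ e) (s≤s z≤n) (s≤s (s≤s z≤n)))
      match false false false true X e _ _ = ⊥-elim (multiple-small {2} X (inj₂ e) (s≤s z≤n) (s≤s (s≤s z≤n)))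
      match false false false false X e _ _ = ⊥-elim (multiple-small {4} X (inj₂ e) (s≤s z≤n) (s≤s (s≤s (s≤s (s≤s z≤n)))))

    -- Traversed in the direction b, an edge with label u moves the coordinates (α, β) by
    -- ± (u, u²), with a twist by (τ₁, τ₂) if χ = 1; γ changes by ± 1, or by ± (1 − s) if χ = 1.
    module FourCycles {V : Set} (γ α β : V → ℤ) (τ₁ τ₂ : ℤ) where

      record Labelled (x y : V) (b : Bool) (u : ℕ) : Set where
        field
          u<p : u < p
          χ : ℤ
          γ≡ : γ y ≡ γ x ⊕ sg b ⊛ (+ 1 ⊝ + s ⊛ χ)
          α≡ : + p ∣ℤ α y ⊝ α x ⊝ sg b ⊛ (+ u ⊕ χ ⊛ τ₁)
          β≡ : + p ∣ℤ β y ⊝ β x ⊝ sg b ⊛ (+ u ⊛ + u ⊕ χ ⊛ τ₂)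

      module _ {y₀ y₁ y₂ y₃ : V} {b₀ b₁ b₂ b₃ u₀ u₁ u₂ u₃}
        (ℓ₀ : Labelled y₀ y₁ b₀ u₀) (ℓ₁ : Labelled y₁ y₂ b₁ u₁) (ℓ₂ : Labelled y₂ y₃ b₂ u₂) (ℓ₃ : Labelled y₃ y₀ b₃ u₃) where
        private
          module L₀ = Labelled ℓ₀
          module L₁ = Labelled ℓ₁
          module L₂ = Labelled ℓ₂
          module L₃ = Labelled ℓ₃

        -- The winding number of the closed walk, since χ marks the edges that close the cycle of
        -- parts.
        X : ℤ
        X = sg b₀ ⊛ L₀.χ ⊕ sg b₁ ⊛ L₁.χ ⊕ sg b₂ ⊛ L₂.χ ⊕ sg b₃ ⊛ L₃.χ

        sum-signs : sg b₀ ⊕ sg b₁ ⊕ sg b₂ ⊕ sg b₃ ≡ + s ⊛ X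
        sum-signs = trans (arith (sg b₀) (sg b₁) (sg b₂) (sg b₃) L₀.χ L₁.χ L₂.χ L₃.χ (+ s)) (trans (cong (λ z → z ⊕ + s ⊛ X) closed) (ℤₚ.+-identityˡ (+ s ⊛ X)))
          where
          e : Bool → ℤ → ℤ
          e b χ = sg b ⊛ (+ 1 ⊝ + s ⊛ χ)
          arith : ∀ a b c d w x y z s → a ⊕ b ⊕ c ⊕ d ≡ (a ⊛ (+ 1 ⊝ s ⊛ w) ⊕ b ⊛ (+ 1 ⊝ s ⊛ x) ⊕ c ⊛ (+ 1 ⊝ s ⊛ y) ⊕ d ⊛ (+ 1 ⊝ s ⊛ z)) ⊕ s ⊛ (a ⊛ w ⊕ b ⊛ x ⊕ c ⊛ y ⊕ d ⊛ z)
          arith = ℤSolver.solve-∀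
          closed : e b₀ L₀.χ ⊕ e b₁ L₁.χ ⊕ e b₂ L₂.χ ⊕ e b₃ L₃.χ ≡ + 0
          closed = ⊕-cancelˡ (γ y₀) (trans (assoc (γ y₀) (e b₀ L₀.χ) (e b₁ L₁.χ) (e b₂ L₂.χ) (e b₃ L₃.χ))
            (trans (cong (λ z → z ⊕ e b₁ L₁.χ ⊕ e b₂ L₂.χ ⊕ e b₃ L₃.χ) (sym L₀.γ≡)) (trans (cong (λ z → z ⊕ e b₂ L₂.χ ⊕ e b₃ L₃.χ) (sym L₁.γ≡))
              (trans (cong (_⊕ e b₃ L₃.χ) (sym L₂.γ≡)) (trans (sym L₃.γ≡) (sym (ℤₚ.+-identityʳ (γ y₀))))))))
            where
            assoc : ∀ g a b c d → g ⊕ (a ⊕ b ⊕ c ⊕ d) ≡ g ⊕ a ⊕ b ⊕ c ⊕ d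
            assoc = ℤSolver.solve-∀

        sum-labels : (f : ℕ → ℤ) (δ : V → ℤ) (τ : ℤ) → + p ∣ℤ δ y₁ ⊝ δ y₀ ⊝ sg b₀ ⊛ (f u₀ ⊕ L₀.χ ⊛ τ) → + p ∣ℤ δ y₂ ⊝ δ y₁ ⊝ sg b₁ ⊛ (f u₁ ⊕ L₁.χ ⊛ τ) →
          + p ∣ℤ δ y₃ ⊝ δ y₂ ⊝ sg b₂ ⊛ (f u₂ ⊕ L₂.χ ⊛ τ) → + p ∣ℤ δ y₀ ⊝ δ y₃ ⊝ sg b₃ ⊛ (f u₃ ⊕ L₃.χ ⊛ τ) → X ≡ + 0 →
          + p ∣ℤ sg b₀ ⊛ f u₀ ⊕ sg b₁ ⊛ f u₁ ⊕ sg b₂ ⊛ f u₂ ⊕ sg b₃ ⊛ f u₃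
        sum-labels f δ τ h₀ h₁ h₂ h₃ X0 = subst (+ p ∣ℤ_) (trans (arith (δ y₀) (δ y₁) (δ y₂) (δ y₃) (sg b₀) (sg b₁) (sg b₂) (sg b₃) (f u₀) (f u₁) (f u₂) (f u₃) L₀.χ L₁.χ L₂.χ L₃.χ τ)
            (trans (cong (λ z → S ⊕ z ⊛ τ) X0) (ℤₚ.+-identityʳ S)))
          (ℤDv.∣m⇒∣-m (ℤDv.∣m∣n⇒∣m+n (ℤDv.∣m∣n⇒∣m+n (ℤDv.∣m∣n⇒∣m+n h₀ h₁) h₂) h₃))
          where
          S : ℤ
          S = sg b₀ ⊛ f u₀ ⊕ sg b₁ ⊛ f u₁ ⊕ sg b₂ ⊛ f u₂ ⊕ sg b₃ ⊛ f u₃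
          arith : ∀ d₀ d₁ d₂ d₃ a b c d u v w x k l m n t →
            ℤ.- ((d₁ ⊝ d₀ ⊝ a ⊛ (u ⊕ k ⊛ t)) ⊕ (d₂ ⊝ d₁ ⊝ b ⊛ (v ⊕ l ⊛ t)) ⊕ (d₃ ⊝ d₂ ⊝ c ⊛ (w ⊕ m ⊛ t)) ⊕ (d₀ ⊝ d₃ ⊝ d ⊛ (x ⊕ n ⊛ t)))
            ≡ (a ⊛ u ⊕ b ⊛ v ⊕ c ⊛ w ⊕ d ⊛ x) ⊕ (a ⊛ k ⊕ b ⊛ l ⊕ c ⊛ m ⊕ d ⊛ n) ⊛ t
          arith = ℤSolver.solve-∀

        -- In a 4-cycle either two consecutive edges have the same label and opposite directions,
        -- or two opposite edges do.
        four-cycle : Match u₀ u₁ u₂ u₃ L₀.u<p L₁.u<p L₂.u<p L₃.u<p (b₀ , b₁ , b₂ , b₃)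
        four-cycle = match u₀ u₁ u₂ u₃ L₀.u<p L₁.u<p L₂.u<p L₃.u<p b₀ b₁ b₂ b₃ X sum-signs
          (sum-labels (λ u → + u) α τ₁ L₀.α≡ L₁.α≡ L₂.α≡ L₃.α≡) (sum-labels (λ u → + u ⊛ + u) β τ₂ L₀.β≡ L₁.β≡ L₂.β≡ L₃.β≡)

-- Points and twisted translations; graphs without C_4 for s ≥ 5

unique-lookup-injective : {A : Set} {xs : List A} → Unique xs → ∀ {i j} → lookup xs i ≡ lookup xs j → i ≡ j
unique-lookup-injective (x∉ ∷ u) {zero} {zero} e = refl
unique-lookup-injective {xs = x ∷ xs} (x∉ ∷ u) {zero} {suc j} e = contradiction e (All.lookup x∉ (Mₚ.∈-lookup j))
unique-lookup-injective {xs = x ∷ xs} (x∉ ∷ u) {suc i} {zero} e = contradiction (sym e) (All.lookup x∉ (Mₚ.∈-lookup i))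
unique-lookup-injective (x∉ ∷ u) {suc i} {suc j} e = cong suc (unique-lookup-injective u e)

pigeonhole : ∀ {M L} (f : Fin M → Fin L) → 1 ≤ L → ∃ λ ℓ → ∃ λ c → Σ (Fin c → Fin M) λ ι →
  (∀ i j → ι i ≡ ι j → i ≡ j) × (∀ i → f (ι i) ≡ ℓ) × M ≤ c * L
pigeonhole {M} {L} f 1≤L = go (Fₚ.any? λ ℓ → M ℕₚ.≤? length (fibre ℓ) * L)
  where
  fibre : Fin L → List (Fin M)
  fibre ℓ = filter (λ k → f k Fₚ.≟ ℓ) (allFin M)
  total : Σ[ allFin L ] (λ ℓ → length (fibre ℓ)) ≡ M
  total = trans (Σ-≡ (allFin L) λ ℓ → length-filter≡Σ (λ k → f k Fₚ.≟ ℓ) (allFin M))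
    (trans (Σ-swap (allFin L) (allFin M) (λ ℓ k → indicator (f k Fₚ.≟ ℓ)))
    (trans (Σ-≡ (allFin M) λ k → one (f k)) (trans (Σ-const (allFin M) 1) (trans (ℕₚ.*-identityʳ _) (Lₚ.length-tabulate {n = M} id)))))
    where
    zeros : ∀ x (l : List (Fin L)) → All (x ≢_) l → Σ[ l ] (λ ℓ → indicator (x Fₚ.≟ ℓ)) ≡ 0
    zeros x [] [] = refl
    zeros x (y ∷ l) (h ∷ hs) with x Fₚ.≟ y
    ... | yes e = contradiction e h
    ... | no _ = zeros x l hs
    once : ∀ x (l : List (Fin L)) → Unique l → x ∈ l → Σ[ l ] (λ ℓ → indicator (x Fₚ.≟ ℓ)) ≡ 1
    once x (y ∷ l) (y∉ ∷ u) x∈ with x Fₚ.≟ y | x∈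
    ... | yes refl | _ = cong suc (zeros x l y∉)
    ... | no ne | here e = contradiction e ne
    ... | no ne | there x∈′ = once x l u x∈′
    one : ∀ x → Σ[ allFin L ] (λ ℓ → indicator (x Fₚ.≟ ℓ)) ≡ 1
    one x = once x (allFin L) (Uₚ.allFin⁺ L) (Mₚ.∈-allFin x)
  go : Dec (∃ λ ℓ → M ≤ length (fibre ℓ) * L) → _
  go (yes (ℓ , h)) = ℓ , length (fibre ℓ) , lookup (fibre ℓ) ,
    (λ i j → unique-lookup-injective (Uₚ.filter⁺ (λ k → f k Fₚ.≟ ℓ) (Uₚ.allFin⁺ M)) {i} {j}) ,
    (λ i → proj₂ (Mₚ.∈-filter⁻ (λ k → f k Fₚ.≟ ℓ) {xs = allFin M} (Mₚ.∈-lookup i))) , h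
  go (no none) = ⊥-elim (ℕₚ.<-irrefl refl (ℕₚ.<-≤-trans strict (ℕₚ.≤-reflexive scaled)))
    where
    each : ∀ ℓ → suc (length (fibre ℓ) * L) ≤ M
    each ℓ = ℕₚ.≰⇒> λ h → none (ℓ , h)
    sumEach : L + M * L ≤ L * M
    sumEach = subst₂ _≤_
      (trans (Σ-+ (allFin L) (λ _ → 1) (λ ℓ → length (fibre ℓ) * L)) (cong₂ _+_
        (trans (Σ-const (allFin L) 1) (trans (ℕₚ.*-identityʳ _) (Lₚ.length-tabulate {n = L} id)))
        (trans (Σ-≡ (allFin L) λ ℓ → ℕₚ.*-comm (length (fibre ℓ)) L) (trans (Σ-scale L (allFin L) (λ ℓ → length (fibre ℓ)))
          (trans (cong (L *_) total) (ℕₚ.*-comm L M))))))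
      (trans (Σ-const (allFin L) M) (cong (_* M) (Lₚ.length-tabulate {n = L} id)))
      (Σ-mono (allFin L) λ ℓ _ → each ℓ)
    strict : M * L < L + M * L
    strict = ℕₚ.+-monoˡ-≤ (M * L) 1≤L
    scaled : L + M * L ≡ M * L
    scaled = ℕₚ.≤-antisym (ℕₚ.≤-trans sumEach (ℕₚ.≤-reflexive (ℕₚ.*-comm L M))) (ℕₚ.m≤n+m (M * L) L)

sumTo : (ℕ → ℕ) → ℕ → ℕ
sumTo f zero = 0
sumTo f (suc i) = sumTo f i + f i

module Points (p : ℕ) (prime-p : Prime p) (3≤p : 3 ≤ p) where
  open Sidon p prime-p 3≤p

  instance
    p≢0 : NonZero p
    p≢0 = prime⇒nonZero prime-p

  -- The coordinates in (ℤ/p)² of the point with index c < p².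
  α₀ β₀ : ℕ → ℤ
  α₀ c = + (c % p)
  β₀ c = + (c / p)

  point≡ : ∀ {c c′} → c < p * p → c′ < p * p → + p ∣ℤ α₀ c ⊝ α₀ c′ → + p ∣ℤ β₀ c ⊝ β₀ c′ → c ≡ c′
  point≡ {c} {c′} c< c′< hα hβ = trans (DM.m≡m%n+[m/n]*n c p) (trans (cong₂ (λ a b → a + b * p)
      (≡-from-∣ (DM.m%n<n c p) (DM.m%n<n c′ p) hα) (≡-from-∣ (DM.m<n*o⇒m/o<n c<) (DM.m<n*o⇒m/o<n c′<) hβ))
    (sym (DM.m≡m%n+[m/n]*n c′ p)))

  mod-∣ : ∀ x → + p ∣ℤ + (x % p) ⊝ + x
  mod-∣ x = subst (+ p ∣ℤ_) (sym (trans (cong (λ z → + (x % p) ⊝ z) (trans (cong +_ (DM.m≡m%n+[m/n]*n x p))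
      (cong (λ z → + (x % p) ⊕ z) (ℤₚ.pos-* (x / p) p)))) (arith (+ (x % p)) (+ (x / p)) (+ p))))
    (ℤDv.∣m⇒∣-m (ℤDv.∣n⇒∣m*n (+ (x / p)) (ℤDv.∣-refl {+ p})))
    where
    arith : ∀ a b c → a ⊝ (a ⊕ b ⊛ c) ≡ ℤ.- (b ⊛ c)
    arith = ℤSolver.solve-∀

  -- c and c′ differ by (u, u²) + χ τ for a label u of class m modulo k.
  record Arc (k m : ℕ) .{{_ : NonZero k}} (χ τ₁ τ₂ : ℤ) (c c′ : ℕ) : Set where
    field
      c< : c < p * p
      c′< : c′ < p * p
      label : ℕ
      label< : label < p
      class : label % k ≡ m
      α≡ : + p ∣ℤ α₀ c′ ⊝ α₀ c ⊝ (+ label ⊕ χ ⊛ τ₁)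
      β≡ : + p ∣ℤ β₀ c′ ⊝ β₀ c ⊝ (+ label ⊛ + label ⊕ χ ⊛ τ₂)

  module _ {k m m′ : ℕ} .{{_ : NonZero k}} {χ χ′ τ₁ τ₂ : ℤ} {c c′ d d′ : ℕ} (f : Arc k m χ τ₁ τ₂ c c′) (g : Arc k m′ χ′ τ₁ τ₂ d d′) where
    private
      module F = Arc f
      module H = Arc g

    same-target : F.label ≡ H.label → χ ≡ χ′ → c′ ≡ d′ → c ≡ d
    same-target refl refl refl = point≡ F.c< H.c<
      (subst (+ p ∣ℤ_) (arith (α₀ c′) (α₀ c) (α₀ d) (+ F.label ⊕ χ ⊛ τ₁)) (ℤDv.∣m∣n⇒∣m-n H.α≡ F.α≡))
      (subst (+ p ∣ℤ_) (arith (β₀ c′) (β₀ c) (β₀ d) (+ F.label ⊛ + F.label ⊕ χ ⊛ τ₂)) (ℤDv.∣m∣n⇒∣m-n H.β≡ F.β≡))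
      where
      arith : ∀ y c d z → (y ⊝ d ⊝ z) ⊝ (y ⊝ c ⊝ z) ≡ c ⊝ d
      arith = ℤSolver.solve-∀

    same-source : F.label ≡ H.label → χ ≡ χ′ → c ≡ d → c′ ≡ d′
    same-source refl refl refl = point≡ F.c′< H.c′<
      (subst (+ p ∣ℤ_) (arith (α₀ c) (α₀ c′) (α₀ d′) (+ F.label ⊕ χ ⊛ τ₁)) (ℤDv.∣m∣n⇒∣m-n F.α≡ H.α≡))
      (subst (+ p ∣ℤ_) (arith (β₀ c) (β₀ c′) (β₀ d′) (+ F.label ⊛ + F.label ⊕ χ ⊛ τ₂)) (ℤDv.∣m∣n⇒∣m-n F.β≡ H.β≡))
      where
      arith : ∀ y c d z → (c ⊝ y ⊝ z) ⊝ (d ⊝ y ⊝ z) ≡ c ⊝ d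
      arith = ℤSolver.solve-∀

    same-label : χ ≡ χ′ → c ≡ d → c′ ≡ d′ → F.label ≡ H.label
    same-label refl refl refl = ≡-from-∣ F.label< H.label<
      (subst (+ p ∣ℤ_) (arith (α₀ c′ ⊝ α₀ c) (+ F.label) (+ H.label) (χ ⊛ τ₁)) (ℤDv.∣m∣n⇒∣m-n H.α≡ F.α≡))
      where
      arith : ∀ y u w z → (y ⊝ (w ⊕ z)) ⊝ (y ⊝ (u ⊕ z)) ≡ u ⊝ w
      arith = ℤSolver.solve-∀

  point : ℕ → ℕ → ℕ
  point a b = a % p + b % p * p

  point< : ∀ a b → point a b < p * p
  point< a b = ℕₚ.<-≤-trans (ℕₚ.+-monoˡ-< (b % p * p) (DM.m%n<n a p)) (ℕₚ.*-monoˡ-≤ p (DM.m%n<n b p))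

  α-point : ∀ a b → α₀ (point a b) ≡ + (a % p)
  α-point a b = cong +_ (trans (DM.[m+kn]%n≡m%n (a % p) (b % p) p) (DM.m%n%n≡m%n a p))

  β-point : ∀ a b → β₀ (point a b) ≡ + (b % p)
  β-point a b = cong +_ (trans (DM.+-distrib-/-∣ʳ (a % p) (divides (b % p) refl))
    (cong₂ _+_ (DM.m<n⇒m/n≡0 (DM.m%n<n a p)) (DM.m*n/n≡m (b % p) p)))

  point-id : ∀ {c} → c < p * p → point c (c / p) ≡ c
  point-id {c} c< = trans (cong (λ z → c % p + z * p) (DM.m<n⇒m%n≡m (DM.m<n*o⇒m/o<n c<))) (sym (DM.m≡m%n+[m/n]*n c p))

  residue-step : ∀ a a′ z → + p ∣ℤ + a′ ⊝ + a ⊝ z → + p ∣ℤ + (a′ % p) ⊝ + (a % p) ⊝ z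
  residue-step a a′ z h = subst (+ p ∣ℤ_) (arith (+ (a′ % p)) (+ a′) (+ (a % p)) (+ a) z)
      (ℤDv.∣m∣n⇒∣m+n (ℤDv.∣m∣n⇒∣m-n (mod-∣ a′) (mod-∣ a)) h)
    where
    arith : ∀ x′ y′ x y z → (x′ ⊝ y′) ⊝ (x ⊝ y) ⊕ (y′ ⊝ y ⊝ z) ≡ x′ ⊝ x ⊝ z
    arith = ℤSolver.solve-∀

  point-arc : ∀ {k m} .{{_ : NonZero k}} {χ τ₁ τ₂} a b a′ b′ u → u < p → u % k ≡ m →
    + p ∣ℤ + a′ ⊝ + a ⊝ (+ u ⊕ χ ⊛ τ₁) → + p ∣ℤ + b′ ⊝ + b ⊝ (+ u ⊛ + u ⊕ χ ⊛ τ₂) → Arc k m χ τ₁ τ₂ (point a b) (point a′ b′)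
  point-arc {χ = χ} {τ₁} {τ₂} a b a′ b′ u u< cl hα hβ = record
    { c< = point< a b ; c′< = point< a′ b′ ; label = u ; label< = u< ; class = cl
    ; α≡ = subst₂ (λ x y → + p ∣ℤ x ⊝ y ⊝ (+ u ⊕ χ ⊛ τ₁)) (sym (α-point a′ b′)) (sym (α-point a b)) (residue-step a a′ _ hα)
    ; β≡ = subst₂ (λ x y → + p ∣ℤ x ⊝ y ⊝ (+ u ⊛ + u ⊕ χ ⊛ τ₂)) (sym (β-point a′ b′)) (sym (β-point a b)) (residue-step b b′ _ hβ) }

  ∣-zero : ∀ {z} → z ≡ + 0 → + p ∣ℤ z
  ∣-zero refl = subst (+ p ∣ℤ_) (ℤₚ.*-zeroʳ (+ p)) (ℤDv.∣m⇒∣m*n (+ 0) (ℤDv.∣-refl {+ p}))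

-- s ≥ 5: the index of a vertex is a point of (ℤ/p)², the part i is joined to the next one by the
-- labels of class i, and the edges closing the cycle of parts are translated by (τ₁, τ₂).
module TwistedGraph (p : ℕ) (prime-p : Prime p) (3≤p : 3 ≤ p) (s₀ : ℕ) (5≤s : 5 ≤ suc s₀) (τ₁ τ₂ : ℤ) where
  open Points p prime-p 3≤p public

  s : ℕ
  s = suc s₀

  χ : ℕ → ℤ
  χ i with i ℕₚ.≟ s₀
  ... | yes _ = + 1
  ... | no _ = + 0

  χ-last : χ s₀ ≡ + 1
  χ-last with s₀ ℕₚ.≟ s₀
  ... | yes _ = refl
  ... | no ne = contradiction refl ne

  χ-inner : ∀ {i} → i ≢ s₀ → χ i ≡ + 0
  χ-inner {i} ne with i ℕₚ.≟ s₀
  ... | yes e = contradiction e ne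
  ... | no _ = refl

  E : ℕ → ℕ → ℕ → Set
  E i = Arc s i (χ i) τ₁ τ₂

  3≤s : 3 ≤ s
  3≤s = ℕₚ.≤-trans (s≤s (s≤s (s≤s z≤n))) 5≤s

  module OnVertices (n : ℕ) where
    open CyclicGraph s₀ n 3≤s E hiding (s)
    open Sidon.FourCycles p prime-p 3≤p {s} 5≤s {Fin n} (λ u → + part u) (λ u → α₀ (idx u)) (λ u → β₀ (idx u)) τ₁ τ₂

    data Directed (x y : Fin n) : Bool → ℕ → Set where
      forward : (h : Up x y) → Directed x y true (Arc.label (edge h))
      backward : (h : Up y x) → Directed x y false (Arc.label (edge h))

    labelOf : ∀ {x y} → Adj G x y → ∃ λ b → ∃ λ u → Directed x y b u
    labelOf (inj₁ h) = _ , _ , forward h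
    labelOf (inj₂ h) = _ , _ , backward h

    γ-step : ∀ {x y} → Up x y → + part y ≡ + part x ⊕ (+ 1 ⊝ + s ⊛ χ (part x))
    γ-step {x} {y} h = go (part x ℕₚ.≟ s₀)
      where
      go : Dec (part x ≡ s₀) → + part y ≡ + part x ⊕ (+ 1 ⊝ + s ⊛ χ (part x))
      go (yes e) = trans (cong +_ (trans (sym (part≡ h)) (trans (cong (λ i → suc i % s) e) (DM.n%n≡0 s))))
        (sym (trans (cong₂ (λ i z → + i ⊕ (+ 1 ⊝ + s ⊛ z)) e (trans (cong χ e) χ-last)) (arith (+ s₀))))
        where
        arith : ∀ x → x ⊕ (+ 1 ⊝ (+ 1 ⊕ x) ⊛ + 1) ≡ + 0
        arith = ℤSolver.solve-∀
      go (no ne) = trans (cong +_ (trans (sym (part≡ h)) (DM.m<n⇒m%n≡m (s≤s (ℕₚ.≤∧≢⇒< (ℕₚ.≤-pred (part< x)) ne)))))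
        (sym (trans (cong (λ z → + part x ⊕ (+ 1 ⊝ + s ⊛ z)) (χ-inner ne)) (arith (+ part x) (+ s))))
        where
        arith : ∀ x s → x ⊕ (+ 1 ⊝ s ⊛ + 0) ≡ + 1 ⊕ x
        arith = ℤSolver.solve-∀

    labelled : ∀ {x y b u} → Directed x y b u → Labelled x y b u
    labelled {x} {y} (forward h) = record
      { u<p = Arc.label< (edge h) ; χ = χ (part x)
      ; γ≡ = trans (γ-step h) (cong (+ part x ⊕_) (sym (ℤₚ.*-identityˡ (+ 1 ⊝ + s ⊛ χ (part x)))))
      ; α≡ = subst (λ z → + p ∣ℤ α₀ (idx y) ⊝ α₀ (idx x) ⊝ z) (sym (ℤₚ.*-identityˡ (+ Arc.label (edge h) ⊕ χ (part x) ⊛ τ₁))) (Arc.α≡ (edge h))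
      ; β≡ = subst (λ z → + p ∣ℤ β₀ (idx y) ⊝ β₀ (idx x) ⊝ z) (sym (ℤₚ.*-identityˡ (+ Arc.label (edge h) ⊛ + Arc.label (edge h) ⊕ χ (part x) ⊛ τ₂))) (Arc.β≡ (edge h)) }
    labelled {x} {y} (backward h) = record
      { u<p = Arc.label< (edge h) ; χ = χ (part y)
      ; γ≡ = trans (arith₀ (+ part y) (+ 1 ⊝ + s ⊛ χ (part y))) (cong (_⊕ sg false ⊛ (+ 1 ⊝ + s ⊛ χ (part y))) (sym (γ-step h)))
      ; α≡ = subst (+ p ∣ℤ_) (arith (α₀ (idx y)) (α₀ (idx x)) (+ Arc.label (edge h) ⊕ χ (part y) ⊛ τ₁)) (ℤDv.∣m⇒∣-m (Arc.α≡ (edge h)))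
      ; β≡ = subst (+ p ∣ℤ_) (arith (β₀ (idx y)) (β₀ (idx x)) (+ Arc.label (edge h) ⊛ + Arc.label (edge h) ⊕ χ (part y) ⊛ τ₂)) (ℤDv.∣m⇒∣-m (Arc.β≡ (edge h))) }
      where
      arith₀ : ∀ y z → y ≡ (y ⊕ z) ⊕ (ℤ.- (+ 1)) ⊛ z
      arith₀ = ℤSolver.solve-∀
      arith : ∀ y x z → ℤ.- (x ⊝ y ⊝ z) ≡ y ⊝ x ⊝ (ℤ.- (+ 1)) ⊛ z
      arith = ℤSolver.solve-∀

    classOf : ∀ {x y} (h : Up x y) → Arc.label (edge h) % s ≡ part x
    classOf h = Arc.class (edge h)

    fold : ∀ {x y z b b′ u u′} → Directed x y b u → Directed y z b′ u′ → b′ ≡ not b → u′ ≡ u → x ≡ z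
    fold {x} {y} {z} (forward h) (backward h′) _ e = vertex≡ px (same-target (edge h) (edge h′) (sym e) (cong χ px) refl)
      where
      px : part x ≡ part z
      px = trans (sym (classOf h)) (trans (cong (_% s) (sym e)) (classOf h′))
    fold {x} {y} {z} (backward h) (forward h′) _ e = vertex≡ (trans (sym (part≡ h)) (part≡ h′)) (same-source (edge h) (edge h′) (sym e) refl refl)

    parts-differ : ∀ {x y} → Adj G x y → part x ≢ part y
    parts-differ {x} {y} (inj₁ h) e = no-loop (part x) (part< x) (trans (part≡ h) (sym e))
      where
      no-loop : ∀ i → i < s → suc i % s ≢ i
      no-loop i i< h = contradiction (%-+-injective {s} 1 i (ℕₚ.≤-trans (s≤s (s≤s z≤n)) 3≤s) (trans h (sym (DM.m<n⇒m%n≡m i<)))) λ ()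
    parts-differ {x} {y} (inj₂ h) e = parts-differ (inj₁ h) (sym e)

    -- The class of a label is the lower part of its edge. Opposite directions therefore put two
    -- adjacent vertices, w and x or y and z, in one part.
    opposite : ∀ {x y z w b b′ u u′} → Directed x y b u → Directed z w b′ u′ → Adj G y z → Adj G w x → b′ ≡ not b → u′ ≡ u → ⊥
    opposite {x} {y} {z} {w} (forward h) (backward h′) _ e _ eq = parts-differ e (trans (sym (classOf h′)) (trans (cong (_% s) eq) (classOf h)))
    opposite {x} {y} {z} {w} (backward h) (forward h′) e _ _ eq = parts-differ e (trans (sym (classOf h)) (trans (cong (_% s) (sym eq)) (classOf h′)))

    no-four-cycle : CycleIn G 4 → ⊥
    no-four-cycle C = go (labelOf e₀) (labelOf e₁) (labelOf e₂) (labelOf e₃)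
      where
      y₀ y₁ y₂ y₃ : Fin n
      y₀ = vtx C zero
      y₁ = vtx C (suc zero)
      y₂ = vtx C (suc (suc zero))
      y₃ = vtx C (suc (suc (suc zero)))
      e₀ : Adj G y₀ y₁
      e₀ = adj C zero
      e₁ : Adj G y₁ y₂
      e₁ = adj C (suc zero)
      e₂ : Adj G y₂ y₃
      e₂ = adj C (suc (suc zero))
      e₃ : Adj G y₃ y₀
      e₃ = adj C (suc (suc (suc zero)))
      ne₀₂ : y₀ ≢ y₂
      ne₀₂ h = contradiction (CycleIn.inj C h) λ ()
      ne₁₃ : y₁ ≢ y₃
      ne₁₃ h = contradiction (CycleIn.inj C h) λ ()
      go : (∃ λ b → ∃ λ u → Directed y₀ y₁ b u) → (∃ λ b → ∃ λ u → Directed y₁ y₂ b u) →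
        (∃ λ b → ∃ λ u → Directed y₂ y₃ b u) → (∃ λ b → ∃ λ u → Directed y₃ y₀ b u) → ⊥
      go (b₀ , u₀ , d₀) (b₁ , u₁ , d₁) (b₂ , u₂ , d₂) (b₃ , u₃ , d₃) =
          conclude (four-cycle (labelled d₀) (labelled d₁) (labelled d₂) (labelled d₃))
        where
        conclude : (b₁ ≡ not b₀ × u₁ ≡ u₀) ⊎ (b₂ ≡ not b₁ × u₂ ≡ u₁) ⊎ (b₃ ≡ not b₂ × u₃ ≡ u₂) ⊎ (b₀ ≡ not b₃ × u₀ ≡ u₃) ⊎ (b₂ ≡ not b₀ × u₂ ≡ u₀) → ⊥
        conclude (inj₁ (e , q)) = ne₀₂ (fold d₀ d₁ e q)
        conclude (inj₂ (inj₁ (e , q))) = ne₁₃ (fold d₁ d₂ e q)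
        conclude (inj₂ (inj₂ (inj₁ (e , q)))) = ne₀₂ (sym (fold d₂ d₃ e q))
        conclude (inj₂ (inj₂ (inj₂ (inj₁ (e , q))))) = ne₁₃ (sym (fold d₃ d₀ e q))
        conclude (inj₂ (inj₂ (inj₂ (inj₂ (e , q))))) = opposite d₀ d₂ e₁ e₃ e q

module _ (w : ℕ → ℕ) (s : ℕ) where
  labelAt : ℕ → ℕ
  labelAt i = w i * s + i

module TwistedCopies (p : ℕ) (prime-p : Prime p) (3≤p : 3 ≤ p) (s₀ : ℕ) (5≤s : 5 ≤ suc s₀) where
  private
    s = suc s₀
    instance
      p≠0 : NonZero p
      p≠0 = prime⇒nonZero prime-p

  r : ℕ
  r = p / s

  labels : Fin (r ^ s) → ℕ → ℕ
  labels k = labelAt (digit {r} {s} k) s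

  T₁ T₂ : Fin (r ^ s) → ℕ
  T₁ k = sumTo (labels k) s
  T₂ k = sumTo (λ i → labels k i * labels k i) s

  residue : ℕ → Fin p
  residue x = fromℕ< (DM.m%n<n x p)

  -- The total displacement along a tuple of labels. A copy closes only if the twist cancels it, so
  -- the graph is built for a frequent value of it, found by the pigeonhole principle.
  hash : Fin (r ^ s) → Fin (p * p)
  hash k = combine (residue (T₁ k)) (residue (T₂ k))

  module Fibre (1≤r : 1 ≤ r) (ℓ : Fin (p * p)) (c : ℕ) (ι : Fin c → Fin (r ^ s)) (ι-injective : ∀ i j → ι i ≡ ι j → i ≡ j)
    (hash≡ : ∀ i → hash (ι i) ≡ ℓ) where

    t₁ t₂ : ℕ
    t₁ = toℕ (proj₁ (remQuot {p} p ℓ))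
    t₂ = toℕ (proj₂ (remQuot {p} p ℓ))

    open TwistedGraph p prime-p 3≤p s₀ 5≤s (ℤ.- (+ t₁)) (ℤ.- (+ t₂)) hiding (s)

    split : ∀ i → remQuot {p} p ℓ ≡ (residue (T₁ (ι i)) , residue (T₂ (ι i)))
    split i = trans (cong (remQuot {p} p) (sym (hash≡ i))) (Fₚ.remQuot-combine {p} (residue (T₁ (ι i))) (residue (T₂ (ι i))))

    T₁≡ : ∀ i → T₁ (ι i) % p ≡ t₁
    T₁≡ i = trans (sym (Fₚ.toℕ-fromℕ< (DM.m%n<n (T₁ (ι i)) p))) (cong (toℕ ∘ proj₁) (sym (split i)))

    T₂≡ : ∀ i → T₂ (ι i) % p ≡ t₂
    T₂≡ i = trans (sym (Fₚ.toℕ-fromℕ< (DM.m%n<n (T₂ (ι i)) p))) (cong (toℕ ∘ proj₂) (sym (split i)))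

    module Tuple (x : Fin (p * p)) (y : Fin c) where
      u : ℕ → ℕ
      u = labels (ι y)

      A B : ℕ → ℕ
      A i = toℕ x % p + sumTo u i
      B i = toℕ x / p + sumTo (λ i → u i * u i) i

      f : ℕ → ℕ
      f i = point (A i) (B i)

      f0 : f 0 ≡ toℕ x
      f0 = trans (cong₂ point (ℕₚ.+-identityʳ (toℕ x % p)) (ℕₚ.+-identityʳ (toℕ x / p)))
        (trans (cong (_+ toℕ x / p % p * p) (DM.m%n%n≡m%n (toℕ x) p)) (point-id (Fₚ.toℕ<n x)))

      u< : ∀ i → i < s → u i < p
      u< i i< = ℕₚ.<-≤-trans (ℕₚ.<-≤-trans (ℕₚ.+-monoʳ-< (digit {r} {s} (ι y) i * s) i<)
        (ℕₚ.≤-reflexive (ℕₚ.+-comm (digit {r} {s} (ι y) i * s) s)))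
        (ℕₚ.≤-trans (ℕₚ.*-monoˡ-≤ s (digit< {r} {s} 1≤r (ι y) i)) (DM.m/n*n≤m p s))

      u-class : ∀ i → i < s → u i % s ≡ i
      u-class i i< = trans (cong (_% s) (ℕₚ.+-comm (digit {r} {s} (ι y) i * s) i))
        (trans (DM.[m+kn]%n≡m%n i (digit {r} {s} (ι y) i) s) (DM.m<n⇒m%n≡m i<))

      edges : ∀ i (i< : i < s) → Σ (E i (f i) (f (suc i % s))) λ a → Arc.label a ≡ u i
      edges i i< = go (i ℕₚ.≟ s₀)
        where
        step₀ : ∀ a S u z → (a ⊕ (S ⊕ u)) ⊝ (a ⊕ S) ⊝ (u ⊕ + 0 ⊛ z) ≡ + 0
        step₀ = ℤSolver.solve-∀
        last₀ : ∀ a S u t → t ⊝ (S ⊕ u) ≡ (a ⊕ + 0) ⊝ (a ⊕ S) ⊝ (u ⊕ + 1 ⊛ (ℤ.- t))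
        last₀ = ℤSolver.solve-∀
        go : Dec (i ≡ s₀) → Σ (E i (f i) (f (suc i % s))) λ a → Arc.label a ≡ u i
        go (no ne) = subst (λ j → Σ (E i (f i) (f j)) λ a → Arc.label a ≡ u i) (sym (DM.m<n⇒m%n≡m (s≤s (ℕₚ.≤∧≢⇒< (ℕₚ.≤-pred i<) ne))))
          (point-arc (A i) (B i) (A (suc i)) (B (suc i)) (u i) (u< i i<) (u-class i i<)
            (∣-zero (trans (cong (λ z → + A (suc i) ⊝ + A i ⊝ (+ u i ⊕ z ⊛ ℤ.- (+ t₁))) (χ-inner ne))
              (step₀ (+ (toℕ x % p)) (+ sumTo u i) (+ u i) (ℤ.- (+ t₁)))))
            (∣-zero (trans (cong₂ (λ z q → + B (suc i) ⊝ + B i ⊝ (q ⊕ z ⊛ ℤ.- (+ t₂))) (χ-inner ne) (sym (ℤₚ.pos-* (u i) (u i))))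
              (step₀ (+ (toℕ x / p)) (+ sumTo (λ i → u i * u i) i) (+ (u i * u i)) (ℤ.- (+ t₂))))) , refl)
        go (yes refl) = subst (λ j → Σ (E i (f i) (f j)) λ a → Arc.label a ≡ u i) (sym (DM.n%n≡0 s))
          (point-arc (A i) (B i) (A 0) (B 0) (u i) (u< i i<) (u-class i i<)
            (subst (+ p ∣ℤ_) (trans (last₀ (+ (toℕ x % p)) (+ sumTo u i) (+ u i) (+ t₁))
                (cong (λ z → + A 0 ⊝ + A i ⊝ (+ u i ⊕ z ⊛ ℤ.- (+ t₁))) (sym χ-last)))
              (subst (λ t → + p ∣ℤ + t ⊝ + T₁ (ι y)) (T₁≡ y) (mod-∣ (T₁ (ι y)))))
            (subst (+ p ∣ℤ_) (trans (last₀ (+ (toℕ x / p)) (+ sumTo (λ i → u i * u i) i) (+ (u i * u i)) (+ t₂))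
                (cong₂ (λ z q → + B 0 ⊝ + B i ⊝ (q ⊕ z ⊛ ℤ.- (+ t₂))) (sym χ-last) (ℤₚ.pos-* (u i) (u i))))
              (subst (λ t → + p ∣ℤ + t ⊝ + T₂ (ι y)) (T₂≡ y) (mod-∣ (T₂ (ι y))))) , refl)

    module _ (n : ℕ) (p²s≤n : p * p * s ≤ n) where
      open CyclicGraph s₀ n 3≤s E hiding (s)
      open Copies (p * p) p²s≤n

      module At (K : Fin (p * p * c)) = Tuple (proj₁ (remQuot {p * p} c K)) (proj₂ (remQuot {p * p} c K))

      copies : DistinctCopies G s (p * p * c)
      copies = distinct-copies (p * p * c) (λ K → At.f K) (λ K i → point< (At.A K i) (At.B K i)) (λ K i i< → proj₁ (At.edges K i i<)) injective
        where
        injective : ∀ K L → (∀ i → i < s → At.f K i ≡ At.f L i) → K ≡ L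
        injective K L h = trans (sym (Fₚ.combine-remQuot {p * p} c K)) (trans (cong₂ combine x≡ y≡) (Fₚ.combine-remQuot {p * p} c L))
          where
          x≡ : proj₁ (remQuot {p * p} c K) ≡ proj₁ (remQuot {p * p} c L)
          x≡ = Fₚ.toℕ-injective (trans (sym (At.f0 K)) (trans (h 0 (s≤s z≤n)) (At.f0 L)))
          label≡ : ∀ i → i < s → At.u K i ≡ At.u L i
          label≡ i i< = trans (sym (proj₂ (At.edges K i i<))) (trans
            (same-label (proj₁ (At.edges K i i<)) (proj₁ (At.edges L i i<)) refl (h i i<) (h (suc i % s) (DM.m%n<n (suc i) s)))
            (proj₂ (At.edges L i i<)))
          y≡ : proj₂ (remQuot {p * p} c K) ≡ proj₂ (remQuot {p * p} c L)
          y≡ = ι-injective _ _ (digit-injective {r} {s} _ _ λ i i< → ℕₚ.*-cancelʳ-≡ _ _ s (ℕₚ.+-cancelʳ-≡ i _ _ (label≡ i i<)))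

-- A prime of the right size for given n; the lower bounds for t = 4

scan : ∀ (g : ℕ → ℕ) → (∀ k → k ≤ g k) → ∀ n → g 0 ≤ n → ∃ λ k → g k ≤ n × n < g (suc k)
scan g grow n h = go (suc n) 0 h (ℕₚ.≤-reflexive (sym (ℕₚ.+-identityʳ (suc n))))
  where
  go : ∀ fuel k → g k ≤ n → suc n ≤ fuel + k → ∃ λ k → g k ≤ n × n < g (suc k)
  go zero k h le = contradiction (ℕₚ.≤-trans le (grow k)) (ℕₚ.<⇒≱ (s≤s h))
  go (suc fuel) k h le with g (suc k) ℕₚ.≤? n
  ... | yes h′ = go fuel (suc k) h′ (subst (suc n ≤_) (sym (ℕₚ.+-suc fuel k)) le)
  ... | no ¬h = k , h , ℕₚ.≰⇒> ¬h

square<2^′ : ∀ {i} → 10 ≤ i → 4 * ((2 + i) * (2 + i)) < 2 ^ i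
square<2^′ h with ℕₚ.m≤n⇒∃[o]m+o≡n h
... | k , refl = square<2^ k

n<2^n : ∀ n → n < 2 ^ n
n<2^n zero = s≤s z≤n
n<2^n (suc n) = ℕₚ.≤-trans (ℕₚ.+-mono-≤ (ℕₚ.m^n>0 2 n) (n<2^n n)) (ℕₚ.≤-reflexive (cong (λ x → 2 ^ n + x) (sym (ℕₚ.+-identityʳ (2 ^ n)))))

-- Consecutive scales g k = 81 Y^4 s differ by the factor 16, so a prime in (Y², 9Y²] serves all n
-- between two of them, with 1296 = 81 · 16. The shift by 10 + s secures p ≥ s and the growth
-- condition of `prime-between`.
prime-scale : ∀ s → 1 ≤ s → ∃ λ N → ∀ n → N ≤ n → ∃ λ p → Prime p × 3 ≤ p × s ≤ p × p * p * s ≤ n × n ≤ 1296 * s * (p * p)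
prime-scale s 1≤s = g 0 , λ n h → go n (scan g grow n h)
  where
  i₀ : ℕ
  i₀ = 10 + s
  Y : ℕ → ℕ
  Y k = 2 ^ (k + i₀)
  g : ℕ → ℕ
  g k = 9 * (Y k * Y k) * (9 * (Y k * Y k)) * s
  Y<X : ∀ k → Y k ≤ Y k * Y k
  Y<X k = ℕₚ.m≤m*n (Y k) (Y k) {{Data.Nat.>-nonZero (ℕₚ.m^n>0 2 (k + i₀))}}
  X≥1 : ∀ k → 1 ≤ Y k * Y k
  X≥1 k = ℕₚ.≤-trans (ℕₚ.m^n>0 2 (k + i₀)) (Y<X k)
  X≤9X : ∀ k → Y k * Y k ≤ 9 * (Y k * Y k)
  X≤9X k = ℕₚ.m≤n*m (Y k * Y k) 9
  grow : ∀ k → k ≤ g k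
  grow k = ℕₚ.≤-trans (ℕₚ.≤-trans (ℕₚ.m≤m+n k i₀) (ℕₚ.<⇒≤ (n<2^n (k + i₀)))) (ℕₚ.≤-trans (Y<X k) (ℕₚ.≤-trans (X≤9X k)
    (ℕₚ.≤-trans (ℕₚ.m≤m*n (9 * (Y k * Y k)) (9 * (Y k * Y k)) {{Data.Nat.>-nonZero (ℕₚ.≤-trans (X≥1 k) (X≤9X k))}})
      (ℕₚ.m≤m*n _ s {{Data.Nat.>-nonZero 1≤s}}))))
  go : ∀ n → (∃ λ k → g k ≤ n × n < g (suc k)) → ∃ λ p → Prime p × 3 ≤ p × s ≤ p × p * p * s ≤ n × n ≤ 1296 * s * (p * p)
  go n (k , lo , hi) = go′ (prime-between (k + i₀) (square<2^′ (ℕₚ.≤-trans (ℕₚ.m≤m+n 10 s) (ℕₚ.m≤n+m i₀ k))))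
    where
    y : ℕ
    y = Y k
    arith : ∀ y s → 9 * (2 * y * (2 * y)) * (9 * (2 * y * (2 * y))) * s ≡ 1296 * s * (y * y * (y * y))
    arith = solve-∀
    large : 10 + s ≤ y * y
    large = ℕₚ.≤-trans (ℕₚ.≤-trans (ℕₚ.m≤n+m i₀ k) (ℕₚ.<⇒≤ (n<2^n (k + i₀)))) (Y<X k)
    go′ : (∃ λ p → Prime p × y * y < p × p ≤ 9 * (y * y)) → _
    go′ (p , pr , lt , le) = p , pr , ℕₚ.≤-trans (ℕₚ.≤-trans (ℕₚ.m≤m+n 3 (7 + s)) large) (ℕₚ.<⇒≤ lt) ,
      ℕₚ.≤-trans (ℕₚ.≤-trans (ℕₚ.m≤n+m s 10) large) (ℕₚ.<⇒≤ lt) ,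
      ℕₚ.≤-trans (ℕₚ.*-monoˡ-≤ s (ℕₚ.*-mono-≤ le le)) lo ,
      ℕₚ.≤-trans (ℕₚ.<⇒≤ hi) (ℕₚ.≤-trans (ℕₚ.≤-reflexive (arith y s)) (ℕₚ.*-monoʳ-≤ (1296 * s) (ℕₚ.*-mono-≤ (ℕₚ.<⇒≤ lt) (ℕₚ.<⇒≤ lt))))

scale-bound : ∀ {n s p r m} a → n ≤ 1296 * s * (p * p) → p ≤ a * r → r ^ s ≤ m →
  n ^ s ≤ (1296 * s * (a * a)) ^ s * (m * m)
scale-bound {n} {s} {p} {r} {m} a hn hp hm = begin
  n ^ s                                          ≤⟨ ℕₚ.^-monoˡ-≤ s (ℕₚ.≤-trans hn (ℕₚ.*-monoʳ-≤ (1296 * s) (ℕₚ.*-mono-≤ hp hp))) ⟩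
  (1296 * s * (a * r * (a * r))) ^ s             ≡⟨ cong (_^ s) (arith (1296 * s) a r) ⟩
  (1296 * s * (a * a) * (r * r)) ^ s             ≡⟨ ^-distribʳ-* (1296 * s * (a * a)) (r * r) s ⟩
  (1296 * s * (a * a)) ^ s * (r * r) ^ s         ≡⟨ cong ((1296 * s * (a * a)) ^ s *_) (^-distribʳ-* r r s) ⟩
  (1296 * s * (a * a)) ^ s * (r ^ s * r ^ s)     ≤⟨ ℕₚ.*-monoʳ-≤ ((1296 * s * (a * a)) ^ s) (ℕₚ.*-mono-≤ hm hm) ⟩
  (1296 * s * (a * a)) ^ s * (m * m)             ∎
  where
  open ℕₚ.≤-Reasoning
  arith : ∀ c a r → c * (a * r * (a * r)) ≡ c * (a * a) * (r * r)
  arith = solve-∀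

-- There are p² starting points and at least r^s / p² label tuples with the chosen displacement,
-- hence at least r^s copies for r = p / s, while n has order p².
four-lower : ∀ s → 5 ≤ s → Lower s 4 s
four-lower (suc s₀) 5≤s = (1296 * s * (2 * s * (2 * s))) ^ s , proj₁ (prime-scale s (s≤s z≤n)) , λ n h → build n (proj₂ (prime-scale s (s≤s z≤n)) n h)
  where
  s : ℕ
  s = suc s₀
  build : ∀ n → (∃ λ p → Prime p × 3 ≤ p × s ≤ p × p * p * s ≤ n × n ≤ 1296 * s * (p * p)) →
    Σ (Graph n) λ G → Σ (ProperColouring G) λ c → ¬ RainbowCycle G c 4 × (∃[ m ] (DistinctCopies G s m × n ^ s ≤ (1296 * s * (2 * s * (2 * s))) ^ s * (m * m)))
  build n (p , pr , 3≤p , s≤p , p²s≤n , n≤) = go (pigeonhole (TwistedCopies.hash p pr 3≤p s₀ 5≤s) 1≤p²)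
    where
    instance
      p≠0 : NonZero p
      p≠0 = prime⇒nonZero pr
    1≤p² : 1 ≤ p * p
    1≤p² = ℕₚ.*-mono-≤ (ℕₚ.≤-trans (s≤s z≤n) 3≤p) (ℕₚ.≤-trans (s≤s z≤n) 3≤p)
    r : ℕ
    r = p / s
    1≤r : 1 ≤ r
    1≤r = DM.m≥n⇒m/n>0 s≤p
    go : (∃ λ ℓ → ∃ λ c → Σ (Fin c → Fin (r ^ s)) λ ι → (∀ i j → ι i ≡ ι j → i ≡ j) × (∀ i → TwistedCopies.hash p pr 3≤p s₀ 5≤s (ι i) ≡ ℓ) × r ^ s ≤ c * (p * p)) →
      Σ (Graph n) λ G → Σ (ProperColouring G) λ c → ¬ RainbowCycle G c 4 × (∃[ m ] (DistinctCopies G s m × n ^ s ≤ (1296 * s * (2 * s * (2 * s))) ^ s * (m * m)))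
    go (ℓ , c , ι , ι-injective , hash≡ , many) =
        G , colouring , (λ (C , _) → OnVertices.no-four-cycle n C) , p * p * c , copies n p²s≤n ,
        scale-bound {n} {s} {p} {r} (2 * s) n≤ (n≤2s*q p s s≤p) (ℕₚ.≤-trans many (ℕₚ.≤-reflexive (ℕₚ.*-comm c (p * p))))
      where
      open TwistedCopies.Fibre p pr 3≤p s₀ 5≤s 1≤r ℓ c ι ι-injective hash≡
      open TwistedGraph p pr 3≤p s₀ 5≤s (ℤ.- (+ t₁)) (ℤ.- (+ t₂)) using (E; 3≤s; module OnVertices)
      open CyclicGraph s₀ n 3≤s E using (G; module Colouring)
      open Colouring (λ _ → ⊥) (λ _ → no id) (λ ()) (λ ()) using (colouring)

-- s = t = 4: the parts 0, 1, 2, 3 are the vertices of a square; labels of class 0 lead from 0 to 1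
-- and from 3 to 2, labels of class 1 from 1 to 2 and from 0 to 3. Edges are coloured by their labels.
module SquareGraph (p : ℕ) (prime-p : Prime p) (3≤p : 3 ≤ p) where
  open Points p prime-p 3≤p

  Step : ℕ → ℕ → ℕ → Set
  Step m = Arc 2 m (+ 0) (+ 0) (+ 0)

  E : ℕ → ℕ → ℕ → Set
  E 0 c c′ = Step 0 c c′
  E 1 c c′ = Step 1 c c′
  E 2 c c′ = Step 0 c′ c
  E 3 c c′ = Step 1 c′ c
  E _ _ _ = ⊥

  -- The distance from part 0 in the square; unlike the part number it grows by one along every
  -- arrow.
  rank : ℕ → ℕ
  rank 0 = 0
  rank 1 = 1
  rank 2 = 2
  rank 3 = 1
  rank _ = 0

  data Arrow : ℕ → ℕ → ℕ → Set where
    0→1 : Arrow 0 1 0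
    3→2 : Arrow 3 2 0
    1→2 : Arrow 1 2 1
    0→3 : Arrow 0 3 1

  arrow-rank : ∀ {i j m} → Arrow i j m → rank j ≡ suc (rank i)
  arrow-rank 0→1 = refl
  arrow-rank 3→2 = refl
  arrow-rank 1→2 = refl
  arrow-rank 0→3 = refl

  arrow-source : ∀ {i i′ j m m′} → Arrow i j m → Arrow i′ j m′ → m ≡ m′ → i ≡ i′
  arrow-source 0→1 0→1 _ = refl
  arrow-source 3→2 3→2 _ = refl
  arrow-source 1→2 1→2 _ = refl
  arrow-source 0→3 0→3 _ = refl

  arrow-target : ∀ {i j j′ m m′} → Arrow i j m → Arrow i j′ m′ → m ≡ m′ → j ≡ j′
  arrow-target 0→1 0→1 _ = refl
  arrow-target 3→2 3→2 _ = refl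
  arrow-target 1→2 1→2 _ = refl
  arrow-target 0→3 0→3 _ = refl

  -- Edges entering a part and edges leaving it have labels of different classes; this is what makes
  -- the colouring by labels proper.
  arrow-apart : ∀ {i j k m m′} → Arrow i j m → Arrow k i m′ → m ≢ m′
  arrow-apart 3→2 0→3 ()
  arrow-apart 1→2 0→1 ()

  module OnVertices (n : ℕ) where
    open CyclicGraph 3 n (s≤s (s≤s (s≤s z≤n))) E hiding (s) public
    -- Any modulus of at least 5 would do here, since all χ are 0 and the ranks themselves make the
    -- signs of a closed walk sum to 0.
    open Sidon.FourCycles p prime-p 3≤p {5} ℕₚ.≤-refl {Fin n} (λ u → + rank (part u)) (λ u → α₀ (idx u)) (λ u → β₀ (idx u)) (+ 0) (+ 0)

    record Pos (x y : Fin n) : Set where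
      constructor pos
      field
        {m} : ℕ
        arrow : Arrow (part x) (part y) m
        arc : Step m (idx x) (idx y)
      open Arc arc public
    open Pos

    up⇒ : ∀ {x y} → Up x y → Pos x y ⊎ Pos y x
    up⇒ {x} {y} (up p≡ e) = go (part x) (part y) refl refl p≡ e
      where
      go : ∀ i j → part x ≡ i → part y ≡ j → suc i % 4 ≡ j → E i (idx x) (idx y) → Pos x y ⊎ Pos y x
      go 0 .1 px py refl e = inj₁ (pos (subst₂ (λ a b → Arrow a b 0) (sym px) (sym py) 0→1) e)
      go 1 .2 px py refl e = inj₁ (pos (subst₂ (λ a b → Arrow a b 1) (sym px) (sym py) 1→2) e)
      go 2 .3 px py refl e = inj₂ (pos (subst₂ (λ a b → Arrow a b 0) (sym py) (sym px) 3→2) e)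
      go 3 .0 px py refl e = inj₂ (pos (subst₂ (λ a b → Arrow a b 1) (sym py) (sym px) 0→3) e)

    adj⇒ : ∀ {x y} → Adj G x y → Pos x y ⊎ Pos y x
    adj⇒ (inj₁ h) = up⇒ h
    adj⇒ (inj₂ h) with up⇒ h
    ... | inj₁ q = inj₂ q
    ... | inj₂ q = inj₁ q

    data Directed (x y : Fin n) : Bool → ℕ → Set where
      forward : (h : Pos x y) → Directed x y true (label h)
      backward : (h : Pos y x) → Directed x y false (label h)

    labelOf : ∀ {x y} → Adj G x y → ∃ λ b → ∃ λ u → Directed x y b u
    labelOf e with adj⇒ e
    ... | inj₁ h = _ , _ , forward h
    ... | inj₂ h = _ , _ , backward h

    labelled : ∀ {x y b u} → Directed x y b u → Labelled x y b u
    labelled {x} {y} (forward h) = record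
      { u<p = label< h ; χ = + 0
      ; γ≡ = trans (cong +_ (arrow-rank (arrow h))) (ℤₚ.+-comm (+ 1) (+ rank (part x)))
      ; α≡ = subst (λ z → + p ∣ℤ α₀ (idx y) ⊝ α₀ (idx x) ⊝ z) (sym (ℤₚ.*-identityˡ (+ label h ⊕ + 0 ⊛ + 0))) (α≡ h)
      ; β≡ = subst (λ z → + p ∣ℤ β₀ (idx y) ⊝ β₀ (idx x) ⊝ z) (sym (ℤₚ.*-identityˡ (+ label h ⊛ + label h ⊕ + 0 ⊛ + 0))) (β≡ h) }
    labelled {x} {y} (backward h) = record
      { u<p = label< h ; χ = + 0
      ; γ≡ = trans (arith₀ (+ rank (part y))) (cong (_⊕ sg false ⊛ (+ 1 ⊝ + 5 ⊛ + 0)) (sym (cong +_ (arrow-rank (arrow h)))))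
      ; α≡ = subst (+ p ∣ℤ_) (arith (α₀ (idx y)) (α₀ (idx x)) (+ label h ⊕ + 0 ⊛ + 0)) (ℤDv.∣m⇒∣-m (α≡ h))
      ; β≡ = subst (+ p ∣ℤ_) (arith (β₀ (idx y)) (β₀ (idx x)) (+ label h ⊛ + label h ⊕ + 0 ⊛ + 0)) (ℤDv.∣m⇒∣-m (β≡ h)) }
      where
      arith₀ : ∀ y → y ≡ (+ 1 ⊕ y) ⊕ (ℤ.- (+ 1))
      arith₀ = ℤSolver.solve-∀
      arith : ∀ y x z → ℤ.- (x ⊝ y ⊝ z) ≡ y ⊝ x ⊝ (ℤ.- (+ 1)) ⊛ z
      arith = ℤSolver.solve-∀

    same-class : ∀ {x y z w} (h : Pos x y) (h′ : Pos z w) → label h ≡ label h′ → m h ≡ m h′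
    same-class h h′ e = trans (sym (class h)) (trans (cong (_% 2) e) (class h′))

    same-target′ : ∀ {x y z} (h : Pos x y) (h′ : Pos z y) → label h ≡ label h′ → x ≡ z
    same-target′ h h′ e = vertex≡ (arrow-source (arrow h) (arrow h′) (same-class h h′ e)) (same-target (arc h) (arc h′) e refl refl)

    same-source′ : ∀ {x y z} (h : Pos y x) (h′ : Pos y z) → label h ≡ label h′ → x ≡ z
    same-source′ h h′ e = vertex≡ (arrow-target (arrow h) (arrow h′) (same-class h h′ e)) (same-source (arc h) (arc h′) e refl refl)

    fold : ∀ {x y z b b′ u u′} → Directed x y b u → Directed y z b′ u′ → b′ ≡ not b → u′ ≡ u → x ≡ z
    fold (forward h) (backward h′) _ e = same-target′ h h′ (sym e)
    fold (backward h) (forward h′) _ e = same-source′ h h′ (sym e)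

    -- A colouring must be defined on all pairs; along an arrow the difference of the first
    -- coordinates modulo p is the label.
    difference : Fin n → Fin n → ℕ
    difference x y = (idx y % p + (p ∸ idx x % p)) % p

    difference≡label : ∀ {x y} (h : Pos x y) → difference x y ≡ label h
    difference≡label {x} {y} h = ≡-from-∣ (DM.m%n<n (idx y % p + (p ∸ idx x % p)) p) (label< h)
      (subst (+ p ∣ℤ_) (arith (+ difference x y) (α₀ (idx y)) (α₀ (idx x)) (+ (p ∸ idx x % p)) (+ label h))
        (ℤDv.∣m∣n⇒∣m+n (ℤDv.∣m∣n⇒∣m+n (mod-∣ (idx y % p + (p ∸ idx x % p))) (α≡ h)) complement))
      where
      open Sidon p prime-p 3≤p using (≡-from-∣)
      complement : + p ∣ℤ + (p ∸ idx x % p) ⊕ α₀ (idx x)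
      complement = subst (+ p ∣ℤ_) (cong +_ (sym (ℕₚ.m∸n+n≡m (ℕₚ.<⇒≤ (DM.m%n<n (idx x) p))))) (ℤDv.∣-refl {+ p})
      arith : ∀ d y x w l → (d ⊝ (y ⊕ w)) ⊕ (y ⊝ x ⊝ (l ⊕ + 0 ⊛ + 0)) ⊕ (w ⊕ x) ≡ d ⊝ l
      arith = ℤSolver.solve-∀

    colour : ∀ x y → Dec (rank (part x) < rank (part y)) → ℕ
    colour x y (yes _) = difference x y
    colour x y (no _) = difference y x

    colourOf : Fin n → Fin n → ℕ
    colourOf x y = colour x y (rank (part x) ℕₚ.<? rank (part y))

    rank< : ∀ {x y} → Pos x y → rank (part x) < rank (part y)
    rank< h = ℕₚ.≤-reflexive (sym (arrow-rank (arrow h)))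

    colour-forward : ∀ {x y} (h : Pos x y) → colourOf x y ≡ label h
    colour-forward {x} {y} h = go (rank (part x) ℕₚ.<? rank (part y))
      where
      go : (d : Dec (rank (part x) < rank (part y))) → colour x y d ≡ label h
      go (yes _) = difference≡label h
      go (no ¬lt) = contradiction (rank< h) ¬lt

    colour-backward : ∀ {x y} (h : Pos y x) → colourOf x y ≡ label h
    colour-backward {x} {y} h = go (rank (part x) ℕₚ.<? rank (part y))
      where
      go : (d : Dec (rank (part x) < rank (part y))) → colour x y d ≡ label h
      go (yes lt) = contradiction (rank< h) (ℕₚ.<⇒≯ lt)
      go (no _) = difference≡label h

    colour≡ : ∀ {x y b u} → Directed x y b u → colourOf x y ≡ u
    colour≡ (forward h) = colour-forward h
    colour≡ (backward h) = colour-backward h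

    colouring : ProperColouring G
    colouring = record { col = colourOf ; colSym = symmetric ; proper = λ e f ne eq → ne (unique (labelOf e) (labelOf f) eq) }
      where
      symmetric : ∀ {x y} → Adj G x y → colourOf x y ≡ colourOf y x
      symmetric e with adj⇒ e
      ... | inj₁ h = trans (colour-forward h) (sym (colour-backward h))
      ... | inj₂ h = trans (colour-backward h) (sym (colour-forward h))
      unique′ : ∀ {x y z b b′ u u′} → Directed x y b u → Directed x z b′ u′ → u ≡ u′ → y ≡ z
      unique′ (forward h) (forward h′) e = same-source′ h h′ e
      unique′ (backward h) (backward h′) e = same-target′ h h′ e
      unique′ (forward h) (backward h′) e = contradiction (same-class h h′ e) (arrow-apart (arrow h) (arrow h′))
      unique′ (backward h) (forward h′) e = contradiction (same-class h′ h (sym e)) (arrow-apart (arrow h′) (arrow h))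
      unique : ∀ {x y z} → (∃ λ b → ∃ λ u → Directed x y b u) → (∃ λ b → ∃ λ u → Directed x z b u) → colourOf x y ≡ colourOf x z → y ≡ z
      unique (_ , _ , d) (_ , _ , d′) eq = unique′ d d′ (trans (sym (colour≡ d)) (trans eq (colour≡ d′)))

    -- Cycles of length 4 abound, but a simple one has no two consecutive edges with equal labels
    -- and opposite directions, so two opposite edges share a label and hence a colour.
    no-rainbow-4 : ¬ RainbowCycle G colouring 4
    no-rainbow-4 (C , rainbow) = go (labelOf (adj C zero)) (labelOf (adj C (suc zero))) (labelOf (adj C (suc (suc zero)))) (labelOf (adj C (suc (suc (suc zero)))))
      where
      y₀ y₁ y₂ y₃ : Fin n
      y₀ = vtx C zero
      y₁ = vtx C (suc zero)
      y₂ = vtx C (suc (suc zero))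
      y₃ = vtx C (suc (suc (suc zero)))
      ne₀₂ : y₀ ≢ y₂
      ne₀₂ h = contradiction (CycleIn.inj C h) λ ()
      ne₁₃ : y₁ ≢ y₃
      ne₁₃ h = contradiction (CycleIn.inj C h) λ ()
      go : (∃ λ b → ∃ λ u → Directed y₀ y₁ b u) → (∃ λ b → ∃ λ u → Directed y₁ y₂ b u) →
        (∃ λ b → ∃ λ u → Directed y₂ y₃ b u) → (∃ λ b → ∃ λ u → Directed y₃ y₀ b u) → ⊥
      go (b₀ , u₀ , d₀) (b₁ , u₁ , d₁) (b₂ , u₂ , d₂) (b₃ , u₃ , d₃) =
          conclude (four-cycle (labelled d₀) (labelled d₁) (labelled d₂) (labelled d₃))
        where
        conclude : (b₁ ≡ not b₀ × u₁ ≡ u₀) ⊎ (b₂ ≡ not b₁ × u₂ ≡ u₁) ⊎ (b₃ ≡ not b₂ × u₃ ≡ u₂) ⊎ (b₀ ≡ not b₃ × u₀ ≡ u₃) ⊎ (b₂ ≡ not b₀ × u₂ ≡ u₀) → ⊥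
        conclude (inj₁ (e , q)) = ne₀₂ (fold d₀ d₁ e q)
        conclude (inj₂ (inj₁ (e , q))) = ne₁₃ (fold d₁ d₂ e q)
        conclude (inj₂ (inj₂ (inj₁ (e , q)))) = ne₀₂ (sym (fold d₂ d₃ e q))
        conclude (inj₂ (inj₂ (inj₂ (inj₁ (e , q))))) = ne₁₃ (sym (fold d₃ d₀ e q))
        conclude (inj₂ (inj₂ (inj₂ (inj₂ (e , q))))) = rainbow zero (suc (suc zero)) (λ ()) (trans (colour≡ d₀) (trans (sym q) (sym (colour≡ d₂))))

  r : ℕ
  r = p / 2

  half< : ∀ {m} (x : Fin r) → m < 2 → toℕ x * 2 + m < p
  half< {m} x m< = ℕₚ.<-≤-trans (ℕₚ.<-≤-trans (ℕₚ.+-monoʳ-< (toℕ x * 2) m<) (ℕₚ.≤-reflexive (ℕₚ.+-comm (toℕ x * 2) 2)))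
    (ℕₚ.≤-trans (ℕₚ.*-monoˡ-≤ 2 (Fₚ.toℕ<n x)) (DM.m/n*n≤m p 2))

  half-class : ∀ {m} (x : Fin r) → m < 2 → (toℕ x * 2 + m) % 2 ≡ m
  half-class {m} x m< = trans (cong (_% 2) (ℕₚ.+-comm (toℕ x * 2) m)) (trans (DM.[m+kn]%n≡m%n m (toℕ x) 2) (DM.m<n⇒m%n≡m m<))

  module Tuple (x : Fin (p * p)) (y z : Fin r) where
    u w a b : ℕ
    u = toℕ y * 2 + 0
    w = toℕ z * 2 + 1
    a = toℕ x % p
    b = toℕ x / p

    -- The four points form a parallelogram with sides (u, u²) and (w, w²), so opposite edges have
    -- equal labels.
    f : ℕ → ℕ
    f 1 = point (a + u) (b + u * u)
    f 2 = point (a + u + w) (b + u * u + w * w)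
    f 3 = point (a + w) (b + w * w)
    f _ = point a b

    f< : ∀ i → f i < p * p
    f< 0 = point< a b
    f< 1 = point< (a + u) (b + u * u)
    f< 2 = point< (a + u + w) (b + u * u + w * w)
    f< 3 = point< (a + w) (b + w * w)
    f< (suc (suc (suc (suc _)))) = point< a b

    f0 : f 0 ≡ toℕ x
    f0 = trans (cong (_+ b % p * p) (DM.m%n%n≡m%n (toℕ x) p)) (point-id (Fₚ.toℕ<n x))

    move : ∀ {m} a b v → v < p → v % 2 ≡ m → Step m (point a b) (point (a + v) (b + v * v))
    move a b v v< cl = point-arc a b (a + v) (b + v * v) v v< cl (∣-zero (arith (+ a) (+ v)))
      (∣-zero (trans (cong (λ q → + (b + v * v) ⊝ + b ⊝ (q ⊕ + 0 ⊛ + 0)) (sym (ℤₚ.pos-* v v))) (arith (+ b) (+ (v * v)))))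
      where
      arith : ∀ a v → (a ⊕ v) ⊝ a ⊝ (v ⊕ + 0 ⊛ + 0) ≡ + 0
      arith = ℤSolver.solve-∀

    class0 : u < p × u % 2 ≡ 0
    class0 = half< {0} y (s≤s z≤n) , half-class {0} y (s≤s z≤n)

    class1 : w < p × w % 2 ≡ 1
    class1 = half< {1} z (s≤s (s≤s z≤n)) , half-class {1} z (s≤s (s≤s z≤n))

    step₀ : Step 0 (f 0) (f 1)
    step₀ = move a b u (proj₁ class0) (proj₂ class0)

    step₃ : Step 1 (f 0) (f 3)
    step₃ = move a b w (proj₁ class1) (proj₂ class1)

    edges : ∀ i → i < 4 → E i (f i) (f (suc i % 4))
    edges 0 _ = step₀
    edges 1 _ = move (a + u) (b + u * u) w (proj₁ class1) (proj₂ class1)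
    edges 2 _ = subst₂ (λ c d → Step 0 (f 3) (point c d)) (swap a w u) (swap b (w * w) (u * u)) (move (a + w) (b + w * w) u (proj₁ class0) (proj₂ class0))
      where
      swap : ∀ a b c → a + b + c ≡ a + c + b
      swap = solve-∀
    edges 3 _ = step₃
    edges (suc (suc (suc (suc i)))) (s≤s (s≤s (s≤s (s≤s ()))))

  module _ (n : ℕ) (p²s≤n : p * p * 4 ≤ n) where
    open OnVertices n
    open Copies (p * p) p²s≤n

    module At (K : Fin (p * p * (r * r))) = Tuple (proj₁ (remQuot {p * p} (r * r) K))
      (proj₁ (remQuot {r} r (proj₂ (remQuot {p * p} (r * r) K)))) (proj₂ (remQuot {r} r (proj₂ (remQuot {p * p} (r * r) K))))

    copies : DistinctCopies G 4 (p * p * (r * r))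
    copies = distinct-copies (p * p * (r * r)) At.f At.f< At.edges injective
      where
      injective : ∀ K L → (∀ i → i < 4 → At.f K i ≡ At.f L i) → K ≡ L
      injective K L h = trans (sym (Fₚ.combine-remQuot {p * p} (r * r) K)) (trans (cong₂ combine x≡ yz≡) (Fₚ.combine-remQuot {p * p} (r * r) L))
        where
        yz : ∀ (K : Fin (p * p * (r * r))) → Fin (r * r)
        yz K = proj₂ (remQuot {p * p} (r * r) K)
        x≡ : proj₁ (remQuot {p * p} (r * r) K) ≡ proj₁ (remQuot {p * p} (r * r) L)
        x≡ = Fₚ.toℕ-injective (trans (sym (At.f0 K)) (trans (h 0 (s≤s z≤n)) (At.f0 L)))
        double-injective : ∀ m {y z : Fin r} → toℕ y * 2 + m ≡ toℕ z * 2 + m → y ≡ z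
        double-injective m {y} {z} e = Fₚ.toℕ-injective (ℕₚ.*-cancelʳ-≡ (toℕ y) (toℕ z) 2 (ℕₚ.+-cancelʳ-≡ m (toℕ y * 2) (toℕ z * 2) e))
        y≡ : proj₁ (remQuot {r} r (yz K)) ≡ proj₁ (remQuot {r} r (yz L))
        y≡ = double-injective 0 (same-label (At.step₀ K) (At.step₀ L) refl (h 0 (s≤s z≤n)) (h 1 (s≤s (s≤s z≤n))))
        z≡ : proj₂ (remQuot {r} r (yz K)) ≡ proj₂ (remQuot {r} r (yz L))
        z≡ = double-injective 1 (same-label (At.step₃ K) (At.step₃ L) refl (h 0 (s≤s z≤n)) (h 3 (s≤s (s≤s (s≤s (s≤s z≤n))))))
        yz≡ : yz K ≡ yz L
        yz≡ = trans (sym (Fₚ.combine-remQuot {r} r (yz K))) (trans (cong₂ combine y≡ z≡) (Fₚ.combine-remQuot {r} r (yz L)))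

four-four-lower : ∀ s → s ≡ 4 → Lower s 4 s
four-four-lower s s≡4 = (1296 * s * (4 * 4)) ^ s , proj₁ (prime-scale s 1≤s) , λ n h → build n (proj₂ (prime-scale s 1≤s) n h)
  where
  1≤s : 1 ≤ s
  1≤s = subst (1 ≤_) (sym s≡4) (s≤s z≤n)
  build : ∀ n → (∃ λ p → Prime p × 3 ≤ p × s ≤ p × p * p * s ≤ n × n ≤ 1296 * s * (p * p)) →
    Σ (Graph n) λ G → Σ (ProperColouring G) λ c → ¬ RainbowCycle G c 4 × (∃[ m ] (DistinctCopies G s m × n ^ s ≤ (1296 * s * (4 * 4)) ^ s * (m * m)))
  build n (p , pr , 3≤p , s≤p , p²s≤n , n≤) = G , colouring , no-rainbow-4 , p * p * (r * r) ,
      subst (λ s → DistinctCopies G s (p * p * (r * r))) (sym s≡4) (copies n (subst (λ s → p * p * s ≤ n) s≡4 p²s≤n)) ,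
      scale-bound {n} {s} {p} {r} 4 n≤ (n≤2s*q p 2 (ℕₚ.≤-trans (s≤s (s≤s z≤n)) 3≤p))
        (ℕₚ.≤-trans (ℕₚ.≤-reflexive (trans (cong (r ^_) s≡4) (arith r))) (ℕₚ.*-monoˡ-≤ (r * r) (ℕₚ.*-mono-≤ r≤p r≤p)))
    where
    open SquareGraph p pr 3≤p
    open OnVertices n
    r≤p : r ≤ p
    r≤p = DM.m/n≤m p 2
    arith : ∀ r → r * (r * (r * (r * 1))) ≡ r * r * (r * r)
    arith = solve-∀

-- Matching the exponents with the cases of the theorem

trivial-upper : ∀ s t → 1 ≤ s → Upper s t (s + s)
trivial-upper (suc s) t _ = cover⇒upper s t 1 (suc s) λ {n} _ _ _ _ _ →
  WindowLists.allW n (suc s) , λ C → 0 , WindowLists.∈-allW n (seq C) 0 (suc s)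

module _ (P : ℕ → ℕ → ℕ → Set₁) where
  cast : ∀ {s s′ t t′ d d′} → s ≡ s′ → t ≡ t′ → d ≡ d′ → P s t d → P s′ t′ d′
  cast refl refl refl h = h

split-≤ : ∀ {m n} → m ≤ n → ∃ λ k → n ≡ k + m
split-≤ {m} h with ℕₚ.m≤n⇒∃[o]m+o≡n h
... | k , refl = k , ℕₚ.+-comm m k

halve-≤ : ∀ {k l} → k + k ≤ suc (l + l) → k ≤ l
halve-≤ {k} {l} h with k ℕₚ.≤? l
... | yes k≤l = k≤l
... | no k≰l = contradiction h (ℕₚ.<⇒≱ (ℕₚ.≤-trans (ℕₚ.≤-reflexive (cong suc (sym (ℕₚ.+-suc l l)))) (ℕₚ.+-mono-≤ (ℕₚ.≰⇒> k≰l) (ℕₚ.≰⇒> k≰l))))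

even-split : ∀ {n} m → Even n → m + m ≤ n → ∃ λ j → n ≡ j + j + (m + m)
even-split {n} m even h with even-form even
... | k , refl with split-≤ {m} {k} (halve-≤ (ℕₚ.m≤n⇒m≤1+n h))
... | j , refl = j , arith j m
  where
  arith : ∀ j m → j + m + (j + m) ≡ j + j + (m + m)
  arith = solve-∀

odd-split : ∀ {n} m → Odd n → m + m ≤ n → ∃ λ j → n ≡ suc (j + j + (m + m))
odd-split {n} m odd h with odd-form odd
... | k , refl with split-≤ {m} {k} (halve-≤ h)
... | j , refl = j , cong suc (arith j m)
  where
  arith : ∀ j m → j + m + (j + m) ≡ j + j + (m + m)
  arith = solve-∀

even-s-upper : ∀ s t → 4 ≤ s → 4 ≤ t → Even s → Even t → Upper s t s
even-s-upper s t 4≤s 4≤t es et with even-split 2 es 4≤s | even-split 2 et 4≤t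
... | r , refl | j , refl = cast Upper (eq₁ r) refl (eq₂ r) (even-upper j (suc r) (s≤s z≤n))
  where
  eq₁ : ∀ r → suc (suc (suc r + suc r)) ≡ r + r + 4
  eq₁ = solve-∀
  eq₂ : ∀ r → suc r + 1 + (suc r + 1) ≡ r + r + 4
  eq₂ = solve-∀

four-upper : ∀ s → 4 ≤ s → Upper s 4 s
four-upper s 4≤s with even-or-odd s
... | inj₁ (k , eq) = even-s-upper s 4 4≤s ℕₚ.≤-refl (divides k (trans eq (k+k≡k*2 k))) (divides 2 refl)
... | inj₂ (k , refl) with split-≤ {2} {k} (halve-≤ 4≤s)
... | r , refl = cast Upper (eq₁ r) refl (eq₂ r) (odd-upper₄ (suc r) (s≤s z≤n))
  where
  eq₂ : ∀ r → suc r + suc r + 3 ≡ 1 + (r + 2 + (r + 2))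
  eq₂ = solve-∀
  eq₁ : ∀ r → suc (suc (suc (suc r + suc r))) ≡ suc (r + 2 + (r + 2))
  eq₁ r = trans (ℕₚ.+-comm 3 (suc r + suc r)) (eq₂ r)

four-lower′ : ∀ s → 4 ≤ s → Lower s 4 s
four-lower′ s 4≤s with s ℕₚ.≟ 4
... | yes eq = four-four-lower s eq
... | no ne = four-lower s (ℕₚ.≤∧≢⇒< 4≤s (ne ∘ sym))

even-s-lower : ∀ s t → 4 ≤ s → 4 ≤ t → Even s → s ≢ t → Lower s t s
even-s-lower (suc s₀) t 4≤s 4≤t es s≢t with t ℕₚ.≟ 4 | even-form es
... | yes refl | _ = four-lower′ (suc s₀) 4≤s
... | no ne | k , eq = cast Lower refl refl (sym eq)
        (alternating-lower s₀ t k 4≤s (ℕₚ.≤∧≢⇒< 4≤t (ne ∘ sym)) s≢t (inj₁ eq))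

self-theta : ∀ s → 6 ≤ s → Even s → ExTheta s s (s ∸ 2)
self-theta s 6≤s es with even-split 3 es 6≤s
... | j , refl = cast Upper (eq₁ j) (eq₂ j) (eq₃ j) (self-upper j) , cast Lower (eq₄ j) (eq₄ j) (eq₅ j) (self-lower j)
  where
  eq₁ : ∀ j → suc (suc (j + j + 4)) ≡ j + j + 6
  eq₁ = solve-∀
  eq₂ : ∀ j → suc j + suc j + 4 ≡ j + j + 6
  eq₂ = solve-∀
  eq₃ : ∀ j → j + 2 + (j + 2) ≡ j + j + 6 ∸ 2
  eq₃ j = trans (arith j) (sym (ℕₚ.+-∸-assoc (j + j) {6} {2} (s≤s (s≤s z≤n))))
    where
    arith : ∀ j → j + 2 + (j + 2) ≡ j + j + 4
    arith = solve-∀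
  eq₄ : ∀ j → 6 + (j + j) ≡ j + j + 6
  eq₄ = solve-∀
  eq₅ : ∀ j → 2 + j + (2 + j) ≡ j + j + 6 ∸ 2
  eq₅ j = trans (arith j) (eq₃ j)
    where
    arith : ∀ j → 2 + j + (2 + j) ≡ j + 2 + (j + 2)
    arith = solve-∀

odd-theta : ∀ s t → 4 ≤ s → 6 ≤ t → Even t → Odd s → ExTheta s t (s ∸ 1)
odd-theta s t 4≤s 6≤t et os with odd-split 2 os 4≤s | even-split 3 et 6≤t
... | r , refl | j , refl = cast Upper (eq₁ r) (eq₂ j) (eq₃ r) (odd-upper j r) ,
    cast Lower refl refl (eq₄ r) (alternating-lower (r + r + 4) (j + j + 6) (r + 2) 4≤s (ℕₚ.≤-trans (ℕₚ.n≤1+n 5) 6≤t)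
      (λ eq → os (subst Even (sym eq) et)) (inj₂ (cong suc (sym (eq₄ r)))))
  where
  eq₁ : ∀ r → suc (suc (suc (suc (suc (r + r))))) ≡ 1 + (r + r + 4)
  eq₁ = solve-∀
  eq₂ : ∀ j → suc j + suc j + 4 ≡ j + j + 6
  eq₂ = solve-∀
  eq₃ : ∀ r → r + 2 + (r + 2) ≡ r + r + 4
  eq₃ = solve-∀
  eq₄ : ∀ r → r + 2 + (r + 2) ≡ r + r + 4
  eq₄ = eq₃

odd-odd-theta : ∀ s t → 4 ≤ s → Odd s → Odd t → s ≤ t → ExTheta s t (2 * (s ∸ 2))
odd-odd-theta s t 4≤s os ot s≤t with odd-split 2 os 4≤s
... | a , refl with odd-form ot
... | l , refl with split-≤ {a + 2} {l} (halve-≤ (subst (_≤ suc (l + l)) (arith a) (ℕₚ.≤-trans (ℕₚ.n≤1+n _) s≤t)))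
  where
  arith : ∀ a → a + a + 4 ≡ a + 2 + (a + 2)
  arith = solve-∀
... | b , refl = cast Upper (eq₁ a) (eq₂ a b) (eq₃ a) (OddSelf.odd-self-upper a b) ,
    cast Lower (eq₄ a) refl (eq₅ a) (matching-lower (a + a) (suc (b + (a + 2) + (b + (a + 2)))) (subst Odd (sym (eq₄ a)) os) ot)
  where
  eq₁ : ∀ a → suc (suc (suc (suc (a + suc a)))) ≡ 1 + (a + a + 4)
  eq₁ = solve-∀
  eq₂ : ∀ a b → b + b + (suc (a + suc a) + 3) ≡ 1 + (b + (a + 2) + (b + (a + 2)))
  eq₂ = solve-∀
  minus : ∀ a → suc (a + a + 4) ∸ 2 ≡ suc (a + a + 2)
  minus a = cong (_∸ 2) (arith a)
    where
    arith : ∀ a → suc (a + a + 4) ≡ 2 + suc (a + a + 2)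
    arith = solve-∀
  eq₃ : ∀ a → suc (a + suc a) + 1 + (suc (a + suc a) + 1) ≡ 2 * (suc (a + a + 4) ∸ 2)
  eq₃ a = trans (arith a) (cong (2 *_) (sym (minus a)))
    where
    arith : ∀ a → suc (a + suc a) + 1 + (suc (a + suc a) + 1) ≡ 2 * suc (a + a + 2)
    arith = solve-∀
  eq₄ : ∀ a → 5 + (a + a) ≡ 1 + (a + a + 4)
  eq₄ = solve-∀
  eq₅ : ∀ a → 3 + (a + a) + (3 + (a + a)) ≡ 2 * (suc (a + a + 4) ∸ 2)
  eq₅ a = trans (arith a) (eq₃ a)
    where
    arith : ∀ a → 3 + (a + a) + (3 + (a + a)) ≡ 1 + (a + suc a) + 1 + (suc (a + suc a) + 1)
    arith = solve-∀

full-theta : ∀ s t → 4 ≤ s → Odd t → (s > t ⊎ Even s) → ExTheta s t (2 * s)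
full-theta s t 4≤s ot cond = cast Upper refl refl (double s) (trivial-upper s t (ℕₚ.≤-trans (s≤s z≤n) 4≤s)) ,
    cast Lower refl refl (double s) (blow-up-lower s t 4≤s ot cond)
  where
  double : ∀ s → s + s ≡ 2 * s
  double = solve-∀

even≥4 : ∀ {t} → 3 ≤ t → Even t → 4 ≤ t
even≥4 {t} 3≤t et with t ℕₚ.≟ 3 | et
... | no ne | _ = ℕₚ.≤∧≢⇒< 3≤t (ne ∘ sym)
... | yes refl | divides q e = contradiction (trans (cong odd? e) (odd?-2* q)) λ ()

theorem1p2 : (s t : ℕ) → s ≥ 4 → t ≥ 3 →
    (t ≡ 4 → ExTheta s t s)
    × (Even s → Even t → s ≢ t → ExTheta s t s)
    × (s ≡ t → t ≥ 6 → Even t → ExTheta s t (s ∸ 2))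
    × (t ≥ 6 → Even t → Odd s → ExTheta s t (s ∸ 1))
    × (Odd s → Odd t → s ≤ t → ExTheta s t (2 * (s ∸ 2)))
    × (Odd t → (s > t ⊎ Even s) → ExTheta s t (2 * s))
theorem1p2 s t 4≤s 3≤t =
    (λ { refl → four-upper s 4≤s , four-lower′ s 4≤s })
  , (λ es et s≢t → even-s-upper s t 4≤s (even≥4 3≤t et) es et , even-s-lower s t 4≤s (even≥4 3≤t et) es s≢t)
  , (λ { refl 6≤t et → self-theta s 6≤t et })
  , (λ 6≤t et os → odd-theta s t 4≤s 6≤t et os)
  , (λ os ot s≤t → odd-odd-theta s t 4≤s os ot s≤t)
  , (λ ot cond → full-theta s t 4≤s ot cond)
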